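{- Let $H$ be a fixed regular, strictly $2$-balanced graph with $v_H$ vertices and $e_H$ edges. Then, as $n\to\infty$, \[ \mathbb{E}\big[e(\mathbb{M}_n(H))\big] = \Omega\Big( n^{2 - (v_H-2)/(e_H-1)} (\ln\ln n)^{1/(e_H-1)} \Big), \] where the implicit constant depends only on $H$.
   Context: A graph $H$ with $v_H$ vertices and $e_H$ edges is strictly $2$-balanced if $v_H, e_H \ge 3$ and for every proper subgraph $F \subsetneq H$ with $v_F \ge 3$ one has $(e_H-1)/(v_H-2) > (e_F-1)/(v_F-2)$. The random graph $\mathbb{M}_n(H)$ is defined as follows: assign to every edge $f$ of the complete graph $K_n$ on vertex set $\{1,\dots,n\}$ an independent birthtime $\beta(f)$ uniform in $[0,1]$ (almost surely all distinct). Starting with the empty graph on $\{1,\dots,n\}$, traverse the edges of $K_n$ in increasing order of birthtime and add each traversed edge to the current graph unless its addition creates a copy of $H$ (a subgraph isomorphic to $H$). $\mathbb{M}_n(H)$ is the final (maximal $H$-free) graph, and $e(\mathbb{M}_n(H))$ is its number of edges. -}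

module Defs where

open import Data.Bool using (Bool; true; false; _∧_; _∨_; not; if_then_else_)
open import Data.Nat using (ℕ; zero; suc; _+_; _*_; _∸_; _^_; _≤_; _<_; _<ᵇ_)
open import Data.Fin using (Fin; toℕ)
open import Data.Fin.Properties using () renaming (_≟_ to _≟F_)
open import Data.Fin.Subset using (Subset; _∈_; _∉_; ∣_∣)
open import Data.List using (List; []; _∷_; _++_; map; concatMap; length; allFin; foldr)
open import Data.Nat.ListAction using (sum)
open import Data.Vec using (Vec; []; _∷_; lookup)
open import Data.Product using (Σ; ∃; _×_; _,_; proj₁; proj₂)
import Data.Nat.Logarithm
import Data.Bool
open import Data.Sum using (_⊎_)
open import Relation.Binary.PropositionalEquality using (_≡_)
open import Relation.Nullary using (¬_)
open import Relation.Nullary.Decidable using (⌊_⌋)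

countB : ∀ {A : Set} → (A → Bool) → List A → ℕ
countB p = foldr (λ a k → if p a then suc k else k) 0

filterB : ∀ {A : Set} → (A → Bool) → List A → List A
filterB p = foldr (λ a as → if p a then a ∷ as else as) []

record Graph (v : ℕ) : Set where
  field
    adj   : Fin v → Fin v → Bool
    sym   : ∀ i j → adj i j ≡ adj j i
    irrefl : ∀ i → adj i i ≡ false
open Graph public

countPairs : ∀ {v} → (Fin v → Fin v → Bool) → ℕ
countPairs {v} E =
  countB (λ p → (toℕ (proj₁ p) <ᵇ toℕ (proj₂ p)) ∧ E (proj₁ p) (proj₂ p))
                 (concatMap (λ i → map (λ j → i , j) (allFin v)) (allFin v))

edges : ∀ {v} → Graph v → ℕ
edges H = countPairs (adj H)

degree : ∀ {v} → Graph v → Fin v → ℕ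
degree {v} H i = countB (λ j → adj H i j) (allFin v)

Regular : ∀ {v} → Graph v → Set
Regular {v} H = ∃ λ d → ∀ (i : Fin v) → degree H i ≡ d

-- Subgraphs of H: a vertex subset S together with an edge set E
-- (only the pairs i<j of E are relevant) such that every edge of E is an
-- edge of H with both endpoints in S.

record SubgraphOf {v} (H : Graph v) : Set where
  field
    verts  : Subset v
    edgs   : Fin v → Fin v → Bool
    sub    : ∀ i j → toℕ i < toℕ j → edgs i j ≡ true →
             (adj H i j ≡ true) × (i ∈ verts) × (j ∈ verts)
open SubgraphOf public

vF : ∀ {v} {H : Graph v} → SubgraphOf H → ℕ
vF F = ∣ verts F ∣

eF : ∀ {v} {H : Graph v} → SubgraphOf H → ℕ
eF F = countPairs (λ i j → edgs F i j)

Proper : ∀ {v} {H : Graph v} → SubgraphOf H → Set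
Proper {v} {H} F =
  (Σ (Fin v) λ i → i ∉ verts F) ⊎
  (Σ (Fin v) λ i → Σ (Fin v) λ j →
     (toℕ i < toℕ j) × (adj H i j ≡ true) × (edgs F i j ≡ false))

-- strictly 2-balanced; the inequality (e_H-1)/(v_H-2) > (e_F-1)/(v_F-2)
-- is cross-multiplied (both denominators positive).  When e_F = 0 the
-- truncated subtraction gives 0 instead of -1; both versions hold trivially
-- then, so this is harmless.
Strictly2Balanced : ∀ {v} → Graph v → Set
Strictly2Balanced {v} H =
  (3 ≤ v) × (3 ≤ edges H) ×
  (∀ (F : SubgraphOf H) → Proper F → 3 ≤ vF F →
     (eF F ∸ 1) * (v ∸ 2) < (edges H ∸ 1) * (vF F ∸ 2))

Edge : ℕ → Set
Edge n = Fin n × Fin n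

edgesK : ∀ n → List (Edge n)
edgesK n = filterB (λ p → toℕ (proj₁ p) <ᵇ toℕ (proj₂ p))
                  (concatMap (λ i → map (λ j → i , j) (allFin n)) (allFin n))

insertEverywhere : ∀ {A : Set} → A → List A → List (List A)
insertEverywhere x []       = (x ∷ []) ∷ []
insertEverywhere x (y ∷ ys) = (x ∷ y ∷ ys) ∷ map (y ∷_) (insertEverywhere x ys)

permutations : ∀ {A : Set} → List A → List (List A)
permutations []       = [] ∷ []
permutations (x ∷ xs) = concatMap (insertEverywhere x) (permutations xs)

HostGraph : ℕ → Set
HostGraph n = Fin n → Fin n → Bool

emptyG : ∀ {n} → HostGraph n
emptyG _ _ = false

_==_ : ∀ {n} → Fin n → Fin n → Bool
a == b = ⌊ a ≟F b ⌋

addEdge : ∀ {n} → HostGraph n → Edge n → HostGraph n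
addEdge G (a , b) x y = G x y ∨ ((x == a) ∧ (y == b)) ∨ ((x == b) ∧ (y == a))

allVecs : ∀ {A : Set} → List A → (k : ℕ) → List (Vec A k)
allVecs xs zero    = [] ∷ []
allVecs xs (suc k) = concatMap (λ x → map (x ∷_) (allVecs xs k)) xs

allB : ∀ {A : Set} → (A → Bool) → List A → Bool
allB p = foldr (λ a b → p a ∧ b) true

anyB : ∀ {A : Set} → (A → Bool) → List A → Bool
anyB p = foldr (λ a b → p a ∨ b) false

isEmbedding : ∀ {v n} → Graph v → HostGraph n → Vec (Fin n) v → Bool
isEmbedding {v} H G φ =
  allB (λ i → allB (λ j →
      ((i == j) ∨ not (lookup φ i == lookup φ j)) ∧
      (not (adj H i j) ∨ G (lookup φ i) (lookup φ j)))
    (allFin v)) (allFin v)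

containsCopy : ∀ {v n} → Graph v → HostGraph n → Bool
containsCopy {v} {n} H G = anyB (isEmbedding H G) (allVecs (allFin n) v)

runProcess : ∀ {v n} → Graph v → HostGraph n → List (Edge n) → ℕ
runProcess H G []       = 0
runProcess H G (f ∷ fs) =
  if containsCopy H (addEdge G f)
  then runProcess H G fs
  else suc (runProcess H (addEdge G f) fs)

eM : ∀ {v} → Graph v → (n : ℕ) → List (Edge n) → ℕ
eM H n order = runProcess H emptyG order

-- Since the birthtimes are i.i.d. uniform, the birth order is a uniformly
-- random ordering of E(K_n); hence E[e(M_n(H))] = totalE H n / numOrders n.
totalE : ∀ {v} → Graph v → ℕ → ℕ
totalE H n = sum (map (eM H n) (permutations (edgesK n)))

numOrders : ℕ → ℕ
numOrders n = length (permutations (edgesK n))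

-- integer proxy for ln ln n (equal to ln ln n up to a constant factor
-- for large n)
loglog : ℕ → ℕ
loglog n = Data.Nat.Logarithm.⌊log₂_⌋ (Data.Nat.Logarithm.⌊log₂_⌋ n)

{-# OPTIONS --safe --termination-depth=3 #-}
-- Let r = e - 1. Give the edges of K_n independent uniform labels; up to ties the process
-- is then determined by the rule that an edge u is accepted unless some link of u, that is,
-- the edge set of a copy of H through u without u itself, consists of accepted edges of
-- smaller label. If the links reached from u in evaluating this rule were disjoint, and u
-- lay in D links, then the probability Q(s) that a given edge has label below s and is
-- accepted would satisfy Q' = (1 - Q ^ r) ^ D. The growth of Q is slowed down only by a factor
-- exp (- O (K ^ r)) as long as Q is below K times the critical density, so at density x times
-- critical with log x of order K ^ r one has reached Q of at least K times critical. Here x may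
-- be a small power of log n, whence K ^ r of order log log n.
--
-- The evaluation is a decision tree asking for the labels on one link at a time. With high
-- probability it stays below a small power of n in size. By strict balance, the copies met are
-- then glued along single edges, no other copies arise among them, and the links that overlap
-- the explored part have negligible total probability; given the positive answers, the
-- negative ones are positively correlated, which bounds the true probability of each branch
-- from below by nearly its probability under fresh labels. Regularity gives minimum degree
-- at least two.
module Submission where

-- Everything is kept finite and rational. Labels are uniform on `L` cells instead of [0,1]; the
-- differential equation becomes the Euler recursion `Q`, which for fresh discrete labels is exact
-- and not an approximation; roots are avoided by comparing r-th powers. `L` affects only ties and
-- the step size, so it is fixed last and as large as convenient.
--
-- A query concerns a whole link because its negative answer, that some label is at least s, is then
-- an increasing event and reveals nothing else. Asking for labels one at a time would leave partial
-- information that Harris' inequality cannot absorb. As only a lower bound for acceptance is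
-- sought, a branch that meets an accident is given up, and its ideal probability is charged to an
-- error term.
--
-- What stops the argument at log log n is the size of the evaluation. An edge lies in D links, each
-- occurring with probability about p ^ r, and D p ^ r is of order x ^ r; the expected size is thus
-- bounded by exp (O (x ^ r)). Its powers have to stay below n, so x ^ r must be below a power of
-- log n with exponent less than 1, and log x of order K ^ r then leaves K ^ r of order log log n.

open import Defs using (Graph; edges; Strictly2Balanced; Regular)
open import Data.Nat.Base as ℕ using (ℕ; zero; suc; z≤n; s≤s; _∸_; _<ᵇ_; _≤ᵇ_)
import Data.Nat.Properties as ℕ
open import Data.Bool.Base using (Bool; true; false)
open import Data.Fin.Base using (Fin; zero; suc; toℕ)
open import Data.List.Base using (List; []; _∷_)
open import Relation.Binary.PropositionalEquality

-- Rational arithmetic behind an abstract interface, with a ring solver.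

module Field where
  open import Data.Integer.Base as ℤ using (ℤ; +_)
  import Data.Integer.Properties as ℤ
  open import Data.Rational.Base as ℚ using (ℚ; mkℚ)
  import Data.Rational.Properties as ℚ
  import Data.Rational.Unnormalised.Base as ℚᵘ
  import Data.Rational.Unnormalised.Properties as ℚᵘ
  open import Data.Nat.Coprimality using (1-coprimeTo) renaming (sym to coprime-sym)
  open import Data.Sum using (_⊎_)
  open import Data.Maybe.Base using (Maybe; just; nothing)
  open import Relation.Nullary using (yes; no)
  open import Algebra.Bundles using (CommutativeRing)
  open import Algebra.Structures using (IsCommutativeRing)
  import Algebra.Solver.Ring as RS
  import Algebra.Solver.Ring.AlmostCommutativeRing as ACR

  infixl 7 _*_
  infixl 6 _+_ _-_
  infix 4 _≤_
  infix 8 -_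

  abstract
    F : Set
    F = ℚ

    _+_ _*_ : F → F → F
    _+_ = ℚ._+_
    _*_ = ℚ._*_

    -_ : F → F
    -_ = ℚ.-_

    _≤_ : F → F → Set
    _≤_ = ℚ._≤_

    ιℤ : ℤ → F
    ιℤ i = mkℚ i 0 (coprime-sym (1-coprimeTo ℤ.∣ i ∣))

  0# 1# : F
  0# = ιℤ (+ 0)
  1# = ιℤ (+ 1)

  abstract
    isCommutativeRing : IsCommutativeRing {A = F} _≡_ _+_ _*_ -_ 0# 1#
    isCommutativeRing = ℚ.+-*-isCommutativeRing

    ≤-refl : ∀ {x} → x ≤ x
    ≤-refl = ℚ.≤-refl

    ≤-trans : ∀ {x y z} → x ≤ y → y ≤ z → x ≤ z
    ≤-trans = ℚ.≤-trans

    ≤-total : ∀ x y → (x ≤ y) ⊎ (y ≤ x)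
    ≤-total = ℚ.≤-total

    +-mono-≤ : ∀ {x y u v} → x ≤ y → u ≤ v → x + u ≤ y + v
    +-mono-≤ = ℚ.+-mono-≤

    *-monoˡ : ∀ {x y} z → 0# ≤ z → x ≤ y → z * x ≤ z * y
    *-monoˡ z 0≤z x≤y = ℚ.*-monoˡ-≤-nonNeg z {{ℚ.nonNegative 0≤z}} x≤y

    ιℤ-+ : ∀ i j → ιℤ (i ℤ.+ j) ≡ ιℤ i + ιℤ j
    ιℤ-+ i j = ℚ.toℚᵘ-injective (ℚᵘ.≃-trans
      (ℚᵘ.*≡* (cong (ℤ._* + 1) (sym (cong₂ ℤ._+_ (ℤ.*-identityʳ i) (ℤ.*-identityʳ j)))))
      (ℚᵘ.≃-sym (ℚ.toℚᵘ-homo-+ (ιℤ i) (ιℤ j))))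

    ιℤ-* : ∀ i j → ιℤ (i ℤ.* j) ≡ ιℤ i * ιℤ j
    ιℤ-* i j = ℚ.toℚᵘ-injective (ℚᵘ.≃-trans (ℚᵘ.*≡* refl)
      (ℚᵘ.≃-sym (ℚ.toℚᵘ-homo-* (ιℤ i) (ιℤ j))))

    ιℤ-neg : ∀ i → ιℤ (ℤ.- i) ≡ - ιℤ i
    ιℤ-neg i = ℚ.toℚᵘ-injective (ℚᵘ.≃-trans (ℚᵘ.*≡* refl)
      (ℚᵘ.≃-sym (ℚ.toℚᵘ-homo‿- (ιℤ i))))

    ι-mono : ∀ {a b} → a ℕ.≤ b → ιℤ (+ a) ≤ ιℤ (+ b)
    ι-mono a≤b = ℚ.*≤* (ℤ.*-monoʳ-≤-nonNeg (+ 1) (ℤ.+≤+ a≤b))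

    ι-reflect : ∀ {a b} → ιℤ (+ a) ≤ ιℤ (+ b) → a ℕ.≤ b
    ι-reflect (ℚ.*≤* p) = ℤ.drop‿+≤+ (ℤ.*-cancelʳ-≤-pos _ _ (+ 1) p)

    -- The value 0 at 0 is a convention that frees `inv-nonneg` of a side condition.
    inv : ℕ → F
    inv zero = ℚ.0ℚ
    inv (suc n) = ℚ.1/ (mkℚ (+ suc n) 0 (coprime-sym (1-coprimeTo (suc n))))

    ι-inv : ∀ n → ιℤ (+ suc n) * inv (suc n) ≡ 1#
    ι-inv n = ℚ.*-inverseʳ (mkℚ (+ suc n) 0 (coprime-sym (1-coprimeTo (suc n))))

    inv-nonneg : ∀ n → 0# ≤ inv n
    inv-nonneg zero = ℚ.≤-refl
    inv-nonneg (suc n) = ℚ.*≤* (ℤ.+≤+ ℕ.z≤n)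

  commutativeRing : CommutativeRing _ _
  commutativeRing = record { isCommutativeRing = isCommutativeRing }

  private
    ringF = ACR.fromCommutativeRing commutativeRing

    morph : ACR._-Raw-AlmostCommutative⟶_
              (CommutativeRing.rawRing ℤ.+-*-commutativeRing) ringF
    morph = record
      { ⟦_⟧ = ιℤ ; +-homo = ιℤ-+ ; *-homo = ιℤ-* ; -‿homo = ιℤ-neg
      ; 0-homo = refl ; 1-homo = refl }

    coeff≟ : (i j : ℤ) → Maybe (ιℤ i ≡ ιℤ j)
    coeff≟ i j with i ℤ.≟ j
    ... | yes p = just (cong ιℤ p)
    ... | no _ = nothing

  module S = RS (CommutativeRing.rawRing ℤ.+-*-commutativeRing) ringF morph coeff≟

  open IsCommutativeRing isCommutativeRing public
    using (+-comm; +-assoc; *-comm; *-assoc; +-identityˡ; +-identityʳ; *-identityˡ; *-identityʳ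
          ; distribˡ; distribʳ; zeroˡ; zeroʳ; -‿inverseˡ; -‿inverseʳ)

  _-_ : F → F → F
  x - y = x + - y

  ι : ℕ → F
  ι n = ιℤ (+ n)

-- Ordered-field lemmas, finite sums and products.

module Sums where
  open Field
  open import Data.Bool.Base using (Bool; true; false; if_then_else_; _∧_; not)
  open import Data.Fin.Base using (Fin; zero; suc)
  open import Data.Integer.Base using () renaming (+_ to pos)
  open import Data.Integer.Properties using (pos-*)
  open import Data.List.Base using (List; []; _∷_; _++_; length; map; concatMap)
  open import Data.Empty using (⊥-elim)
  open import Data.List.Membership.Propositional using (_∈_)
  open import Data.List.Membership.Propositional.Properties using (∈-∃++; ∈-++⁻; ∈-++⁺ˡ; ∈-++⁺ʳ)
  open import Data.List.Relation.Binary.Subset.Propositional using (_⊆_)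
  import Data.List.Relation.Unary.All as All
  open import Data.List.Relation.Unary.AllPairs using ([]; _∷_)
  open import Data.List.Relation.Unary.Any using (here; there)
  open import Data.List.Relation.Unary.Unique.Propositional using (Unique)
  open import Data.Product using (_,_)
  open import Data.Sum using (inj₁; inj₂)

  infixr 8 _^_

  _^_ : F → ℕ → F
  x ^ zero = 1#
  x ^ suc n = x * x ^ n

  infix 3 _∎
  infixr 2 _≤⟨_⟩_ _≈⟨_⟩_

  _≤⟨_⟩_ : ∀ x {y z} → x ≤ y → y ≤ z → x ≤ z
  _ ≤⟨ p ⟩ q = ≤-trans p q

  _≈⟨_⟩_ : ∀ x {y z} → x ≡ y → y ≤ z → x ≤ z
  _ ≈⟨ refl ⟩ q = q

  _∎ : ∀ x → x ≤ x
  _ ∎ = ≤-refl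

  ≤-reflexive : ∀ {x y} → x ≡ y → x ≤ y
  ≤-reflexive refl = ≤-refl

  ι-+ : ∀ m n → ι (m ℕ.+ n) ≡ ι m + ι n
  ι-+ m n = ιℤ-+ (pos m) (pos n)

  ι-* : ∀ m n → ι (m ℕ.* n) ≡ ι m * ι n
  ι-* m n = trans (cong ιℤ (pos-* m n)) (ιℤ-* (pos m) (pos n))

  ι-suc : ∀ n → ι (suc n) ≡ 1# + ι n
  ι-suc n = ι-+ 1 n

  ι-^ : ∀ m n → ι (m ℕ.^ n) ≡ ι m ^ n
  ι-^ m zero = refl
  ι-^ m (suc n) = trans (ι-* m (m ℕ.^ n)) (cong (ι m *_) (ι-^ m n))

  0≤1 : 0# ≤ 1#
  0≤1 = ι-mono {0} {1} z≤n

  0≤ι : ∀ n → 0# ≤ ι n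
  0≤ι n = ι-mono z≤n

  1≤ι : ∀ {n} → 1 ℕ.≤ n → 1# ≤ ι n
  1≤ι p = ι-mono p

  ι-inv′ : ∀ {k} → 1 ℕ.≤ k → ι k * inv k ≡ 1#
  ι-inv′ {suc k} _ = ι-inv k

  +-monoˡ : ∀ {x y} z → x ≤ y → x + z ≤ y + z
  +-monoˡ z p = +-mono-≤ p ≤-refl

  +-monoʳ : ∀ {x y} z → x ≤ y → z + x ≤ z + y
  +-monoʳ z p = +-mono-≤ (≤-refl {z}) p

  *-monoʳ : ∀ {x y} z → 0# ≤ z → x ≤ y → x * z ≤ y * z
  *-monoʳ {x} {y} z 0≤z p = subst₂ _≤_ (*-comm z x) (*-comm z y) (*-monoˡ z 0≤z p)

  *-mono : ∀ {a b c d} → 0# ≤ a → 0# ≤ d → a ≤ b → c ≤ d → a * c ≤ b * d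
  *-mono {a} {b} {c} {d} 0≤a 0≤d p q = ≤-trans (*-monoˡ a 0≤a q) (*-monoʳ d 0≤d p)

  0≤* : ∀ {x y} → 0# ≤ x → 0# ≤ y → 0# ≤ x * y
  0≤* {x} {y} p q = subst (_≤ x * y) (zeroʳ x) (*-monoˡ x p q)

  0≤+ : ∀ {x y} → 0# ≤ x → 0# ≤ y → 0# ≤ x + y
  0≤+ {x} {y} p q = subst (_≤ x + y) (+-identityˡ 0#) (+-mono-≤ p q)

  x≤x+y : ∀ x {y} → 0# ≤ y → x ≤ x + y
  x≤x+y x {y} p = subst (_≤ x + y) (+-identityʳ x) (+-monoʳ x p)

  x≤y+x : ∀ x {y} → 0# ≤ y → x ≤ y + x
  x≤y+x x {y} p = subst (_≤ y + x) (+-identityˡ x) (+-monoˡ x p)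

  ≤⇒0≤- : ∀ {x y} → x ≤ y → 0# ≤ y - x
  ≤⇒0≤- {x} {y} p = subst (_≤ y - x) (-‿inverseʳ x) (+-monoˡ (- x) p)

  0≤-⇒≤ : ∀ {x y} → 0# ≤ y - x → x ≤ y
  0≤-⇒≤ {x} {y} p = subst₂ _≤_ (+-identityˡ x)
    (S.solve 2 (λ x y → (y S.:- x) S.:+ x S.:= y) refl x y) (+-monoˡ x p)

  neg-mono : ∀ {x y} → x ≤ y → - y ≤ - x
  neg-mono {x} {y} p = 0≤-⇒≤ (subst (0# ≤_)
    (S.solve 2 (λ x y → y S.:- x S.:= (S.:- x) S.:- (S.:- y)) refl x y) (≤⇒0≤- p))

  sub-monoʳ : ∀ z {x y} → x ≤ y → z - y ≤ z - x
  sub-monoʳ z p = +-monoʳ z (neg-mono p)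

  x-y≤x : ∀ x {y} → 0# ≤ y → x - y ≤ x
  x-y≤x x {y} p = 0≤-⇒≤ (subst (0# ≤_) (S.solve 2 (λ x y → y S.:= x S.:- (x S.:- y)) refl x y) p)

  0≤^ : ∀ {x} n → 0# ≤ x → 0# ≤ x ^ n
  0≤^ zero p = 0≤1
  0≤^ (suc n) p = 0≤* p (0≤^ n p)

  ^-mono : ∀ {x y} n → 0# ≤ x → x ≤ y → x ^ n ≤ y ^ n
  ^-mono zero _ _ = ≤-refl
  ^-mono (suc n) p q = *-mono p (0≤^ n (≤-trans p q)) q (^-mono n p q)

  ^≤1 : ∀ {x} n → 0# ≤ x → x ≤ 1# → x ^ n ≤ 1#
  ^≤1 zero _ _ = ≤-refl
  ^≤1 {x} (suc n) p q = subst (x * x ^ n ≤_) (*-identityˡ 1#) (*-mono p 0≤1 q (^≤1 n p q))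

  1≤^ : ∀ {x} n → 1# ≤ x → 1# ≤ x ^ n
  1≤^ zero _ = ≤-refl
  1≤^ {x} (suc n) p = subst (_≤ x * x ^ n) (*-identityˡ 1#)
    (*-mono 0≤1 (≤-trans 0≤1 (1≤^ n p)) p (1≤^ n p))

  ^-+ : ∀ x m n → x ^ (m ℕ.+ n) ≡ x ^ m * x ^ n
  ^-+ x zero n = sym (*-identityˡ _)
  ^-+ x (suc m) n = trans (cong (x *_) (^-+ x m n)) (sym (*-assoc x _ _))

  ^-* : ∀ x m n → x ^ (m ℕ.* n) ≡ (x ^ n) ^ m
  ^-* x zero n = refl
  ^-* x (suc m) n = trans (^-+ x n (m ℕ.* n)) (cong (x ^ n *_) (^-* x m n))

  *-^ : ∀ x y n → (x * y) ^ n ≡ x ^ n * y ^ n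
  *-^ x y zero = sym (*-identityˡ 1#)
  *-^ x y (suc n) = trans (cong (x * y *_) (*-^ x y n))
    (S.solve 4 (λ x y a b → x S.:* y S.:* (a S.:* b) S.:= (x S.:* a) S.:* (y S.:* b)) refl x y _ _)

  1^ : ∀ n → 1# ^ n ≡ 1#
  1^ zero = refl
  1^ (suc n) = trans (*-identityˡ _) (1^ n)

  ^-anti : ∀ {x m n} → 0# ≤ x → x ≤ 1# → m ℕ.≤ n → x ^ n ≤ x ^ m
  ^-anti {n = n} p q z≤n = ^≤1 n p q
  ^-anti p q (s≤s m≤n) = *-monoˡ _ p (^-anti p q m≤n)

  b2F : Bool → F
  b2F b = if b then 1# else 0#

  0≤b2F : ∀ b → 0# ≤ b2F b
  0≤b2F true = 0≤1
  0≤b2F false = ≤-refl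

  b2F≤1 : ∀ b → b2F b ≤ 1#
  b2F≤1 true = ≤-refl
  b2F≤1 false = 0≤1

  b2F-∧ : ∀ a b → b2F (a ∧ b) ≡ b2F a * b2F b
  b2F-∧ true b = sym (*-identityˡ _)
  b2F-∧ false b = sym (zeroˡ _)

  b2F-not : ∀ a → b2F (not a) ≡ 1# - b2F a
  b2F-not true = sym (-‿inverseʳ 1#)
  b2F-not false = S.solve 0 (S.con (pos 1) S.:= S.con (pos 1) S.:- S.con (pos 0)) refl

  Σ : ∀ {n} → (Fin n → F) → F
  Σ {zero} f = 0#
  Σ {suc n} f = f zero + Σ (λ i → f (suc i))

  Σ-cong : ∀ {n} {f g : Fin n → F} → (∀ i → f i ≡ g i) → Σ f ≡ Σ g
  Σ-cong {zero} h = refl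
  Σ-cong {suc n} h = cong₂ _+_ (h zero) (Σ-cong (λ i → h (suc i)))

  Σ-mono : ∀ {n} {f g : Fin n → F} → (∀ i → f i ≤ g i) → Σ f ≤ Σ g
  Σ-mono {zero} h = ≤-refl
  Σ-mono {suc n} h = +-mono-≤ (h zero) (Σ-mono (λ i → h (suc i)))

  Σ-+ : ∀ {n} (f g : Fin n → F) → Σ (λ i → f i + g i) ≡ Σ f + Σ g
  Σ-+ {zero} f g = sym (+-identityˡ 0#)
  Σ-+ {suc n} f g = trans (cong (f zero + g zero +_) (Σ-+ (λ i → f (suc i)) (λ i → g (suc i))))
    (S.solve 4 (λ a b c d → a S.:+ b S.:+ (c S.:+ d) S.:= (a S.:+ c) S.:+ (b S.:+ d)) refl _ _ _ _)

  Σ-*ˡ : ∀ {n} c (f : Fin n → F) → Σ (λ i → c * f i) ≡ c * Σ f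
  Σ-*ˡ {zero} c f = sym (zeroʳ c)
  Σ-*ˡ {suc n} c f = trans (cong (c * f zero +_) (Σ-*ˡ c (λ i → f (suc i)))) (sym (distribˡ c _ _))

  Σ-const : ∀ {n} c → Σ {n} (λ _ → c) ≡ ι n * c
  Σ-const {zero} c = sym (zeroˡ c)
  Σ-const {suc n} c = trans (cong (c +_) (Σ-const {n} c)) (sym (trans (cong (_* c) (ι-suc n))
    (trans (distribʳ c _ _) (cong (_+ ι n * c) (*-identityˡ c)))))

  Σ-0 : ∀ {n} → Σ {n} (λ _ → 0#) ≡ 0#
  Σ-0 {n} = trans (Σ-const {n} 0#) (zeroʳ _)

  Σ-nonneg : ∀ {n} {f : Fin n → F} → (∀ i → 0# ≤ f i) → 0# ≤ Σ f
  Σ-nonneg {n} {f} h = subst (_≤ Σ f) (Σ-0 {n}) (Σ-mono h)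

  sumL : ∀ {A : Set} → (A → F) → List A → F
  sumL f [] = 0#
  sumL f (x ∷ xs) = f x + sumL f xs

  prodL : ∀ {A : Set} → (A → F) → List A → F
  prodL f [] = 1#
  prodL f (x ∷ xs) = f x * prodL f xs

  module _ {A : Set} where

    sumL-cong : ∀ {f g : A → F} → (∀ x → f x ≡ g x) → ∀ xs → sumL f xs ≡ sumL g xs
    sumL-cong h [] = refl
    sumL-cong h (x ∷ xs) = cong₂ _+_ (h x) (sumL-cong h xs)

    sumL-mono : ∀ {f g : A → F} → (∀ x → f x ≤ g x) → ∀ xs → sumL f xs ≤ sumL g xs
    sumL-mono h [] = ≤-refl
    sumL-mono h (x ∷ xs) = +-mono-≤ (h x) (sumL-mono h xs)

    sumL-+ : ∀ (f g : A → F) xs → sumL (λ x → f x + g x) xs ≡ sumL f xs + sumL g xs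
    sumL-+ f g [] = sym (+-identityˡ 0#)
    sumL-+ f g (x ∷ xs) = trans (cong (f x + g x +_) (sumL-+ f g xs))
      (S.solve 4 (λ a b c d → a S.:+ b S.:+ (c S.:+ d) S.:= (a S.:+ c) S.:+ (b S.:+ d)) refl _ _ _ _)

    sumL-*ˡ : ∀ c (f : A → F) xs → sumL (λ x → c * f x) xs ≡ c * sumL f xs
    sumL-*ˡ c f [] = sym (zeroʳ c)
    sumL-*ˡ c f (x ∷ xs) = trans (cong (c * f x +_) (sumL-*ˡ c f xs)) (sym (distribˡ c _ _))

    sumL-const : ∀ c (xs : List A) → sumL (λ _ → c) xs ≡ ι (length xs) * c
    sumL-const c [] = sym (zeroˡ c)
    sumL-const c (x ∷ xs) = trans (cong (c +_) (sumL-const c xs)) (sym (trans (cong (_* c) (ι-suc _))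
      (trans (distribʳ c _ _) (cong (_+ ι (length xs) * c) (*-identityˡ c)))))

    sumL-nonneg : ∀ {f : A → F} → (∀ x → 0# ≤ f x) → ∀ xs → 0# ≤ sumL f xs
    sumL-nonneg h [] = ≤-refl
    sumL-nonneg h (x ∷ xs) = 0≤+ (h x) (sumL-nonneg h xs)

    sumL-++ : ∀ (f : A → F) xs ys → sumL f (xs ++ ys) ≡ sumL f xs + sumL f ys
    sumL-++ f [] ys = sym (+-identityˡ _)
    sumL-++ f (x ∷ xs) ys = trans (cong (f x +_) (sumL-++ f xs ys)) (sym (+-assoc _ _ _))

    prodL-nonneg : ∀ {f : A → F} → (∀ x → 0# ≤ f x) → ∀ xs → 0# ≤ prodL f xs
    prodL-nonneg h [] = 0≤1
    prodL-nonneg h (x ∷ xs) = 0≤* (h x) (prodL-nonneg h xs)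

  sumL-map : ∀ {A B : Set} (f : B → F) (g : A → B) xs → sumL f (map g xs) ≡ sumL (λ x → f (g x)) xs
  sumL-map f g [] = refl
  sumL-map f g (x ∷ xs) = cong (f (g x) +_) (sumL-map f g xs)

  sumL-concatMap : ∀ {A B : Set} (f : B → F) (g : A → List B) xs →
    sumL f (concatMap g xs) ≡ sumL (λ x → sumL f (g x)) xs
  sumL-concatMap f g [] = refl
  sumL-concatMap f g (x ∷ xs) = trans (sumL-++ f (g x) (concatMap g xs))
    (cong (sumL f (g x) +_) (sumL-concatMap f g xs))

  sumL-mono-∈ : ∀ {A : Set} {f g : A → F} xs → (∀ x → x ∈ xs → f x ≤ g x) → sumL f xs ≤ sumL g xs
  sumL-mono-∈ [] k = ≤-refl
  sumL-mono-∈ (x ∷ xs) k = +-mono-≤ (k x (here refl)) (sumL-mono-∈ xs (λ y p → k y (there p)))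

  -- Each x is cancelled against one occurrence in ys; uniqueness of xs keeps the remaining elements
  -- inside what is left. This is the form in which union bounds are taken.
  sumL-⊆ : ∀ {A : Set} (w : A → F) → (∀ x → 0# ≤ w x) → ∀ {xs ys} → Unique xs → xs ⊆ ys → sumL w xs ≤ sumL w ys
  sumL-⊆ w nn {[]} {ys} _ _ = sumL-nonneg nn ys
  sumL-⊆ w nn {x ∷ xs} (x# ∷ u) s with ∈-∃++ (s (here refl))
  ... | as , bs , refl =
    w x + sumL w xs ≤⟨ +-monoʳ (w x) (sumL-⊆ w nn u sub) ⟩
    w x + sumL w (as ++ bs) ≈⟨ cong (w x +_) (sumL-++ w as bs) ⟩
    w x + (sumL w as + sumL w bs) ≈⟨ S.solve 3 (λ a b c → a S.:+ (b S.:+ c) S.:= b S.:+ (a S.:+ c)) refl _ _ _ ⟩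
    sumL w as + (w x + sumL w bs) ≈⟨ sym (sumL-++ w as (x ∷ bs)) ⟩
    sumL w (as ++ x ∷ bs) ∎
    where
    sub : xs ⊆ as ++ bs
    sub {y} p with ∈-++⁻ as (s (there p))
    ... | inj₁ q = ∈-++⁺ˡ q
    ... | inj₂ (here refl) = ⊥-elim (All.lookup x# p refl)
    ... | inj₂ (there q) = ∈-++⁺ʳ as q

-- Independent uniform labels: expectation, conditioning, Harris' inequality.

module Avg (L′ : ℕ) where
  open Field
  open Sums
  open import Data.Bool.Base using (Bool; true; _∧_)
  open import Data.Fin.Base using (Fin; zero; suc; toℕ)
  open import Data.Fin.Properties using () renaming (_≟_ to _≟F_)
  open import Data.Integer.Base using () renaming (+_ to pos; -[1+_] to negsuc)
  open import Data.List.Base using (List; []; _∷_; length)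
  open import Data.List.Relation.Unary.All using (All; []; _∷_)
  open import Data.List.Relation.Unary.Unique.Propositional using (Unique)
  open import Data.List.Relation.Unary.AllPairs using ([]; _∷_)
  open import Data.Vec.Base using (Vec; []; _∷_; lookup; _[_]≔_)
  open import Data.Vec.Properties using (lookup∘update′)
  open import Relation.Nullary using (does; yes; no)
  open import Relation.Nullary.Decidable using (dec-true; dec-false)

  L : ℕ
  L = suc L′

  -- The point mass at a label as a density with respect to the uniform measure. Conditioning on a
  -- label is multiplication by `δ`, without dividing by a probability.
  δ : Fin L → Fin L → F
  δ a b = ι L * b2F (does (a ≟F b))

  0≤δ : ∀ a b → 0# ≤ δ a b
  0≤δ a b = 0≤* (0≤ι L) (0≤b2F _)

  does-sym : ∀ {n} (a b : Fin n) → does (a ≟F b) ≡ does (b ≟F a)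
  does-sym a b with a ≟F b
  ... | yes refl = sym (dec-true (b ≟F b) refl)
  ... | no p = sym (dec-false (b ≟F a) (λ e → p (sym e)))

  Σ-pick : ∀ {n} (b : Fin n) (f : Fin n → F) → Σ (λ i → b2F (does (b ≟F i)) * f i) ≡ f b
  Σ-pick {suc n} zero f = trans (cong₂ _+_ (*-identityˡ _)
    (trans (Σ-cong {n} (λ i → zeroˡ _)) (Σ-0 {n}))) (+-identityʳ _)
  Σ-pick {suc n} (suc b) f = trans (cong₂ _+_ (zeroˡ _) (Σ-pick b (λ i → f (suc i)))) (+-identityˡ _)

  -- Passing from n to n + 1 terms increases the difference of the two sides by the sum of (f i - f
  -- 0) (g i - g 0), whose terms are nonnegative as both factors have the same sign.
  chebyshev : ∀ {n} (f g : Fin n → F) →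
    (∀ {i j} → toℕ i ℕ.≤ toℕ j → f i ≤ f j) → (∀ {i j} → toℕ i ℕ.≤ toℕ j → g i ≤ g j) →
    Σ f * Σ g ≤ ι n * Σ (λ i → f i * g i)
  chebyshev {zero} f g _ _ = ≤-reflexive (trans (zeroˡ _) (sym (zeroʳ _)))
  chebyshev {suc n} f g mf mg = 0≤-⇒≤ (subst (0# ≤_) lem (0≤+ ih cross))
    where
    f₀ = f zero
    g₀ = g zero
    f′ = λ i → f (suc i)
    g′ = λ i → g (suc i)
    Σf = Σ f′
    Σg = Σ g′
    Σfg = Σ (λ i → f′ i * g′ i)
    ih : 0# ≤ ι n * Σfg - Σf * Σg
    ih = ≤⇒0≤- (chebyshev f′ g′ (λ p → mf (s≤s p)) (λ p → mg (s≤s p)))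
    cross : 0# ≤ Σ (λ i → (f′ i - f₀) * (g′ i - g₀))
    cross = Σ-nonneg {n} (λ i → 0≤* (≤⇒0≤- (mf {zero} {suc i} z≤n)) (≤⇒0≤- (mg {zero} {suc i} z≤n)))
    expand : Σ (λ i → (f′ i - f₀) * (g′ i - g₀)) ≡ Σfg + ((- f₀) * Σg + ((- g₀) * Σf + ι n * (f₀ * g₀)))
    expand = trans (Σ-cong (λ i → S.solve 4 (λ a b c d → (a S.:- b) S.:* (c S.:- d) S.:=
        a S.:* c S.:+ ((S.:- b) S.:* c S.:+ ((S.:- d) S.:* a S.:+ b S.:* d))) refl (f′ i) f₀ (g′ i) g₀))
      (trans (Σ-+ (λ i → f′ i * g′ i) _) (cong (Σfg +_) (trans (Σ-+ (λ i → (- f₀) * g′ i) _)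
      (cong₂ _+_ (Σ-*ˡ (- f₀) g′) (trans (Σ-+ (λ i → (- g₀) * f′ i) _)
        (cong₂ _+_ (Σ-*ˡ (- g₀) f′) (Σ-const {n} (f₀ * g₀))))))))
    lem : (ι n * Σfg - Σf * Σg) + Σ (λ i → (f′ i - f₀) * (g′ i - g₀)) ≡
          ι (suc n) * (f₀ * g₀ + Σfg) - (f₀ + Σf) * (g₀ + Σg)
    lem = trans (cong (ι n * Σfg - Σf * Σg +_) expand)
      (trans (S.solve 6 (λ n f g F G H →
         (n S.:* H S.:- F S.:* G) S.:+ (H S.:+ ((S.:- f) S.:* G S.:+ ((S.:- g) S.:* F S.:+ n S.:* (f S.:* g))))
         S.:= (S.con (pos 1) S.:+ n) S.:* (f S.:* g S.:+ H) S.:- (f S.:+ F) S.:* (g S.:+ G))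
         refl (ι n) f₀ g₀ Σf Σg Σfg)
        (cong (λ z → z * (f₀ * g₀ + Σfg) - (f₀ + Σf) * (g₀ + Σg)) (sym (ι-suc n))))

  abstract
    avg : (Fin L → F) → F
    avg f = inv L * Σ f

    ιL-inv : ∀ x → inv L * (ι L * x) ≡ x
    ιL-inv x = trans (sym (*-assoc _ _ x))
      (trans (cong (_* x) (trans (*-comm (inv L) (ι L)) (ι-inv L′))) (*-identityˡ x))

    avg-cong : ∀ {f g} → (∀ i → f i ≡ g i) → avg f ≡ avg g
    avg-cong h = cong (inv L *_) (Σ-cong {L} h)

    avg-mono : ∀ {f g} → (∀ i → f i ≤ g i) → avg f ≤ avg g
    avg-mono h = *-monoˡ (inv L) (inv-nonneg L) (Σ-mono {L} h)

    avg-+ : ∀ f g → avg (λ i → f i + g i) ≡ avg f + avg g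
    avg-+ f g = trans (cong (inv L *_) (Σ-+ {L} f g)) (distribˡ _ _ _)

    avg-*ˡ : ∀ c f → avg (λ i → c * f i) ≡ c * avg f
    avg-*ˡ c f = trans (cong (inv L *_) (Σ-*ˡ {L} c f))
      (S.solve 3 (λ a b c → a S.:* (b S.:* c) S.:= b S.:* (a S.:* c)) refl _ _ _)

    avg-const : ∀ c → avg (λ _ → c) ≡ c
    avg-const c = trans (cong (inv L *_) (Σ-const {L} c)) (ιL-inv c)

    avg-nonneg : ∀ {f} → (∀ i → 0# ≤ f i) → 0# ≤ avg f
    avg-nonneg h = 0≤* (inv-nonneg L) (Σ-nonneg {L} h)

    avg-δ : ∀ (b : Fin L) (f : Fin L → F) → avg (λ i → δ b i * f i) ≡ f b
    avg-δ b f = trans (cong (inv L *_) (trans (Σ-cong {L} (λ i → *-assoc (ι L) (b2F (does (b ≟F i))) (f i))) (Σ-*ˡ {L} (ι L) (λ i → b2F (does (b ≟F i)) * f i))))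
      (trans (ιL-inv _) (Σ-pick b f))

    avg-δ′ : ∀ (b : Fin L) (f : Fin L → F) → avg (λ i → δ i b * f i) ≡ f b
    avg-δ′ b f = trans (avg-cong (λ i → cong (λ d → ι L * b2F d * f i) (does-sym i b))) (avg-δ b f)

    avg-chebyshev : ∀ (f g : Fin L → F) →
      (∀ {i j} → toℕ i ℕ.≤ toℕ j → f i ≤ f j) → (∀ {i j} → toℕ i ℕ.≤ toℕ j → g i ≤ g j) →
      avg f * avg g ≤ avg (λ i → f i * g i)
    avg-chebyshev f g mf mg =
      (inv L * Σ f) * (inv L * Σ g)
        ≈⟨ S.solve 3 (λ i a b → (i S.:* a) S.:* (i S.:* b) S.:= i S.:* (i S.:* (a S.:* b))) refl (inv L) _ _ ⟩
      inv L * (inv L * (Σ f * Σ g))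
        ≤⟨ *-monoˡ _ (inv-nonneg L) (*-monoˡ _ (inv-nonneg L) (chebyshev f g mf mg)) ⟩
      inv L * (inv L * (ι L * Σ (λ ℓ → f ℓ * g ℓ)))
        ≈⟨ cong (inv L *_) (ιL-inv _) ⟩
      inv L * Σ (λ ℓ → f ℓ * g ℓ) ∎

  E : ∀ N → (Vec (Fin L) N → F) → F
  E zero G = G []
  E (suc N) G = avg (λ ℓ → E N (λ β → G (ℓ ∷ β)))

  E-cong : ∀ N {f g} → (∀ β → f β ≡ g β) → E N f ≡ E N g
  E-cong zero h = h []
  E-cong (suc N) h = avg-cong (λ ℓ → E-cong N (λ β → h (ℓ ∷ β)))

  E-mono : ∀ N {f g} → (∀ β → f β ≤ g β) → E N f ≤ E N g
  E-mono zero h = h []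
  E-mono (suc N) h = avg-mono (λ ℓ → E-mono N (λ β → h (ℓ ∷ β)))

  E-+ : ∀ N f g → E N (λ β → f β + g β) ≡ E N f + E N g
  E-+ zero f g = refl
  E-+ (suc N) f g = trans (avg-cong (λ ℓ → E-+ N _ _)) (avg-+ _ _)

  E-*ˡ : ∀ N c f → E N (λ β → c * f β) ≡ c * E N f
  E-*ˡ zero c f = refl
  E-*ˡ (suc N) c f = trans (avg-cong (λ ℓ → E-*ˡ N c _)) (avg-*ˡ c _)

  E-const : ∀ N c → E N (λ _ → c) ≡ c
  E-const zero c = refl
  E-const (suc N) c = trans (avg-cong (λ ℓ → E-const N c)) (avg-const c)

  E-nonneg : ∀ N {f} → (∀ β → 0# ≤ f β) → 0# ≤ E N f
  E-nonneg N {f} h = subst (_≤ E N f) (E-const N 0#) (E-mono N h)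

  E-1- : ∀ N f → E N (λ β → 1# - f β) ≡ 1# - E N f
  E-1- N f = trans (E-cong N (λ β → S.solve 2 (λ x o → o S.:- x S.:= o S.:+ S.con (negsuc 0) S.:* x) refl (f β) 1#))
    (trans (E-+ N _ _) (trans (cong₂ _+_ (E-const N 1#) (E-*ˡ N _ f))
    (S.solve 2 (λ x o → o S.:+ S.con (negsuc 0) S.:* x S.:= o S.:- x) refl (E N f) 1#)))

  E-sumL : ∀ N {A : Set} (f : A → Vec (Fin L) N → F) xs →
    E N (λ β → sumL (λ x → f x β) xs) ≡ sumL (λ x → E N (f x)) xs
  E-sumL N f [] = E-const N 0#
  E-sumL N f (x ∷ xs) = trans (E-+ N _ _) (cong (E N (f x) +_) (E-sumL N f xs))

  E-Σ : ∀ N {n} (f : Fin n → Vec (Fin L) N → F) →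
    E N (λ β → Σ (λ i → f i β)) ≡ Σ (λ i → E N (f i))
  E-Σ N {zero} f = E-const N 0#
  E-Σ N {suc n} f = trans (E-+ N _ _) (cong (E N (f zero) +_) (E-Σ N (λ i → f (suc i))))

  abstract
    E-avg : ∀ N (f : Fin L → Vec (Fin L) N → F) →
      E N (λ β → avg (λ i → f i β)) ≡ avg (λ i → E N (f i))
    E-avg N f = trans (E-*ˡ N (inv L) _) (cong (inv L *_) (E-Σ N f))

  E-E : ∀ N m (f : Vec (Fin L) m → Vec (Fin L) N → F) →
    E N (λ β → E m (λ v → f v β)) ≡ E m (λ v → E N (f v))
  E-E N zero f = refl
  E-E N (suc m) f = trans (E-avg N _) (avg-cong (λ ℓ → E-E N m (λ v → f (ℓ ∷ v))))

  -- Conditioning on the label of g amounts to overwriting it, since the labels are independent.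
  E-δ : ∀ N (g : Fin N) ℓ (G : Vec (Fin L) N → F) →
    E N (λ β → δ (lookup β g) ℓ * G β) ≡ E N (λ β → G (β [ g ]≔ ℓ))
  E-δ (suc N) zero ℓ G = trans (avg-cong (λ b → E-*ˡ N (δ b ℓ) (λ β → G (b ∷ β))))
    (trans (avg-δ′ ℓ (λ b → E N (λ β → G (b ∷ β)))) (sym (avg-const _)))
  E-δ (suc N) (suc g) ℓ G = avg-cong (λ b → E-δ N g ℓ (λ β → G (b ∷ β)))

  labels : ∀ {N} → Vec (Fin L) N → (C : List (Fin N)) → Vec (Fin L) (length C)
  labels β [] = []
  labels β (x ∷ C) = lookup β x ∷ labels β C

  labels-update : ∀ {N} (β : Vec (Fin L) N) {x} {C} ℓ → All (x ≢_) C →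
    labels (β [ x ]≔ ℓ) C ≡ labels β C
  labels-update β ℓ [] = refl
  labels-update β ℓ (p ∷ ps) = cong₂ _∷_ (lookup∘update′ (λ e → p (sym e)) β ℓ) (labels-update β ℓ ps)

  -- Each label is written as an average against `δ` and then overwritten; by distinctness the
  -- overwriting does not disturb the later labels of C.
  E-labels : ∀ N {C : List (Fin N)} → Unique C → (f : Vec (Fin L) (length C) → F) →
    E N (λ β → f (labels β C)) ≡ E (length C) f
  E-labels N [] f = E-const N _
  E-labels N {x ∷ C} (p ∷ u) f = trans
    (E-cong N (λ β → sym (avg-δ (lookup β x) (λ ℓ → f (ℓ ∷ labels β C)))))
    (trans (E-avg N _) (avg-cong (λ ℓ → trans (E-δ N x ℓ (λ β → f (ℓ ∷ labels β C)))
    (trans (E-cong N (λ β → cong (λ v → f (ℓ ∷ v)) (labels-update β ℓ p)))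
    (E-labels N u (λ v → f (ℓ ∷ v)))))))

  prodV : (Fin L → F) → ∀ {m} → Vec (Fin L) m → F
  prodV h [] = 1#
  prodV h (ℓ ∷ v) = h ℓ * prodV h v

  E-prodV : ∀ m h → E m (prodV h) ≡ avg h ^ m
  E-prodV zero h = refl
  E-prodV (suc m) h = trans (avg-cong (λ ℓ → trans (E-*ˡ m (h ℓ) _)
    (trans (cong (h ℓ *_) (E-prodV m h)) (*-comm _ _))))
    (trans (avg-*ˡ (avg h ^ m) h) (*-comm _ _))

  prodV-* : ∀ f g {m} (v : Vec (Fin L) m) → prodV f v * prodV g v ≡ prodV (λ ℓ → f ℓ * g ℓ) v
  prodV-* f g [] = *-identityˡ 1#
  prodV-* f g (ℓ ∷ v) = trans
    (S.solve 4 (λ a b c d → (a S.:* b) S.:* (c S.:* d) S.:= (a S.:* c) S.:* (b S.:* d)) refl _ _ _ _)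
    (cong (f ℓ * g ℓ *_) (prodV-* f g v))

  alive : ℕ → ∀ {m} → Vec (Fin L) m → Bool
  alive s [] = true
  alive s (ℓ ∷ v) = (toℕ ℓ ℕ.<ᵇ s) ∧ alive s v

  below : ℕ → Fin L → F
  below s ℓ = b2F (toℕ ℓ ℕ.<ᵇ s)

  b2F-alive : ∀ s {m} (v : Vec (Fin L) m) → b2F (alive s v) ≡ prodV (below s) v
  b2F-alive s [] = refl
  b2F-alive s (ℓ ∷ v) = trans (b2F-∧ _ _) (cong (below s ℓ *_) (b2F-alive s v))

  sumℕ : ℕ → (ℕ → F) → F
  sumℕ zero f = 0#
  sumℕ (suc s) f = sumℕ s f + f s

  sumℕ-front : ∀ s f → sumℕ (suc s) f ≡ f 0 + sumℕ s (λ i → f (suc i))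
  sumℕ-front zero f = +-comm _ _
  sumℕ-front (suc s) f = trans (cong (_+ f (suc s)) (sumℕ-front s f)) (+-assoc _ _ _)

  Σ-below : ∀ {n} s f → s ℕ.≤ n → Σ {n} (λ i → b2F (toℕ i ℕ.<ᵇ s) * f (toℕ i)) ≡ sumℕ s f
  Σ-below {n} zero f _ = trans (Σ-cong {n} (λ i → zeroˡ (f (toℕ i)))) (Σ-0 {n})
  Σ-below {suc n} (suc s) f (s≤s p) = trans
    (cong₂ _+_ (*-identityˡ (f 0)) (Σ-below {n} s (λ i → f (suc i)) p)) (sym (sumℕ-front s f))

  abstract
    avg-below : ∀ s f → s ℕ.≤ L → avg (λ ℓ → below s ℓ * f (toℕ ℓ)) ≡ inv L * sumℕ s f
    avg-below s f p = cong (inv L *_) (Σ-below s f p)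

  ratio : ℕ → F
  ratio s = avg (below s)

  E-alive : ∀ m s → E m (λ v → b2F (alive s v)) ≡ ratio s ^ m
  E-alive m s = trans (E-cong m (b2F-alive s)) (E-prodV m (below s))

  sumV : (Fin L → F) → ∀ {m} → Vec (Fin L) m → F
  sumV h [] = 0#
  sumV h (ℓ ∷ v) = h ℓ + sumV h v

  -- By symmetry all summands contribute equally: one coordinate carries both b and h, the other m
  -- only b.
  E-prodV-sumV : ∀ m b h → E (suc m) (λ v → prodV b v * sumV h v) ≡
    ι (suc m) * (avg b ^ m * avg (λ ℓ → b ℓ * h ℓ))
  E-prodV-sumV m b h = trans
    (avg-cong (λ ℓ → trans (E-cong m (λ v → S.solve 4 (λ a p c s → (a S.:* p) S.:* (c S.:+ s) S.:=
        (a S.:* c) S.:* p S.:+ a S.:* (p S.:* s)) refl (b ℓ) (prodV b v) (h ℓ) (sumV h v)))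
      (trans (E-+ m _ _) (cong₂ _+_ (trans (E-*ˡ m (b ℓ * h ℓ) (prodV b)) (trans (cong (b ℓ * h ℓ *_) (E-prodV m b)) (*-comm _ _)))
        (trans (E-*ˡ m (b ℓ) (λ v → prodV b v * sumV h v)) (*-comm _ _))))))
    (trans (avg-+ _ _) (trans (cong₂ _+_ (avg-*ˡ (avg b ^ m) (λ ℓ → b ℓ * h ℓ)) (avg-*ˡ _ b)) (rest m)))
    where
    X = avg (λ ℓ → b ℓ * h ℓ)
    rest : ∀ m → avg b ^ m * X + E m (λ v → prodV b v * sumV h v) * avg b ≡ ι (suc m) * (avg b ^ m * X)
    rest zero = trans (cong (1# * X +_) (trans (cong (_* avg b) (zeroʳ 1#)) (zeroˡ _)))
      (trans (+-identityʳ _) (sym (*-identityˡ _)))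
    rest (suc m) = trans (cong (λ z → avg b ^ suc m * X + z * avg b) (E-prodV-sumV m b h))
      (trans (S.solve 4 (λ x p b n → (b S.:* p) S.:* x S.:+ (n S.:* (p S.:* x)) S.:* b S.:=
          (S.con (pos 1) S.:+ n) S.:* ((b S.:* p) S.:* x)) refl X (avg b ^ m) (avg b) (ι (suc m)))
        (cong (λ z → z * (avg b ^ suc m * X)) (sym (ι-suc (suc m)))))

  -- A record and not a function type, so that both labellings can be inferred from a proof of the
  -- relation.
  infix 4 _⊑_
  record _⊑_ {N} (β β′ : Vec (Fin L) N) : Set where
    constructor mk⊑
    field at : ∀ i → toℕ (lookup β i) ℕ.≤ toℕ (lookup β′ i)

  Mono : ∀ {N} → (Vec (Fin L) N → F) → Set
  Mono f = ∀ {β β′} → β ⊑ β′ → f β ≤ f β′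

  ⊑-cons : ∀ {N} {β β′ : Vec (Fin L) N} {i j} → toℕ i ℕ.≤ toℕ j → β ⊑ β′ → (i ∷ β) ⊑ (j ∷ β′)
  ⊑-cons p (mk⊑ q) = mk⊑ λ { zero → p ; (suc k) → q k }

  ⊑-refl : ∀ {N} {β : Vec (Fin L) N} → β ⊑ β
  ⊑-refl = mk⊑ λ _ → ℕ.≤-refl

  -- Induction on the coordinates. The inductive hypothesis compares the two functions with the
  -- first label held fixed; their averages are again increasing in that label, so Chebyshev's
  -- inequality joins the slices.
  harris₂ : ∀ N {f g} → Mono f → Mono g → E N f * E N g ≤ E N (λ β → f β * g β)
  harris₂ zero mf mg = ≤-refl
  harris₂ (suc N) {f} {g} mf mg =
    avg F₁ * avg G₁
      ≤⟨ avg-chebyshev F₁ G₁ (mono mf) (mono mg) ⟩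
    avg (λ ℓ → F₁ ℓ * G₁ ℓ)
      ≤⟨ avg-mono (λ ℓ → harris₂ N (λ p → mf (⊑-cons ℕ.≤-refl p)) (λ p → mg (⊑-cons ℕ.≤-refl p))) ⟩
    E (suc N) (λ β → f β * g β) ∎
    where
    F₁ = λ ℓ → E N (λ β → f (ℓ ∷ β))
    G₁ = λ ℓ → E N (λ β → g (ℓ ∷ β))
    mono : ∀ {h} → Mono h → ∀ {i j} → toℕ i ℕ.≤ toℕ j → E N (λ β → h (i ∷ β)) ≤ E N (λ β → h (j ∷ β))
    mono mh p = E-mono N (λ β → mh (⊑-cons p ⊑-refl))

  harris : ∀ N {A : Set} (f : A → Vec (Fin L) N → F) (xs : List A) →
    (∀ x → Mono (f x)) → (∀ x β → 0# ≤ f x β) →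
    prodL (λ x → E N (f x)) xs ≤ E N (λ β → prodL (λ x → f x β) xs)
  harris N f [] m nn = ≤-reflexive (sym (E-const N 1#))
  harris N f (x ∷ xs) m nn =
    E N (f x) * prodL (λ x → E N (f x)) xs
      ≤⟨ *-monoˡ _ (E-nonneg N (nn x)) (harris N f xs m nn) ⟩
    E N (f x) * E N (λ β → prodL (λ x → f x β) xs)
      ≤⟨ harris₂ N (m x) (monoProd xs) ⟩
    E N (λ β → f x β * prodL (λ x → f x β) xs) ∎
    where
    monoProd : ∀ ys → Mono (λ β → prodL (λ x → f x β) ys)
    monoProd [] p = ≤-refl
    monoProd (y ∷ ys) {β} {β′} p = *-mono (nn y β) (prodL-nonneg (λ x → nn x β′) ys) (m y p) (monoProd ys p)

  0≤ratio : ∀ s → 0# ≤ ratio s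
  0≤ratio s = avg-nonneg (λ ℓ → 0≤b2F (toℕ ℓ ℕ.<ᵇ s))

  module Density (D r : ℕ) where

    -- Euler's scheme with step 1 / L for Q' = (1 - Q ^ r) ^ D. In the ideal model `q s` is the
    -- probability that an edge with label s is accepted, and `Q s` that its label is below s and it
    -- is accepted.
    mutual
      Q : ℕ → F
      Q zero = 0#
      Q (suc s) = Q s + inv L * q s

      q : ℕ → F
      q s = (1# - Q s ^ r) ^ D

    Q-avg : ∀ s → s ℕ.≤ L → avg (λ ℓ → below s ℓ * q (toℕ ℓ)) ≡ Q s
    Q-avg s p = trans (avg-below s q p) (lem s)
      where
      lem : ∀ s → inv L * sumℕ s q ≡ Q s
      lem zero = zeroʳ _
      lem (suc s) = trans (distribˡ _ _ _) (cong (_+ inv L * q s) (lem s))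

-- Decision trees for the acceptance rule and their behaviour under fresh labels.

module DT (L′ N : ℕ) (links : Fin N → List (List (Fin N))) where
  open import Data.Fin.Base using (Fin; zero; suc; toℕ)
  open import Data.List.Base using (List; []; _∷_; length)

  open Field
  open Sums
  open Avg L′
  open import Data.Bool.Base using (Bool; true; false; if_then_else_; _∧_; T)
  open import Data.Bool.Properties using (T-∧)
  open import Data.Fin.Properties using (toℕ<n)
  open import Data.Integer.Base using () renaming (+_ to pos)
  open import Data.List.Relation.Unary.All using (All; []; _∷_)
  open import Data.Product using (_×_; _,_)
  open import Data.Unit using (⊤)
  open import Function.Bundles using (Equivalence)
  open import Data.Vec.Base using (Vec; []; _∷_)

  Link : Set
  Link = List (Fin N)

  -- `ask u s C` inquires whether all labels on C are below s. A positive answer reveals these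
  -- labels, a negative one nothing beyond itself. `u` is the edge of which C is a link and s its
  -- label.
  data DT : Set where
    leaf : Bool → DT
    ask : Fin N → ℕ → (C : Link) → DT → (Vec (Fin L) (length C) → DT) → DT

  -- In contrast to run, every question is answered by fresh independent labels.
  ideal : DT → F
  ideal (leaf b) = b2F b
  ideal (ask u s C no yes) = (1# - ratio s ^ length C) * ideal no
    + E (length C) (λ v → b2F (alive s v) * ideal (yes v))

  -- The expected number of positive answers, again under fresh labels.
  cost : DT → F
  cost (leaf b) = 0#
  cost (ask u s C no yes) = (1# - ratio s ^ length C) * cost no
    + E (length C) (λ v → b2F (alive s v) * (1# + cost (yes v)))

  run : DT → Vec (Fin L) N → Bool
  run (leaf b) β = b
  run (ask u s C no yes) β = if alive s (labels β C) then run (yes (labels β C)) β else run no β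

  -- Evaluation, in continuation-passing style, of the statement that no link in a
  -- list has all its elements below s and accepted.
  mutual
    node : ℕ → Fin N → ℕ → List Link → (Bool → DT) → DT
    node k u s [] κ = κ true
    node zero u s (C ∷ cs) κ = κ true
    node (suc k) u s (C ∷ cs) κ = ask u s C (node (suc k) u s cs κ)
      (λ v → kids k C v (λ b → if b then κ false else node (suc k) u s cs κ))

    kids : ℕ → (C : Link) → Vec (Fin L) (length C) → (Bool → DT) → DT
    kids k [] [] κ = κ true
    kids k (g ∷ C) (ℓ ∷ v) κ = node k g (toℕ ℓ) (links g) (λ b → if b then kids k C v κ else κ false)

  -- The recursion of `node` and `kids` carried out on a given labelling. The fuel k is to be at
  -- least s: labels fall strictly along links, so at fuel zero no label lies below s and `true` is
  -- the correct default.
  mutual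
    accL : ℕ → ℕ → List Link → Vec (Fin L) N → Bool
    accL k s [] β = true
    accL zero s (C ∷ cs) β = true
    accL (suc k) s (C ∷ cs) β =
      if alive s (labels β C) ∧ accK k C (labels β C) β then false else accL (suc k) s cs β

    accK : ℕ → (C : Link) → Vec (Fin L) (length C) → Vec (Fin L) N → Bool
    accK k [] [] β = true
    accK k (g ∷ C) (ℓ ∷ v) β = accL k (toℕ ℓ) (links g) β ∧ accK k C v β

  mutual
    run-node : ∀ k u s cs κ β → run (node k u s cs κ) β ≡ run (κ (accL k s cs β)) β
    run-node k u s [] κ β = refl
    run-node zero u s (C ∷ cs) κ β = refl
    run-node (suc k) u s (C ∷ cs) κ β with alive s (labels β C)
    ... | false = run-node (suc k) u s cs κ β
    ... | true with accK k C (labels β C) β | run-kids k C (labels β C) (λ b → if b then κ false else node (suc k) u s cs κ) β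
    ...   | true | eq = eq
    ...   | false | eq = trans eq (run-node (suc k) u s cs κ β)

    run-kids : ∀ k C v κ β → run (kids k C v κ) β ≡ run (κ (accK k C v β)) β
    run-kids k [] [] κ β = refl
    run-kids k (g ∷ C) (ℓ ∷ v) κ β with accL k (toℕ ℓ) (links g) β
      | run-node k g (toℕ ℓ) (links g) (λ b → if b then kids k C v κ else κ false) β
    ... | true | eq = trans eq (run-kids k C v κ β)
    ... | false | eq = eq

  AllBelow : ∀ {m} → ℕ → Vec (Fin L) m → Set
  AllBelow s [] = ⊤
  AllBelow s (ℓ ∷ v) = toℕ ℓ ℕ.< s × AllBelow s v

  alive⇒below : ∀ s {m} (v : Vec (Fin L) m) → T (alive s v) → AllBelow s v
  alive⇒below s [] _ = _
  alive⇒below s (ℓ ∷ v) t with Equivalence.to T-∧ t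
  ... | p , q = ℕ.<ᵇ⇒< _ _ p , alive⇒below s v q

  below⇒alive : ∀ s {m} (v : Vec (Fin L) m) → AllBelow s v → T (alive s v)
  below⇒alive s [] _ = _
  below⇒alive s (ℓ ∷ v) (p , q) = Equivalence.from T-∧ (ℕ.<⇒<ᵇ p , below⇒alive s v q)

  alive-mono : ∀ s {m} (v : Vec (Fin L) m) {a b} → (T (alive s v) → a ≤ b) →
    b2F (alive s v) * a ≤ b2F (alive s v) * b
  alive-mono s v {a} {b} f with alive s v
  ... | true = *-monoˡ 1# 0≤1 (f _)
  ... | false = ≤-reflexive (trans (zeroˡ a) (sym (zeroˡ b)))

  0≤1-^ : ∀ s n → 0# ≤ 1# - ratio s ^ n
  0≤1-^ s n = ≤⇒0≤- (^≤1 n (0≤ratio s)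
    (subst (ratio s ≤_) (avg-const 1#) (avg-mono (λ ℓ → b2F≤1 (toℕ ℓ ℕ.<ᵇ s)))))

  module Analysis (V : Fin N → Set) (D r′ : ℕ)
    (len-links : ∀ {u} → V u → length (links u) ≡ D)
    (ok-links : ∀ {u} → V u → All (λ C → length C ≡ suc r′ × All V C) (links u))
    where

    r : ℕ
    r = suc r′

    Ok : Link → Set
    Ok C = length C ≡ r × All V C

    open Density D r

    mix : F → F → F → F
    mix p a b = p * a + (1# - p) * b

    E-alive-mix : ∀ s m (P : Vec (Fin L) m → F) (G : Vec (Fin L) m → F) a b →
      (∀ v → AllBelow s v → G v ≡ mix (P v) a b) →
      E m (λ v → b2F (alive s v) * G v) ≡
        E m (λ v → b2F (alive s v) * P v) * (a - b) + ratio s ^ m * b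
    E-alive-mix s m P G a b h = trans (E-cong m pt) (trans (E-+ m _ _)
      (cong₂ _+_ (trans (E-*ˡ m (a - b) (λ v → b2F (alive s v) * P v)) (*-comm _ _))
        (trans (E-*ˡ m b (λ v → b2F (alive s v))) (trans (*-comm _ _) (cong (_* b) (E-alive m s))))))
      where
      pt : ∀ v → b2F (alive s v) * G v ≡ (a - b) * (b2F (alive s v) * P v) + b * b2F (alive s v)
      pt v with alive s v in eq
      ... | true = trans (cong (1# *_) (h v (alive⇒below s v (subst T (sym eq) _))))
        (S.solve 3 (λ p a b → S.con (pos 1) S.:* (p S.:* a S.:+ (S.con (pos 1) S.:- p) S.:* b) S.:=
           (a S.:- b) S.:* (S.con (pos 1) S.:* p) S.:+ b S.:* S.con (pos 1)) refl (P v) a b)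
      ... | false = S.solve 4 (λ g p a b → S.con (pos 0) S.:* g S.:=
           (a S.:- b) S.:* (S.con (pos 0) S.:* p) S.:+ b S.:* S.con (pos 0)) refl (G v) (P v) a b

    E-alive-q : ∀ s m → s ℕ.≤ L →
      E m (λ v → b2F (alive s v) * prodV (λ ℓ → q (toℕ ℓ)) v) ≡ Q s ^ m
    E-alive-q s m p = trans (E-cong m (λ v → trans (cong (_* _) (b2F-alive s v)) (prodV-* _ _ v)))
      (trans (E-prodV m _) (cong (_^ m) (Q-avg s p)))

    mutual
      -- Under fresh labels the links are independent, and each consists of accepted edges below s
      -- with probability Q s ^ r. In continuation-passing style this reads as a convex combination
      -- of the two continuations, which is stable under nesting.
      ideal-node : ∀ k u s cs κ → s ℕ.≤ k → s ℕ.≤ L → All Ok cs →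
        ideal (node k u s cs κ) ≡ mix ((1# - Q s ^ r) ^ length cs) (ideal (κ true)) (ideal (κ false))
      ideal-node k u s [] κ _ _ _ = mix-1 _ _
        where
        mix-1 : ∀ a b → a ≡ mix 1# a b
        mix-1 a b = sym (trans (cong₂ _+_ (*-identityˡ a) (trans (cong (_* b) (-‿inverseʳ 1#)) (zeroˡ b))) (+-identityʳ a))
      ideal-node zero u zero (C ∷ cs) κ z≤n _ _ = sym (trans (cong (λ z → mix z _ _) one) (mix-1 _ _))
        where
        mix-1 : ∀ a b → mix 1# a b ≡ a
        mix-1 a b = trans (cong₂ _+_ (*-identityˡ a) (trans (cong (_* b) (-‿inverseʳ 1#)) (zeroˡ b))) (+-identityʳ a)
        one : (1# - 0# ^ r) ^ length (C ∷ cs) ≡ 1#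
        one = trans (cong (_^ length (C ∷ cs)) (trans (cong (λ z → 1# - z) (zeroˡ _))
          (sym (b2F-not false)))) (1^ (length (C ∷ cs)))
      ideal-node (suc k) u s (C ∷ cs) κ s≤k s≤L ((lenC , VC) ∷ oks) = begin′
        where
        X = ideal (node (suc k) u s cs κ)
        A = ideal (κ true)
        B = ideal (κ false)
        m = length C
        z = Q s ^ m
        ρ = ratio s ^ m
        -- Averaging over the revealed labels turns the product of the `q` into Q s ^ m. The
        -- probability ρ that the link is alive then cancels against the weight of the negative
        -- branch.
        step : E m (λ v → b2F (alive s v) * ideal (kids k C v (λ b → if b then κ false else node (suc k) u s cs κ)))
               ≡ z * (B - X) + ρ * X
        step = trans (E-alive-mix s m (λ v → prodV (λ ℓ → q (toℕ ℓ)) v) _ B X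
                 (λ v bl → ideal-kids k C v _ VC (below-≤ v bl)))
               (cong (λ w → w * (B - X) + ρ * X) (E-alive-q s m s≤L))
          where
          below-≤ : ∀ {m} (v : Vec (Fin L) m) → AllBelow s v → AllBelow (suc k) v
          below-≤ [] _ = _
          below-≤ (ℓ ∷ v) (p , ps) = ℕ.≤-trans p s≤k , below-≤ v ps
        Y = (1# - Q s ^ r) ^ length cs
        ih : X ≡ mix Y A B
        ih = ideal-node (suc k) u s cs κ s≤k s≤L oks
        begin′ : (1# - ρ) * X + E m _ ≡ mix ((1# - Q s ^ r) * Y) A B
        begin′ = trans (cong ((1# - ρ) * X +_) step)
          (trans (S.solve 5 (λ o ρ X z B → (o S.:- ρ) S.:* X S.:+ (z S.:* (B S.:- X) S.:+ ρ S.:* X) S.:=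
             (o S.:- z) S.:* X S.:+ z S.:* B) refl 1# ρ X z B)
          (trans (cong₂ (λ x w → (1# - w) * x + w * B) ih (cong (Q s ^_) lenC))
          (one-solve (Q s ^ r) Y A B)))
          where
          one-solve : ∀ z Y A B → (1# - z) * (Y * A + (1# - Y) * B) + z * B ≡ mix ((1# - z) * Y) A B
          one-solve = S.solve 4 (λ z Y A B → (S.con (pos 1) S.:- z) S.:* (Y S.:* A S.:+ (S.con (pos 1) S.:- Y) S.:* B) S.:+ z S.:* B S.:=
               (S.con (pos 1) S.:- z) S.:* Y S.:* A S.:+ (S.con (pos 1) S.:- (S.con (pos 1) S.:- z) S.:* Y) S.:* B) refl

      ideal-kids : ∀ k C v κ → All V C → AllBelow (suc k) v →
        ideal (kids k C v κ) ≡ mix (prodV (λ ℓ → q (toℕ ℓ)) v) (ideal (κ true)) (ideal (κ false))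
      ideal-kids k [] [] κ _ _ = sym (trans (cong₂ _+_ (*-identityˡ _)
        (trans (cong (_* ideal (κ false)) (-‿inverseʳ 1#)) (zeroˡ _))) (+-identityʳ _))
      ideal-kids k (g ∷ C) (ℓ ∷ v) κ (Vg ∷ VC) (p , ps) = trans
        (ideal-node k g (toℕ ℓ) (links g) _ (ℕ.≤-pred p) (ℕ.<⇒≤ (toℕ<n ℓ)) (ok-links Vg))
        (trans (cong₂ (λ e x → mix ((1# - Q (toℕ ℓ) ^ r) ^ e) x (ideal (κ false))) (len-links Vg)
                  (ideal-kids k C v κ VC ps))
          (S.solve 4 (λ x P A B → x S.:* (P S.:* A S.:+ (S.con (pos 1) S.:- P) S.:* B) S.:+ (S.con (pos 1) S.:- x) S.:* B S.:=
               x S.:* P S.:* A S.:+ (S.con (pos 1) S.:- x S.:* P) S.:* B) refl _ _ _ _))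

    -- `y s` bounds the expected number of positive answers caused by one link tested at level s,
    -- and `y-step` says that it is a supersolution: the link itself counts once if it is alive, and
    -- each of its r elements with label t below s brings D further links of cost y t. Early
    -- stopping of the evaluation is ignored.
    module Cost (Tm : ℕ) (y : ℕ → F) (0≤y : ∀ s → 0# ≤ y s)
      (y-step : ∀ s → s ℕ.≤ Tm →
        ratio s ^ r + E r (λ v → b2F (alive s v) * sumV (λ ℓ → ι D * y (toℕ ℓ)) v) ≤ y s)
      where

      h : Fin L → F
      h ℓ = ι D * y (toℕ ℓ)

      mutual
        cost-node : ∀ k u s cs κ M → s ℕ.≤ Tm → All Ok cs → (∀ b → cost (κ b) ≤ M) →
          cost (node k u s cs κ) ≤ ι (length cs) * y s + M
        cost-node k u s [] κ M _ _ hκ = ≤-trans (hκ true) (≤-reflexive (sym (trans (cong (_+ M) (zeroˡ (y s))) (+-identityˡ M))))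
        cost-node zero u s (C ∷ cs) κ M _ _ hκ = ≤-trans (hκ true) (x≤y+x M (0≤* (0≤ι _) (0≤y s)))
        cost-node (suc k) u s (C ∷ cs) κ M s≤T ((lenC , VC) ∷ oks) hκ =
          (1# - ρ) * cost no + E m (λ v → b2F (alive s v) * (1# + cost (yes v)))
            ≤⟨ +-mono-≤ (*-monoˡ _ (0≤1-^ s m) ih)
                 (E-mono m (λ v → alive-mono s v (λ al → +-monoʳ 1# (ihv v (alive⇒below s v al))))) ⟩
          (1# - ρ) * B + E m (λ v → b2F (alive s v) * (1# + (sumV h v + B)))
            ≈⟨ cong ((1# - ρ) * B +_) split ⟩
          (1# - ρ) * B + (ρ * (1# + B) + Eh)
            ≈⟨ S.solve 3 (λ ρ B e → (S.con (pos 1) S.:- ρ) S.:* B S.:+ (ρ S.:* (S.con (pos 1) S.:+ B) S.:+ e) S.:=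
                 (ρ S.:+ e) S.:+ B) refl ρ B Eh ⟩
          (ρ + Eh) + B
            ≤⟨ +-monoˡ B (subst (λ j → ratio s ^ j + E j (λ v → b2F (alive s v) * sumV h v) ≤ y s) (sym lenC) (y-step s s≤T)) ⟩
          y s + (ι (length cs) * y s + M)
            ≈⟨ S.solve 3 (λ y n M → y S.:+ (n S.:* y S.:+ M) S.:= (S.con (pos 1) S.:+ n) S.:* y S.:+ M) refl (y s) _ M ⟩
          (1# + ι (length cs)) * y s + M
            ≈⟨ cong (λ z → z * y s + M) (sym (ι-suc (length cs))) ⟩
          ι (length (C ∷ cs)) * y s + M ∎
          where
          m = length C
          ρ = ratio s ^ m
          no = node (suc k) u s cs κ
          yes = λ v → kids k C v (λ b → if b then κ false else no)
          B = ι (length cs) * y s + M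
          Eh = E m (λ v → b2F (alive s v) * sumV h v)
          ih : cost no ≤ B
          ih = cost-node (suc k) u s cs κ M s≤T oks hκ
          ihb : ∀ b → cost (if b then κ false else no) ≤ B
          ihb true = ≤-trans (hκ false) (x≤y+x M (0≤* (0≤ι _) (0≤y s)))
          ihb false = ih
          below-≤ : ∀ {m} (v : Vec (Fin L) m) → AllBelow s v → AllBelow Tm v
          below-≤ [] _ = _
          below-≤ (ℓ ∷ v) (p , ps) = ℕ.≤-trans p s≤T , below-≤ v ps
          ihv : ∀ v → AllBelow s v → cost (yes v) ≤ sumV h v + B
          ihv v bl = cost-kids k C v _ B VC (below-≤ v bl) ihb
          split : E m (λ v → b2F (alive s v) * (1# + (sumV h v + B))) ≡ ρ * (1# + B) + Eh
          split = trans (E-cong m (λ v → S.solve 3 (λ a x B → a S.:* (S.con (pos 1) S.:+ (x S.:+ B)) S.:=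
                     (S.con (pos 1) S.:+ B) S.:* a S.:+ a S.:* x) refl (b2F (alive s v)) (sumV h v) B))
            (trans (E-+ m _ _) (cong (_+ Eh) (trans (E-*ˡ m (1# + B) (λ v → b2F (alive s v)))
              (trans (*-comm _ _) (cong (_* (1# + B)) (E-alive m s))))))

        cost-kids : ∀ k C v κ M → All V C → AllBelow Tm v → (∀ b → cost (κ b) ≤ M) →
          cost (kids k C v κ) ≤ sumV h v + M
        cost-kids k [] [] κ M _ _ hκ = ≤-trans (hκ true) (≤-reflexive (sym (+-identityˡ M)))
        cost-kids k (g ∷ C) (ℓ ∷ v) κ M (Vg ∷ VC) (p , ps) hκ =
          ≤-trans (cost-node k g (toℕ ℓ) (links g) _ (sumV h v + M) (ℕ.<⇒≤ p) (ok-links Vg) ihb)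
            (≤-reflexive (trans (cong (λ n → ι n * y (toℕ ℓ) + (sumV h v + M)) (len-links Vg)) (sym (+-assoc _ _ _))))
          where
          0≤sumV : ∀ {m} (v : Vec (Fin L) m) → 0# ≤ sumV h v
          0≤sumV [] = ≤-refl
          0≤sumV (ℓ ∷ v) = 0≤+ (0≤* (0≤ι D) (0≤y _)) (0≤sumV v)
          ihb : ∀ b → cost (if b then kids k C v κ else κ false) ≤ sumV h v + M
          ihb true = cost-kids k C v κ M VC ps hκ
          ihb false = ≤-trans (hκ false) (x≤y+x M (0≤sumV v))

-- No query is repeated, and every query concerns an edge with known label.

module WF (L′ N : ℕ) (links : Fin N → List (List (Fin N))) where
  open import Data.Fin.Base using (Fin; zero; suc; toℕ)
  open import Data.List.Base using (List; []; _∷_; _++_; length; map)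

  open Avg L′
  open DT L′ N links
  open import Data.Bool.Base using (true; false; if_then_else_)
  open import Data.Empty using (⊥-elim)
  open import Data.List.Membership.Propositional using (_∈_; _∉_)
  open import Data.List.Membership.Propositional.Properties using (∈-++⁺ˡ; ∈-++⁺ʳ; ∈-map⁺; ∈-map⁻)
  open import Data.List.Relation.Binary.Subset.Propositional using (_⊆_)
  open import Data.List.Relation.Unary.Any using (here; there)
  open import Data.List.Relation.Unary.All as All using (All; []; _∷_)
  open import Data.List.Relation.Unary.AllPairs using ([]; _∷_)
  open import Data.List.Relation.Unary.Unique.Propositional using (Unique)
  open import Data.Product using (∃; _×_; _,_; proj₁; proj₂)
  open import Data.Sum using (_⊎_; inj₁; inj₂)
  open import Data.Unit using (⊤)
  open import Data.Vec.Base using (Vec; []; _∷_)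
  open import Function.Base using (_∘_)
  open import Relation.Nullary using (¬_)

  Cell : Set
  Cell = Fin N × Fin L

  dom : List Cell → List (Fin N)
  dom = map proj₁

  cells : (C : Link) → Vec (Fin L) (length C) → List Cell
  cells [] [] = []
  cells (x ∷ C) (ℓ ∷ v) = (x , ℓ) ∷ cells C v

  cells-∈ : ∀ {x} C v → x ∈ C → ∃ λ ℓ → (x , ℓ) ∈ cells C v
  cells-∈ (x ∷ C) (ℓ ∷ v) (here refl) = ℓ , here refl
  cells-∈ (x ∷ C) (ℓ ∷ v) (there p) with cells-∈ C v p
  ... | ℓ′ , q = ℓ′ , there q

  dom-cells : ∀ C v → dom (cells C v) ≡ C
  dom-cells [] [] = refl
  dom-cells (x ∷ C) (ℓ ∷ v) = cong (x ∷_) (dom-cells C v)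

  -- A negative answer: no simultaneous labels below s on C, a link of u.
  Neg : Set
  Neg = Fin N × ℕ × Link

  Pair : Set
  Pair = Fin N × Link

  pair : Neg → Pair
  pair (u , s , C) = u , C

  Asked : List Neg → List Pair → Fin N → Link → Set
  Asked 𝒩 𝒴 u C = (u , C) ∈ map pair 𝒩 ⊎ (u , C) ∈ 𝒴

  -- ζ holds the labels revealed so far, 𝒩 and 𝒴 the negative and positive answers. After a positive
  -- answer something is claimed only if the link was disjoint from the known edges; the other case
  -- is among the accidents that are given up.
  WF : DT → List Cell → List Neg → List Pair → Set
  WF (leaf b) ζ 𝒩 𝒴 = ⊤
  WF (ask u s C no yes) ζ 𝒩 𝒴 =
    (∃ λ ℓ → (u , ℓ) ∈ ζ × toℕ ℓ ≡ s) × C ∈ links u × ¬ Asked 𝒩 𝒴 u C ×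
    WF no ζ ((u , s , C) ∷ 𝒩) 𝒴 ×
    (∀ v → AllBelow s v → All (_∉ dom ζ) C → WF (yes v) (cells C v ++ ζ) 𝒩 ((u , C) ∷ 𝒴))

  AskedIn : List Cell → List Neg → List Pair → Set
  AskedIn ζ 𝒩 𝒴 = ∀ u C → Asked 𝒩 𝒴 u C → u ∈ dom ζ

  -- What a continuation may assume about the state in which it is resumed: knowledge has only
  -- grown, and edges known before have received no new queries, apart from those in P.
  record Ext (P : Fin N → Set) (ζ : List Cell) (𝒩 : List Neg) (𝒴 : List Pair)
             (ζ′ : List Cell) (𝒩′ : List Neg) (𝒴′ : List Pair) : Set where
    constructor ext
    field
      sub : ζ ⊆ ζ′
      inn : AskedIn ζ′ 𝒩′ 𝒴′
      new : ∀ u C → u ∈ dom ζ → ¬ P u → Asked 𝒩′ 𝒴′ u C → Asked 𝒩 𝒴 u C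

  ∈-dom : ∀ {x ℓ} {ζ : List Cell} → (x , ℓ) ∈ ζ → x ∈ dom ζ
  ∈-dom = ∈-map⁺ proj₁

  dom-⊆ : ∀ {ζ ζ′ : List Cell} → ζ ⊆ ζ′ → ∀ {x} → x ∈ dom ζ → x ∈ dom ζ′
  dom-⊆ s p with ∈-map⁻ proj₁ p
  ... | (x , ℓ) , q , refl = ∈-dom (s q)

  module _ (V : Fin N → Set)
    (ok-links : ∀ {u C} → V u → C ∈ links u → All V C × Unique C)
    (uniq-links : ∀ u → Unique (links u))
    where

    mutual
      -- An edge is evaluated only once: the elements of a link disjoint from the known edges have
      -- never been queried, because every query is made at a known edge. Hence after an excursion
      -- into the children of C the remaining links of u are still unasked.
      wf-node : ∀ k u ℓ cs κ ζ 𝒩 𝒴 → V u → (u , ℓ) ∈ ζ → Unique cs → cs ⊆ links u →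
        AskedIn ζ 𝒩 𝒴 → (∀ C → C ∈ cs → ¬ Asked 𝒩 𝒴 u C) →
        (∀ b ζ′ 𝒩′ 𝒴′ → Ext (_≡ u) ζ 𝒩 𝒴 ζ′ 𝒩′ 𝒴′ → WF (κ b) ζ′ 𝒩′ 𝒴′) →
        WF (node k u (toℕ ℓ) cs κ) ζ 𝒩 𝒴
      wf-node k u ℓ [] κ ζ 𝒩 𝒴 Vu uℓ uq sb inn fr K = K true ζ 𝒩 𝒴 (ext (λ p → p) inn (λ _ _ _ _ p → p))
      wf-node zero u ℓ (C ∷ cs) κ ζ 𝒩 𝒴 Vu uℓ uq sb inn fr K = K true ζ 𝒩 𝒴 (ext (λ p → p) inn (λ _ _ _ _ p → p))
      wf-node (suc k) u ℓ (C ∷ cs) κ ζ 𝒩 𝒴 Vu uℓ (C# ∷ uq) sb inn fr K =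
        (ℓ , uℓ , refl) , sb (here refl) , fr C (here refl) ,
        wf-node (suc k) u ℓ cs κ ζ ((u , toℕ ℓ , C) ∷ 𝒩) 𝒴 Vu uℓ uq (sb ∘ there) inn₀ fr₀ K₀ ,
        (λ v bl disj → wf-kids k C v _ (cells C v ++ ζ) 𝒩 ((u , C) ∷ 𝒴) ∈-++⁺ˡ
          (proj₂ (ok-links Vu (sb (here refl)))) (proj₁ (ok-links Vu (sb (here refl))))
          (inn₁ v) (λ g g∈C C′ → fr₁ disj g g∈C C′) (K₁ v disj))
        where
        inn₀ : AskedIn ζ ((u , toℕ ℓ , C) ∷ 𝒩) 𝒴
        inn₀ u′ C′ (inj₁ (here refl)) = ∈-dom uℓ
        inn₀ u′ C′ (inj₁ (there p)) = inn u′ C′ (inj₁ p)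
        inn₀ u′ C′ (inj₂ p) = inn u′ C′ (inj₂ p)
        fr₀ : ∀ C′ → C′ ∈ cs → ¬ Asked ((u , toℕ ℓ , C) ∷ 𝒩) 𝒴 u C′
        fr₀ C′ p (inj₁ (here refl)) = All.lookup C# p refl
        fr₀ C′ p (inj₁ (there q)) = fr C′ (there p) (inj₁ q)
        fr₀ C′ p (inj₂ q) = fr C′ (there p) (inj₂ q)
        K₀ : ∀ b ζ′ 𝒩′ 𝒴′ → Ext (_≡ u) ζ ((u , toℕ ℓ , C) ∷ 𝒩) 𝒴 ζ′ 𝒩′ 𝒴′ → WF (κ b) ζ′ 𝒩′ 𝒴′
        K₀ b ζ′ 𝒩′ 𝒴′ (ext s i n) = K b ζ′ 𝒩′ 𝒴′ (ext s i n′)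
          where
          n′ : ∀ u′ C′ → u′ ∈ dom ζ → ¬ (u′ ≡ u) → Asked 𝒩′ 𝒴′ u′ C′ → Asked 𝒩 𝒴 u′ C′
          n′ u′ C′ d ne a with n u′ C′ d ne a
          ... | inj₁ (here refl) = ⊥-elim (ne refl)
          ... | inj₁ (there p) = inj₁ p
          ... | inj₂ p = inj₂ p
        inn₁ : ∀ v → AskedIn (cells C v ++ ζ) 𝒩 ((u , C) ∷ 𝒴)
        inn₁ v u′ C′ (inj₁ p) = dom-⊆ (∈-++⁺ʳ (cells C v)) (inn u′ C′ (inj₁ p))
        inn₁ v u′ C′ (inj₂ (here refl)) = dom-⊆ (∈-++⁺ʳ (cells C v)) (∈-dom uℓ)
        inn₁ v u′ C′ (inj₂ (there p)) = dom-⊆ (∈-++⁺ʳ (cells C v)) (inn u′ C′ (inj₂ p))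
        fr₁ : All (_∉ dom ζ) C → ∀ g → g ∈ C → ∀ C′ → ¬ Asked 𝒩 ((u , C) ∷ 𝒴) g C′
        fr₁ disj g p C′ (inj₁ q) = All.lookup disj p (inn g C′ (inj₁ q))
        fr₁ disj g p C′ (inj₂ (here refl)) = All.lookup disj p (∈-dom uℓ)
        fr₁ disj g p C′ (inj₂ (there q)) = All.lookup disj p (inn g C′ (inj₂ q))
        K₁ : ∀ v → All (_∉ dom ζ) C → ∀ b ζ′ 𝒩′ 𝒴′ →
          Ext (_∈ C) (cells C v ++ ζ) 𝒩 ((u , C) ∷ 𝒴) ζ′ 𝒩′ 𝒴′ →
          WF (if b then κ false else node (suc k) u (toℕ ℓ) cs κ) ζ′ 𝒩′ 𝒴′
        K₁ v disj b ζ′ 𝒩′ 𝒴′ (ext s i n) = go b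
          where
          back : ∀ u′ C′ → u′ ∈ dom ζ → Asked 𝒩′ 𝒴′ u′ C′ → Asked 𝒩 ((u , C) ∷ 𝒴) u′ C′
          back u′ C′ d a = n u′ C′ (dom-⊆ (∈-++⁺ʳ (cells C v)) d) (λ m → All.lookup disj m d) a
          strip : ∀ u′ C′ → u′ ∈ dom ζ → ¬ (u′ ≡ u) → Asked 𝒩′ 𝒴′ u′ C′ → Asked 𝒩 𝒴 u′ C′
          strip u′ C′ d ne a with back u′ C′ d a
          ... | inj₁ p = inj₁ p
          ... | inj₂ (here refl) = ⊥-elim (ne refl)
          ... | inj₂ (there p) = inj₂ p
          fr′ : ∀ C′ → C′ ∈ cs → ¬ Asked 𝒩′ 𝒴′ u C′
          fr′ C′ p a with back u C′ (∈-dom uℓ) a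
          ... | inj₁ q = fr C′ (there p) (inj₁ q)
          ... | inj₂ (here refl) = All.lookup C# p refl
          ... | inj₂ (there q) = fr C′ (there p) (inj₂ q)
          sub′ : ζ ⊆ ζ′
          sub′ = s ∘ ∈-++⁺ʳ (cells C v)
          go : ∀ b → WF (if b then κ false else node (suc k) u (toℕ ℓ) cs κ) ζ′ 𝒩′ 𝒴′
          go true = K false ζ′ 𝒩′ 𝒴′ (ext sub′ i strip)
          go false = wf-node (suc k) u ℓ cs κ ζ′ 𝒩′ 𝒴′ Vu (sub′ uℓ) uq (sb ∘ there) i fr′
            (λ b ζ″ 𝒩″ 𝒴″ (ext s₂ i₂ n₂) → K b ζ″ 𝒩″ 𝒴″ (ext (s₂ ∘ sub′) i₂
              (λ u′ C′ d ne a → strip u′ C′ d ne (n₂ u′ C′ (dom-⊆ sub′ d) ne a))))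

      wf-kids : ∀ k C v κ ζ 𝒩 𝒴 → cells C v ⊆ ζ → Unique C → All V C →
        AskedIn ζ 𝒩 𝒴 → (∀ g → g ∈ C → ∀ C′ → ¬ Asked 𝒩 𝒴 g C′) →
        (∀ b ζ′ 𝒩′ 𝒴′ → Ext (_∈ C) ζ 𝒩 𝒴 ζ′ 𝒩′ 𝒴′ → WF (κ b) ζ′ 𝒩′ 𝒴′) →
        WF (kids k C v κ) ζ 𝒩 𝒴
      wf-kids k [] [] κ ζ 𝒩 𝒴 cv uq VC inn fr K = K true ζ 𝒩 𝒴 (ext (λ p → p) inn (λ _ _ _ _ p → p))
      wf-kids k (g ∷ C) (ℓ ∷ v) κ ζ 𝒩 𝒴 cv (g# ∷ uq) (Vg ∷ VC) inn fr K =
        wf-node k g ℓ (links g) _ ζ 𝒩 𝒴 Vg (cv (here refl)) (uniq-links g) (λ p → p) inn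
          (λ C′ _ → fr g (here refl) C′) K′
        where
        K′ : ∀ b ζ′ 𝒩′ 𝒴′ → Ext (_≡ g) ζ 𝒩 𝒴 ζ′ 𝒩′ 𝒴′ →
          WF (if b then kids k C v κ else κ false) ζ′ 𝒩′ 𝒴′
        K′ true ζ′ 𝒩′ 𝒴′ (ext s i n) = wf-kids k C v κ ζ′ 𝒩′ 𝒴′ (s ∘ cv ∘ there) uq VC i
          (λ g′ p C′ a → fr g′ (there p) C′ (n g′ C′ (∈-dom (cv (there (proj₂ (cells-∈ C v p)))))
            (λ e → All.lookup g# p (sym e)) a))
          (λ b ζ″ 𝒩″ 𝒴″ (ext s₂ i₂ n₂) → K b ζ″ 𝒩″ 𝒴″ (ext (s₂ ∘ s) i₂
            (λ u′ C′ d ne a → n u′ C′ d (λ e → ne (here e)) (n₂ u′ C′ (dom-⊆ s d) (λ e → ne (there e)) a))))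
        K′ false ζ′ 𝒩′ 𝒴′ (ext s i n) = K false ζ′ 𝒩′ 𝒴′ (ext s i (λ u′ C′ d ne → n u′ C′ d (λ e → ne (here e))))

-- True against ideal probability of acceptance.

module Main (L′ N : ℕ) (links : Fin N → List (List (Fin N)))
  (V : Fin N → Set) (Gen : List (Fin N) → Fin N → List (Fin N) → Bool) (r′ Tm : ℕ) where
  open import Data.Bool.Base using (Bool; true; false; if_then_else_; not; T)
  open import Data.Fin.Base using (Fin; zero; suc; toℕ)
  open import Data.List.Base using (List; []; _∷_; _++_; length; map; concatMap; filter)

  open Field
  open Sums
  open Avg L′
  open DT L′ N links
  open WF L′ N links
  open import Data.Empty using (⊥-elim)
  open import Data.Integer.Base using () renaming (+_ to pos)
  open import Data.Fin.Properties using () renaming (_≟_ to _≟F_)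
  open import Data.List.Properties using (length-++; map-++; length-filter)
  open import Data.List.Membership.Propositional using (_∈_; _∉_)
  open import Data.List.Membership.DecPropositional (_≟F_ {N}) using (_∈?_)
  open import Data.List.Membership.Propositional.Properties using (∈-++⁺ˡ; ∈-++⁺ʳ; ∈-++⁻; ∈-map⁺; ∈-map⁻; ∈-filter⁻; ∈-filter⁺; ∈-concatMap⁺)
  open import Data.List.Relation.Binary.Subset.Propositional using (_⊆_)
  open import Data.List.Relation.Unary.Any as Any using (Any; here; there)
  open import Data.List.Relation.Unary.All as All using (All; []; _∷_)
  import Data.List.Relation.Unary.All.Properties as All
  open import Data.List.Relation.Unary.AllPairs using ([]; _∷_)
  open import Data.List.Relation.Unary.Unique.Propositional using (Unique)
  import Data.List.Relation.Unary.Unique.Propositional.Properties as Uniq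
  open import Data.Product using (∃; ∃₂; _×_; _,_; proj₁; proj₂)
  open import Data.Sum using (inj₁; inj₂)
  open import Data.Vec.Base using (Vec; []; _∷_; lookup; _[_]≔_)
  open import Data.Vec.Properties using (lookup∘update; lookup∘update′)
  open import Relation.Nullary using (¬_; yes; no)
  open import Relation.Nullary.Decidable using (¬?)

  r : ℕ
  r = suc r′

  -- The labelled edges reached by following links from a root, as long as every new copy
  -- meets the vertices reached before only in the edge it is attached to.
  data Tree : List Cell → List Pair → Set where
    root : ∀ {f ℓ} → V f → toℕ ℓ ℕ.≤ Tm → Tree ((f , ℓ) ∷ []) []
    grow : ∀ {ζ 𝒴 w ℓ C} v → Tree ζ 𝒴 → (w , ℓ) ∈ ζ → C ∈ links w → T (Gen (dom ζ) w C) →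
      AllBelow (toℕ ℓ) v → Tree (cells C v ++ ζ) ((w , C) ∷ 𝒴)

  -- The density of the event that β has the labels recorded in ζ. Expectations against it are
  -- conditional expectations given these labels.
  dens : List Cell → Vec (Fin L) N → F
  dens ζ β = prodL (λ c → δ (lookup β (proj₁ c)) (proj₂ c)) ζ

  deadAt : Neg → Vec (Fin L) N → F
  deadAt (u , s , C) β = 1# - b2F (alive s (labels β C))

  dead : List Neg → Vec (Fin L) N → F
  dead 𝒩 β = prodL (λ n → deadAt n β) 𝒩

  -- Given the labels in ζ, the probability that all answers in 𝒩 are negative and that the rest of
  -- the evaluation ends in acceptance. It is a joint probability in 𝒩, so no normalisation occurs
  -- in the induction.
  real : DT → List Cell → List Neg → F
  real t ζ 𝒩 = E N (λ β → dens ζ β * dead 𝒩 β * b2F (run t β))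

  weight : List Neg → F
  weight 𝒩 = prodL (λ n → 1# - ratio (proj₁ (proj₂ n)) ^ r) 𝒩

  fresh : List (Fin N) → Link → Link
  fresh Z C = filter (λ x → ¬? (x ∈? Z)) C

  mixed : ℕ → ℕ → Bool
  mixed zero m = false
  mixed (suc o) m = suc o ℕ.<ᵇ m

  -- The probability that C occurs given that the part inside Z does; zero when C
  -- is disjoint from Z or contained in it.
  ρ : F → List (Fin N) → Link → F
  ρ p Z C = if mixed (length (fresh Z C)) (length C) then p ^ length (fresh Z C) else 0#

  flagged : List (Fin N) → List Neg → F
  flagged Z 𝒩 = sumL (λ n → b2F (not (Gen Z (proj₁ n) (proj₂ (proj₂ n))))) 𝒩

  dens-cells : ∀ β C (G : Vec (Fin L) (length C) → F) →
    E (length C) (λ v → dens (cells C v) β * G v) ≡ G (labels β C)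
  dens-cells β [] G = *-identityˡ _
  dens-cells β (x ∷ C) G = trans (avg-cong (λ ℓ →
      trans (E-cong (length C) (λ v → *-assoc (δ (lookup β x) ℓ) (dens (cells C v) β) (G (ℓ ∷ v))))
      (trans (E-*ˡ (length C) _ _) (cong (δ (lookup β x) ℓ *_) (dens-cells β C (λ v → G (ℓ ∷ v)))))))
    (avg-δ (lookup β x) (λ ℓ → G (ℓ ∷ labels β C)))

  prodL-++ : ∀ {A : Set} (f : A → F) xs ys → prodL f (xs ++ ys) ≡ prodL f xs * prodL f ys
  prodL-++ f [] ys = sym (*-identityˡ _)
  prodL-++ f (x ∷ xs) ys = trans (cong (f x *_) (prodL-++ f xs ys)) (sym (*-assoc _ _ _))

  -- The counterpart of the recursion for `ideal`: a negative answer is merely remembered, while a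
  -- positive one is resolved by averaging over the possible labels of C against their density
  -- (`dens-cells`).
  real-ask : ∀ u s C tn ty ζ 𝒩 → real (ask u s C tn ty) ζ 𝒩 ≡
    real tn ζ ((u , s , C) ∷ 𝒩) +
    E (length C) (λ v → b2F (alive s v) * real (ty v) (cells C v ++ ζ) 𝒩)
  real-ask u s C tn ty ζ 𝒩 = trans (E-cong N pt) (trans (E-+ N _ _)
    (cong (real tn ζ ((u , s , C) ∷ 𝒩) +_)
      (trans (E-E N (length C) (λ v β → b2F (alive s v) * (dens (cells C v ++ ζ) β * dead 𝒩 β * b2F (run (ty v) β))))
        (E-cong (length C) (λ v → E-*ˡ N _ _)))))
    where
    choose : ∀ b x y → b2F (if b then x else y) ≡ (1# - b2F b) * b2F y + b2F b * b2F x
    choose true x y = S.solve 2 (λ x y → x S.:= (S.con (pos 1) S.:- S.con (pos 1)) S.:* y S.:+ S.con (pos 1) S.:* x) refl (b2F x) (b2F y)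
    choose false x y = S.solve 2 (λ x y → y S.:= (S.con (pos 1) S.:- S.con (pos 0)) S.:* y S.:+ S.con (pos 0) S.:* x) refl (b2F x) (b2F y)
    pt : ∀ β → dens ζ β * dead 𝒩 β * b2F (run (ask u s C tn ty) β) ≡
      dens ζ β * dead ((u , s , C) ∷ 𝒩) β * b2F (run tn β) +
      E (length C) (λ v → b2F (alive s v) * (dens (cells C v ++ ζ) β * dead 𝒩 β * b2F (run (ty v) β)))
    pt β = trans (cong (dens ζ β * dead 𝒩 β *_) (choose (alive s (labels β C)) (run (ty (labels β C)) β) (run tn β)))
      (trans (S.solve 5 (λ D K a n y → D S.:* K S.:* ((S.con (pos 1) S.:- a) S.:* n S.:+ a S.:* y) S.:=
          D S.:* ((S.con (pos 1) S.:- a) S.:* K) S.:* n S.:+ (D S.:* K) S.:* (a S.:* y)) refl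
          (dens ζ β) (dead 𝒩 β) (b2F (alive s (labels β C))) (b2F (run tn β)) (b2F (run (ty (labels β C)) β)))
        (cong (dens ζ β * dead ((u , s , C) ∷ 𝒩) β * b2F (run tn β) +_)
          (sym (trans (E-cong (length C) (λ v → trans (cong (λ z → b2F (alive s v) * (z * dead 𝒩 β * b2F (run (ty v) β))) (prodL-++ _ (cells C v) ζ))
              (S.solve 5 (λ a d D K y → a S.:* (d S.:* D S.:* K S.:* y) S.:= d S.:* ((D S.:* K) S.:* (a S.:* y))) refl
                (b2F (alive s v)) (dens (cells C v) β) (dens ζ β) (dead 𝒩 β) (b2F (run (ty v) β)))))
            (dens-cells β C (λ v → (dens ζ β * dead 𝒩 β) * (b2F (alive s v) * b2F (run (ty v) β))))))))

  module _ {A : Set} where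

    prodL-mono-∈ : ∀ {f g : A → F} xs → (∀ x → 0# ≤ f x) → (∀ x → x ∈ xs → f x ≤ g x) → prodL f xs ≤ prodL g xs
    prodL-mono-∈ [] nn h = ≤-refl
    prodL-mono-∈ (x ∷ xs) nn h = *-mono (nn x) (≤-trans (prodL-nonneg nn xs) ih) (h x (here refl)) ih
      where ih = prodL-mono-∈ xs nn (λ y p → h y (there p))

    prodL-* : ∀ (f g : A → F) xs → prodL (λ x → f x * g x) xs ≡ prodL f xs * prodL g xs
    prodL-* f g [] = sym (*-identityˡ 1#)
    prodL-* f g (x ∷ xs) = trans (cong (f x * g x *_) (prodL-* f g xs))
      (S.solve 4 (λ a b c d → a S.:* b S.:* (c S.:* d) S.:= (a S.:* c) S.:* (b S.:* d)) refl _ _ _ _)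

    weierstrass : ∀ (w : A → F) → (∀ x → 0# ≤ w x) → (∀ x → w x ≤ 1#) → ∀ xs →
      1# - sumL w xs ≤ prodL (λ x → 1# - w x) xs
    weierstrass w nn le [] = ≤-reflexive (S.solve 0 (S.con (pos 1) S.:- S.con (pos 0) S.:= S.con (pos 1)) refl)
    weierstrass w nn le (x ∷ xs) =
      1# - (w x + sumL w xs)
        ≤⟨ 0≤-⇒≤ (subst (0# ≤_) (S.solve 2 (λ a s → a S.:* s S.:= (S.con (pos 1) S.:- a) S.:* (S.con (pos 1) S.:- s) S.:- (S.con (pos 1) S.:- (a S.:+ s))) refl (w x) (sumL w xs))
             (0≤* (nn x) (sumL-nonneg nn xs))) ⟩
      (1# - w x) * (1# - sumL w xs)
        ≤⟨ *-monoˡ _ (≤⇒0≤- (le x)) (weierstrass w nn le xs) ⟩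
      (1# - w x) * prodL (λ x → 1# - w x) xs ∎

  ov : List Cell → Vec (Fin L) N → Vec (Fin L) N
  ov [] β = β
  ov ((x , ℓ) ∷ ζ) β = ov ζ β [ x ]≔ ℓ

  ov-∉ : ∀ ζ β {x} → x ∉ dom ζ → lookup (ov ζ β) x ≡ lookup β x
  ov-∉ [] β p = refl
  ov-∉ ((y , ℓ) ∷ ζ) β p = trans (lookup∘update′ (λ e → p (here e)) (ov ζ β) ℓ) (ov-∉ ζ β (λ q → p (there q)))

  ov-∈ : ∀ ζ β {x ℓ} → Unique (dom ζ) → (x , ℓ) ∈ ζ → lookup (ov ζ β) x ≡ ℓ
  ov-∈ ((y , ℓ) ∷ ζ) β (y# ∷ u) (here refl) = lookup∘update y (ov ζ β) ℓ
  ov-∈ ((y , ℓ) ∷ ζ) β (y# ∷ u) (there p) =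
    trans (lookup∘update′ (λ e → All.lookup y# (∈-dom p) (sym e)) (ov ζ β) ℓ) (ov-∈ ζ β u p)

  dens-update : ∀ ζ β {x} ℓ → x ∉ dom ζ → dens ζ (β [ x ]≔ ℓ) ≡ dens ζ β
  dens-update [] β ℓ p = refl
  dens-update ((y , ℓ′) ∷ ζ) β ℓ p = cong₂ (λ a b → δ a ℓ′ * b)
    (lookup∘update′ (λ e → p (here (sym e))) β ℓ) (dens-update ζ β ℓ (λ q → p (there q)))

  -- Iterated conditioning is iterated overwriting; distinctness of the domain makes the order of
  -- overwriting immaterial.
  E-dens : ∀ ζ (G : Vec (Fin L) N → F) → Unique (dom ζ) → E N (λ β → dens ζ β * G β) ≡ E N (λ β → G (ov ζ β))
  E-dens [] G _ = E-cong N (λ β → *-identityˡ _)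
  E-dens ((x , ℓ) ∷ ζ) G (x# ∷ u) =
    trans (E-cong N (λ β → *-assoc _ _ _))
    (trans (E-δ N x ℓ (λ β → dens ζ β * G β))
    (trans (E-cong N (λ β → cong (_* G (β [ x ]≔ ℓ)) (dens-update ζ β ℓ (λ q → All.lookup x# q refl))))
    (E-dens ζ (λ β → G (β [ x ]≔ ℓ)) u)))

  ov-mono : ∀ ζ {β β′} → β ⊑ β′ → ov ζ β ⊑ ov ζ β′
  ov-mono [] p = p
  ov-mono ((x , ℓ) ∷ ζ) {β} {β′} p = mk⊑ go
    where
    go : ∀ i → toℕ (lookup (ov ζ β [ x ]≔ ℓ) i) ℕ.≤ toℕ (lookup (ov ζ β′ [ x ]≔ ℓ) i)
    go i with i ≟F x
    ... | yes refl = ℕ.≤-reflexive (cong toℕ (trans (lookup∘update x (ov ζ β) ℓ) (sym (lookup∘update x (ov ζ β′) ℓ))))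
    ... | no ne = subst₂ ℕ._≤_ (cong toℕ (sym (lookup∘update′ ne (ov ζ β) ℓ)))
      (cong toℕ (sym (lookup∘update′ ne (ov ζ β′) ℓ))) (_⊑_.at (ov-mono ζ p) i)

  b2F-mono : ∀ {a b} → (T a → T b) → b2F a ≤ b2F b
  b2F-mono {true} {true} _ = ≤-refl
  b2F-mono {true} {false} f = ⊥-elim (f _)
  b2F-mono {false} {b} _ = 0≤b2F b

  labels-below : ∀ {s} (β : Vec (Fin L) N) (C : Link) → AllBelow s (labels β C) → ∀ {x} → x ∈ C → toℕ (lookup β x) ℕ.< s
  labels-below β (x ∷ C) (p , ps) (here refl) = p
  labels-below β (x ∷ C) (p , ps) (there q) = labels-below β C ps q

  below-labels : ∀ {s} (β : Vec (Fin L) N) (C : Link) → (∀ {x} → x ∈ C → toℕ (lookup β x) ℕ.< s) → AllBelow s (labels β C)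
  below-labels β [] h = _
  below-labels β (x ∷ C) h = h (here refl) , below-labels β C (λ p → h (there p))

  alive-labels : ∀ s (β : Vec (Fin L) N) (C : Link) → T (alive s (labels β C)) → ∀ {x} → x ∈ C → toℕ (lookup β x) ℕ.< s
  alive-labels s β C t = labels-below β C (alive⇒below s (labels β C) t)

  labels-alive : ∀ s (β : Vec (Fin L) N) (C : Link) → (∀ {x} → x ∈ C → toℕ (lookup β x) ℕ.< s) → T (alive s (labels β C))
  labels-alive s β C h = below⇒alive s (labels β C) (below-labels β C h)

  deadAt-mono : ∀ ζ n → Mono (λ β → deadAt n (ov ζ β))
  deadAt-mono ζ (u , s , C) {β} {β′} le = sub-monoʳ 1#
    (b2F-mono {alive s (labels (ov ζ β′) C)} {alive s (labels (ov ζ β) C)} (λ t → labels-alive s (ov ζ β) C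
      (λ {x} m → ℕ.≤-<-trans (_⊑_.at (ov-mono ζ le) x) (alive-labels s (ov ζ β′) C t m))))

  deadAt-nonneg : ∀ n β → 0# ≤ deadAt n β
  deadAt-nonneg n β = ≤⇒0≤- (b2F≤1 _)

  dens-nonneg : ∀ ζ β → 0# ≤ dens ζ β
  dens-nonneg ζ β = prodL-nonneg (λ c → 0≤δ (lookup β (proj₁ c)) (proj₂ c)) ζ

  real-nonneg : ∀ t ζ 𝒩 → 0# ≤ real t ζ 𝒩
  real-nonneg t ζ 𝒩 = E-nonneg N (λ β → 0≤* (0≤* (dens-nonneg ζ β) (prodL-nonneg (λ n → deadAt-nonneg n β) 𝒩)) (0≤b2F _))

  -- The condition on the already known part of C is dropped; the labels on the remaining part are
  -- independent of ζ.
  fresh-alive : ∀ ζ s C → Unique C →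
    E N (λ β → b2F (alive s (labels (ov ζ β) C))) ≤ ratio s ^ length (fresh (dom ζ) C)
  fresh-alive ζ s C uC = ≤-trans
    (E-mono N (λ β → b2F-mono {alive s (labels (ov ζ β) C)} {alive s (labels β (fresh (dom ζ) C))} (λ t → labels-alive s β (fresh (dom ζ) C) (λ {x} m →
       let (m′ , nd) = ∈-filter⁻ (λ x → ¬? (x ∈? dom ζ)) {xs = C} m in
       subst (ℕ._< s) (cong toℕ (ov-∉ ζ β nd)) (alive-labels s (ov ζ β) C t m′)))))
    (≤-reflexive (trans (E-labels N (Uniq.filter⁺ (λ x → ¬? (x ∈? dom ζ)) uC) (λ v → b2F (alive s v)))
      (E-alive (length (fresh (dom ζ) C)) s)))

  E-alive-≤ : ∀ s m {G : Vec (Fin L) m → F} → (∀ v → G v ≤ 1#) → E m (λ v → b2F (alive s v) * G v) ≤ ratio s ^ m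
  E-alive-≤ s m {G} h = ≤-trans (E-mono m (λ v → ≤-trans (*-monoˡ _ (0≤b2F (alive s v)) (h v)) (≤-reflexive (trans (*-comm _ _) (*-identityˡ _)))))
    (≤-reflexive (E-alive m s))

  ideal-≤1 : ∀ t → ideal t ≤ 1#
  ideal-≤1 (leaf b) = b2F≤1 b
  ideal-≤1 (ask u s C tn ty) =
    (1# - π) * ideal tn + E (length C) (λ v → b2F (alive s v) * ideal (ty v))
      ≤⟨ +-mono-≤ (*-monoˡ _ (0≤1-^ s (length C)) (ideal-≤1 tn)) (E-alive-≤ s (length C) (λ v → ideal-≤1 (ty v))) ⟩
    (1# - π) * 1# + π
      ≈⟨ S.solve 1 (λ x → (S.con (pos 1) S.:- x) S.:* S.con (pos 1) S.:+ x S.:= S.con (pos 1)) refl π ⟩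
    1# ∎
    where π = ratio s ^ length C

  0≤cost : ∀ t → 0# ≤ cost t
  0≤cost (leaf b) = ≤-refl
  0≤cost (ask u s C tn ty) = 0≤+ (0≤* (0≤1-^ s (length C)) (0≤cost tn))
    (E-nonneg (length C) (λ v → 0≤* (0≤b2F (alive s v)) (0≤+ 0≤1 (0≤cost (ty v)))))

  module Basic
    (len-link : ∀ {u C} → V u → C ∈ links u → length C ≡ r)
    (ok-links : ∀ {u C} → V u → C ∈ links u → All V C × Unique C)
    where

    dom-++ : ∀ C v ζ → dom (cells C v ++ ζ) ≡ C ++ dom ζ
    dom-++ C v ζ = trans (map-++ proj₁ (cells C v) ζ) (cong (_++ dom ζ) (dom-cells C v))

    tree-V : ∀ {ζ 𝒴} → Tree ζ 𝒴 → All V (dom ζ)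
    tree-V (root Vf _) = Vf ∷ []
    tree-V (grow {ζ} {C = C} v t w∈ C∈ g bl) = subst (All V) (sym (dom-++ C v ζ))
      (All.++⁺ (proj₁ (ok-links (All.lookup (tree-V t) (∈-dom w∈)) C∈)) (tree-V t))

    tree-length : ∀ {ζ 𝒴} → Tree ζ 𝒴 → length (dom ζ) ≡ suc (length 𝒴 ℕ.* r)
    tree-length (root _ _) = refl
    tree-length (grow {ζ} {C = C} v t w∈ C∈ g bl) = trans (cong length (dom-++ C v ζ))
      (trans (length-++ C) (trans (cong₂ ℕ._+_ (len-link (All.lookup (tree-V t) (∈-dom w∈)) C∈) (tree-length t))
        (ℕ.+-suc r _)))

  -- The combinatorial input. `closed` and `small` are the hypotheses that rest on strict balance:
  -- the first says that no copies arise by chance within the explored part, the second that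
  -- partially overlapping links have small total probability. `count` bounds the non-generic links
  -- at one known edge.
  module Hyps
    (len-link : ∀ {u C} → V u → C ∈ links u → length C ≡ r)
    (ok-links : ∀ {u C} → V u → C ∈ links u → All V C × Unique C)
    (uniq-links : ∀ u → Unique (links u))
    (canon : ∀ {u C C′} → V u → C ∈ links u → C′ ∈ links u → C ⊆ C′ → C′ ⊆ C → C ≡ C′)
    (self : ∀ {u C} → V u → C ∈ links u → u ∉ C)
    (gen-disj : ∀ {Z u C} → All V Z → u ∈ Z → C ∈ links u → T (Gen Z u C) → All (_∉ Z) C)
    (gen-anti : ∀ X {Z u C} → T (Gen (X ++ Z) u C) → T (Gen Z u C))
    (closed : ∀ {ζ 𝒴 u C} → Tree ζ 𝒴 → u ∈ dom ζ → C ∈ links u → C ⊆ dom ζ →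
      ∃₂ λ w C′ → (w , C′) ∈ 𝒴 × (u ∷ C) ⊆ (w ∷ C′) × (w ∷ C′) ⊆ (u ∷ C))
    (M b : ℕ) (p η₁ η : F) (0≤p : 0# ≤ p) (p≤1 : p ≤ 1#)
    (ratio-p : ∀ s → s ℕ.≤ Tm → ratio s ≤ p)
    (count : ∀ {ζ 𝒴 u} → Tree ζ 𝒴 → length 𝒴 ℕ.≤ M → u ∈ dom ζ →
      sumL (λ C → b2F (not (Gen (dom ζ) u C))) (links u) ≤ ι b)
    (small : ∀ {ζ 𝒴 u} → Tree ζ 𝒴 → length 𝒴 ℕ.≤ M → u ∈ dom ζ →
      sumL (ρ p (dom ζ)) (links u) ≤ η₁)
    (0≤η₁ : 0# ≤ η₁) (η-bound : ι (suc (M ℕ.* r)) * η₁ ≤ η) (η≤1 : η ≤ 1#)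
    where

    open Basic len-link ok-links

    grow-disj : ∀ {ζ 𝒴 w ℓ C} → Tree ζ 𝒴 → (w , ℓ) ∈ ζ → C ∈ links w → T (Gen (dom ζ) w C) → All (_∉ dom ζ) C
    grow-disj t w∈ C∈ g = gen-disj (tree-V t) (∈-dom w∈) C∈ g

    tree-unique : ∀ {ζ 𝒴} → Tree ζ 𝒴 → Unique (dom ζ)
    tree-unique (root _ _) = [] ∷ []
    tree-unique (grow {ζ} {C = C} v t w∈ C∈ g bl) = subst Unique (sym (dom-++ C v ζ))
      (Uniq.++⁺ (proj₂ (ok-links (All.lookup (tree-V t) (∈-dom w∈)) C∈)) (tree-unique t)
        (λ { (p , q) → All.lookup (grow-disj t w∈ C∈ g) p q }))

    below-cells : ∀ {s} C v → AllBelow s v → ∀ {x ℓ} → (x , ℓ) ∈ cells C v → toℕ ℓ ℕ.< s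
    below-cells [] [] _ ()
    below-cells (x ∷ C) (ℓ ∷ v) (p , ps) (here refl) = p
    below-cells (x ∷ C) (ℓ ∷ v) (p , ps) (there q) = below-cells C v ps q

    tree-≤ : ∀ {ζ 𝒴} → Tree ζ 𝒴 → ∀ {x ℓ} → (x , ℓ) ∈ ζ → toℕ ℓ ℕ.≤ Tm
    tree-≤ (root _ le) (here refl) = le
    tree-≤ (grow {C = C} v t w∈ C∈ g bl) m with ∈-++⁻ (cells C v) m
    ... | inj₁ q = ℕ.<⇒≤ (ℕ.<-≤-trans (below-cells C v bl q) (tree-≤ t w∈))
    ... | inj₂ q = tree-≤ t q

    tree-descend : ∀ {ζ 𝒴} → Tree ζ 𝒴 → ∀ {w C} → (w , C) ∈ 𝒴 → ∃ λ ℓ → (w , ℓ) ∈ ζ × C ∈ links w ×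
      (∀ {x} → x ∈ C → ∃ λ ℓ′ → (x , ℓ′) ∈ ζ × toℕ ℓ′ ℕ.< toℕ ℓ)
    tree-descend (grow {ℓ = ℓ} {C = C} v t w∈ C∈ g bl) (here refl) = ℓ , ∈-++⁺ʳ (cells C v) w∈ , C∈ ,
      λ m → let (ℓ′ , q) = cells-∈ C v m in ℓ′ , ∈-++⁺ˡ q , below-cells C v bl q
    tree-descend (grow {C = C} v t w∈ C∈ g bl) (there m) =
      let (ℓ , p , c , h) = tree-descend t m in
      ℓ , ∈-++⁺ʳ (cells C v) p , c , λ m → let (ℓ′ , q , lt) = h m in ℓ′ , ∈-++⁺ʳ (cells C v) q , lt

    ∈-functional : ∀ {ζ : List Cell} → Unique (dom ζ) → ∀ {x ℓ ℓ′} → (x , ℓ) ∈ ζ → (x , ℓ′) ∈ ζ → ℓ ≡ ℓ′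
    ∈-functional (_ ∷ u) (here refl) (here refl) = refl
    ∈-functional (x# ∷ u) (here refl) (there q) = ⊥-elim (All.lookup x# (∈-dom q) refl)
    ∈-functional (x# ∷ u) (there p) (here refl) = ⊥-elim (All.lookup x# (∈-dom p) refl)
    ∈-functional (_ ∷ u) (there p) (there q) = ∈-functional u p q

    NegOk : List Cell → List Pair → Neg → Set
    NegOk ζ 𝒴 (u , s , C) = (∃ λ ℓ → (u , ℓ) ∈ ζ × toℕ ℓ ≡ s) × C ∈ links u × (u , C) ∉ 𝒴

    -- A link inside the domain belongs to the copy of some tree edge (w , C′); then w ∈ C,
    -- and w carries a larger label than u.
    inside-dead : ∀ {ζ 𝒴 u s C} → Tree ζ 𝒴 → NegOk ζ 𝒴 (u , s , C) → C ⊆ dom ζ →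
      ∀ β → ¬ T (alive s (labels (ov ζ β) C))
    inside-dead {ζ} {𝒴} {u} {s} {C} t ((ℓ , uℓ , refl) , C∈ , uC∉) sub β al
      with closed t (∈-dom uℓ) C∈ sub
    ... | w , C′ , wC′ , s₁ , s₂ with tree-descend t wC′
    ...   | ℓw , wℓ , C′∈ , h with w ≟F u
    ...     | yes refl = uC∉ (subst (λ X → (w , X) ∈ 𝒴) (sym C≡) wC′)
      where
      Vu = All.lookup (tree-V t) (∈-dom uℓ)
      shrink : ∀ {X Y : Link} → (w ∷ X) ⊆ (w ∷ Y) → w ∉ X → X ⊆ Y
      shrink sb nx {y} m with sb (there m)
      ... | here refl = ⊥-elim (nx m)
      ... | there q = q
      C≡ : C ≡ C′
      C≡ = canon Vu C∈ C′∈ (shrink s₁ (self Vu C∈)) (shrink s₂ (self Vu C′∈))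
    ...     | no ne with s₁ (here refl)
    ...       | here e = ne (sym e)
    ...       | there u∈C′ with s₂ (here refl)
    ...         | here e = ne e
    ...         | there w∈C with h u∈C′
    ...           | ℓ′ , uℓ′ , lt = ℕ.<-asym lt′ (subst (λ z → toℕ z ℕ.< toℕ ℓw) (∈-functional (tree-unique t) uℓ′ uℓ) lt)
      where
      lt′ : toℕ ℓw ℕ.< toℕ ℓ
      lt′ = subst (λ z → toℕ z ℕ.< toℕ ℓ) (ov-∈ ζ β (tree-unique t) wℓ) (alive-labels (toℕ ℓ) (ov ζ β) C al w∈C)

    ρ-nonneg : ∀ Z C → 0# ≤ ρ p Z C
    ρ-nonneg Z C with mixed (length (fresh Z C)) (length C)
    ... | true = 0≤^ (length (fresh Z C)) 0≤p
    ... | false = ≤-refl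

    ρ-≤1 : ∀ Z C → ρ p Z C ≤ 1#
    ρ-≤1 Z C with mixed (length (fresh Z C)) (length C)
    ... | true = ^≤1 (length (fresh Z C)) 0≤p p≤1
    ... | false = 0≤1

    fresh-empty : ∀ Z C → length (fresh Z C) ≡ 0 → C ⊆ Z
    fresh-empty Z C e {x} m with x ∈? Z
    ... | yes q = q
    ... | no nq = ⊥-elim (nonempty (∈-filter⁺ (λ x → ¬? (x ∈? Z)) m nq) e)
      where
      nonempty : ∀ {xs : Link} → x ∈ xs → length xs ≢ 0
      nonempty (here _) ()
      nonempty (there _) ()

    -- Three cases according to the number o of fresh elements of C. For o = 0 the link cannot be
    -- alive; for o strictly between 0 and r it is alive with probability at most p ^ o, the value
    -- of ρ; for o = r it is alive with the ideal probability and ρ vanishes.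
    factor : ∀ {ζ 𝒴 u s C} → Tree ζ 𝒴 → NegOk ζ 𝒴 (u , s , C) →
      (1# - ratio s ^ r) * (1# - ρ p (dom ζ) C) ≤ E N (λ β → deadAt (u , s , C) (ov ζ β))
    factor {ζ} {𝒴} {u} {s} {C} t ok@((ℓ , uℓ , refl) , C∈ , _) =
      ≤-trans (cases (length (fresh Z C)) Ea0 Ea≤ (length-filter (λ x → ¬? (x ∈? Z)) C)) (≤-reflexive (sym (E-1- N _)))
      where
      Z = dom ζ
      Vu = All.lookup (tree-V t) (∈-dom uℓ)
      uC = proj₂ (ok-links Vu C∈)
      Ea = E N (λ β → b2F (alive s (labels (ov ζ β) C)))
      Ea≤ : Ea ≤ ratio s ^ length (fresh Z C)
      Ea≤ = fresh-alive ζ s C uC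
      s≤ : s ℕ.≤ Tm
      s≤ = tree-≤ t uℓ
      Ea0 : length (fresh Z C) ≡ 0 → Ea ≤ 0#
      Ea0 e = ≤-trans (E-mono N (λ β → b2F-mono {alive s (labels (ov ζ β) C)} {false} (inside-dead t ok (fresh-empty Z C e) β))) (≤-reflexive (E-const N 0#))
      drop : ∀ {x y} → 0# ≤ x → 0# ≤ 1# - y → (1# - x) * (1# - y) ≤ 1# - y
      drop {x} {y} 0≤x 0≤1-y = 0≤-⇒≤ (subst (0# ≤_) (S.solve 2 (λ x y → x S.:* (S.con (pos 1) S.:- y) S.:=
         (S.con (pos 1) S.:- y) S.:- (S.con (pos 1) S.:- x) S.:* (S.con (pos 1) S.:- y)) refl x y) (0≤* 0≤x 0≤1-y))
      *1-0 : ∀ x → x * (1# - 0#) ≡ x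
      *1-0 = S.solve 1 (λ x → x S.:* (S.con (pos 1) S.:- S.con (pos 0)) S.:= x) refl
      cases : ∀ o → (o ≡ 0 → Ea ≤ 0#) → Ea ≤ ratio s ^ o → o ℕ.≤ length C →
        (1# - ratio s ^ r) * (1# - (if mixed o (length C) then p ^ o else 0#)) ≤ 1# - Ea
      cases zero e0 _ _ =
        _ ≈⟨ *1-0 _ ⟩
        1# - ratio s ^ r ≤⟨ sub-monoʳ 1# (≤-trans (e0 refl) (0≤^ r (0≤ratio s))) ⟩
        1# - Ea ∎
      cases (suc o) _ e1 o≤ with suc o ℕ.<ᵇ length C in eq
      ... | true = ≤-trans (drop (0≤^ r (0≤ratio s)) (≤⇒0≤- (^≤1 (suc o) 0≤p p≤1)))
                     (sub-monoʳ 1# (≤-trans e1 (^-mono (suc o) (0≤ratio s) (ratio-p s s≤))))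
      ... | false = ≤-trans (≤-reflexive (*1-0 _)) (sub-monoʳ 1# (≤-trans e1 (≤-reflexive (cong (ratio s ^_) o≡r))))
        where
        o≡r : suc o ≡ r
        o≡r = trans (ℕ.≤-antisym o≤ (ℕ.≮⇒≥ (λ lt → subst T eq (ℕ.<⇒<ᵇ lt)))) (len-link Vu C∈)

    pairsOf : List (Fin N) → List Pair
    pairsOf Z = concatMap (λ u → map (u ,_) (links u)) Z

    -- The negative answers belong to distinct pairs of a known edge and one of its links, and at
    -- most 1 + M r edges are known.
    sum-pairs : ∀ {ζ 𝒴} (w : Pair → F) c → (∀ x → 0# ≤ w x) → Tree ζ 𝒴 → length 𝒴 ℕ.≤ M →
      0# ≤ c → (∀ u → u ∈ dom ζ → sumL (λ C → w (u , C)) (links u) ≤ c) →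
      ∀ 𝒩 → All (NegOk ζ 𝒴) 𝒩 → Unique (map pair 𝒩) →
      sumL (λ n → w (pair n)) 𝒩 ≤ ι (suc (M ℕ.* r)) * c
    sum-pairs {ζ} {𝒴} w c nn t le 0≤c h 𝒩 ok un =
      sumL (λ n → w (pair n)) 𝒩 ≈⟨ sym (sumL-map w pair 𝒩) ⟩
      sumL w (map pair 𝒩) ≤⟨ sumL-⊆ w nn un sub ⟩
      sumL w (pairsOf (dom ζ)) ≈⟨ sumL-concatMap w _ (dom ζ) ⟩
      sumL (λ u → sumL w (map (u ,_) (links u))) (dom ζ) ≈⟨ sumL-cong (λ u → sumL-map w (u ,_) (links u)) (dom ζ) ⟩
      sumL (λ u → sumL (λ C → w (u , C)) (links u)) (dom ζ) ≤⟨ sumL-mono-∈ (dom ζ) h ⟩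
      sumL (λ u → c) (dom ζ) ≈⟨ sumL-const c (dom ζ) ⟩
      ι (length (dom ζ)) * c ≤⟨ *-monoʳ c 0≤c (ι-mono (subst (ℕ._≤ suc (M ℕ.* r)) (sym (tree-length t)) (s≤s (ℕ.*-monoˡ-≤ r le)))) ⟩
      ι (suc (M ℕ.* r)) * c ∎
      where
      sub : map pair 𝒩 ⊆ pairsOf (dom ζ)
      sub m with ∈-map⁻ pair m
      ... | (u , s , C) , n∈ , refl with All.lookup ok n∈
      ...   | (ℓ , uℓ , _) , C∈ , _ = ∈-concatMap⁺ (λ u → map (u ,_) (links u)) (Any.map (λ { refl → ∈-map⁺ (u ,_) C∈ }) (∈-dom uℓ))

    -- The negative answers are monotone events, so Harris' inequality applies once the positive
    -- answers are fixed.
    leaf-bound : ∀ {ζ 𝒴} 𝒩 → Tree ζ 𝒴 → length 𝒴 ℕ.≤ M → All (NegOk ζ 𝒴) 𝒩 → Unique (map pair 𝒩) →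
      (1# - η) * weight 𝒩 ≤ E N (λ β → dens ζ β * dead 𝒩 β)
    leaf-bound {ζ} {𝒴} 𝒩 t le ok un =
      (1# - η) * weight 𝒩
        ≤⟨ *-monoʳ _ (prodL-nonneg (λ n → 0≤1-^ (proj₁ (proj₂ n)) r) 𝒩) (≤-trans (sub-monoʳ 1# sum≤)
             (weierstrass w (λ n → ρ-nonneg Z (C n)) (λ n → ρ-≤1 Z (C n)) 𝒩)) ⟩
      prodL (λ n → 1# - w n) 𝒩 * weight 𝒩
        ≈⟨ trans (*-comm _ _) (sym (prodL-* _ _ 𝒩)) ⟩
      prodL (λ n → (1# - ratio (proj₁ (proj₂ n)) ^ r) * (1# - w n)) 𝒩
        ≤⟨ prodL-mono-∈ 𝒩 (λ n → 0≤* (0≤1-^ (proj₁ (proj₂ n)) r) (≤⇒0≤- (ρ-≤1 Z (C n)))) (λ n m → factor t (All.lookup ok m)) ⟩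
      prodL (λ n → E N (λ β → deadAt n (ov ζ β))) 𝒩
        ≤⟨ harris N (λ n β → deadAt n (ov ζ β)) 𝒩 (deadAt-mono ζ) (λ n β → deadAt-nonneg n (ov ζ β)) ⟩
      E N (λ β → dead 𝒩 (ov ζ β))
        ≈⟨ sym (E-dens ζ (dead 𝒩) (tree-unique t)) ⟩
      E N (λ β → dens ζ β * dead 𝒩 β) ∎
      where
      Z = dom ζ
      C : Neg → Link
      C n = proj₂ (proj₂ n)
      w : Neg → F
      w n = ρ p Z (C n)
      sum≤ : sumL w 𝒩 ≤ η
      sum≤ = ≤-trans (sum-pairs (λ x → ρ p (dom ζ) (proj₂ x)) η₁ (λ x → ρ-nonneg Z (proj₂ x)) t le 0≤η₁ (λ u m → small t le m) 𝒩 ok un) η-bound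

    -- A bound for the number of non-generic links at all edges that can be known after at most M
    -- positive answers.
    B : F
    B = ι (suc (M ℕ.* r)) * ι b

    iM : F
    iM = inv (suc M)

    bracket : DT → List (Fin N) → List Neg → List Pair → F
    bracket t Z 𝒩 𝒴 = ideal t - p ^ r * (B - flagged Z 𝒩) - (ι (length 𝒴) + cost t) * iM

    flagged-≤ : ∀ {ζ 𝒴} 𝒩 → Tree ζ 𝒴 → length 𝒴 ℕ.≤ M → All (NegOk ζ 𝒴) 𝒩 → Unique (map pair 𝒩) →
      flagged (dom ζ) 𝒩 ≤ B
    flagged-≤ {ζ} 𝒩 t le ok un = sum-pairs (λ x → b2F (not (Gen (dom ζ) (proj₁ x) (proj₂ x)))) (ι b)
      (λ x → 0≤b2F (not (Gen (dom ζ) (proj₁ x) (proj₂ x)))) t le (0≤ι b) (λ u m → count t le m) 𝒩 ok un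

    flagged-mono : ∀ X Z 𝒩 → flagged Z 𝒩 ≤ flagged (X ++ Z) 𝒩
    flagged-mono X Z 𝒩 = sumL-mono (λ { (u , s , C) → b2F-mono {not (Gen Z u C)} {not (Gen (X ++ Z) u C)} (not-mono (gen-anti X)) }) 𝒩
      where
      not-mono : ∀ {a b} → (T a → T b) → T (not b) → T (not a)
      not-mono {false} f _ = _
      not-mono {true} {true} f ()
      not-mono {true} {false} f _ = ⊥-elim (f _)

    0≤1-η : 0# ≤ 1# - η
    0≤1-η = ≤⇒0≤- η≤1

    0≤iM : 0# ≤ iM
    0≤iM = inv-nonneg (suc M)

    0≤weight : ∀ 𝒩 → 0# ≤ weight 𝒩
    0≤weight 𝒩 = prodL-nonneg (λ n → 0≤1-^ (proj₁ (proj₂ n)) r) 𝒩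

    0≤p^r : 0# ≤ p ^ r
    0≤p^r = 0≤^ r 0≤p

    bracket-≤ : ∀ {ζ 𝒴} t 𝒩 → Tree ζ 𝒴 → length 𝒴 ℕ.≤ M → All (NegOk ζ 𝒴) 𝒩 → Unique (map pair 𝒩) →
      bracket t (dom ζ) 𝒩 𝒴 ≤ ideal t
    bracket-≤ t 𝒩 tr le ok un = ≤-trans (x-y≤x _ (0≤* (0≤+ (0≤ι _) (0≤cost t)) 0≤iM))
      (x-y≤x _ (0≤* 0≤p^r (≤⇒0≤- (flagged-≤ 𝒩 tr le ok un))))

    -- Along a branch without accident, the true probability falls short of the ideal one by the
    -- factor 1 - η at most. The subtracted terms bound the ideal probabilities of the accidents:
    -- a positive answer at a non-generic link (at most B of them are ever asked, and flagged
    -- counts those already used up), and more than M positive answers (Markov).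
    main : ∀ t ζ 𝒩 𝒴 → Tree ζ 𝒴 → length 𝒴 ℕ.≤ M → All (NegOk ζ 𝒴) 𝒩 → Unique (map pair 𝒩) →
      WF t ζ 𝒩 𝒴 → (1# - η) * weight 𝒩 * bracket t (dom ζ) 𝒩 𝒴 ≤ real t ζ 𝒩
    main (leaf bl) ζ 𝒩 𝒴 tr le ok un _ =
      (1# - η) * weight 𝒩 * bracket (leaf bl) (dom ζ) 𝒩 𝒴
        ≤⟨ *-monoˡ _ (0≤* 0≤1-η (0≤weight 𝒩)) (bracket-≤ (leaf bl) 𝒩 tr le ok un) ⟩
      (1# - η) * weight 𝒩 * b2F bl
        ≤⟨ *-monoʳ _ (0≤b2F bl) (leaf-bound 𝒩 tr le ok un) ⟩
      E N (λ β → dens ζ β * dead 𝒩 β) * b2F bl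
        ≈⟨ trans (*-comm _ _) (trans (sym (E-*ˡ N _ _)) (E-cong N (λ β → *-comm _ _))) ⟩
      real (leaf bl) ζ 𝒩 ∎
    main t@(ask u s C tn ty) ζ 𝒩 𝒴 tr le ok un ((ℓ , uℓ , refl) , C∈ , na , wn , wy)
      with Gen (dom ζ) u C in geq
    -- A non-generic link: the positive branch is abandoned. Its ideal probability is at most π,
    -- hence at most p ^ r, and this is exactly what the bracket gains when `flagged` grows by one.
    ... | false =
      c * g * bracket t Z 𝒩 𝒴
        ≤⟨ *-monoˡ _ (0≤* 0≤1-η (0≤weight 𝒩)) numeric ⟩
      c * g * ((1# - π) * bracket tn Z 𝒩′ 𝒴)
        ≈⟨ trans (S.solve 4 (λ c g x y → c S.:* g S.:* (x S.:* y) S.:= c S.:* (x S.:* g) S.:* y) refl c g _ _)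
             (cong (λ z → c * ((1# - ratio s ^ z) * g) * bracket tn Z 𝒩′ 𝒴) lenC) ⟩
      c * weight 𝒩′ * bracket tn Z 𝒩′ 𝒴
        ≤⟨ main tn ζ 𝒩′ 𝒴 tr le ok′ un′ wn ⟩
      real tn ζ 𝒩′
        ≤⟨ x≤x+y _ (E-nonneg (length C) (λ v → 0≤* (0≤b2F (alive s v)) (real-nonneg (ty v) (cells C v ++ ζ) 𝒩))) ⟩
      real tn ζ 𝒩′ + E (length C) (λ v → b2F (alive s v) * real (ty v) (cells C v ++ ζ) 𝒩)
        ≈⟨ sym (real-ask u s C tn ty ζ 𝒩) ⟩
      real t ζ 𝒩 ∎
      where
      Z = dom ζ
      𝒩′ = (u , s , C) ∷ 𝒩
      c = 1# - η
      g = weight 𝒩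
      π = ratio s ^ length C
      lenC = len-link (All.lookup (tree-V tr) (∈-dom uℓ)) C∈
      ok′ : All (NegOk ζ 𝒴) 𝒩′
      ok′ = ((ℓ , uℓ , refl) , C∈ , λ m → na (inj₂ m)) ∷ ok
      un′ : Unique (map pair 𝒩′)
      un′ = All.tabulate (λ { m refl → na (inj₁ m) }) ∷ un
      f = flagged Z 𝒩
      pr = p ^ r
      j = ι (length 𝒴)
      Ey = E (length C) (λ v → b2F (alive s v) * ideal (ty v))
      Ec = E (length C) (λ v → b2F (alive s v) * (1# + cost (ty v)))
      f′≡ : flagged Z 𝒩′ ≡ 1# + f
      f′≡ = cong (λ z → b2F (not z) + f) geq
      numeric : bracket t Z 𝒩 𝒴 ≤ (1# - π) * bracket tn Z 𝒩′ 𝒴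
      numeric = 0≤-⇒≤ (subst (0# ≤_) (trans (S.solve 10 (λ π Ey pr B f j c i Ec In →
          let o = S.con (pos 1) in
          ((π S.:- Ey) S.:+ (pr S.:- π)) S.:+ (π S.:* (pr S.:* (B S.:- (o S.:+ f))) S.:+ (π S.:* (j S.:* i) S.:+ Ec S.:* i)) S.:=
          (o S.:- π) S.:* (In S.:- pr S.:* (B S.:- (o S.:+ f)) S.:- (j S.:+ c) S.:* i) S.:-
            (((o S.:- π) S.:* In S.:+ Ey) S.:- pr S.:* (B S.:- f) S.:- (j S.:+ ((o S.:- π) S.:* c S.:+ Ec)) S.:* i))
          refl π Ey pr B f j (cost tn) iM Ec (ideal tn))
          (cong (λ z → (1# - π) * (ideal tn - pr * (B - z) - (j + cost tn) * iM) - bracket t Z 𝒩 𝒴) (sym f′≡)))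
        (0≤+ (0≤+ (≤⇒0≤- (E-alive-≤ s (length C) (λ v → ideal-≤1 (ty v)))) (≤⇒0≤- π≤pr))
          (0≤+ (0≤* 0≤π (0≤* 0≤p^r (≤⇒0≤- (subst (_≤ B) f′≡ (flagged-≤ 𝒩′ tr le ok′ un′)))))
            (0≤+ (0≤* 0≤π (0≤* (0≤ι _) 0≤iM))
              (0≤* (E-nonneg (length C) (λ v → 0≤* (0≤b2F (alive s v)) (0≤+ 0≤1 (0≤cost (ty v))))) 0≤iM)))))
        where
        0≤π = 0≤^ (length C) (0≤ratio s)
        π≤pr : π ≤ pr
        π≤pr = ≤-trans (≤-reflexive (cong (ratio s ^_) lenC)) (^-mono r (0≤ratio s) (ratio-p s (tree-≤ tr uℓ)))
    -- A generic link: the bracket is affine in the branches, so its error terms split in the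
    -- proportion 1 - π to π. The factor 1 - π joins the weight of the new negative answer, and both
    -- branches go by induction.
    ... | true =
      c * g * bracket t Z 𝒩 𝒴
        ≈⟨ S.solve 11 (λ c′ g π Ey pr X j c i Ec In →
          let o = S.con (pos 1) in
          c′ S.:* g S.:* (((o S.:- π) S.:* In S.:+ Ey) S.:- X S.:- (j S.:+ ((o S.:- π) S.:* c S.:+ Ec)) S.:* i) S.:=
          c′ S.:* ((o S.:- π) S.:* g) S.:* (In S.:- X S.:- (j S.:+ c) S.:* i) S.:+
            c′ S.:* g S.:* ((Ey S.:- i S.:* Ec) S.:- (X S.:+ j S.:* i) S.:* π)) refl
            c g π Ey pr X j (cost tn) iM Ec (ideal tn) ⟩
      c * ((1# - π) * g) * (ideal tn - X - (j + cost tn) * iM) + c * g * ((Ey - iM * Ec) - (X + j * iM) * π)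
        ≈⟨ cong₂ (λ a b → a + b) (trans (cong (λ z → c * ((1# - ratio s ^ z) * g) * (ideal tn - X - (j + cost tn) * iM)) lenC)
              (cong (λ z → c * weight 𝒩′ * (ideal tn - pr * (B - z) - (j + cost tn) * iM)) (sym f′≡))) (sym lin) ⟩
      c * weight 𝒩′ * bracket tn Z 𝒩′ 𝒴 + E (length C) (λ v → b2F (alive s v) * (c * g * LB v))
        ≤⟨ +-mono-≤ (main tn ζ 𝒩′ 𝒴 tr le ok′ un′ wn) (E-mono (length C) (λ v → alive-mono s v (λ al → yes-bound v (alive⇒below s v al)))) ⟩
      real tn ζ 𝒩′ + E (length C) (λ v → b2F (alive s v) * real (ty v) (cells C v ++ ζ) 𝒩)
        ≈⟨ sym (real-ask u s C tn ty ζ 𝒩) ⟩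
      real t ζ 𝒩 ∎
      where
      Z = dom ζ
      𝒩′ = (u , s , C) ∷ 𝒩
      𝒴′ = (u , C) ∷ 𝒴
      c = 1# - η
      g = weight 𝒩
      π = ratio s ^ length C
      lenC = len-link (All.lookup (tree-V tr) (∈-dom uℓ)) C∈
      ok′ : All (NegOk ζ 𝒴) 𝒩′
      ok′ = ((ℓ , uℓ , refl) , C∈ , λ m → na (inj₂ m)) ∷ ok
      un′ : Unique (map pair 𝒩′)
      un′ = All.tabulate (λ { m refl → na (inj₁ m) }) ∷ un
      f = flagged Z 𝒩
      pr = p ^ r
      X = pr * (B - f)
      j = ι (length 𝒴)
      Ey = E (length C) (λ v → b2F (alive s v) * ideal (ty v))
      Ec = E (length C) (λ v → b2F (alive s v) * (1# + cost (ty v)))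
      f′≡ : flagged Z 𝒩′ ≡ f
      f′≡ = trans (cong (λ z → b2F (not z) + f) geq) (+-identityˡ f)
      LB : Vec (Fin L) (length C) → F
      LB v = ideal (ty v) - X - (j + (1# + cost (ty v))) * iM
      lin : E (length C) (λ v → b2F (alive s v) * (c * g * LB v)) ≡ c * g * ((Ey - iM * Ec) - (X + j * iM) * π)
      lin = trans (E-cong m (λ v → S.solve 7 (λ a k I X j w i → a S.:* (k S.:* (I S.:- X S.:- (j S.:+ w) S.:* i)) S.:=
                k S.:* (a S.:* I S.:+ ((S.:- i) S.:* (a S.:* w) S.:+ (S.:- (X S.:+ j S.:* i)) S.:* a)))
                refl (b2F (alive s v)) (c * g) (ideal (ty v)) X j (1# + cost (ty v)) iM))
        (trans (E-*ˡ m (c * g) _) (cong (c * g *_) (trans (E-+ m _ _) (trans (cong (Ey +_) (trans (E-+ m _ _)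
          (cong₂ _+_ (E-*ˡ m (- iM) (λ v → b2F (alive s v) * (1# + cost (ty v))))
            (trans (E-*ˡ m (- (X + j * iM)) (λ v → b2F (alive s v))) (cong ((- (X + j * iM)) *_) (E-alive m s))))))
          (S.solve 5 (λ E i w k π → E S.:+ ((S.:- i) S.:* w S.:+ (S.:- k) S.:* π) S.:= (E S.:- i S.:* w) S.:- k S.:* π) refl Ey iM Ec (X + j * iM) π)))))
        where m = length C
      yes-bound : ∀ v → AllBelow s v → c * g * LB v ≤ real (ty v) (cells C v ++ ζ) 𝒩
      yes-bound v bl with suc (length 𝒴) ℕ.≤? M
      ... | yes le′ = ≤-trans (*-monoˡ _ (0≤* 0≤1-η (0≤weight 𝒩)) step)
                        (main (ty v) (cells C v ++ ζ) 𝒩 𝒴′ tr′ le′ ok″ un (wy v bl (grow-disj tr uℓ C∈ gen)))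
        where
        gen : T (Gen (dom ζ) u C)
        gen = subst T (sym geq) _
        tr′ : Tree (cells C v ++ ζ) 𝒴′
        tr′ = grow v tr uℓ C∈ gen bl
        ok″ : All (NegOk (cells C v ++ ζ) 𝒴′) 𝒩
        ok″ = All.tabulate (λ { {n} m → let ((ℓ′ , p′ , e) , c∈ , ∉𝒴) = All.lookup ok m in
          (ℓ′ , ∈-++⁺ʳ (cells C v) p′ , e) , c∈ , λ { (here refl) → na (inj₁ (∈-map⁺ pair m)) ; (there q) → ∉𝒴 q } })
        step : LB v ≤ bracket (ty v) (dom (cells C v ++ ζ)) 𝒩 𝒴′
        step = +-mono-≤ (+-monoʳ (ideal (ty v)) (neg-mono (*-monoˡ _ 0≤p^r (sub-monoʳ B
                 (subst (λ z → f ≤ flagged z 𝒩) (sym (dom-++ C v ζ)) (flagged-mono C (dom ζ) 𝒩))))))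
               (≤-reflexive (cong (λ z → - (z * iM)) (trans (S.solve 2 (λ j c → j S.:+ (S.con (pos 1) S.:+ c) S.:= (S.con (pos 1) S.:+ j) S.:+ c) refl j (cost (ty v)))
                 (cong (_+ cost (ty v)) (sym (ι-suc (length 𝒴)))))))
      -- The answer would be number M + 1. Then the Markov term is at least 1 and hence at least the
      -- ideal value, so the bracket is nonpositive and there is nothing to prove.
      ... | no gt = ≤-trans (≤-trans (*-monoˡ _ (0≤* 0≤1-η (0≤weight 𝒩)) LB≤0) (≤-reflexive (zeroʳ _))) (real-nonneg (ty v) (cells C v ++ ζ) 𝒩)
        where
        j≡ : length 𝒴 ≡ M
        j≡ = ℕ.≤-antisym le (ℕ.≤-pred (ℕ.≰⇒> gt))
        one : 1# ≤ (j + (1# + cost (ty v))) * iM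
        one = ≤-trans (≤-reflexive (sym (ι-inv M))) (*-monoʳ iM 0≤iM
          (≤-trans (≤-reflexive (trans (ι-suc M) (trans (+-comm _ _) (cong (λ z → ι z + 1#) (sym j≡)))))
            (+-monoʳ j (x≤x+y 1# (0≤cost (ty v))))))
        LB≤0 : LB v ≤ 0#
        LB≤0 = ≤-trans (+-mono-≤ (≤-trans (x-y≤x _ (0≤* 0≤p^r (≤⇒0≤- (flagged-≤ 𝒩 tr le ok un)))) (ideal-≤1 (ty v))) (neg-mono one))
          (≤-reflexive (-‿inverseʳ 1#))

-- Boolean filters, duplicate-free lists and the pigeonhole principle.

module Lists where
  open import Defs using (filterB; countB)
  open import Data.Bool.Base using (Bool; true; false; not; _∧_; _∨_; T)
  open import Data.Bool.Properties using (∨-zeroʳ)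
  open import Data.Empty using (⊥-elim)
  open import Data.Fin.Base using (Fin; suc)
  open import Data.List.Base using (List; []; _∷_; _++_; length; map; allFin; concatMap; cartesianProduct)
  open import Data.List.Properties using (length-++)
  open import Data.List.Membership.Propositional using (_∈_)
  open import Data.List.Membership.Propositional.Properties using (∈-∃++; ∈-++⁺ˡ; ∈-++⁺ʳ; ∈-++⁻; ∈-map⁻; ∈-cartesianProduct⁺; ∈-allFin)
  open import Data.List.Relation.Binary.Subset.Propositional using (_⊆_)
  open import Data.List.Relation.Unary.Any using (here; there)
  open import Data.List.Relation.Unary.All as All using (All; []; _∷_)
  open import Data.List.Relation.Unary.AllPairs using ([]; _∷_)
  open import Data.List.Relation.Unary.Unique.Propositional using (Unique)
  import Data.List.Relation.Unary.Unique.Propositional.Properties as Uniq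
  open import Data.Nat.Base as ℕ using (ℕ; suc; _≤_; _+_; z≤n; s≤s; _<ᵇ_)
  open import Data.Product using (_×_; _,_; proj₁)
  open import Data.Sum using (_⊎_; inj₁; inj₂)
  open import Relation.Nullary using (Dec; yes; no; does; ¬_)
  open import Relation.Binary.Definitions using (DecidableEquality)

  does⁺ : ∀ {P : Set} (d : Dec P) → P → does d ≡ true
  does⁺ (yes _) p = refl
  does⁺ (no ¬p) p = ⊥-elim (¬p p)

  does⁻ : ∀ {P : Set} (d : Dec P) → does d ≡ true → P
  does⁻ (yes p) _ = p

  ∧-true : ∀ {a b} → a ∧ b ≡ true → a ≡ true × b ≡ true
  ∧-true {true} {true} _ = refl , refl

  true-∧ : ∀ {a b} → a ≡ true → b ≡ true → a ∧ b ≡ true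
  true-∧ refl refl = refl

  <ᵇ-true : ∀ {a b} → (a <ᵇ b) ≡ true → a ℕ.< b
  <ᵇ-true {a} {b} e = ℕ.<ᵇ⇒< a b (subst T (sym e) _)

  true-<ᵇ : ∀ {a b} → a ℕ.< b → (a <ᵇ b) ≡ true
  true-<ᵇ {a} {b} lt with a <ᵇ b | ℕ.<⇒<ᵇ lt
  ... | true | _ = refl

  ∨-true : ∀ {a b} → a ∨ b ≡ true → a ≡ true ⊎ b ≡ true
  ∨-true {true} _ = inj₁ refl
  ∨-true {false} p = inj₂ p

  true-∨ˡ : ∀ {a b} → a ≡ true → a ∨ b ≡ true
  true-∨ˡ refl = refl

  true-∨ʳ : ∀ {a b} → b ≡ true → a ∨ b ≡ true
  true-∨ʳ {a} refl = ∨-zeroʳ a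

  not-false : ∀ {a} → a ≡ false → not a ≡ true
  not-false refl = refl

  not-true : ∀ {a} → not a ≡ true → a ≡ false
  not-true {false} _ = refl

  does-no : ∀ {P : Set} (d : Dec P) → ¬ P → does d ≡ false
  does-no (yes p) np = ⊥-elim (np p)
  does-no (no _) _ = refl

  does-no⁻ : ∀ {P : Set} (d : Dec P) → does d ≡ false → ¬ P
  does-no⁻ (no np) _ = np

  module _ {A : Set} where

    ∈-filterB⁺ : ∀ (p : A → Bool) {x xs} → x ∈ xs → p x ≡ true → x ∈ filterB p xs
    ∈-filterB⁺ p {xs = y ∷ ys} (here refl) e rewrite e = here refl
    ∈-filterB⁺ p {xs = y ∷ ys} (there m) e with p y
    ... | true = there (∈-filterB⁺ p m e)
    ... | false = ∈-filterB⁺ p m e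

    ∈-filterB⁻ : ∀ (p : A → Bool) {x} xs → x ∈ filterB p xs → x ∈ xs × p x ≡ true
    ∈-filterB⁻ p (y ∷ ys) m with p y in e
    ∈-filterB⁻ p (y ∷ ys) (here refl) | true = here refl , e
    ∈-filterB⁻ p (y ∷ ys) (there m) | true = let (a , b) = ∈-filterB⁻ p ys m in there a , b
    ... | false = let (a , b) = ∈-filterB⁻ p ys m in there a , b

    unique-filterB : ∀ (p : A → Bool) {xs} → Unique xs → Unique (filterB p xs)
    unique-filterB p [] = []
    unique-filterB p {y ∷ ys} (y# ∷ u) with p y
    ... | true = All.tabulate (λ m → All.lookup y# (proj₁ (∈-filterB⁻ p ys m))) ∷ unique-filterB p u
    ... | false = unique-filterB p u

    filterB-split : ∀ (p : A → Bool) xs → length (filterB p xs) + length (filterB (λ x → not (p x)) xs) ≡ length xs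
    filterB-split p [] = refl
    filterB-split p (x ∷ xs) with p x
    ... | true = cong suc (filterB-split p xs)
    ... | false = trans (ℕ.+-suc _ _) (cong suc (filterB-split p xs))

    filterB-ext : ∀ (p q : A → Bool) xs → (∀ x → x ∈ xs → p x ≡ q x) → filterB p xs ≡ filterB q xs
    filterB-ext p q [] h = refl
    filterB-ext p q (x ∷ xs) h rewrite h x (here refl) with q x
    ... | true = cong (x ∷_) (filterB-ext p q xs (λ y m → h y (there m)))
    ... | false = filterB-ext p q xs (λ y m → h y (there m))

    countB-length : ∀ (p : A → Bool) xs → countB p xs ≡ length (filterB p xs)
    countB-length p [] = refl
    countB-length p (x ∷ xs) with p x
    ... | true = cong suc (countB-length p xs)
    ... | false = countB-length p xs

    unique-⊆-length : ∀ {xs ys : List A} → Unique xs → xs ⊆ ys → length xs ≤ length ys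
    unique-⊆-length {[]} _ _ = z≤n
    unique-⊆-length {x ∷ xs} (x# ∷ u) s with ∈-∃++ (s (here refl))
    ... | as , bs , refl = subst (suc (length xs) ≤_) (sym (trans (length-++ as) (trans (ℕ.+-suc _ _) (cong suc (sym (length-++ as))))))
      (s≤s (unique-⊆-length u sub))
      where
      sub : xs ⊆ as ++ bs
      sub p with ∈-++⁻ as (s (there p))
      ... | inj₁ q = ∈-++⁺ˡ q
      ... | inj₂ (here refl) = ⊥-elim (All.lookup x# p refl)
      ... | inj₂ (there q) = ∈-++⁺ʳ as q

    unique-⊆-antisym : ∀ {xs ys : List A} → Unique xs → Unique ys → xs ⊆ ys → ys ⊆ xs → length xs ≡ length ys
    unique-⊆-antisym ux uy s t = ℕ.≤-antisym (unique-⊆-length ux s) (unique-⊆-length uy t)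

    unique-⊇ : DecidableEquality A → ∀ {xs ys : List A} → Unique xs → xs ⊆ ys → length ys ≤ length xs → ys ⊆ xs
    unique-⊇ _≟_ {xs} {ys} u s le {y} y∈ with y ∈? xs
      where open import Data.List.Membership.DecPropositional _≟_ using (_∈?_)
    ... | yes m = m
    ... | no nm = ⊥-elim (ℕ.<-irrefl refl (ℕ.≤-trans
      (unique-⊆-length {y ∷ xs} (All.tabulate (λ m e → nm (subst (_∈ xs) (sym e) m)) ∷ u)
        (λ { (here refl) → y∈ ; (there m) → s m })) le))

    unique-map-∈ : ∀ {B : Set} (f : A → B) {xs} → (∀ {x y} → x ∈ xs → y ∈ xs → f x ≡ f y → x ≡ y) →
      Unique xs → Unique (map f xs)
    unique-map-∈ f h [] = []
    unique-map-∈ f {x ∷ xs} h (x# ∷ u) =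
      All.tabulate (λ m e → let (y , y∈ , e′) = ∈-map⁻ f m in
        All.lookup x# y∈ (h (here refl) (there y∈) (trans e e′)))
      ∷ unique-map-∈ f (λ p q → h (there p) (there q)) u

  pairs : ∀ n → List (Fin n × Fin n)
  pairs n = concatMap (λ i → map (λ j → i , j) (allFin n)) (allFin n)

  pairs≡ : ∀ n → pairs n ≡ cartesianProduct (allFin n) (allFin n)
  pairs≡ n = go (allFin n)
    where
    go : ∀ is → concatMap (λ i → map (λ j → i , j) (allFin n)) is ≡ cartesianProduct is (allFin n)
    go [] = refl
    go (i ∷ is) = cong (map (i ,_) (allFin n) ++_) (go is)

  unique-pairs : ∀ n → Unique (pairs n)
  unique-pairs n = subst Unique (sym (pairs≡ n)) (Uniq.cartesianProduct⁺ (Uniq.allFin⁺ n) (Uniq.allFin⁺ n))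

  ∈-pairs : ∀ {n} i j → (i , j) ∈ pairs n
  ∈-pairs {n} i j = subst ((i , j) ∈_) (sym (pairs≡ n)) (∈-cartesianProduct⁺ (∈-allFin i) (∈-allFin j))

-- Edges of the complete graph as numbers.

module Codes (n : ℕ) where
  open Lists
  open import Data.Bool.Base using (true; false; if_then_else_; T)
  open import Data.Empty using (⊥-elim)
  open import Data.Fin.Base using (Fin; toℕ; combine; remQuot)
  open import Data.Fin.Properties using (remQuot-combine; toℕ-injective)
  open import Data.List.Base using (List; []; _∷_; _++_; length; concatMap)
  open import Data.List.Membership.Propositional using (_∈_)
  open import Data.List.Membership.Propositional.Properties using (∈-concatMap⁺; ∈-++⁺ʳ)
  open import Data.List.Relation.Unary.Any as Any using (here; there)
  open import Data.List.Relation.Binary.Subset.Propositional using (_⊆_)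
  open import Data.Product using (∃; ∃₂; _×_; _,_; proj₁; proj₂)
  open import Data.Sum using (_⊎_; inj₁; inj₂)
  open import Relation.Nullary using (¬_)

  -- The edge {i , j} of K_n is coded by the pair with the smaller endpoint first.
  code : Fin n → Fin n → Fin (n ℕ.* n)
  code i j = if toℕ i <ᵇ toℕ j then combine i j else combine j i

  ends : Fin (n ℕ.* n) → List (Fin n)
  ends x = proj₁ (remQuot {n} n x) ∷ proj₂ (remQuot {n} n x) ∷ []

  verts : List (Fin (n ℕ.* n)) → List (Fin n)
  verts Z = concatMap ends Z

  -- Only pairs with the smaller endpoint first code an edge; labellings are defined on all n * n
  -- pairs.
  Valid : Fin (n ℕ.* n) → Set
  Valid x = ∃₂ λ (i j : Fin n) → i ≢ j × x ≡ code i j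

  ends-combine : ∀ (i j : Fin n) → ends (combine i j) ≡ i ∷ j ∷ []
  ends-combine i j = cong (λ p → proj₁ p ∷ proj₂ p ∷ []) (remQuot-combine i j)

  ends-code : ∀ (i j : Fin n) → ends (code i j) ≡ i ∷ j ∷ [] ⊎ ends (code i j) ≡ j ∷ i ∷ []
  ends-code i j with toℕ i <ᵇ toℕ j
  ... | true = inj₁ (ends-combine i j)
  ... | false = inj₂ (ends-combine j i)

  code-sym : ∀ (i j : Fin n) → code i j ≡ code j i
  code-sym i j with toℕ i <ᵇ toℕ j in e | toℕ j <ᵇ toℕ i in e′
  ... | true | true = ⊥-elim (ℕ.<-asym (ℕ.<ᵇ⇒< (toℕ i) (toℕ j) (subst T (sym e) _)) (ℕ.<ᵇ⇒< (toℕ j) (toℕ i) (subst T (sym e′) _)))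
  ... | true | false = refl
  ... | false | true = refl
  ... | false | false = cong₂ combine (sym i≡j) i≡j
    where
    ≮ : ∀ {a b} → (a <ᵇ b) ≡ false → ¬ (a ℕ.< b)
    ≮ q lt = subst T q (ℕ.<⇒<ᵇ lt)
    i≡j : i ≡ j
    i≡j = toℕ-injective (ℕ.≤-antisym (ℕ.≮⇒≥ (≮ e′)) (ℕ.≮⇒≥ (≮ e)))

  ∈-ends-code⁻ : ∀ {i j z : Fin n} → z ∈ ends (code i j) → z ≡ i ⊎ z ≡ j
  ∈-ends-code⁻ {i} {j} {z} m with ends-code i j
  ... | inj₁ e with subst (z ∈_) e m
  ...   | here p = inj₁ p
  ...   | there (here p) = inj₂ p
  ∈-ends-code⁻ {i} {j} {z} m | inj₂ e with subst (z ∈_) e m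
  ...   | here p = inj₂ p
  ...   | there (here p) = inj₁ p

  ∈-ends-codeˡ : ∀ (i j : Fin n) → i ∈ ends (code i j)
  ∈-ends-codeˡ i j with ends-code i j
  ... | inj₁ e = subst (i ∈_) (sym e) (here refl)
  ... | inj₂ e = subst (i ∈_) (sym e) (there (here refl))

  ∈-ends-codeʳ : ∀ (i j : Fin n) → j ∈ ends (code i j)
  ∈-ends-codeʳ i j = subst (λ x → j ∈ ends x) (code-sym j i) (∈-ends-codeˡ j i)

  code-inj : ∀ {i j k l : Fin n} → i ≢ j → code i j ≡ code k l → (i ≡ k × j ≡ l) ⊎ (i ≡ l × j ≡ k)
  code-inj {i} {j} {k} {l} ne e
    with ∈-ends-code⁻ (subst (λ x → i ∈ ends x) e (∈-ends-codeˡ i j)) | ∈-ends-code⁻ (subst (λ x → j ∈ ends x) e (∈-ends-codeʳ i j))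
  ... | inj₁ a | inj₂ b = inj₁ (a , b)
  ... | inj₂ a | inj₁ b = inj₂ (a , b)
  ... | inj₁ a | inj₁ b = ⊥-elim (ne (trans a (sym b)))
  ... | inj₂ a | inj₂ b = ⊥-elim (ne (trans a (sym b)))

  valid-ext : ∀ {x y : Fin (n ℕ.* n)} → Valid x → Valid y → ends x ⊆ ends y → x ≡ y
  valid-ext (i , j , i≢j , refl) (k , l , _ , refl) s
    with ∈-ends-code⁻ (s (∈-ends-codeˡ i j)) | ∈-ends-code⁻ (s (∈-ends-codeʳ i j))
  ... | inj₁ refl | inj₂ refl = refl
  ... | inj₂ refl | inj₁ refl = code-sym i j
  ... | inj₁ a | inj₁ b = ⊥-elim (i≢j (trans a (sym b)))
  ... | inj₂ a | inj₂ b = ⊥-elim (i≢j (trans a (sym b)))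

  ∈-verts⁺ : ∀ {x y} {Z : List (Fin (n ℕ.* n))} → x ∈ Z → y ∈ ends x → y ∈ verts Z
  ∈-verts⁺ {Z = Z} x∈ y∈ = ∈-concatMap⁺ ends (Any.map (λ { refl → y∈ }) x∈)

  ∈-verts⁻ : ∀ {y} (Z : List (Fin (n ℕ.* n))) → y ∈ verts Z → ∃ λ x → x ∈ Z × y ∈ ends x
  ∈-verts⁻ (x ∷ Z) (here refl) = x , here refl , here refl
  ∈-verts⁻ (x ∷ Z) (there (here refl)) = x , here refl , there (here refl)
  ∈-verts⁻ (x ∷ Z) (there (there m)) = let (x′ , a , b) = ∈-verts⁻ Z m in x′ , there a , b

  length-verts : ∀ (Z : List (Fin (n ℕ.* n))) → length (verts Z) ≡ length Z ℕ.* 2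
  length-verts [] = refl
  length-verts (x ∷ Z) = cong (λ z → suc (suc z)) (length-verts Z)

  verts-++ : ∀ X {Z : List (Fin (n ℕ.* n))} → verts Z ⊆ verts (X ++ Z)
  verts-++ X {Z} m = let (x , a , b) = ∈-verts⁻ Z m in ∈-verts⁺ (∈-++⁺ʳ X a) b

-- Copies of H and the links of an edge.

module Copies {v : ℕ} (H : Graph v) (n : ℕ) where
  open import Defs using (Graph; adj; irrefl; edges; filterB; allVecs) renaming (sym to adj-sym)

  open Lists
  open Codes n
  open import Data.Bool.Base using (Bool; true; false; _∧_; not)
  open import Data.Empty using (⊥-elim)
  open import Data.Fin.Base using (Fin; zero; suc; toℕ)
  open import Data.Fin.Properties using (toℕ-injective; all?) renaming (_≟_ to _≟F_)
  open import Data.List.Base using (List; []; _∷_; length; map; allFin; deduplicate)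
  open import Data.List.Properties using (length-map; ≡-dec)
  open import Data.List.Membership.Propositional using (_∈_; _∉_)
  open import Data.List.Membership.DecPropositional (_≟F_ {n ℕ.* n}) using (_∈?_) public
  open import Data.List.Membership.Propositional.Properties using (∈-map⁺; ∈-map⁻; ∈-concatMap⁺; ∈-allFin; ∈-deduplicate⁻; ∈-deduplicate⁺)
  open import Data.List.Relation.Binary.Subset.Propositional using (_⊆_)
  open import Data.List.Relation.Unary.Any as Any using (here; there)
  open import Data.List.Relation.Unary.All as All using (All; []; _∷_)
  open import Data.List.Relation.Unary.AllPairs using ([]; _∷_)
  open import Data.List.Relation.Unary.Unique.Propositional using (Unique)
  import Data.List.Relation.Unary.Unique.Propositional.Properties as Uniq
  import Data.List.Relation.Unary.Unique.DecPropositional.Properties as UniqDec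
  open import Data.Product using (∃; ∃₂; _×_; _,_; proj₁; proj₂)
  open import Data.Sum using (inj₁; inj₂)
  open import Data.Vec.Base using (Vec; []; _∷_; lookup)
  open import Relation.Binary.Definitions using (tri<; tri≈; tri>)
  open import Relation.Nullary using (Dec; yes; no; does)
  open import Relation.Nullary.Decidable using (_→-dec_; map′)

  N : ℕ
  N = n ℕ.* n

  EH : List (Fin v × Fin v)
  EH = filterB (λ p → (toℕ (proj₁ p) <ᵇ toℕ (proj₂ p)) ∧ adj H (proj₁ p) (proj₂ p)) (pairs v)

  edges≡ : edges H ≡ length EH
  edges≡ = countB-length _ (pairs v)

  ∈-EH⁺ : ∀ {i j} → toℕ i ℕ.< toℕ j → adj H i j ≡ true → (i , j) ∈ EH
  ∈-EH⁺ {i} {j} lt a = ∈-filterB⁺ _ (∈-pairs i j) (true-∧ (true-<ᵇ lt) a)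

  ∈-EH⁻ : ∀ {i j} → (i , j) ∈ EH → toℕ i ℕ.< toℕ j × adj H i j ≡ true
  ∈-EH⁻ {i} {j} m = let (a , b) = ∧-true (proj₂ (∈-filterB⁻ (λ p → (toℕ (proj₁ p) <ᵇ toℕ (proj₂ p)) ∧ adj H (proj₁ p) (proj₂ p)) (pairs v) m)) in <ᵇ-true a , b

  unique-EH : Unique EH
  unique-EH = unique-filterB _ (unique-pairs v)

  adj-≢ : ∀ {i j} → adj H i j ≡ true → i ≢ j
  adj-≢ {i} a refl with () ← trans (sym a) (irrefl H i)

  Emb : Set
  Emb = Vec (Fin n) v

  record Inj (φ : Emb) : Set where
    constructor mkInj
    field inj-at : ∀ i j → lookup φ i ≡ lookup φ j → i ≡ j
  open Inj public

  inj? : ∀ φ → Dec (Inj φ)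
  inj? φ = map′ mkInj inj-at (all? (λ i → all? (λ j → (lookup φ i ≟F lookup φ j) →-dec (i ≟F j))))

  codeOf : Emb → Fin v × Fin v → Fin N
  codeOf φ (i , j) = code (lookup φ i) (lookup φ j)

  im : Emb → List (Fin N)
  im φ = map (codeOf φ) EH

  ∈-im⁺ : ∀ φ {i j} → adj H i j ≡ true → code (lookup φ i) (lookup φ j) ∈ im φ
  ∈-im⁺ φ {i} {j} a with ℕ.<-cmp (toℕ i) (toℕ j)
  ... | tri< lt _ _ = ∈-map⁺ (codeOf φ) (∈-EH⁺ lt a)
  ... | tri≈ _ e _ = ⊥-elim (adj-≢ a (toℕ-injective e))
  ... | tri> _ _ gt = subst (_∈ im φ) (code-sym (lookup φ j) (lookup φ i))
    (∈-map⁺ (codeOf φ) (∈-EH⁺ gt (trans (adj-sym H j i) a)))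

  ∈-im⁻ : ∀ φ {x} → x ∈ im φ → ∃₂ λ i j → (i , j) ∈ EH × x ≡ code (lookup φ i) (lookup φ j)
  ∈-im⁻ φ m with ∈-map⁻ (codeOf φ) m
  ... | (i , j) , p , e = i , j , p , e

  valid-im : ∀ {φ} → Inj φ → ∀ {x} → x ∈ im φ → Valid x
  valid-im {φ} inj m with ∈-im⁻ φ m
  ... | i , j , p , e = lookup φ i , lookup φ j , (λ q → adj-≢ (proj₂ (∈-EH⁻ p)) (inj-at inj i j q)) , e

  codeOf-inj : ∀ {φ} → Inj φ → ∀ {p q} → p ∈ EH → q ∈ EH → codeOf φ p ≡ codeOf φ q → p ≡ q
  codeOf-inj {φ} inj {i , j} {k , l} p q e
    with code-inj (λ x → adj-≢ (proj₂ (∈-EH⁻ p)) (inj-at inj i j x)) e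
  ... | inj₁ (a , b) = cong₂ _,_ (inj-at inj i k a) (inj-at inj j l b)
  ... | inj₂ (a , b) with inj-at inj i l a | inj-at inj j k b
  ...   | refl | refl = ⊥-elim (ℕ.<-asym (proj₁ (∈-EH⁻ p)) (proj₁ (∈-EH⁻ q)))

  unique-im : ∀ {φ} → Inj φ → Unique (im φ)
  unique-im inj = unique-map-∈ _ (codeOf-inj inj) unique-EH

  length-im : ∀ φ → length (im φ) ≡ edges H
  length-im φ = trans (length-map _ EH) (sym edges≡)

  inLink : Emb → Fin N → Fin N → Bool
  inLink φ u x = does (x ∈? im φ) ∧ not (does (x ≟F u))

  -- Listed in the order of `allFin N`, so that the list depends only on the set of edges.
  -- Deduplication in `links` then counts copies and not embeddings.
  linkOf : Emb → Fin N → List (Fin N)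
  linkOf φ u = filterB (inLink φ u) (allFin N)

  ∈-linkOf⁺ : ∀ φ {u x} → x ∈ im φ → x ≢ u → x ∈ linkOf φ u
  ∈-linkOf⁺ φ {u} {x} m ne = ∈-filterB⁺ (inLink φ u) (∈-allFin x) (true-∧ (does⁺ (x ∈? im φ) m) lem)
    where
    lem : not (does (x ≟F u)) ≡ true
    lem with x ≟F u
    ... | yes e = ⊥-elim (ne e)
    ... | no _ = refl

  ∈-linkOf⁻ : ∀ φ {u x} → x ∈ linkOf φ u → x ∈ im φ × x ≢ u
  ∈-linkOf⁻ φ {u} {x} m with ∧-true (proj₂ (∈-filterB⁻ (inLink φ u) (allFin N) m))
  ... | a , b = does⁻ (x ∈? im φ) a , lem b
    where
    lem : not (does (x ≟F u)) ≡ true → x ≢ u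
    lem with x ≟F u
    ... | yes _ = λ ()
    ... | no ne = λ _ → ne

  unique-linkOf : ∀ φ u → Unique (linkOf φ u)
  unique-linkOf φ u = unique-filterB _ (Uniq.allFin⁺ N)

  linkOf-ext : ∀ φ ψ u w → linkOf φ u ⊆ linkOf ψ w → linkOf ψ w ⊆ linkOf φ u → linkOf φ u ≡ linkOf ψ w
  linkOf-ext φ ψ u w s t = filterB-ext _ _ (allFin N) lem
    where
    lem : ∀ x → x ∈ allFin N → inLink φ u x ≡ inLink ψ w x
    lem x x∈ with inLink φ u x in e | inLink ψ w x in e′
    ... | true | true = refl
    ... | false | false = refl
    ... | true | false = trans (sym (proj₂ (∈-filterB⁻ (inLink ψ w) (allFin N) (s (∈-filterB⁺ (inLink φ u) x∈ e))))) e′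
    ... | false | true = trans (sym e) (proj₂ (∈-filterB⁻ (inLink φ u) (allFin N) (t (∈-filterB⁺ (inLink ψ w) x∈ e′))))

  length-linkOf : ∀ {φ u} → Inj φ → u ∈ im φ → suc (length (linkOf φ u)) ≡ edges H
  length-linkOf {φ} {u} inj u∈ = trans (unique-⊆-antisym {xs = u ∷ linkOf φ u}
      (All.tabulate (λ m e → proj₂ (∈-linkOf⁻ φ m) (sym e)) ∷ unique-linkOf φ u) (unique-im inj)
      (λ { (here refl) → u∈ ; (there m) → proj₁ (∈-linkOf⁻ φ m) }) back) (length-im φ)
    where
    back : im φ ⊆ u ∷ linkOf φ u
    back {x} m with x ≟F u
    ... | yes e = here e
    ... | no ne = there (∈-linkOf⁺ φ m ne)

  ∈-allVecs : ∀ k (φ : Vec (Fin n) k) → φ ∈ allVecs (allFin n) k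
  ∈-allVecs ℕ.zero [] = here refl
  ∈-allVecs (suc k) (x ∷ φ) = ∈-concatMap⁺ (λ x → map (x ∷_) (allVecs (allFin n) k))
    (Any.map (λ { refl → ∈-map⁺ (x ∷_) (∈-allVecs k φ) }) (∈-allFin x))

  through : Fin N → Emb → Bool
  through u φ = does (inj? φ) ∧ does (u ∈? im φ)

  _≟L_ : (C C′ : List (Fin N)) → Dec (C ≡ C′)
  _≟L_ = ≡-dec _≟F_

  embs : Fin N → List Emb
  embs u = filterB (through u) (allVecs (allFin n) v)

  links : Fin N → List (List (Fin N))
  links u = deduplicate _≟L_ (map (λ φ → linkOf φ u) (embs u))

  ∈-embs⁻ : ∀ {u φ} → φ ∈ embs u → Inj φ × u ∈ im φ
  ∈-embs⁻ {u} {φ} m with ∧-true (proj₂ (∈-filterB⁻ (through u) (allVecs (allFin n) v) m))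
  ... | a , b = does⁻ (inj? φ) a , does⁻ (u ∈? im φ) b

  ∈-embs⁺ : ∀ {u φ} → Inj φ → u ∈ im φ → φ ∈ embs u
  ∈-embs⁺ {u} {φ} i m = ∈-filterB⁺ (through u) (∈-allVecs v φ) (true-∧ (does⁺ (inj? φ) i) (does⁺ (u ∈? im φ) m))

  ∈-links⁻ : ∀ {u C} → C ∈ links u → ∃ λ φ → Inj φ × u ∈ im φ × C ≡ linkOf φ u
  ∈-links⁻ {u} m with ∈-map⁻ (λ φ → linkOf φ u) (∈-deduplicate⁻ _≟L_ (map (λ φ → linkOf φ u) (embs u)) m)
  ... | φ , p , e = φ , proj₁ (∈-embs⁻ p) , proj₂ (∈-embs⁻ p) , e

  ∈-links⁺ : ∀ {u φ} → Inj φ → u ∈ im φ → linkOf φ u ∈ links u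
  ∈-links⁺ {u} {φ} i m = ∈-deduplicate⁺ _≟L_ (∈-map⁺ (λ φ → linkOf φ u) (∈-embs⁺ i m))

  unique-links : ∀ u → Unique (links u)
  unique-links u = UniqDec.deduplicate-! _≟L_ (map (λ φ → linkOf φ u) (embs u))

  link-ok : ∀ {u C} → C ∈ links u → All Valid C × Unique C
  link-ok {u} m with ∈-links⁻ m
  ... | φ , inj , _ , refl = All.tabulate (λ p → valid-im inj (proj₁ (∈-linkOf⁻ φ p))) , unique-linkOf φ u

  link-canon : ∀ {u C C′} → C ∈ links u → C′ ∈ links u → C ⊆ C′ → C′ ⊆ C → C ≡ C′
  link-canon {u} m m′ s t with ∈-links⁻ m | ∈-links⁻ m′
  ... | φ , _ , _ , refl | ψ , _ , _ , refl = linkOf-ext φ ψ u u s t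

  link-self : ∀ {u C} → C ∈ links u → u ∉ C
  link-self m with ∈-links⁻ m
  ... | φ , _ , _ , refl = λ p → proj₂ (∈-linkOf⁻ φ p) refl

  link-length : ∀ {u C} → C ∈ links u → suc (length C) ≡ edges H
  link-length m with ∈-links⁻ m
  ... | φ , inj , u∈ , refl = length-linkOf inj u∈

-- Consequences of strict balance: degrees, and rigidity of generically glued copies.

module Structure {v : ℕ} (H : Graph v) (n : ℕ) (reg : Regular H) (s2b : Strictly2Balanced H) where
  open import Defs using (Graph; adj; edges; filterB; Strictly2Balanced; Regular; SubgraphOf; Proper; countB) renaming (sym to adj-sym)

  open Lists
  open Codes n
  open Copies H n
  open Field
  open Sums
  open import Data.Bool.Base using (Bool; true; false; _∧_; _∨_; not; T)
  open import Data.Bool.Properties using (∨-zeroʳ)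
  open import Data.Empty using (⊥; ⊥-elim)
  open import Data.Fin.Base using (Fin; zero; suc; toℕ)
  open import Data.Fin.Properties using (toℕ-injective) renaming (_≟_ to _≟F_)
  open import Data.Fin.Subset using (∣_∣) renaming (_∈_ to _∈S_; _∉_ to _∉S_)
  open import Data.List.Base as List using (List; []; _∷_; _++_; length; map; allFin)
  open import Data.List.Properties using (length-map; length-++; length-tabulate)
  open import Data.List.Membership.Propositional using (_∈_; _∉_)
  open import Data.List.Membership.DecPropositional (_≟F_ {n}) using () renaming (_∈?_ to _∈v?_)
  open import Data.List.Membership.Propositional.Properties using (∈-map⁺; ∈-map⁻; ∈-allFin; ∈-++⁻; ∈-++⁺ˡ; ∈-++⁺ʳ)
  open import Data.List.Relation.Binary.Subset.Propositional using (_⊆_)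
  open import Data.List.Relation.Unary.Any as Any using (here; there)
  open import Data.List.Relation.Unary.All as All using (All; []; _∷_)
  open import Data.List.Relation.Unary.AllPairs using ([]; _∷_)
  open import Data.List.Relation.Unary.Unique.Propositional using (Unique)
  import Data.List.Relation.Unary.Unique.Propositional.Properties as Uniq
  open import Data.Product using (∃; ∃₂; _×_; _,_; proj₁; proj₂)
  open import Data.Product.Properties using () renaming (≡-dec to ×-≡-dec)
  open import Data.Sum using (_⊎_; inj₁; inj₂)
  open import Data.Vec.Base as Vec using ([]; _∷_; lookup; tabulate)
  open import Data.Vec.Properties using (lookup∘tabulate; []=⇒lookup; lookup⇒[]=)
  open import Function.Base using (_∘_; id)
  open import Relation.Binary.Definitions using (tri<; tri≈; tri>)
  open import Relation.Nullary using (Dec; yes; no; does)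
  open import Relation.Nullary.Decidable using (_→-dec_)

  e : ℕ
  e = edges H

  #V : (Fin v → Bool) → ℕ
  #V X = length (filterB X (allFin v))

  edgeList : (Fin v → Fin v → Bool) → List (Fin v × Fin v)
  edgeList Eb = filterB (λ p → (toℕ (proj₁ p) <ᵇ toℕ (proj₂ p)) ∧ Eb (proj₁ p) (proj₂ p)) (pairs v)

  #E : (Fin v → Fin v → Bool) → ℕ
  #E Eb = length (edgeList Eb)

  ∈-edgeList⁺ : ∀ {Eb i j} → toℕ i ℕ.< toℕ j → Eb i j ≡ true → (i , j) ∈ edgeList Eb
  ∈-edgeList⁺ {i = i} {j} lt a = ∈-filterB⁺ _ (∈-pairs i j) (true-∧ (true-<ᵇ lt) a)

  ∈-edgeList⁻ : ∀ Eb {i j} → (i , j) ∈ edgeList Eb → toℕ i ℕ.< toℕ j × Eb i j ≡ true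
  ∈-edgeList⁻ Eb {i} {j} m = let (a , b) = ∧-true (proj₂ (∈-filterB⁻ (λ p → (toℕ (proj₁ p) <ᵇ toℕ (proj₂ p)) ∧ Eb (proj₁ p) (proj₂ p)) (pairs v) m)) in <ᵇ-true a , b

  card-tabulate : ∀ {A : Set} k (X : A → Bool) (f : Fin k → A) →
    ∣ tabulate (X ∘ f) ∣ ≡ length (filterB X (List.tabulate f))
  card-tabulate zero X f = refl
  card-tabulate (suc k) X f with X (f zero)
  ... | true = cong suc (card-tabulate k X (f ∘ suc))
  ... | false = card-tabulate k X (f ∘ suc)

  balanced : ∀ (X : Fin v → Bool) (Eb : Fin v → Fin v → Bool) →
    (∀ i j → toℕ i ℕ.< toℕ j → Eb i j ≡ true → adj H i j ≡ true × X i ≡ true × X j ≡ true) →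
    (∃ λ i → X i ≡ false) ⊎ (∃₂ λ i j → (i , j) ∈ EH × Eb i j ≡ false) →
    3 ℕ.≤ #V X → (#E Eb ∸ 1) ℕ.* (v ∸ 2) ℕ.< (e ∸ 1) ℕ.* (#V X ∸ 2)
  balanced X Eb sub pr le =
    subst₂ (λ a b → (a ∸ 1) ℕ.* (v ∸ 2) ℕ.< (e ∸ 1) ℕ.* (b ∸ 2)) (countB-length _ (pairs v)) card
      (proj₂ (proj₂ s2b) part (proper pr) (subst (3 ℕ.≤_) (sym card) le))
    where
    card : ∣ tabulate X ∣ ≡ #V X
    card = card-tabulate v X id
    mem⁺ : ∀ i → X i ≡ true → i ∈S tabulate X
    mem⁺ i p = lookup⇒[]= i (tabulate X) (trans (lookup∘tabulate X i) p)
    mem⁻ : ∀ i → X i ≡ false → i ∉S tabulate X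
    mem⁻ i p m with () ← trans (sym p) (trans (sym (lookup∘tabulate X i)) ([]=⇒lookup m))
    part : SubgraphOf H
    part = record { verts = tabulate X ; edgs = Eb ; sub = λ i j lt p →
      let (a , b , c) = sub i j lt p in a , mem⁺ i b , mem⁺ j c }
    proper : (∃ λ i → X i ≡ false) ⊎ (∃₂ λ i j → (i , j) ∈ EH × Eb i j ≡ false) → Proper part
    proper (inj₁ (i , p)) = inj₁ (i , mem⁻ i p)
    proper (inj₂ (i , j , m , p)) = inj₂ (i , j , proj₁ (∈-EH⁻ m) , proj₂ (∈-EH⁻ m) , p)

  three : ∀ (X : Fin v → Bool) {i j k} → X i ≡ true → X j ≡ true → X k ≡ true →
    i ≢ j → k ≢ i → k ≢ j → 3 ℕ.≤ #V X
  three X {i} {j} {k} a b c ne₁ ne₂ ne₃ = unique-⊆-length {xs = i ∷ j ∷ k ∷ []}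
    ((ne₁ ∷ (λ q → ne₂ (sym q)) ∷ []) ∷ ((λ q → ne₃ (sym q)) ∷ []) ∷ [] ∷ [])
    (λ { (here refl) → ∈-filterB⁺ X (∈-allFin i) a ; (there (here refl)) → ∈-filterB⁺ X (∈-allFin j) b
       ; (there (there (here refl))) → ∈-filterB⁺ X (∈-allFin k) c })

  third : ∀ {i j k l : Fin v} → toℕ i ℕ.< toℕ j → toℕ k ℕ.< toℕ l → (i , j) ≢ (k , l) →
    (k ≢ i × k ≢ j) ⊎ (l ≢ i × l ≢ j)
  third {i} {j} {k} {l} lt lt′ ne with k ≟F i | k ≟F j | l ≟F i | l ≟F j
  ... | no a | no b | _ | _ = inj₁ (a , b)
  ... | yes a | _ | no c | no d = inj₂ (c , d)
  ... | _ | yes b | no c | no d = inj₂ (c , d)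
  ... | yes refl | _ | yes refl | _ = ⊥-elim (ℕ.<-irrefl refl lt′)
  ... | yes refl | _ | no _ | yes refl = ⊥-elim (ne refl)
  ... | no _ | yes refl | yes refl | _ = ⊥-elim (ℕ.<-asym lt lt′)
  ... | no _ | yes refl | no _ | yes refl = ⊥-elim (ℕ.<-irrefl refl lt′)

  third-vertex : ∀ (X : Fin v → Bool) {i j k l} → (i , j) ∈ EH → (k , l) ∈ EH → (i , j) ≢ (k , l) →
    X i ≡ true → X j ≡ true → X k ≡ true → X l ≡ true → 3 ℕ.≤ #V X
  third-vertex X p q ne a b c d with third (proj₁ (∈-EH⁻ p)) (proj₁ (∈-EH⁻ q)) ne
  ... | inj₁ (x , y) = three X a b c (adj-≢ (proj₂ (∈-EH⁻ p))) x y
  ... | inj₂ (x , y) = three X a b d (adj-≢ (proj₂ (∈-EH⁻ p))) x y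

  3≤e : 3 ℕ.≤ e
  3≤e = proj₁ (proj₂ s2b)

  3≤v : 3 ℕ.≤ v
  3≤v = proj₁ s2b

  -- Strict balance applied to the union of two edges.
  v<2e : v ℕ.< 2 ℕ.* e
  v<2e with EH in eq | subst (3 ℕ.≤_) edges≡ 3≤e | unique-EH
  ... | [] | () | _
  ... | _ ∷ [] | s≤s () | _
  ... | _ ∷ _ ∷ [] | s≤s (s≤s ()) | _
  ... | h₁@(i , j) ∷ h₂@(k , l) ∷ h₃@(a , b) ∷ hs | _ | ((h₁≢h₂ ∷ h₁≢h₃ ∷ _) ∷ (h₂≢h₃ ∷ _) ∷ _) = conclude
    where
    _≟P_ = ×-≡-dec (_≟F_ {v}) (_≟F_ {v})
    m₁ : h₁ ∈ EH
    m₁ = subst (h₁ ∈_) (sym eq) (here refl)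
    m₂ : h₂ ∈ EH
    m₂ = subst (h₂ ∈_) (sym eq) (there (here refl))
    m₃ : h₃ ∈ EH
    m₃ = subst (h₃ ∈_) (sym eq) (there (there (here refl)))
    X : Fin v → Bool
    X x = does (x ≟F i) ∨ (does (x ≟F j) ∨ (does (x ≟F k) ∨ does (x ≟F l)))
    Eb : Fin v → Fin v → Bool
    Eb x y = does ((x , y) ≟P h₁) ∨ does ((x , y) ≟P h₂)
    Xi : X i ≡ true
    Xi rewrite does⁺ (i ≟F i) refl = refl
    Xj : X j ≡ true
    Xj rewrite does⁺ (j ≟F j) refl = ∨-zeroʳ _
    Xk : X k ≡ true
    Xk rewrite does⁺ (k ≟F k) refl | ∨-zeroʳ (does (k ≟F j)) = ∨-zeroʳ _
    Xl : X l ≡ true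
    Xl rewrite does⁺ (l ≟F l) refl | ∨-zeroʳ (does (l ≟F k)) | ∨-zeroʳ (does (l ≟F j)) = ∨-zeroʳ _
    X⁻ : ∀ {x} → X x ≡ true → x ∈ i ∷ j ∷ k ∷ l ∷ []
    X⁻ {x} p with x ≟F i | x ≟F j | x ≟F k | x ≟F l
    ... | yes q | _ | _ | _ = here q
    ... | no _ | yes q | _ | _ = there (here q)
    ... | no _ | no _ | yes q | _ = there (there (here q))
    ... | no _ | no _ | no _ | yes q = there (there (there (here q)))
    sub : ∀ x y → toℕ x ℕ.< toℕ y → Eb x y ≡ true → adj H x y ≡ true × X x ≡ true × X y ≡ true
    sub x y lt p with (x , y) ≟P h₁ | (x , y) ≟P h₂
    ... | yes refl | _ = proj₂ (∈-EH⁻ m₁) , Xi , Xj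
    ... | no _ | yes refl = proj₂ (∈-EH⁻ m₂) , Xk , Xl
    E₃ : Eb a b ≡ false
    E₃ with (a , b) ≟P h₁ | (a , b) ≟P h₂
    ... | yes q | _ = ⊥-elim (h₁≢h₃ (sym q))
    ... | no _ | yes q = ⊥-elim (h₂≢h₃ (sym q))
    ... | no _ | no _ = refl
    E≥2 : 2 ℕ.≤ #E Eb
    E≥2 = unique-⊆-length {xs = h₁ ∷ h₂ ∷ []} ((h₁≢h₂ ∷ []) ∷ [] ∷ []) λ
      { (here refl) → ∈-edgeList⁺ {Eb} (proj₁ (∈-EH⁻ m₁)) (E₁ _ refl) ; (there (here refl)) → ∈-edgeList⁺ {Eb} (proj₁ (∈-EH⁻ m₂)) E₂ }
      where
      E₁ : ∀ z → z ≡ does (h₁ ≟P h₂) → Eb i j ≡ true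
      E₁ _ _ rewrite does⁺ (h₁ ≟P h₁) refl = refl
      E₂ : Eb k l ≡ true
      E₂ rewrite does⁺ (h₂ ≟P h₂) refl = ∨-zeroʳ _
    V≤4 : #V X ℕ.≤ 4
    V≤4 = unique-⊆-length (unique-filterB X (Uniq.allFin⁺ v)) (λ m → X⁻ (proj₂ (∈-filterB⁻ X (allFin v) m)))
    bal : (#E Eb ∸ 1) ℕ.* (v ∸ 2) ℕ.< (e ∸ 1) ℕ.* (#V X ∸ 2)
    bal = balanced X Eb sub (inj₂ (a , b , m₃ , E₃)) (third-vertex X m₁ m₂ h₁≢h₂ Xi Xj Xk Xl)
    v-2< : v ∸ 2 ℕ.< (e ∸ 1) ℕ.* 2
    v-2< = ℕ.≤-<-trans (ℕ.≤-trans (ℕ.≤-reflexive (sym (ℕ.*-identityˡ (v ∸ 2)))) (ℕ.*-monoˡ-≤ (v ∸ 2) (ℕ.∸-monoˡ-≤ 1 E≥2)))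
      (ℕ.<-≤-trans bal (ℕ.*-monoʳ-≤ (e ∸ 1) (ℕ.∸-monoˡ-≤ 2 V≤4)))
    conclude : v ℕ.< 2 ℕ.* e
    conclude = subst₂ ℕ._<_ (ℕ.m+[n∸m]≡n (ℕ.≤-trans (s≤s (s≤s z≤n)) 3≤v))
      (trans (cong (2 ℕ.+_) (ℕ.*-comm (e ∸ 1) 2)) (trans (sym (ℕ.*-distribˡ-+ 2 1 (e ∸ 1)))
        (cong (2 ℕ.*_) (ℕ.m+[n∸m]≡n (ℕ.≤-trans (s≤s z≤n) 3≤e))))) (ℕ.+-monoʳ-< 2 v-2<)

  sumL-swap : ∀ {A B : Set} (f : A → B → F) xs ys →
    sumL (λ x → sumL (f x) ys) xs ≡ sumL (λ y → sumL (λ x → f x y) xs) ys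
  sumL-swap f [] ys = sym (trans (sumL-const 0# ys) (zeroʳ _))
  sumL-swap f (x ∷ xs) ys = trans (cong (sumL (f x) ys +_) (sumL-swap f xs ys)) (sym (sumL-+ _ _ ys))

  ι-countB : ∀ {A : Set} (p : A → Bool) xs → ι (countB p xs) ≡ sumL (λ x → b2F (p x)) xs
  ι-countB p [] = refl
  ι-countB p (x ∷ xs) with p x
  ... | true = trans (ι-suc _) (cong (1# +_) (ι-countB p xs))
  ... | false = trans (ι-countB p xs) (sym (+-identityˡ _))

  -- Each adjacency is split as `up i j + up j i`, one of which vanishes; interchanging the double
  -- sum shows that both halves count the edges.
  handshake : v ℕ.* proj₁ reg ≡ e ℕ.+ e
  handshake = ℕ.≤-antisym (ι-reflect (≤-reflexive eq)) (ι-reflect (≤-reflexive (sym eq)))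
    where
    is = allFin v
    up : Fin v → Fin v → F
    up i j = b2F ((toℕ i <ᵇ toℕ j) ∧ adj H i j)
    eE : ι e ≡ sumL (λ i → sumL (up i) is) is
    eE = trans (ι-countB _ (pairs v)) (trans (sumL-concatMap _ _ is) (sumL-cong (λ i → sumL-map _ _ is) is))
    pt : ∀ i j → b2F (adj H i j) ≡ up i j + up j i
    pt i j rewrite adj-sym H j i with toℕ i <ᵇ toℕ j in p | toℕ j <ᵇ toℕ i in q | adj H i j in a
    ... | true | true | _ = ⊥-elim (ℕ.<-asym (<ᵇ-true {toℕ i} {toℕ j} p) (<ᵇ-true {toℕ j} {toℕ i} q))
    ... | true | false | _ = sym (+-identityʳ _)
    ... | false | true | _ = sym (+-identityˡ _)
    ... | false | false | false = sym (+-identityˡ _)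
    ... | false | false | true with ℕ.<-cmp (toℕ i) (toℕ j)
    ...   | tri< lt _ _ with () ← trans (sym p) (true-<ᵇ lt)
    ...   | tri> _ _ gt with () ← trans (sym q) (true-<ᵇ gt)
    ...   | tri≈ _ eq _ = ⊥-elim (adj-≢ a (toℕ-injective eq))
    eq : ι (v ℕ.* proj₁ reg) ≡ ι (e ℕ.+ e)
    eq = trans (ι-* v (proj₁ reg)) (trans (cong (λ z → ι z * ι (proj₁ reg)) (sym (length-tabulate {n = v} id)))
      (trans (sym (sumL-const (ι (proj₁ reg)) is))
      (trans (sumL-cong (λ i → trans (cong ι (sym (proj₂ reg i))) (trans (ι-countB (adj H i) is)
         (trans (sumL-cong (pt i) is) (sumL-+ _ _ is)))) is)
      (trans (sumL-+ _ _ is) (trans (cong₂ _+_ (sym eE) (trans (sumL-swap (λ i j → up j i) is is) (sym eE)))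
        (sym (ι-+ e e)))))))

  -- Degree at most 1 would give 2 e = v d ≤ v, contrary to `v<2e`. Regularity is what turns the
  -- average degree exceeding 1 into a bound for every vertex.
  2≤d : 2 ℕ.≤ proj₁ reg
  2≤d with 2 ℕ.≤? proj₁ reg
  ... | yes p = p
  ... | no np = ⊥-elim (ℕ.<⇒≱ v<2e (ℕ.≤-trans (ℕ.≤-reflexive (trans (cong (e ℕ.+_) (ℕ.+-identityʳ e)) (sym handshake)))
    (ℕ.≤-trans (ℕ.*-monoʳ-≤ v (ℕ.≤-pred (ℕ.≰⇒> np))) (ℕ.≤-reflexive (ℕ.*-identityʳ v)))))

  neighbours : ∀ k → ∃₂ λ l₁ l₂ → l₁ ≢ l₂ × adj H k l₁ ≡ true × adj H k l₂ ≡ true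
  neighbours k with filterB (adj H k) (allFin v) in eq | unique-filterB (adj H k) (Uniq.allFin⁺ v)
    | subst (2 ℕ.≤_) (trans (sym (proj₂ reg k)) (countB-length (adj H k) (allFin v))) 2≤d
  ... | l₁ ∷ l₂ ∷ _ | ((ne ∷ _) ∷ _) | _ = l₁ , l₂ , ne ,
    proj₂ (∈-filterB⁻ (adj H k) (allFin v) (subst (l₁ ∈_) (sym eq) (here refl))) ,
    proj₂ (∈-filterB⁻ (adj H k) (allFin v) (subst (l₂ ∈_) (sym eq) (there (here refl))))
  ... | _ ∷ [] | _ | s≤s ()
  ... | [] | _ | ()

  vimg : Emb → List (Fin n)
  vimg φ = map (lookup φ) (allFin v)

  unique-vimg : ∀ {φ} → Inj φ → Unique (vimg φ)
  unique-vimg {φ} inj = unique-map-∈ (lookup φ) (λ _ _ p → inj-at inj _ _ p) (Uniq.allFin⁺ v)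

  length-vimg : ∀ φ → length (vimg φ) ≡ v
  length-vimg φ = trans (length-map (lookup φ) (allFin v)) (length-tabulate {n = v} id)

  ∈-vimg : ∀ φ i → lookup φ i ∈ vimg φ
  ∈-vimg φ i = ∈-map⁺ (lookup φ) (∈-allFin i)

  im-vimg : ∀ φ {x y} → x ∈ im φ → y ∈ ends x → y ∈ vimg φ
  im-vimg φ m p with ∈-im⁻ φ m
  ... | i , j , _ , refl with ∈-ends-code⁻ p
  ...   | inj₁ refl = ∈-vimg φ i
  ...   | inj₂ refl = ∈-vimg φ j

  -- A vertex of a copy lies on an edge of the copy other than w, as degrees are at least two.
  vertex-link : ∀ {ψ} → Inj ψ → ∀ w k → ∃ λ x → x ∈ linkOf ψ w × lookup ψ k ∈ ends x
  vertex-link {ψ} inj w k with neighbours k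
  ... | l₁ , l₂ , ne , a₁ , a₂ with code (lookup ψ k) (lookup ψ l₁) ≟F w
  ...   | no q = _ , ∈-linkOf⁺ ψ (∈-im⁺ ψ a₁) q , ∈-ends-codeˡ (lookup ψ k) (lookup ψ l₁)
  ...   | yes q = _ , ∈-linkOf⁺ ψ (∈-im⁺ ψ a₂) q₂ , ∈-ends-codeˡ (lookup ψ k) (lookup ψ l₂)
    where
    q₂ : code (lookup ψ k) (lookup ψ l₂) ≢ w
    q₂ q′ with code-inj (λ p → adj-≢ a₁ (inj-at inj k l₁ p)) (trans q (sym q′))
    ... | inj₁ (_ , p) = ne (inj-at inj l₁ l₂ p)
    ... | inj₂ (p , _) = adj-≢ a₂ (inj-at inj k l₂ p)

  -- Attached at u, the copy meets the vertices of Z only in the endpoints of u. The condition is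
  -- put on the link alone, which loses nothing: by `vertex-link` the edges of a link already cover
  -- all vertices of its copy.
  GenP : List (Fin N) → Fin N → List (Fin N) → Set
  GenP Z u C = All (λ y → y ∈ verts Z → y ∈ ends u) (verts C)

  gen? : ∀ Z u C → Dec (GenP Z u C)
  gen? Z u C = All.all? (λ y → (y ∈v? verts Z) →-dec (y ∈v? ends u)) (verts C)

  Gen : List (Fin N) → Fin N → List (Fin N) → Bool
  Gen Z u C = does (gen? Z u C)

  gen⁻ : ∀ Z u C → T (Gen Z u C) → GenP Z u C
  gen⁻ Z u C t with gen? Z u C
  ... | yes p = p

  module Inside {φ : Emb} (Z : List (Fin N)) (injφ : Inj φ) where

    V₂ : Fin v → Bool
    V₂ i = does (lookup φ i ∈v? verts Z)
    E₂ : Fin v → Fin v → Bool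
    E₂ i j = adj H i j ∧ does (codeOf φ (i , j) ∈? Z)

    V₂-Z : ∀ {i x} → x ∈ Z → lookup φ i ∈ ends x → V₂ i ≡ true
    V₂-Z {i} m p = does⁺ (lookup φ i ∈v? verts Z) (∈-verts⁺ m p)

    sub₂ : ∀ i j → toℕ i ℕ.< toℕ j → E₂ i j ≡ true → adj H i j ≡ true × V₂ i ≡ true × V₂ j ≡ true
    sub₂ i j _ p with ∧-true p
    ... | a , q = a , V₂-Z (does⁻ (_ ∈? Z) q) (∈-ends-codeˡ (lookup φ i) (lookup φ j))
                    , V₂-Z (does⁻ (_ ∈? Z) q) (∈-ends-codeʳ (lookup φ i) (lookup φ j))

    inZ : Fin N → Bool
    inZ x = does (x ∈? Z)

    e₂-bound : length (filterB inZ (im φ)) ℕ.≤ #E E₂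
    e₂-bound = subst (length (filterB inZ (im φ)) ℕ.≤_) (length-map (codeOf φ) (edgeList E₂))
      (unique-⊆-length (unique-filterB _ (unique-im injφ)) incl)
      where
      incl : filterB inZ (im φ) ⊆ map (codeOf φ) (edgeList E₂)
      incl {x} m with ∈-filterB⁻ inZ (im φ) m
      ... | m′ , z with ∈-im⁻ φ m′
      ...   | i , j , p , refl = ∈-map⁺ (codeOf φ) (∈-edgeList⁺ {E₂} (proj₁ (∈-EH⁻ p)) (true-∧ (proj₂ (∈-EH⁻ p)) z))

  -- Two copies of H can overlap as described only if they coincide: otherwise the part of
  -- ψ's copy shared with φ's, together with w, and the part of φ's copy inside Z are
  -- proper subgraphs of H that are jointly too dense.
  module Overlap {φ ψ : Emb} {w : Fin N} {Z : List (Fin N)} (injφ : Inj φ) (injψ : Inj ψ)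
    (validZ : All Valid Z) (w∈Z : w ∈ Z) (w∈ψ : w ∈ im ψ) (gen : GenP Z w (linkOf ψ w))
    (cover : im φ ⊆ linkOf ψ w ++ Z) {x₀ : Fin N} (x₀∈ : x₀ ∈ im φ) (x₀∉ : x₀ ∉ Z) where

    open Inside Z injφ

    C* : List (Fin N)
    C* = linkOf ψ w

    shared : ∀ {y} → y ∈ vimg ψ → y ∈ verts Z → y ∈ ends w
    shared m p with ∈-map⁻ (lookup ψ) m
    ... | k , _ , refl with vertex-link injψ w k
    ...   | x , x∈ , y∈ = All.lookup gen (∈-verts⁺ x∈ y∈) p

    outside : ∀ {x} → x ∈ im φ → x ∉ Z → x ∈ C*
    outside m nz with ∈-++⁻ C* (cover m)
    ... | inj₁ q = q
    ... | inj₂ q = ⊥-elim (nz q)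

    V₁ : Fin v → Bool
    V₁ i = does (lookup ψ i ∈v? vimg φ) ∨ does (lookup ψ i ∈v? ends w)
    E₁ : Fin v → Fin v → Bool
    E₁ i j = adj H i j ∧ (does (codeOf ψ (i , j) ∈? im φ) ∨ does (codeOf ψ (i , j) ≟F w))
    V₁-φ : ∀ {i x} → x ∈ im φ → lookup ψ i ∈ ends x → V₁ i ≡ true
    V₁-φ {i} m p = true-∨ˡ (does⁺ (lookup ψ i ∈v? vimg φ) (im-vimg φ m p))

    V₁-w : ∀ {i} → lookup ψ i ∈ ends w → V₁ i ≡ true
    V₁-w {i} p = true-∨ʳ {does (lookup ψ i ∈v? vimg φ)} (does⁺ (lookup ψ i ∈v? ends w) p)

    sub₁ : ∀ i j → toℕ i ℕ.< toℕ j → E₁ i j ≡ true → adj H i j ≡ true × V₁ i ≡ true × V₁ j ≡ true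
    sub₁ i j _ p with ∧-true p
    ... | a , q with ∨-true q
    ...   | inj₁ q′ = a , V₁-φ (does⁻ (_ ∈? im φ) q′) (∈-ends-codeˡ (lookup ψ i) (lookup ψ j))
                        , V₁-φ (does⁻ (_ ∈? im φ) q′) (∈-ends-codeʳ (lookup ψ i) (lookup ψ j))
    ...   | inj₂ q′ = a , V₁-w (subst (λ z → lookup ψ i ∈ ends z) (does⁻ (_ ≟F w) q′) (∈-ends-codeˡ (lookup ψ i) (lookup ψ j)))
                        , V₁-w (subst (λ z → lookup ψ j ∈ ends z) (does⁻ (_ ≟F w) q′) (∈-ends-codeʳ (lookup ψ i) (lookup ψ j)))

    e₁-bound : suc (length (filterB (λ x → not (inZ x)) (im φ))) ℕ.≤ #E E₁
    e₁-bound = subst (suc (length B′) ℕ.≤_) (length-map (codeOf ψ) (edgeList E₁))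
      (unique-⊆-length {xs = w ∷ B′} (All.tabulate w# ∷ unique-filterB _ (unique-im injφ)) incl)
      where
      B′ = filterB (λ x → not (inZ x)) (im φ)
      w# : ∀ {x} → x ∈ B′ → w ≢ x
      w# m refl = does-no⁻ (w ∈? Z) (not-true (proj₂ (∈-filterB⁻ (λ x → not (inZ x)) (im φ) m))) w∈Z
      incl : w ∷ B′ ⊆ map (codeOf ψ) (edgeList E₁)
      incl (here refl) with ∈-im⁻ ψ w∈ψ
      ... | i , j , p , e = subst (_∈ map (codeOf ψ) (edgeList E₁)) (sym e) (∈-map⁺ (codeOf ψ)
        (∈-edgeList⁺ {E₁} (proj₁ (∈-EH⁻ p)) (true-∧ (proj₂ (∈-EH⁻ p)) (true-∨ʳ (does⁺ (_ ≟F w) (sym e))))))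
      incl {x} (there m) with ∈-filterB⁻ (λ x → not (inZ x)) (im φ) m
      ... | m′ , nz with ∈-im⁻ ψ (proj₁ (∈-linkOf⁻ ψ (outside m′ (does-no⁻ (x ∈? Z) (not-true nz)))))
      ...   | i , j , p , e = subst (_∈ map (codeOf ψ) (edgeList E₁)) (sym e) (∈-map⁺ (codeOf ψ)
        (∈-edgeList⁺ {E₁} (proj₁ (∈-EH⁻ p)) (true-∧ (proj₂ (∈-EH⁻ p)) (true-∨ˡ (does⁺ (_ ∈? im φ) (subst (_∈ im φ) e m′))))))

    -- Every edge of φ's copy is counted in `E₂` if it lies in Z and in `E₁` otherwise. In addition
    -- `E₁` counts w, which lies in Z; this is the surplus of one.
    e-sum : suc e ℕ.≤ #E E₁ ℕ.+ #E E₂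
    e-sum = subst (ℕ._≤ #E E₁ ℕ.+ #E E₂)
      (cong suc (trans (ℕ.+-comm (length (filterB (λ x → not (inZ x)) (im φ))) _)
        (trans (filterB-split inZ (im φ)) (length-im φ))))
      (ℕ.+-mono-≤ e₁-bound e₂-bound)

    A₁ A₂ : List (Fin n)
    A₁ = map (lookup ψ) (filterB V₁ (allFin v))
    A₂ = map (lookup φ) (filterB V₂ (allFin v))

    unique-A₁ : Unique A₁
    unique-A₁ = unique-map-∈ (lookup ψ) (λ _ _ p → inj-at injψ _ _ p) (unique-filterB V₁ (Uniq.allFin⁺ v))
    unique-A₂ : Unique A₂
    unique-A₂ = unique-map-∈ (lookup φ) (λ _ _ p → inj-at injφ _ _ p) (unique-filterB V₂ (Uniq.allFin⁺ v))

    -- Inclusion and exclusion: the union of the two vertex sets lies in φ's copy together with the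
    -- ends of w, and by genericity their intersection lies among the ends of w that belong to φ's
    -- copy. The two ends of w are thus counted once in total, inside or outside φ's copy.
    v-sum : #V V₁ ℕ.+ #V V₂ ℕ.≤ v ℕ.+ 2
    v-sum = subst₂ ℕ._≤_ lhs rhs (ℕ.+-mono-≤ out-bound in-bound)
      where
      in₂ : Fin n → Bool
      in₂ y = does (y ∈v? A₂)
      inφ : Fin n → Bool
      inφ y = does (y ∈v? vimg φ)
      A₂⊆ : ∀ {y} → y ∈ A₂ → y ∈ vimg φ × y ∈ verts Z
      A₂⊆ m with ∈-map⁻ (lookup φ) m
      ... | i , i∈ , refl = ∈-vimg φ i , does⁻ (_ ∈v? verts Z) (proj₂ (∈-filterB⁻ V₂ (allFin v) i∈))
      A₁⊆ : ∀ {y} → y ∈ A₁ → y ∈ vimg ψ × (y ∈ vimg φ ⊎ y ∈ ends w)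
      A₁⊆ m with ∈-map⁻ (lookup ψ) m
      ... | i , i∈ , refl with ∨-true (proj₂ (∈-filterB⁻ V₁ (allFin v) i∈))
      ...   | inj₁ q = ∈-vimg ψ i , inj₁ (does⁻ (_ ∈v? vimg φ) q)
      ...   | inj₂ q = ∈-vimg ψ i , inj₂ (does⁻ (_ ∈v? ends w) q)
      out = filterB (λ y → not (in₂ y)) A₁
      disj : ∀ {y} → y ∈ out × y ∈ A₂ → ⊥
      disj {y} (p , q) = does-no⁻ (y ∈v? A₂) (not-true (proj₂ (∈-filterB⁻ (λ y → not (in₂ y)) A₁ p))) q
      out-incl : out ++ A₂ ⊆ vimg φ ++ filterB (λ y → not (inφ y)) (ends w)
      out-incl {y} m with ∈-++⁻ out m
      ... | inj₂ q = ∈-++⁺ˡ (proj₁ (A₂⊆ q))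
      ... | inj₁ q with A₁⊆ (proj₁ (∈-filterB⁻ (λ y → not (in₂ y)) A₁ q))
      ...   | _ , inj₁ r = ∈-++⁺ˡ r
      ...   | _ , inj₂ r with y ∈v? vimg φ
      ...     | yes s = ∈-++⁺ˡ s
      ...     | no s = ∈-++⁺ʳ (vimg φ) (∈-filterB⁺ (λ y → not (inφ y)) r (not-false (does-no (y ∈v? vimg φ) s)))
      out-bound : length out ℕ.+ length A₂ ℕ.≤ v ℕ.+ length (filterB (λ y → not (inφ y)) (ends w))
      out-bound = subst₂ ℕ._≤_ (length-++ out) (trans (length-++ (vimg φ)) (cong (λ z → z ℕ.+ length (filterB (λ y → not (inφ y)) (ends w))) (length-vimg φ)))
        (unique-⊆-length (Uniq.++⁺ (unique-filterB _ unique-A₁) unique-A₂ disj) out-incl)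
      in-bound : length (filterB in₂ A₁) ℕ.≤ length (filterB inφ (ends w))
      in-bound = unique-⊆-length (unique-filterB _ unique-A₁) λ {y} m →
        let (m₁ , q) = ∈-filterB⁻ in₂ A₁ m
            (a , b) = A₂⊆ (does⁻ (y ∈v? A₂) q)
        in ∈-filterB⁺ inφ (shared (proj₁ (A₁⊆ m₁)) b) (does⁺ (y ∈v? vimg φ) a)
      lhs : (length out ℕ.+ length A₂) ℕ.+ length (filterB in₂ A₁) ≡ #V V₁ ℕ.+ #V V₂
      lhs = trans (ℕ.+-assoc (length out) _ _) (trans (cong (length out ℕ.+_) (ℕ.+-comm (length A₂) _))
        (trans (sym (ℕ.+-assoc (length out) _ _)) (cong₂ ℕ._+_
          (trans (ℕ.+-comm (length out) _) (trans (filterB-split in₂ A₁) (length-map (lookup ψ) (filterB V₁ (allFin v)))))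
          (length-map (lookup φ) (filterB V₂ (allFin v))))))
      rhs : (v ℕ.+ length (filterB (λ y → not (inφ y)) (ends w))) ℕ.+ length (filterB inφ (ends w)) ≡ v ℕ.+ 2
      rhs = trans (ℕ.+-assoc v _ _) (cong (v ℕ.+_) (trans (ℕ.+-comm (length (filterB (λ y → not (inφ y)) (ends w))) _)
        (filterB-split inφ (ends w))))

    3≤V₁ : 3 ℕ.≤ #V V₁
    3≤V₁ with ∈-im⁻ ψ w∈ψ | ∈-im⁻ ψ (proj₁ (∈-linkOf⁻ ψ (outside x₀∈ x₀∉)))
    ... | a , b , p , e₁ | c , d , q , e₂ = third-vertex V₁ p q
      (λ { refl → x₀∉ (subst (_∈ Z) (trans e₁ (sym e₂)) w∈Z) })
      (V₁-w (subst (λ z → lookup ψ a ∈ ends z) (sym e₁) (∈-ends-codeˡ (lookup ψ a) (lookup ψ b))))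
      (V₁-w (subst (λ z → lookup ψ b ∈ ends z) (sym e₁) (∈-ends-codeʳ (lookup ψ a) (lookup ψ b))))
      (V₁-φ x₀∈ (subst (λ z → lookup ψ c ∈ ends z) (sym e₂) (∈-ends-codeˡ (lookup ψ c) (lookup ψ d))))
      (V₁-φ x₀∈ (subst (λ z → lookup ψ d ∈ ends z) (sym e₂) (∈-ends-codeʳ (lookup ψ c) (lookup ψ d))))

    missing : (X : Fin v → Bool) → #V X ℕ.< v → ∃ λ i → X i ≡ false
    missing X lt with filterB (λ x → not (X x)) (allFin v) in eq | filterB-split X (allFin v)
    ... | [] | s = ⊥-elim (ℕ.<-irrefl (trans (sym (ℕ.+-identityʳ _)) (trans s (length-tabulate {n = v} id))) lt)
    ... | i ∷ _ | _ = i , not-true (proj₂ (∈-filterB⁻ (λ x → not (X x)) (allFin v) (subst (i ∈_) (sym eq) (here refl))))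

    -- Adding the two balance inequalities gives (a + b - 2) (v - 2) < (e - 1) (c + d - 4), whereas
    -- a + b - 2 ≥ e - 1 and c + d - 4 ≤ v - 2.
    too-dense : ∀ a b c d → suc e ℕ.≤ a ℕ.+ b → c ℕ.+ d ℕ.≤ v ℕ.+ 2 → 3 ℕ.≤ c → 3 ℕ.≤ d → 2 ℕ.≤ b →
      (a ∸ 1) ℕ.* (v ∸ 2) ℕ.< (e ∸ 1) ℕ.* (c ∸ 2) → (b ∸ 1) ℕ.* (v ∸ 2) ℕ.< (e ∸ 1) ℕ.* (d ∸ 2) → ⊥
    too-dense a b (suc (suc c)) (suc (suc d)) h₁ h₂ _ _ _ p q = ℕ.<⇒≱ sum (ℕ.≤-trans (ℕ.*-monoʳ-≤ (e ∸ 1) cd) (ℕ.*-monoˡ-≤ (v ∸ 2) ab))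
      where
      sum : (a ∸ 1 ℕ.+ (b ∸ 1)) ℕ.* (v ∸ 2) ℕ.< (e ∸ 1) ℕ.* (c ℕ.+ d)
      sum = subst₂ ℕ._<_ (sym (ℕ.*-distribʳ-+ (v ∸ 2) (a ∸ 1) (b ∸ 1))) (sym (ℕ.*-distribˡ-+ (e ∸ 1) c d)) (ℕ.+-mono-< p q)
      cd : c ℕ.+ d ℕ.≤ v ∸ 2
      cd = ℕ.+-cancelʳ-≤ 2 _ _ (ℕ.≤-trans (ℕ.+-cancelʳ-≤ 2 _ _ (ℕ.≤-trans (ℕ.≤-reflexive eq) h₂))
        (ℕ.≤-reflexive (sym (ℕ.m∸n+n≡m (ℕ.≤-trans (s≤s (s≤s z≤n)) 3≤v)))))
        where
        eq : (c ℕ.+ d ℕ.+ 2) ℕ.+ 2 ≡ suc (suc c) ℕ.+ suc (suc d)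
        eq = trans (ℕ.+-assoc (c ℕ.+ d) 2 2) (trans (ℕ.+-comm (c ℕ.+ d) 4)
          (cong (λ z → suc (suc z)) (sym (trans (ℕ.+-suc c (suc d)) (cong suc (ℕ.+-suc c d))))))
      ab : e ∸ 1 ℕ.≤ a ∸ 1 ℕ.+ (b ∸ 1)
      ab = ℕ.≤-trans (ℕ.∸-monoˡ-≤ 2 h₁) (lem a b)
        where
        lem : ∀ a b → a ℕ.+ b ∸ 2 ℕ.≤ a ∸ 1 ℕ.+ (b ∸ 1)
        lem zero b = ℕ.∸-monoʳ-≤ b (s≤s z≤n)
        lem (suc a) zero = ℕ.≤-trans (ℕ.m∸n≤m (a ℕ.+ 0) 1) ℕ.≤-refl
        lem (suc a) (suc b) = ℕ.≤-reflexive (cong (_∸ 1) (ℕ.+-suc a b))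
    too-dense a b (suc (suc c)) 1 _ _ _ (s≤s ()) _ _ _
    too-dense a b 1 d _ _ (s≤s ()) _ _ _ _

    3≤V₂ : 2 ℕ.≤ #E E₂ → 3 ℕ.≤ #V V₂
    3≤V₂ p₂ with edgeList E₂ in eq | p₂ | unique-filterB (λ q → (toℕ (proj₁ q) <ᵇ toℕ (proj₂ q)) ∧ E₂ (proj₁ q) (proj₂ q)) (unique-pairs v)
    ... | [] | () | _
    ... | _ ∷ [] | s≤s () | _
    ... | (a , b) ∷ (c , d) ∷ _ | _ | u = third-vertex V₂ (inEH m₁) (inEH m₂) (distinct u)
        (proj₁ (proj₂ (s₂ m₁))) (proj₂ (proj₂ (s₂ m₁))) (proj₁ (proj₂ (s₂ m₂))) (proj₂ (proj₂ (s₂ m₂)))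
      where
      distinct : ∀ {y z : Fin v × Fin v} {zs} → Unique (y ∷ z ∷ zs) → y ≢ z
      distinct ((ne ∷ _) ∷ _) = ne
      m₁ : (a , b) ∈ edgeList E₂
      m₁ = subst ((a , b) ∈_) (sym eq) (here refl)
      m₂ : (c , d) ∈ edgeList E₂
      m₂ = subst ((c , d) ∈_) (sym eq) (there (here refl))
      s₂ : ∀ {y z} → (y , z) ∈ edgeList E₂ → adj H y z ≡ true × V₂ y ≡ true × V₂ z ≡ true
      s₂ {y} {z} m = let (lt , q) = ∈-edgeList⁻ E₂ m in sub₂ y z lt q
      inEH : ∀ {y z} → (y , z) ∈ edgeList E₂ → (y , z) ∈ EH
      inEH m = ∈-EH⁺ (proj₁ (∈-edgeList⁻ E₂ m)) (proj₁ (s₂ m))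

    -- The edge x is missing from `E₁`. If `E₂` has at most one edge, `e-sum` forces `E₁` to contain
    -- all e edges, which it does not. Otherwise both parts have at least three vertices and are
    -- proper, the second because `v-sum` and the three vertices of the first leave it fewer than v.
    incomparable : ∀ {x} → x ∈ im ψ → x ∉ im φ → x ≢ w → ⊥
    incomparable {x} x∈ x∉ x≢ with ∈-im⁻ ψ x∈
    ... | i , j , p , refl with 2 ℕ.≤? #E E₂
    ...   | no np = ℕ.<⇒≱ E₁<e (ℕ.+-cancelʳ-≤ 1 _ _ (ℕ.≤-trans (ℕ.≤-reflexive (ℕ.+-comm e 1))
              (ℕ.≤-trans e-sum (ℕ.+-monoʳ-≤ (#E E₁) (ℕ.≤-pred (ℕ.≰⇒> np))))))
      where
      E₁ij : E₁ i j ≡ false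
      E₁ij rewrite proj₂ (∈-EH⁻ p) | does-no (codeOf ψ (i , j) ∈? im φ) x∉ | does-no (codeOf ψ (i , j) ≟F w) x≢ = refl
      E₁<e : #E E₁ ℕ.< e
      E₁<e = subst (#E E₁ ℕ.<_) (sym edges≡) (unique-⊆-length {xs = (i , j) ∷ edgeList E₁}
        (All.tabulate (λ { m refl → true≢false (trans (sym (proj₂ (∈-edgeList⁻ E₁ m))) E₁ij) }) ∷ unique-filterB _ (unique-pairs v))
        λ { (here refl) → p ; {a , b} (there m) → let (lt , q) = ∈-edgeList⁻ E₁ m in ∈-EH⁺ lt (proj₁ (∧-true q)) })
        where
        true≢false : true ≢ false
        true≢false ()
    ...   | yes p₂ = too-dense (#E E₁) (#E E₂) (#V V₁) (#V V₂) e-sum v-sum 3≤V₁ (3≤V₂ p₂) p₂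
              (balanced V₁ E₁ sub₁ (inj₂ (i , j , p , E₁ij)) 3≤V₁)
              (balanced V₂ E₂ sub₂ (inj₁ (missing V₂ V₂<v)) (3≤V₂ p₂))
      where
      E₁ij : E₁ i j ≡ false
      E₁ij rewrite proj₂ (∈-EH⁻ p) | does-no (codeOf ψ (i , j) ∈? im φ) x∉ | does-no (codeOf ψ (i , j) ≟F w) x≢ = refl
      V₂<v : #V V₂ ℕ.< v
      V₂<v = ℕ.+-cancelˡ-≤ 2 _ _ (ℕ.≤-trans (ℕ.+-monoˡ-≤ (#V V₂) 3≤V₁) (ℕ.≤-trans v-sum (ℕ.≤-reflexive (ℕ.+-comm v 2))))
    link-⊆ : ∀ {x} → x ∈ im ψ → x ≢ w → x ∈ im φ
    link-⊆ {x} m ne with x ∈? im φ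
    ... | yes p = p
    ... | no np = ⊥-elim (incomparable m np ne)

    vimg-⊆ : vimg ψ ⊆ vimg φ
    vimg-⊆ m with ∈-map⁻ (lookup ψ) m
    ... | k , _ , refl with vertex-link injψ w k
    ...   | x , x∈ , y∈ = im-vimg φ (link-⊆ (proj₁ (∈-linkOf⁻ ψ x∈)) (proj₂ (∈-linkOf⁻ ψ x∈))) y∈

    vimg-⊇ : vimg φ ⊆ vimg ψ
    vimg-⊇ = unique-⊇ _≟F_ (unique-vimg injψ) vimg-⊆ (ℕ.≤-reflexive (trans (length-vimg φ) (sym (length-vimg ψ))))

    -- A link has one edge less than a copy, so φ's copy has an edge h outside ψ's link, hence in Z.
    -- Both copies have the same vertices, so by genericity the ends of h are ends of w, and h is w.
    w∈φ : w ∈ im φ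
    w∈φ with filterB (λ x → not (does (x ∈? C*))) (im φ) in eq
    ... | h ∷ _ = subst (_∈ im φ) (valid-ext (valid-im injφ h∈) (All.lookup validZ w∈Z) sub) h∈
      where
      hh : h ∈ im φ × not (does (h ∈? C*)) ≡ true
      hh = ∈-filterB⁻ (λ x → not (does (x ∈? C*))) (im φ) (subst (h ∈_) (sym eq) (here refl))
      h∈ : h ∈ im φ
      h∈ = proj₁ hh
      h∈Z : h ∈ Z
      h∈Z with ∈-++⁻ C* (cover h∈)
      ... | inj₁ q = ⊥-elim (does-no⁻ (h ∈? C*) (not-true (proj₂ hh)) q)
      ... | inj₂ q = q
      sub : ends h ⊆ ends w
      sub m = shared (vimg-⊇ (im-vimg φ h∈ m)) (∈-verts⁺ h∈Z m)
    ... | [] = ⊥-elim (ℕ.<-irrefl refl (ℕ.≤-trans (ℕ.≤-reflexive (trans (length-linkOf injψ w∈ψ) (sym (length-im φ)))) (unique-⊆-length (unique-im injφ) all-in)))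
      where
      all-in : im φ ⊆ C*
      all-in {x} m with x ∈? C*
      ... | yes p = p
      ... | no np with subst (x ∈_) eq (∈-filterB⁺ (λ x → not (does (x ∈? C*))) m (not-false (does-no (x ∈? C*) np)))
      ...   | ()

    ψ⊆φ : im ψ ⊆ im φ
    ψ⊆φ {x} m with x ≟F w
    ... | yes refl = w∈φ
    ... | no ne = link-⊆ m ne

    φ⊆ψ : im φ ⊆ im ψ
    φ⊆ψ = unique-⊇ _≟F_ (unique-im injψ) ψ⊆φ (ℕ.≤-reflexive (trans (length-im φ) (sym (length-im ψ))))

-- All edges lie in equally many links.

module Counting {v : ℕ} (H : Graph v) (n : ℕ) (reg : Regular H) (s2b : Strictly2Balanced H) where
  open import Defs using (Graph; filterB; Strictly2Balanced; Regular)

  open Lists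
  open Codes n
  open Copies H n
  open Structure H n reg s2b
  open import Data.Bool.Base using (Bool; true; false; if_then_else_)
  open import Data.Empty using (⊥)
  open import Data.Fin.Base using (Fin; suc; remQuot)
  open import Data.Fin.Properties using () renaming (_≟_ to _≟F_)
  open import Data.Fin.Subset using (∣_∣)
  open import Data.List.Base as List using (List; []; _∷_; length; map; allFin)
  open import Data.List.Properties using (length-map; length-tabulate; map-∘; map-cong; ∷-injectiveˡ; ∷-injectiveʳ)
  open import Data.List.Membership.Propositional using (_∈_)
  open import Data.List.Membership.DecPropositional (_≟F_ {n}) using () renaming (_∈?_ to _∈v?_)
  open import Data.List.Membership.Propositional.Properties using (∈-map⁺; ∈-map⁻; ∈-allFin)
  open import Data.List.Relation.Binary.Subset.Propositional using (_⊆_)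
  open import Data.List.Relation.Unary.All as All using (All; []; _∷_)
  import Data.List.Relation.Unary.All.Properties as All
  open import Data.List.Relation.Unary.AllPairs using ([]; _∷_)
  import Data.List.Relation.Unary.Unique.Propositional.Properties as Uniq
  open import Data.Product using (_,_; proj₁; proj₂)
  open import Data.Sum using (inj₁; inj₂)
  open import Data.Vec.Base as Vec using (Vec; []; _∷_; lookup; tabulate)
  open import Data.Vec.Properties using (lookup-map)
  open import Function.Base using (id)
  open import Relation.Nullary using (yes; no; does)

  module Relabel (σ : Fin n → Fin n) (σ-inj : ∀ {i j} → σ i ≡ σ j → i ≡ j) where

    σ* : Fin N → Fin N
    σ* x = code (σ (proj₁ (remQuot {n} n x))) (σ (proj₂ (remQuot {n} n x)))

    σ*-code : ∀ i j → σ* (code i j) ≡ code (σ i) (σ j)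
    σ*-code i j with ends-code i j
    ... | inj₁ e = cong₂ (λ a b → code (σ a) (σ b)) (∷-injectiveˡ e) (∷-injectiveˡ (∷-injectiveʳ e))
    ... | inj₂ e = trans (cong₂ (λ a b → code (σ a) (σ b)) (∷-injectiveˡ e) (∷-injectiveˡ (∷-injectiveʳ e))) (code-sym (σ j) (σ i))

    σ*-inj : ∀ {x y} → Valid x → Valid y → σ* x ≡ σ* y → x ≡ y
    σ*-inj (i , j , ne , refl) (k , l , _ , refl) e
      with code-inj (λ p → ne (σ-inj p)) (trans (sym (σ*-code i j)) (trans e (σ*-code k l)))
    ... | inj₁ (a , b) = cong₂ code (σ-inj a) (σ-inj b)
    ... | inj₂ (a , b) = trans (cong₂ code (σ-inj a) (σ-inj b)) (code-sym l k)

    σφ : Emb → Emb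
    σφ = Vec.map σ

    inj-σφ : ∀ {φ} → Inj φ → Inj (σφ φ)
    inj-σφ {φ} inj = mkInj λ i j e → inj-at inj i j (σ-inj (trans (sym (lookup-map i σ φ)) (trans e (lookup-map j σ φ))))

    im-σφ : ∀ φ → im (σφ φ) ≡ map σ* (im φ)
    im-σφ φ = trans (map-cong (λ { (i , j) → trans (cong₂ code (lookup-map i σ φ) (lookup-map j σ φ)) (sym (σ*-code _ _)) }) EH) (map-∘ EH)

    inσ : List (Fin N) → Fin N → Bool
    inσ C x = does (x ∈? map σ* C)

    -- The image of a link under the relabelling, listed anew in the canonical order so that it is
    -- literally a link.
    push : List (Fin N) → List (Fin N)
    push C = filterB (inσ C) (allFin N)

    push-link : ∀ {φ u} → Inj φ → u ∈ im φ → push (linkOf φ u) ≡ linkOf (σφ φ) (σ* u)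
    push-link {φ} {u} inj u∈ = filterB-ext _ _ (allFin N) (λ x _ → iff x)
      where
      to : ∀ x → x ∈ map σ* (linkOf φ u) → x ∈ linkOf (σφ φ) (σ* u)
      to x m with ∈-map⁻ σ* m
      ... | y , y∈ , refl with ∈-linkOf⁻ φ y∈
      ...   | y∈im , y≢ = ∈-linkOf⁺ (σφ φ) (subst (σ* y ∈_) (sym (im-σφ φ)) (∈-map⁺ σ* y∈im))
                (λ e → y≢ (σ*-inj (valid-im inj y∈im) (valid-im inj u∈) e))
      from : ∀ x → x ∈ linkOf (σφ φ) (σ* u) → x ∈ map σ* (linkOf φ u)
      from x m with ∈-linkOf⁻ (σφ φ) m
      ... | x∈ , x≢ with ∈-map⁻ σ* (subst (x ∈_) (im-σφ φ) x∈)
      ...   | y , y∈ , refl = ∈-map⁺ σ* (∈-linkOf⁺ φ y∈ (λ { refl → x≢ refl }))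
      iff : ∀ x → inσ (linkOf φ u) x ≡ inLink (σφ φ) (σ* u) x
      iff x with inLink (σφ φ) (σ* u) x in e
      ... | true = does⁺ (x ∈? map σ* (linkOf φ u)) (from x (∈-filterB⁺ (inLink (σφ φ) (σ* u)) (∈-allFin x) e))
      ... | false = does-no (x ∈? map σ* (linkOf φ u)) λ m → absurd (trans (sym (proj₂ (∈-filterB⁻ (inLink (σφ φ) (σ* u)) (allFin N) (to x m)))) e)
        where
        absurd : true ≡ false → ⊥
        absurd ()

    push-⊆ : ∀ {C C′} → All Valid C → All Valid C′ → push C ≡ push C′ → C ⊆ C′
    push-⊆ {C} {C′} VC VC′ e {x} m with does⁻ (σ* x ∈? map σ* C′) (proj₂ (∈-filterB⁻ (inσ C′) (allFin N)
      (subst (σ* x ∈_) e (∈-filterB⁺ (inσ C) (∈-allFin (σ* x)) (does⁺ (σ* x ∈? map σ* C) (∈-map⁺ σ* m))))))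
    ... | m′ with ∈-map⁻ σ* m′
    ...   | y , y∈ , q = subst (_∈ C′) (sym (σ*-inj (All.lookup VC m) (All.lookup VC′ y∈) q)) y∈

    links-≤ : ∀ u → length (links u) ℕ.≤ length (links (σ* u))
    links-≤ u = subst (ℕ._≤ length (links (σ* u))) (length-map push (links u))
      (unique-⊆-length (unique-map-∈ push inj (unique-links u)) sub)
      where
      inj : ∀ {C C′} → C ∈ links u → C′ ∈ links u → push C ≡ push C′ → C ≡ C′
      inj m m′ e = link-canon m m′ (push-⊆ (proj₁ (link-ok m)) (proj₁ (link-ok m′)) e) (push-⊆ (proj₁ (link-ok m′)) (proj₁ (link-ok m)) (sym e))
      sub : map push (links u) ⊆ links (σ* u)
      sub m with ∈-map⁻ push m
      ... | C , C∈ , refl with ∈-links⁻ C∈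
      ...   | φ , i , u∈ , refl = subst (_∈ links (σ* u)) (sym (push-link i u∈))
              (∈-links⁺ (inj-σφ i) (subst (σ* u ∈_) (sym (im-σφ φ)) (∈-map⁺ σ* u∈)))

  swap : Fin n → Fin n → Fin n → Fin n
  swap x y z = if does (z ≟F x) then y else if does (z ≟F y) then x else z

  swap-involutive : ∀ x y z → swap x y (swap x y z) ≡ z
  swap-involutive x y z with z ≟F x
  swap-involutive x y z | yes refl with y ≟F z
  ... | yes e = e
  ... | no _ rewrite does⁺ (y ≟F y) refl = refl
  swap-involutive x y z | no ne with z ≟F y
  ... | yes refl rewrite does⁺ (x ≟F x) refl = refl
  ... | no ne′ rewrite does-no (z ≟F x) ne | does-no (z ≟F y) ne′ = refl

  swap-inj : ∀ x y {a b} → swap x y a ≡ swap x y b → a ≡ b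
  swap-inj x y {a} {b} e = trans (sym (swap-involutive x y a)) (trans (cong (swap x y) e) (swap-involutive x y b))

  swap-x : ∀ x y → swap x y x ≡ y
  swap-x x y rewrite does⁺ (x ≟F x) refl = refl

  swap-other : ∀ x y {z} → z ≢ x → z ≢ y → swap x y z ≡ z
  swap-other x y {z} a b rewrite does-no (z ≟F x) a | does-no (z ≟F y) b = refl

  -- The symmetric group acts transitively on the edges: a transposition takes a to c, and a second
  -- one takes the image of b to d while fixing c. Relabelling then maps links injectively to links.
  links-length-≤ : ∀ {u w} → Valid u → Valid w → length (links u) ℕ.≤ length (links w)
  links-length-≤ (a , b , a≢b , refl) (c , d , c≢d , refl) =
    subst (λ z → length (links (code a b)) ℕ.≤ length (links z)) (trans (R.σ*-code a b) (cong₂ code σa σb)) (R.links-≤ (code a b))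
    where
    b₁ = swap a c b
    b₁≢c : b₁ ≢ c
    b₁≢c p = a≢b (swap-inj a c (trans (swap-x a c) (sym p)))
    σ : Fin n → Fin n
    σ z = swap b₁ d (swap a c z)
    σa : σ a ≡ c
    σa = trans (cong (swap b₁ d) (swap-x a c)) (swap-other b₁ d (λ p → b₁≢c (sym p)) c≢d)
    σb : σ b ≡ d
    σb = swap-x b₁ d
    module R = Relabel σ (λ p → swap-inj a c (swap-inj b₁ d p))

  links-length : ∀ {u w} → Valid u → Valid w → length (links u) ≡ length (links w)
  links-length p q = ℕ.≤-antisym (links-length-≤ p q) (links-length-≤ q p)

  hits : List (Fin n) → ∀ {k} → Vec (Fin n) k → ℕ
  hits U [] = 0
  hits U (y ∷ φ) = if does (y ∈v? U) then suc (hits U φ) else hits U φ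

  hits-#V : ∀ U φ → hits U φ ≡ #V (λ i → does (lookup φ i ∈v? U))
  hits-#V U φ = trans (sym (go φ)) (card-tabulate v (λ i → does (lookup φ i ∈v? U)) id)
    where
    go : ∀ {k} (φ : Vec (Fin n) k) → ∣ tabulate (λ i → does (lookup φ i ∈v? U)) ∣ ≡ hits U φ
    go [] = refl
    go (y ∷ φ) with does (y ∈v? U)
    ... | true = cong suc (go φ)
    ... | false = go φ

  hits-≤ : ∀ U φ → hits U φ ℕ.≤ v
  hits-≤ U φ = ℕ.≤-trans (ℕ.≤-reflexive (hits-#V U φ)) (ℕ.≤-trans (unique-⊆-length {ys = allFin v} (unique-filterB _ (Uniq.allFin⁺ v)) (λ m → ∈-allFin _))
    (ℕ.≤-reflexive (length-tabulate {n = v} id)))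

-- Counting copies with prescribed vertices.

module Hits {v : ℕ} (H : Graph v) (n : ℕ) (reg : Regular H) (s2b : Strictly2Balanced H) where
  open import Defs using (Graph; filterB; allVecs; Strictly2Balanced; Regular)

  open Lists
  open Codes n
  open Copies H n
  open Structure H n reg s2b
  open Counting H n reg s2b
  open Field
  open Sums
  open import Data.Bool.Base using (Bool; true; false; not)
  open import Data.Empty using (⊥-elim)
  open import Data.Fin.Base using (Fin; zero; suc)
  open import Data.Integer.Base using () renaming (+_ to pos)
  open import Data.Fin.Properties using () renaming (_≟_ to _≟F_)
  open import Data.List.Base as List using (List; []; _∷_; length; map; allFin; filter)
  open import Data.List.Properties using (length-tabulate; filter-all)
  open import Data.List.Membership.Propositional using (_∈_; _∉_)
  open import Data.List.Membership.DecPropositional (_≟F_ {n}) using () renaming (_∈?_ to _∈v?_)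
  open import Data.List.Membership.Propositional.Properties using (∈-map⁻; ∈-allFin; ∈-filter⁺; ∈-filter⁻; ∈-deduplicate⁻)
  open import Data.List.Relation.Binary.Subset.Propositional using (_⊆_)
  open import Data.List.Relation.Unary.Any as Any using (here; there)
  open import Data.List.Relation.Unary.All as All using (All; []; _∷_)
  import Data.List.Relation.Unary.All.Properties as All
  open import Data.List.Relation.Unary.AllPairs using ([]; _∷_)
  import Data.List.Relation.Unary.Unique.Propositional.Properties as Uniq
  open import Data.Product using (∃; ∃₂; _×_; _,_; proj₁; proj₂)
  open import Data.Sum using (inj₂)
  open import Data.Vec.Base as Vec using ([]; _∷_; lookup)
  open import Function.Base using (_∘_; id)
  open import Relation.Nullary using (yes; no; does; ¬_)
  open import Relation.Nullary.Decidable using (¬?)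

  -- One coordinate at a time: it takes either one of at most |U| values in U or one of at most n
  -- values elsewhere. The hypothesis lets the factor n be absorbed by the weight, so every
  -- coordinate contributes a factor |U| + 1.
  sum-hits : ∀ U k (W : ℕ → F) K → 0# ≤ K → (∀ j → 0# ≤ W j) →
    (∀ j → j ℕ.≤ k → W j * ι n ^ (k ∸ j) ≤ K) →
    sumL (λ φ → W (hits U φ)) (allVecs (allFin n) k) ≤ ι (suc (length U)) ^ k * K
  sum-hits U zero W K 0≤K 0≤W h = ≤-trans (≤-reflexive (trans (+-identityʳ _) (sym (*-identityʳ _))))
    (≤-trans (h 0 z≤n) (≤-reflexive (sym (*-identityˡ K))))
  sum-hits U (suc k) W K 0≤K 0≤W h =
    sumL (λ φ → W (hits U φ)) (allVecs (allFin n) (suc k))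
      ≈⟨ trans (sumL-concatMap _ _ (allFin n)) (sumL-cong (λ y → sumL-map _ _ vs) (allFin n)) ⟩
    sumL (λ y → sumL (λ φ → W (hits U (y ∷ φ))) vs) (allFin n)
      ≤⟨ sumL-mono pt (allFin n) ⟩
    sumL (λ y → S₁ * b2F (does (y ∈v? U)) + S₀) (allFin n)
      ≈⟨ trans (sumL-+ _ _ (allFin n)) (cong₂ _+_ (sumL-*ˡ S₁ _ (allFin n))
           (trans (sumL-const S₀ (allFin n)) (cong (λ z → ι z * S₀) (length-tabulate {n = n} id)))) ⟩
    S₁ * sumL (λ y → b2F (does (y ∈v? U))) (allFin n) + ι n * S₀
      ≤⟨ +-mono-≤ (*-mono 0≤S₁ (0≤ι (length U)) ih₁ cnt) ih₀ ⟩
    P * ι (length U) + P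
      ≈⟨ S.solve 3 (λ t l K → t S.:* K S.:* l S.:+ t S.:* K S.:= ((S.con (pos 1) S.:+ l) S.:* t) S.:* K) refl (ι (suc (length U)) ^ k) (ι (length U)) K ⟩
    ((1# + ι (length U)) * ι (suc (length U)) ^ k) * K
      ≈⟨ cong (λ z → (z * ι (suc (length U)) ^ k) * K) (sym (ι-suc (length U))) ⟩
    ι (suc (length U)) ^ suc k * K ∎
    where
    vs = allVecs (allFin n) k
    S₁ = sumL (λ φ → W (suc (hits U φ))) vs
    S₀ = sumL (λ φ → W (hits U φ)) vs
    P = ι (suc (length U)) ^ k * K
    0≤S₁ : 0# ≤ S₁
    0≤S₁ = sumL-nonneg (λ φ → 0≤W _) vs
    0≤S₀ : 0# ≤ S₀
    0≤S₀ = sumL-nonneg (λ φ → 0≤W _) vs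
    pt : ∀ y → sumL (λ φ → W (hits U (y ∷ φ))) vs ≤ S₁ * b2F (does (y ∈v? U)) + S₀
    pt y with does (y ∈v? U)
    ... | true = ≤-trans (x≤x+y S₁ 0≤S₀) (≤-reflexive (cong (_+ S₀) (sym (*-identityʳ S₁))))
    ... | false = ≤-reflexive (sym (trans (cong (_+ S₀) (zeroʳ S₁)) (+-identityˡ S₀)))
    ih₁ : S₁ ≤ P
    ih₁ = sum-hits U k (W ∘ suc) K 0≤K (0≤W ∘ suc) (λ j le → h (suc j) (s≤s le))
    ih₀ : ι n * S₀ ≤ P
    ih₀ = ≤-trans (≤-reflexive (sym (sumL-*ˡ (ι n) _ vs)))
      (sum-hits U k (λ j → ι n * W j) K 0≤K (λ j → 0≤* (0≤ι n) (0≤W j)) (λ j le →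
        ≤-trans (≤-reflexive (trans (S.solve 3 (λ a w b → a S.:* w S.:* b S.:= w S.:* (a S.:* b)) refl (ι n) (W j) (ι n ^ (k ∸ j)))
          (cong (λ z → W j * ι n ^ z) (sym (ℕ.+-∸-assoc 1 le))))) (h j (ℕ.m≤n⇒m≤1+n le))))
    cnt : sumL (λ y → b2F (does (y ∈v? U))) (allFin n) ≤ ι (length U)
    cnt = ≤-trans (≤-reflexive (sym (ι-countB _ (allFin n)))) (ι-mono (ℕ.≤-trans (ℕ.≤-reflexive (countB-length _ (allFin n)))
      (unique-⊆-length (unique-filterB _ (Uniq.allFin⁺ n)) (λ {y} m → does⁻ (y ∈v? U) (proj₂ (∈-filterB⁻ (λ y → does (y ∈v? U)) (allFin n) m))))))

  sum-filterB : ∀ {A : Set} (p : A → Bool) (f g : A → F) → (∀ x → 0# ≤ g x) → ∀ xs →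
    (∀ x → p x ≡ true → f x ≤ g x) → sumL f (filterB p xs) ≤ sumL g xs
  sum-filterB p f g nn [] h = ≤-refl
  sum-filterB p f g nn (x ∷ xs) h with p x in e
  ... | true = +-mono-≤ (h x e) (sum-filterB p f g nn xs h)
  ... | false = ≤-trans (sum-filterB p f g nn xs h) (x≤y+x _ (nn x))

  -- A union bound over all embeddings through u, several of which may give the same link, with
  -- weights controlled by the number of vertices mapped into U.
  sum-links : ∀ u U (w : List (Fin N) → F) (W : ℕ → F) K → (∀ C → 0# ≤ w C) → 0# ≤ K → (∀ j → 0# ≤ W j) →
    (∀ j → j ℕ.≤ v → W j * ι n ^ (v ∸ j) ≤ K) →
    (∀ φ → Inj φ → u ∈ im φ → w (linkOf φ u) ≤ W (hits U φ)) →
    sumL w (links u) ≤ ι (suc (length U)) ^ v * K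
  sum-links u U w W K 0≤w 0≤K 0≤W hW h =
    sumL w (links u)
      ≤⟨ sumL-⊆ w 0≤w (unique-links u) (λ m → ∈-deduplicate⁻ _≟L_ (map (λ φ → linkOf φ u) (embs u)) m) ⟩
    sumL w (map (λ φ → linkOf φ u) (embs u))
      ≈⟨ sumL-map w (λ φ → linkOf φ u) (embs u) ⟩
    sumL (λ φ → w (linkOf φ u)) (embs u)
      ≤⟨ sum-filterB (through u) _ (λ φ → W (hits U φ)) (λ φ → 0≤W _) (allVecs (allFin n) v)
           (λ φ e → let (a , b) = ∧-true e in h φ (does⁻ (inj? φ) a) (does⁻ (u ∈? im φ) b)) ⟩
    sumL (λ φ → W (hits U φ)) (allVecs (allFin n) v)
      ≤⟨ sum-hits U v W K 0≤K 0≤W hW ⟩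
    ι (suc (length U)) ^ v * K ∎

  module _ (1≤n : 1 ℕ.≤ n) where

    atLeast : ℕ → ℕ → F
    atLeast k j = b2F (k <ᵇ j)

    atLeast-weight : ∀ k j → j ℕ.≤ v → atLeast k j * ι n ^ (v ∸ j) ≤ ι n ^ (v ∸ suc k)
    atLeast-weight k j le with k <ᵇ j in e
    ... | false = ≤-trans (≤-reflexive (zeroˡ _)) (0≤^ (v ∸ suc k) (0≤ι n))
    ... | true = ≤-trans (≤-reflexive (*-identityˡ _)) (≤-trans (≤-reflexive (sym (ι-^ n (v ∸ j))))
        (≤-trans (ι-mono (ℕ.^-monoʳ-≤ n {{ℕ.>-nonZero 1≤n}} (ℕ.∸-monoʳ-≤ v (<ᵇ-true {k} {j} e)))) (≤-reflexive (ι-^ n (v ∸ suc k)))))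

    1≤atLeast : ∀ {k j} → k ℕ.< j → 1# ≤ atLeast k j
    1≤atLeast {k} {j} lt rewrite true-<ᵇ lt = ≤-refl

    module _ {u φ} (inj : Inj φ) (u∈ : u ∈ im φ) where

      hits-3 : ∀ {Z} → u ∈ Z → ∀ {x} → x ∈ im φ → (∃ λ y → y ∈ ends x × y ∈ verts Z × y ∉ ends u) → 3 ℕ.≤ hits (verts Z) φ
      hits-3 {Z} u∈Z x∈ (y , y∈x , y∈Z , y∉u) with ∈-im⁻ φ u∈ | ∈-map⁻ (lookup φ) (im-vimg φ x∈ y∈x)
      ... | i , j , p , refl | k , _ , refl = ℕ.≤-trans (three X (in-Z (∈-ends-codeˡ (lookup φ i) (lookup φ j))) (in-Z (∈-ends-codeʳ (lookup φ i) (lookup φ j))) (does⁺ (_ ∈v? verts Z) y∈Z)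
          (adj-≢ (proj₂ (∈-EH⁻ p)))
          (λ { refl → y∉u (∈-ends-codeˡ (lookup φ i) (lookup φ j)) }) (λ { refl → y∉u (∈-ends-codeʳ (lookup φ i) (lookup φ j)) }))
          (ℕ.≤-reflexive (sym (hits-#V (verts Z) φ)))
        where
        X : Fin v → Bool
        X i = does (lookup φ i ∈v? verts Z)
        in-Z : ∀ {k} → lookup φ k ∈ ends (code (lookup φ i) (lookup φ j)) → X k ≡ true
        in-Z {k} m = does⁺ (lookup φ k ∈v? verts Z) (∈-verts⁺ u∈Z m)

      hits-2 : ∀ {Z} → u ∈ Z → 2 ℕ.≤ hits (verts Z) φ
      hits-2 {Z} u∈Z with ∈-im⁻ φ u∈
      ... | i , j , p , refl = ℕ.≤-trans (unique-⊆-length {xs = i ∷ j ∷ []} ((adj-≢ (proj₂ (∈-EH⁻ p)) ∷ []) ∷ [] ∷ [])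
          λ { (here refl) → ∈-filterB⁺ X (∈-allFin i) (in-Z (∈-ends-codeˡ (lookup φ i) (lookup φ j)))
            ; (there (here refl)) → ∈-filterB⁺ X (∈-allFin j) (in-Z (∈-ends-codeʳ (lookup φ i) (lookup φ j))) })
          (ℕ.≤-reflexive (sym (hits-#V (verts Z) φ)))
        where
        X : Fin v → Bool
        X i = does (lookup φ i ∈v? verts Z)
        in-Z : ∀ {k} → lookup φ k ∈ ends (code (lookup φ i) (lookup φ j)) → X k ≡ true
        in-Z {k} m = does⁺ (lookup φ k ∈v? verts Z) (∈-verts⁺ u∈Z m)

    -- Two of the v vertices are the endpoints of u. The base 3 is one more than the number of these
    -- endpoints.
    few-links : ∀ u → ι (length (links u)) ≤ ι 3 ^ v * ι n ^ (v ∸ 2)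
    few-links u = ≤-trans (≤-reflexive (trans (sym (*-identityʳ _)) (sym (sumL-const 1# (links u)))))
      (sum-links u (verts (u ∷ [])) (λ _ → 1#) (atLeast 1) (ι n ^ (v ∸ 2)) (λ _ → 0≤1) (0≤^ (v ∸ 2) (0≤ι n)) (λ j → 0≤b2F (1 <ᵇ j))
        (atLeast-weight 1) (λ φ inj u∈ → 1≤atLeast (hits-2 inj u∈ {u ∷ []} (here refl))))

    -- Failure of genericity puts a third vertex of the copy into the vertices of Z, which leaves
    -- one free choice fewer than in `few-links`.
    few-nongeneric : ∀ {Z u} → u ∈ Z →
      sumL (λ C → b2F (not (Gen Z u C))) (links u) ≤ ι (suc (length (verts Z))) ^ v * ι n ^ (v ∸ 3)
    few-nongeneric {Z} {u} u∈Z = sum-links u (verts Z) _ (atLeast 2) (ι n ^ (v ∸ 3)) (λ C → 0≤b2F (not (Gen Z u C))) (0≤^ (v ∸ 3) (0≤ι n)) (λ j → 0≤b2F (2 <ᵇ j))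
      (atLeast-weight 2) bound
      where
      bound : ∀ φ → Inj φ → u ∈ im φ → b2F (not (Gen Z u (linkOf φ u))) ≤ atLeast 2 (hits (verts Z) φ)
      bound φ inj u∈ with gen? Z u (linkOf φ u)
      ... | yes _ = 0≤b2F (2 <ᵇ hits (verts Z) φ)
      ... | no ng with find-bad (verts (linkOf φ u)) ng
        where
        find-bad : ∀ ys → ¬ All (λ y → y ∈ verts Z → y ∈ ends u) ys → ∃ λ y → y ∈ ys × y ∈ verts Z × y ∉ ends u
        find-bad [] h = ⊥-elim (h [])
        find-bad (y ∷ ys) h with y ∈v? verts Z | y ∈v? ends u
        ... | yes a | no b = y , here refl , a , b
        ... | yes a | yes b = let (z , m , p) = find-bad ys (λ q → h ((λ _ → b) ∷ q)) in z , there m , p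
        ... | no a | _ = let (z , m , p) = find-bad ys (λ q → h ((λ c → ⊥-elim (a c)) ∷ q)) in z , there m , p
      ...   | y , m , yZ , yu with ∈-verts⁻ (linkOf φ u) m
      ...     | x , x∈ , y∈x = 1≤atLeast (hits-3 inj u∈ u∈Z (proj₁ (∈-linkOf⁻ φ x∈)) (y , y∈x , yZ , yu))

    freshIn : List (Fin N) → List (Fin N) → List (Fin N)
    freshIn Z C = filter (λ x → ¬? (x ∈? Z)) C

    -- Strict balance makes a partial overlap cost more in probability than it gains in choices.
    overlap-balance : ∀ {Z u φ} → All Valid Z → u ∈ Z → Inj φ → u ∈ im φ →
      1 ℕ.≤ length (freshIn Z (linkOf φ u)) → length (freshIn Z (linkOf φ u)) ℕ.< length (linkOf φ u) →
      (e ∸ length (freshIn Z (linkOf φ u)) ∸ 1) ℕ.* (v ∸ 2) ℕ.< (e ∸ 1) ℕ.* (hits (verts Z) φ ∸ 2)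
    overlap-balance {Z} {u} {φ} VZ u∈Z inj u∈ lo hi =
      ℕ.≤-<-trans (ℕ.*-monoˡ-≤ (v ∸ 2) (ℕ.∸-monoˡ-≤ 1 e-o≤))
        (subst (λ z → (#E E₂ ∸ 1) ℕ.* (v ∸ 2) ℕ.< (e ∸ 1) ℕ.* (z ∸ 2)) (sym (hits-#V (verts Z) φ))
          (balanced V₂ E₂ sub₂ (inj₂ proper) (subst (3 ℕ.≤_) (hits-#V (verts Z) φ) h3)))
      where
      open Inside {φ} Z inj
      C = linkOf φ u
      o = length (freshIn Z C)
      nonempty : ∀ {A : Set} (xs : List A) → 1 ℕ.≤ length xs → ∃ λ x → x ∈ xs
      nonempty (x ∷ xs) _ = x , here refl
      o≡ : o ≡ length (filterB (λ x → not (inZ x)) (im φ))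
      o≡ = unique-⊆-antisym (Uniq.filter⁺ (λ x → ¬? (x ∈? Z)) (unique-linkOf φ u)) (unique-filterB _ (unique-im inj))
        (λ {x} m → let (a , b) = ∈-filter⁻ (λ x → ¬? (x ∈? Z)) {xs = C} m in
          ∈-filterB⁺ (λ x → not (inZ x)) (proj₁ (∈-linkOf⁻ φ a)) (not-false (does-no (x ∈? Z) b)))
        (λ {x} m → let (a , b) = ∈-filterB⁻ (λ x → not (inZ x)) (im φ) m
                       nz = does-no⁻ (x ∈? Z) (not-true b)
                   in ∈-filter⁺ (λ x → ¬? (x ∈? Z)) (∈-linkOf⁺ φ a (λ { refl → nz u∈Z })) nz)
      e-o≤ : e ∸ o ℕ.≤ #E E₂
      e-o≤ = ℕ.≤-trans (ℕ.≤-reflexive (trans (cong₂ _∸_ (sym (trans (filterB-split inZ (im φ)) (length-im φ))) o≡) (ℕ.m+n∸n≡m _ (length (filterB (λ x → not (inZ x)) (im φ)))))) e₂-bound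
      proper : ∃₂ λ i j → (i , j) ∈ EH × E₂ i j ≡ false
      proper with nonempty (freshIn Z C) lo
      ... | x , m with ∈-filter⁻ (λ x → ¬? (x ∈? Z)) {xs = C} m
      ...   | x∈C , x∉Z with ∈-im⁻ φ (proj₁ (∈-linkOf⁻ φ x∈C))
      ...     | i , j , p , refl = i , j , p , lem
        where
        lem : E₂ i j ≡ false
        lem rewrite proj₂ (∈-EH⁻ p) = does-no (codeOf φ (i , j) ∈? Z) x∉Z
      old : ∃ λ x → x ∈ C × x ∈ Z
      old with All.all? (λ x → ¬? (x ∈? Z)) C
      ... | yes al = ⊥-elim (ℕ.<-irrefl (cong length (filter-all (λ x → ¬? (x ∈? Z)) al)) hi)
      ... | no nal = find C nal
        where
        find : ∀ xs → ¬ All (_∉ Z) xs → ∃ λ x → x ∈ xs × x ∈ Z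
        find [] h = ⊥-elim (h [])
        find (x ∷ xs) h with x ∈? Z
        ... | yes p = x , here refl , p
        ... | no np = let (y , m , q) = find xs (λ a → h (np ∷ a)) in y , there m , q
      h3 : 3 ℕ.≤ hits (verts Z) φ
      h3 with old
      ... | x , x∈C , x∈Z = hits-3 inj u∈ u∈Z (proj₁ (∈-linkOf⁻ φ x∈C)) other
        where
        other : ∃ λ y → y ∈ ends x × y ∈ verts Z × y ∉ ends u
        other with All.all? (λ y → y ∈v? ends u) (ends x)
        ... | yes al = ⊥-elim (proj₂ (∈-linkOf⁻ φ x∈C) (valid-ext (All.lookup VZ x∈Z) (All.lookup VZ u∈Z) (λ m → All.lookup al m)))
        ... | no nal = find (ends x) nal (λ m → m)
          where
          find : ∀ ys → ¬ All (_∈ ends u) ys → ys ⊆ ends x → ∃ λ y → y ∈ ends x × y ∈ verts Z × y ∉ ends u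
          find [] h _ = ⊥-elim (h [])
          find (y ∷ ys) h s with y ∈v? ends u
          ... | yes p = find ys (λ a → h (p ∷ a)) (λ m → s (there m))
          ... | no np = y , s (here refl) , ∈-verts⁺ x∈Z (s (here refl)) , np

-- Orderings along which a labelling increases.

module Perm where
  open import Defs using (insertEverywhere; permutations)
  open Field
  open Sums
  open import Data.Bool.Base using (Bool; true; false; _∧_; T)
  open import Data.Empty using (⊥-elim)
  open import Data.List.Base using (List; []; _∷_; length; map; concatMap)
  open import Data.List.Membership.Propositional using (_∈_)
  open import Data.List.Membership.Propositional.Properties using (∈-map⁻; ∈-++⁻)
  open import Data.List.Relation.Binary.Subset.Propositional using (_⊆_)
  open import Data.List.Relation.Unary.Any as Any using (here; there)
  open import Data.List.Relation.Unary.All as All using (All; []; _∷_)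
  open import Data.List.Relation.Unary.AllPairs using ([]; _∷_)
  open import Data.List.Relation.Unary.Unique.Propositional using (Unique)
  open import Data.Product using (∃; _×_; _,_)
  open import Data.Sum using (inj₁; inj₂)
  open import Relation.Nullary using (yes; no)

  module _ {A : Set} where

    record Inserted (x : A) (ys zs : List A) : Set where
      field
        len : length zs ≡ suc (length ys)
        new : x ∈ zs
        old : ys ⊆ zs
        all : zs ⊆ x ∷ ys
        uni : Unique (x ∷ ys) → Unique zs

    inserted : ∀ x ys {zs} → zs ∈ insertEverywhere x ys → Inserted x ys zs
    inserted x [] (here refl) = record { len = refl ; new = here refl ; old = λ () ; all = λ m → m ; uni = λ u → u }
    inserted x (y ∷ ys) (here refl) = record { len = refl ; new = here refl ; old = there ; all = λ m → m ; uni = λ u → u }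
    inserted x (y ∷ ys) (there m) with ∈-map⁻ (y ∷_) m
    ... | zs , m′ , refl = record
      { len = cong suc (Inserted.len ih) ; new = there (Inserted.new ih)
      ; old = λ { (here e) → here e ; (there p) → there (Inserted.old ih p) }
      ; all = λ { (here e) → there (here e) ; (there p) → weaken (Inserted.all ih p) }
      ; uni = uni′ }
      where
      ih = inserted x ys m′
      weaken : ∀ {w} → w ∈ x ∷ ys → w ∈ x ∷ y ∷ ys
      weaken (here e) = here e
      weaken (there p) = there (there p)
      uni′ : Unique (x ∷ y ∷ ys) → Unique (y ∷ zs)
      uni′ ((x≢y ∷ x#) ∷ (y# ∷ u)) = All.tabulate ne ∷ Inserted.uni ih (x# ∷ u)
        where
        ne : ∀ {w} → w ∈ zs → y ≢ w
        ne p refl with Inserted.all ih p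
        ... | here e = x≢y (sym e)
        ... | there q = All.lookup y# q refl

    record Arranged (xs zs : List A) : Set where
      field
        len : length zs ≡ length xs
        old : xs ⊆ zs
        all : zs ⊆ xs
        uni : Unique xs → Unique zs

    arranged : ∀ xs {zs} → zs ∈ permutations xs → Arranged xs zs
    arranged [] (here refl) = record { len = refl ; old = λ m → m ; all = λ m → m ; uni = λ u → u }
    arranged (x ∷ xs) {zs} m with find (permutations xs) m
      where
      find : ∀ yss → zs ∈ concatMap (insertEverywhere x) yss → ∃ λ ys → ys ∈ yss × zs ∈ insertEverywhere x ys
      find (ys ∷ yss) p with ∈-++⁻ (insertEverywhere x ys) p
      ... | inj₁ q = ys , here refl , q
      ... | inj₂ q = let (ys′ , a , b) = find yss q in ys′ , there a , b
    ... | ys , ys∈ , zs∈ = record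
      { len = trans (Inserted.len i) (cong suc (Arranged.len a))
      ; old = λ { (here refl) → Inserted.new i ; (there p) → Inserted.old i (Arranged.old a p) }
      ; all = λ p → back (Inserted.all i p)
      ; uni = λ { (x# ∷ u) → Inserted.uni i (All.tabulate (λ p → All.lookup x# (Arranged.all a p)) ∷ Arranged.uni a u) } }
      where
      i = inserted x ys zs∈
      a = arranged xs ys∈
      back : ∀ {w} → w ∈ x ∷ ys → w ∈ x ∷ xs
      back (here e) = here e
      back (there p) = there (Arranged.all a p)

    -- Strict increase, with lo as lower bound for the first value; a labelling with ties is
    -- increasing along no ordering.
    inc : (A → ℕ) → ℕ → List A → Bool
    inc h lo [] = true
    inc h lo (x ∷ xs) = (lo ≤ᵇ h x) ∧ inc h (suc (h x)) xs

    module _ (h : A → ℕ) where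

      #inc : ℕ → List (List A) → F
      #inc lo = sumL (λ zs → b2F (inc h lo zs))

      ≤ᵇ-true : ∀ {m n} → m ℕ.≤ n → (m ≤ᵇ n) ≡ true
      ≤ᵇ-true {m} {n} p with m ≤ᵇ n | ℕ.≤⇒≤ᵇ p
      ... | true | _ = refl

      ≤ᵇ-false : ∀ {m n} → n ℕ.< m → (m ≤ᵇ n) ≡ false
      ≤ᵇ-false {m} {n} p with m ≤ᵇ n in e
      ... | false = refl
      ... | true = ⊥-elim (ℕ.<⇒≱ p (ℕ.≤ᵇ⇒≤ m n (subst T (sym e) _)))

      #inc-cons : ∀ lo y yss → #inc lo (map (y ∷_) yss) ≡ b2F (lo ≤ᵇ h y) * #inc (suc (h y)) yss
      #inc-cons lo y yss = trans (sumL-map _ (y ∷_) yss) (trans (sumL-cong (λ zs → b2F-∧ (lo ≤ᵇ h y) _) yss) (sumL-*ˡ _ _ yss))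

      insert-late : ∀ lo x ys → h x ℕ.< lo → #inc lo (insertEverywhere x ys) ≡ 0#
      insert-late lo x [] p rewrite ≤ᵇ-false p = +-identityʳ 0#
      insert-late lo x (y ∷ ys) p rewrite ≤ᵇ-false p = trans (+-identityˡ _) (trans (#inc-cons lo y (insertEverywhere x ys)) rest)
        where
        rest : b2F (lo ≤ᵇ h y) * #inc (suc (h y)) (insertEverywhere x ys) ≡ 0#
        rest with lo ≤ᵇ h y in e
        ... | true = trans (cong (1# *_) (insert-late (suc (h y)) x ys (s≤s (ℕ.≤-trans (ℕ.<⇒≤ p) (ℕ.≤ᵇ⇒≤ lo (h y) (subst T (sym e) _)))))) (zeroʳ _)
        ... | false = zeroˡ _

      -- At most one position can work: if h x < h y, then x has to stand before y, and otherwise it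
      -- has to go behind y, where the induction continues.
      insert-≤ : ∀ lo x ys → #inc lo (insertEverywhere x ys) ≤ b2F (inc h lo ys)
      insert-≤ lo x [] = ≤-trans (≤-reflexive (+-identityʳ _)) (b2F≤1 _)
      insert-≤ lo x (y ∷ ys) with h x ℕ.<? h y
      ... | yes lt = ≤-trans (≤-reflexive (trans (cong₂ _+_ refl (trans (#inc-cons lo y (insertEverywhere x ys))
                (trans (cong (b2F (lo ≤ᵇ h y) *_) (insert-late (suc (h y)) x ys (s≤s (ℕ.<⇒≤ lt)))) (zeroʳ _)))) (+-identityʳ _))) first
        where
        first : b2F ((lo ≤ᵇ h x) ∧ inc h (suc (h x)) (y ∷ ys)) ≤ b2F (inc h lo (y ∷ ys))
        first with lo ≤ᵇ h x in e
        ... | false = 0≤b2F _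
        ... | true rewrite ≤ᵇ-true lt | ≤ᵇ-true (ℕ.≤-trans (ℕ.≤ᵇ⇒≤ lo (h x) (subst T (sym e) _)) (ℕ.<⇒≤ lt)) = ≤-refl
      ... | no ge = ≤-trans (≤-reflexive (trans (cong₂ _+_ zero-first (#inc-cons lo y (insertEverywhere x ys))) (+-identityˡ _)))
          (≤-trans (*-monoˡ _ (0≤b2F (lo ≤ᵇ h y)) (insert-≤ (suc (h y)) x ys)) (≤-reflexive (sym (b2F-∧ (lo ≤ᵇ h y) _))))
        where
        zero-first : b2F (inc h lo (x ∷ y ∷ ys)) ≡ 0#
        zero-first rewrite ≤ᵇ-false {suc (h x)} {h y} (s≤s (ℕ.≮⇒≥ ge)) with lo ≤ᵇ h x
        ... | true = refl
        ... | false = refl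

      -- With a value different from all the others, the position found by the same comparison does
      -- work.
      insert-≡ : ∀ lo x ys → lo ℕ.≤ h x → All (λ y → h x ≢ h y) ys → b2F (inc h lo ys) ≤ #inc lo (insertEverywhere x ys)
      insert-≡ lo x [] le _ rewrite ≤ᵇ-true le = ≤-reflexive (sym (+-identityʳ 1#))
      insert-≡ lo x (y ∷ ys) le (ne ∷ nes) with h x ℕ.<? h y
      ... | yes lt = ≤-trans first (x≤x+y _ (sumL-nonneg (λ zs → 0≤b2F _) (map (y ∷_) (insertEverywhere x ys))))
        where
        first : b2F (inc h lo (y ∷ ys)) ≤ b2F (inc h lo (x ∷ y ∷ ys))
        first rewrite ≤ᵇ-true le | ≤ᵇ-true lt | ≤ᵇ-true (ℕ.≤-trans le (ℕ.<⇒≤ lt)) = ≤-refl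
      ... | no ge = ≤-trans (≤-reflexive (b2F-∧ (lo ≤ᵇ h y) _))
          (≤-trans (*-monoˡ _ (0≤b2F (lo ≤ᵇ h y)) (insert-≡ (suc (h y)) x ys (ℕ.≤∧≢⇒< (ℕ.≮⇒≥ ge) (λ e → ne (sym e))) nes))
          (≤-trans (≤-reflexive (sym (#inc-cons lo y (insertEverywhere x ys)))) (x≤y+x _ (0≤b2F _))))

      increasing-≤1 : ∀ xs → #inc 0 (permutations xs) ≤ 1#
      increasing-≤1 [] = ≤-reflexive (+-identityʳ 1#)
      increasing-≤1 (x ∷ xs) = ≤-trans (≤-reflexive (sumL-concatMap _ (insertEverywhere x) (permutations xs)))
        (≤-trans (sumL-mono (insert-≤ 0 x) (permutations xs)) (increasing-≤1 xs))

      increasing-≥1 : ∀ xs → Unique (map h xs) → 1# ≤ #inc 0 (permutations xs)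
      increasing-≥1 [] _ = ≤-reflexive (sym (+-identityʳ 1#))
      increasing-≥1 (x ∷ xs) (x# ∷ u) = ≤-trans (increasing-≥1 xs u)
        (≤-trans (sumL-mono-∈ (permutations xs) (λ zs m → insert-≡ 0 x zs z≤n (All.tabulate (λ p → distinct (Arranged.all (arranged xs m) p)))))
          (≤-reflexive (sym (sumL-concatMap _ (insertEverywhere x) (permutations xs)))))
        where
        distinct : ∀ {y} → y ∈ xs → h x ≢ h y
        distinct {y} p = lookup-map xs x# p
          where
          lookup-map : ∀ ys → All (h x ≢_) (map h ys) → y ∈ ys → h x ≢ h y
          lookup-map (z ∷ ys) (q ∷ _) (here refl) = q
          lookup-map (z ∷ ys) (_ ∷ qs) (there m) = lookup-map ys qs m

-- From random labels to uniformly random orderings.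

module Transfer (L′ N : ℕ) where
  open import Defs using (permutations)
  open Field
  open Sums
  open Lists using (unique-map-∈)
  open Perm
  open Avg L′
  open import Data.Bool.Base using (true; false; _∧_)
  open import Data.Empty using (⊥-elim)
  open import Data.Fin.Base using (Fin; toℕ)
  open import Data.Fin.Properties using (toℕ-injective) renaming (_≟_ to _≟F_)
  open import Data.List.Base using (List; []; _∷_; length; map)
  open import Data.List.Membership.Propositional using (_∈_)
  open import Data.List.Membership.Propositional.Properties using (∈-map⁺)
  open import Data.List.Relation.Unary.Any using (here; there)
  open import Data.List.Relation.Unary.All as All using (All; []; _∷_)
  open import Data.List.Relation.Unary.AllPairs using ([]; _∷_; allPairs?)
  open import Data.List.Relation.Unary.Unique.Propositional using (Unique)
  open import Data.Product using (∃; _×_; _,_)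
  open import Data.Vec.Base using (Vec; []; _∷_; lookup; _[_]≔_)
  open import Data.Vec.Properties using (lookup∘update′)
  open import Relation.Nullary using (Dec; yes; no; does; ¬_)
  open import Relation.Nullary.Decidable using (¬?)

  Labels : Set
  Labels = Vec (Fin L) N

  -- The probability that m independent labels are strictly increasing and start at lo or above. It
  -- depends on the length alone, which is the symmetry between the orderings.
  chance : ℕ → ℕ → F
  chance zero lo = 1#
  chance (suc m) lo = avg (λ ℓ → b2F (lo ≤ᵇ toℕ ℓ) * chance m (suc (toℕ ℓ)))

  module _ {A : Set} (c : A → Fin N) where

    lab : Labels → A → ℕ
    lab β x = toℕ (lookup β (c x))

    inc-update : ∀ β {x} ℓ lo xs → All (x ≢_) (map c xs) → inc (lab (β [ x ]≔ ℓ)) lo xs ≡ inc (lab β) lo xs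
    inc-update β ℓ lo [] _ = refl
    inc-update β ℓ lo (y ∷ ys) (ne ∷ nes) rewrite lookup∘update′ (λ e → ne (sym e)) β ℓ =
      cong (_ ∧_) (inc-update β ℓ _ ys nes)

    E-inc : ∀ lo xs → Unique (map c xs) → E N (λ β → b2F (inc (lab β) lo xs)) ≡ chance (length xs) lo
    E-inc lo [] _ = E-const N 1#
    E-inc lo (x ∷ xs) (x# ∷ u) =
      trans (E-cong N (λ β → trans (b2F-∧ _ _) (sym (avg-δ (lookup β (c x)) (λ ℓ → b2F (lo ≤ᵇ toℕ ℓ) * b2F (inc (lab β) (suc (toℕ ℓ)) xs))))))
      (trans (E-avg N _) (avg-cong (λ ℓ →
        trans (E-δ N (c x) ℓ (λ β → b2F (lo ≤ᵇ toℕ ℓ) * b2F (inc (lab β) (suc (toℕ ℓ)) xs)))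
        (trans (E-*ˡ N _ _) (cong (b2F (lo ≤ᵇ toℕ ℓ) *_)
          (trans (E-cong N (λ β → cong b2F (inc-update β ℓ (suc (toℕ ℓ)) xs x#))) (E-inc (suc (toℕ ℓ)) xs u)))))))

    injective? : (β : Labels) (xs : List A) → Dec (Unique (map (lab β) xs))
    injective? β xs = allPairs? (λ i j → ¬? (i ℕ.≟ j)) (map (lab β) xs)

    injB : List A → Labels → F
    injB xs β = b2F (does (injective? β xs))

    -- A labelling is increasing along at most one ordering, along exactly one if it is
    -- injective, and no ordering is favoured.
    transfer : ∀ xs (a : Labels → F) (m : List A → ℕ) → Unique (map c xs) → Unique xs → (∀ β → 0# ≤ a β) →
      (∀ β zs → zs ∈ permutations xs → Unique (map (lab β) xs) → inc (lab β) 0 zs ≡ true → a β ≤ ι (m zs)) →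
      E N (λ β → injB xs β * a β) * ι (length (permutations xs)) ≤ sumL (λ zs → ι (m zs)) (permutations xs)
    transfer xs a m uc ux 0≤a h =
      E N (λ β → injB xs β * a β) * ι numO
        ≤⟨ *-monoʳ _ (0≤ι numO) lower ⟩
      (I * tot) * ι numO
        ≈⟨ S.solve 3 (λ i t k → (i S.:* t) S.:* k S.:= (k S.:* i) S.:* t) refl I tot (ι numO) ⟩
      (ι numO * I) * tot
        ≤⟨ *-monoʳ tot (sumL-nonneg (λ zs → 0≤ι (m zs)) perms) I-bound ⟩
      1# * tot
        ≈⟨ *-identityˡ tot ⟩
      tot ∎
      where
      perms = permutations xs
      numO = length perms
      I = chance (length xs) 0
      tot = sumL (λ zs → ι (m zs)) perms
      uc′ : ∀ {zs} → zs ∈ perms → Unique (map c zs)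
      uc′ p = unique-map-∈ c (λ q r → inj′ (Arranged.all (arranged xs p) q) (Arranged.all (arranged xs p) r)) (Arranged.uni (arranged xs p) ux)
        where
        inj-on : ∀ {ys} → Unique (map c ys) → ∀ {x y} → x ∈ ys → y ∈ ys → c x ≡ c y → x ≡ y
        inj-on (_ ∷ u) (here refl) (here refl) e = refl
        inj-on (z# ∷ u) (here refl) (there q) e = ⊥-elim (All.lookup z# (∈-map⁺ c q) e)
        inj-on (z# ∷ u) (there q) (here refl) e = ⊥-elim (All.lookup z# (∈-map⁺ c q) (sym e))
        inj-on (_ ∷ u) (there p) (there q) e = inj-on u p q e
        inj′ = inj-on uc
      E-inc′ : ∀ zs → zs ∈ perms → E N (λ β → b2F (inc (lab β) 0 zs)) ≡ I
      E-inc′ zs p = trans (E-inc 0 zs (uc′ p)) (cong (λ k → chance k 0) (Arranged.len (arranged xs p)))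
      -- A labelling is increasing along at most one ordering, so the common probability `I` of the
      -- orderings is at most 1 / numO; ties account for the deficit.
      I-bound : ι numO * I ≤ 1#
      I-bound =
        ι numO * I ≈⟨ sym (sumL-const I perms) ⟩
        sumL (λ _ → I) perms ≤⟨ sumL-mono-∈ perms (λ zs p → ≤-reflexive (sym (E-inc′ zs p))) ⟩
        sumL (λ zs → E N (λ β → b2F (inc (lab β) 0 zs))) perms ≈⟨ sym (E-sumL N _ perms) ⟩
        E N (λ β → #inc (lab β) 0 perms) ≤⟨ E-mono N (λ β → increasing-≤1 (lab β) xs) ⟩
        E N (λ _ → 1#) ≈⟨ E-const N 1# ⟩
        1# ∎
      point : ∀ β → injB xs β * a β ≤ sumL (λ zs → ι (m zs) * b2F (inc (lab β) 0 zs)) perms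
      point β with injective? β xs
      ... | no _ = ≤-trans (≤-reflexive (zeroˡ _)) (sumL-nonneg (λ zs → 0≤* (0≤ι (m zs)) (0≤b2F _)) perms)
      ... | yes u =
        1# * a β ≤⟨ *-monoʳ (a β) (0≤a β) (increasing-≥1 (lab β) xs u) ⟩
        #inc (lab β) 0 perms * a β ≈⟨ trans (*-comm _ _) (sym (sumL-*ˡ (a β) _ perms)) ⟩
        sumL (λ zs → a β * b2F (inc (lab β) 0 zs)) perms ≤⟨ sumL-mono-∈ perms each ⟩
        sumL (λ zs → ι (m zs) * b2F (inc (lab β) 0 zs)) perms ∎
        where
        each : ∀ zs → zs ∈ perms → a β * b2F (inc (lab β) 0 zs) ≤ ι (m zs) * b2F (inc (lab β) 0 zs)
        each zs p with inc (lab β) 0 zs in e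
        ... | true = *-monoʳ 1# 0≤1 (h β zs p u e)
        ... | false = ≤-reflexive (trans (zeroʳ _) (sym (zeroʳ _)))
      lower : E N (λ β → injB xs β * a β) ≤ I * tot
      lower =
        E N (λ β → injB xs β * a β) ≤⟨ E-mono N point ⟩
        E N (λ β → sumL (λ zs → ι (m zs) * b2F (inc (lab β) 0 zs)) perms) ≈⟨ E-sumL N _ perms ⟩
        sumL (λ zs → E N (λ β → ι (m zs) * b2F (inc (lab β) 0 zs))) perms
          ≤⟨ sumL-mono-∈ perms (λ zs p → ≤-reflexive (trans (E-*ˡ N (ι (m zs)) _) (trans (cong (ι (m zs) *_) (E-inc′ zs p)) (*-comm _ _)))) ⟩
        sumL (λ zs → I * ι (m zs)) perms ≈⟨ sumL-*ˡ I _ perms ⟩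
        I * tot ∎

    collide : ∀ x y → c x ≢ c y → E N (λ β → b2F (does (lookup β (c x) ≟F lookup β (c y)))) ≡ inv L
    collide x y ne = trans (E-cong N scale) (trans (E-*ˡ N (inv L) _) (trans (cong (inv L *_)
        (trans (E-cong N (λ β → sym (avg-δ (lookup β (c y)) (λ ℓ → δ (lookup β (c x)) ℓ))))
        (trans (E-avg N _) (trans (avg-cong (λ ℓ → trans (E-δ N (c y) ℓ (λ β → δ (lookup β (c x)) ℓ))
           (trans (E-cong N (λ β → trans (cong (λ z → δ z ℓ) (lookup∘update′ ne β ℓ)) (sym (*-identityʳ _))))
             (trans (E-δ N (c x) ℓ (λ _ → 1#)) (E-const N 1#))))) (avg-const 1#))))) (*-identityʳ _)))
      where
      scale : ∀ β → b2F (does (lookup β (c x) ≟F lookup β (c y))) ≡ inv L * δ (lookup β (c x)) (lookup β (c y))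
      scale β = sym (ιL-inv _)

    -- A union bound over pairs of distinct elements, each pair being tied with probability 1 / L.
    injB-≥ : ∀ xs → Unique (map c xs) → 1# - ι (length xs ℕ.* length xs) * inv L ≤ E N (injB xs)
    injB-≥ xs uc =
      1# - ι (n ℕ.* n) * inv L
        ≤⟨ sub-monoʳ 1# sumE ⟩
      1# - E N (λ β → bad β)
        ≈⟨ sym (E-1- N bad) ⟩
      E N (λ β → 1# - bad β)
        ≤⟨ E-mono N point ⟩
      E N (injB xs) ∎
      where
      n = length xs
      clash : Labels → A → A → F
      clash β x y with c x ≟F c y
      ... | yes _ = 0#
      ... | no _ = b2F (does (lookup β (c x) ≟F lookup β (c y)))
      0≤clash : ∀ β x y → 0# ≤ clash β x y
      0≤clash β x y with c x ≟F c y
      ... | yes _ = ≤-refl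
      ... | no _ = 0≤b2F (does (lookup β (c x) ≟F lookup β (c y)))
      bad : Labels → F
      bad β = sumL (λ x → sumL (clash β x) xs) xs
      E-clash : ∀ x y → E N (λ β → clash β x y) ≤ inv L
      E-clash x y with c x ≟F c y
      ... | yes _ = ≤-trans (≤-reflexive (E-const N 0#)) (inv-nonneg L)
      ... | no ne = ≤-reflexive (collide x y ne)
      sumE : E N bad ≤ ι (n ℕ.* n) * inv L
      sumE =
        E N bad ≈⟨ trans (E-sumL N _ xs) (sumL-cong (λ x → E-sumL N (λ y β → clash β x y) xs) xs) ⟩
        sumL (λ x → sumL (λ y → E N (λ β → clash β x y)) xs) xs ≤⟨ sumL-mono (λ x → sumL-mono (λ y → E-clash x y) xs) xs ⟩
        sumL (λ x → sumL (λ y → inv L) xs) xs ≈⟨ trans (sumL-cong (λ x → sumL-const (inv L) xs) xs) (sumL-const _ xs) ⟩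
        ι n * (ι n * inv L) ≈⟨ trans (sym (*-assoc _ _ _)) (cong (_* inv L) (sym (ι-* n n))) ⟩
        ι (n ℕ.* n) * inv L ∎
      term : ∀ {B : Set} (f : B → F) → (∀ x → 0# ≤ f x) → ∀ {x} ys → x ∈ ys → f x ≤ sumL f ys
      term f nn (y ∷ ys) (here refl) = x≤x+y _ (sumL-nonneg nn ys)
      term f nn (y ∷ ys) (there m) = ≤-trans (term f nn ys m) (x≤y+x _ (nn y))
      not-unique : ∀ β ys → Unique (map c ys) → ¬ Unique (map (lab β) ys) → ∃ λ x → ∃ λ y → x ∈ ys × y ∈ ys × c x ≢ c y × lab β x ≡ lab β y
      not-unique β [] _ nu = ⊥-elim (nu [])
      not-unique β (y ∷ ys) (y# ∷ u) nu with All.all? (λ k → ¬? (lab β y ℕ.≟ k)) (map (lab β) ys)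
      ... | yes al = let (a , b , p , q , r , s) = not-unique β ys u (λ v → nu (al ∷ v)) in a , b , there p , there q , r , s
      ... | no nal = let (z , m , e) = find ys nal in y , z , here refl , there m , All.lookup y# (∈-map⁺ c m) , e
        where
        find : ∀ zs → ¬ All (λ k → ¬ lab β y ≡ k) (map (lab β) zs) → ∃ λ z → z ∈ zs × lab β y ≡ lab β z
        find [] h = ⊥-elim (h [])
        find (z ∷ zs) h with lab β y ℕ.≟ lab β z
        ... | yes e = z , here refl , e
        ... | no ne = let (w , m , e) = find zs (λ a → h (ne ∷ a)) in w , there m , e
      point : ∀ β → 1# - bad β ≤ injB xs β
      point β with injective? β xs
      ... | yes _ = x-y≤x 1# (sumL-nonneg (λ x → sumL-nonneg (0≤clash β x) xs) xs)
      ... | no nu with not-unique β xs uc nu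
      ...   | x , y , x∈ , y∈ , ne , e = ≤-trans (sub-monoʳ 1# one) (≤-reflexive (-‿inverseʳ 1#))
        where
        clash1 : 1# ≤ clash β x y
        clash1 with c x ≟F c y
        ... | yes q = ⊥-elim (ne q)
        ... | no _ with lookup β (c x) ≟F lookup β (c y)
        ...   | yes _ = ≤-refl
        ...   | no q = ⊥-elim (q (toℕ-injective e))
        one : 1# ≤ bad β
        one = ≤-trans clash1 (≤-trans (term (clash β x) (0≤clash β x) xs y∈)
          (term (λ x → sumL (clash β x) xs) (λ x → sumL-nonneg (0≤clash β x) xs) xs x∈))

-- The acceptance rule describes the greedy process.

module Greedy {v : ℕ} (H : Graph v) (n L′ : ℕ) where
  open import Defs using (Graph; adj; edgesK; permutations; eM; runProcess; containsCopy; isEmbedding; addEdge; emptyG; allVecs; allB; anyB; HostGraph; Edge; _==_)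

  open Field
  open Sums
  open Lists
  open Perm
  open Codes n
  open Copies H n
  open Avg L′
  open DT L′ N links
  open Transfer L′ N
  open import Data.Bool.Base using (Bool; true; false; _∧_; _∨_; not; T)
  open import Data.Bool.Properties using (∨-zeroʳ)
  open import Data.Empty using (⊥; ⊥-elim)
  open import Data.Fin.Base using (Fin; combine; zero; suc; toℕ)
  open import Data.Fin.Properties using (toℕ<n; toℕ-injective) renaming (_≟_ to _≟F_)
  open import Data.List.Base using (List; []; _∷_; length; allFin)
  open import Data.List.Membership.Propositional using (_∈_)
  open import Data.List.Membership.Propositional.Properties using (∈-allFin)
  open import Data.List.Relation.Binary.Subset.Propositional using (_⊆_)
  open import Data.List.Relation.Unary.Any using (here; there)
  open import Data.List.Relation.Unary.All as All using (All; []; _∷_)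
  open import Data.Product using (∃; _×_; _,_; proj₁; proj₂)
  open import Data.Sum using (_⊎_; inj₁; inj₂)
  open import Data.Vec.Base using (Vec; []; _∷_; lookup)
  open import Relation.Nullary using (yes; no; ¬_)

  NonEmpty : List (Fin N) → Set
  NonEmpty C = 1 ℕ.≤ length C

  absurd : ∀ {A : Set} {b} → b ≡ true → b ≡ false → A
  absurd refl ()

  module _ (ne : ∀ {u C} → C ∈ links u → NonEmpty C) (β : Labels) where

    ne-links : ∀ u → All NonEmpty (links u)
    ne-links u = All.tabulate ne

    accL-zero : ∀ cs → accL zero zero cs β ≡ true
    accL-zero [] = refl
    accL-zero (_ ∷ _) = refl

    weaken : ∀ {s k m} → s ℕ.≤ k → (v : Vec (Fin L) m) → AllBelow s v → AllBelow k v
    weaken p [] _ = _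
    weaken p (ℓ ∷ v) (a , b) = ℕ.≤-trans a p , weaken p v b

    mutual
      -- Fuel beyond s changes nothing, because labels fall along links. At fuel zero also s is
      -- zero, and then a link can be alive only if it is empty; hence the assumption `ne`.
      accL-fuel : ∀ k k′ s cs → s ℕ.≤ k → s ℕ.≤ k′ → All NonEmpty cs → accL k s cs β ≡ accL k′ s cs β
      accL-fuel k k′ s [] _ _ _ = refl
      accL-fuel zero zero s (C ∷ cs) _ _ _ = refl
      accL-fuel zero (suc k′) zero ((x ∷ C) ∷ cs) _ _ (_ ∷ a) =
        trans (sym (accL-zero cs)) (accL-fuel zero (suc k′) zero cs z≤n z≤n a)
      accL-fuel (suc k) zero zero ((x ∷ C) ∷ cs) _ _ (_ ∷ a) =
        trans (accL-fuel (suc k) zero zero cs z≤n z≤n a) (accL-zero cs)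
      accL-fuel (suc k) (suc k′) s (C ∷ cs) p q (_ ∷ a)
        rewrite accL-fuel (suc k) (suc k′) s cs p q a with alive s (labels β C) in e
      ... | false = refl
      ... | true rewrite accK-fuel k k′ C (labels β C) (weaken p (labels β C) (alive⇒below s (labels β C) (subst T (sym e) _)))
                (weaken q (labels β C) (alive⇒below s (labels β C) (subst T (sym e) _))) = refl

      accK-fuel : ∀ k k′ C v → AllBelow (suc k) v → AllBelow (suc k′) v → accK k C v β ≡ accK k′ C v β
      accK-fuel k k′ [] [] _ _ = refl
      accK-fuel k k′ (g ∷ C) (ℓ ∷ v) (p , ps) (q , qs) =
        cong₂ _∧_ (accL-fuel k k′ (toℕ ℓ) (links g) (ℕ.≤-pred p) (ℕ.≤-pred q) (ne-links g)) (accK-fuel k k′ C v ps qs)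

    Acc : Fin N → Bool
    Acc g = accL L (toℕ (lookup β g)) (links g) β

    Good : ℕ → List (Fin N) → Set
    Good s C = ∀ {g} → g ∈ C → toℕ (lookup β g) ℕ.< s × Acc g ≡ true

    Acc-pred : ∀ g → accL L′ (toℕ (lookup β g)) (links g) β ≡ Acc g
    Acc-pred g = accL-fuel L′ L (toℕ (lookup β g)) (links g) (ℕ.≤-pred (toℕ<n (lookup β g))) (ℕ.<⇒≤ (toℕ<n (lookup β g))) (ne-links g)

    good⇒ : ∀ s C → Good s C → alive s (labels β C) ∧ accK L′ C (labels β C) β ≡ true
    good⇒ s [] h = refl
    good⇒ s (g ∷ C) h with h (here refl) | good⇒ s C (λ m → h (there m))
    ... | lt , a | ih = true-∧ (true-∧ (true-<ᵇ lt) (proj₁ (∧-true ih))) (true-∧ (trans (Acc-pred g) a) (proj₂ (∧-true ih)))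

    ⇒good : ∀ s C → alive s (labels β C) ∧ accK L′ C (labels β C) β ≡ true → Good s C
    ⇒good s (g ∷ C) e (here refl) = <ᵇ-true (proj₁ (∧-true (proj₁ (∧-true e)))) ,
      trans (sym (Acc-pred g)) (proj₁ (∧-true (proj₂ (∧-true {alive s (labels β (g ∷ C))} e))))
    ⇒good s (g ∷ C) e (there m) = ⇒good s C (true-∧ (proj₂ (∧-true {toℕ (lookup β g) <ᵇ s} (proj₁ (∧-true e))))
      (proj₂ (∧-true {accL L′ (toℕ (lookup β g)) (links g) β} (proj₂ (∧-true {alive s (labels β (g ∷ C))} e))))) m

    acc-true : ∀ s cs → accL L s cs β ≡ true → ∀ {C} → C ∈ cs → ¬ Good s C
    acc-true s (C ∷ cs) e m h with alive s (labels β C) ∧ accK L′ C (labels β C) β in q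
    acc-true s (C ∷ cs) () m h | true
    acc-true s (C ∷ cs) e (here refl) h | false = absurd (good⇒ s C h) q
    acc-true s (C ∷ cs) e (there m) h | false = acc-true s cs e m h

    acc-false : ∀ s cs → accL L s cs β ≡ false → ∃ λ C → C ∈ cs × Good s C
    acc-false s [] ()
    acc-false s (C ∷ cs) e with alive s (labels β C) ∧ accK L′ C (labels β C) β in q
    ... | true = C , here refl , ⇒good s C q
    ... | false = let (C′ , m , h) = acc-false s cs e in C′ , there m , h

    ==⁺ : ∀ {k} {a b : Fin k} → a ≡ b → (a == b) ≡ true
    ==⁺ {a = a} {b} p with a ≟F b
    ... | yes _ = refl
    ... | no q = ⊥-elim (q p)

    ==⁻ : ∀ {k} {a b : Fin k} → (a == b) ≡ true → a ≡ b
    ==⁻ {a = a} {b} e with a ≟F b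
    ... | yes p = p

    allB⁻ : ∀ {A : Set} (p : A → Bool) {x} xs → allB p xs ≡ true → x ∈ xs → p x ≡ true
    allB⁻ p (y ∷ ys) e (here refl) = proj₁ (∧-true e)
    allB⁻ p (y ∷ ys) e (there m) = allB⁻ p ys (proj₂ (∧-true {p y} e)) m

    allB⁺ : ∀ {A : Set} (p : A → Bool) xs → (∀ x → x ∈ xs → p x ≡ true) → allB p xs ≡ true
    allB⁺ p [] h = refl
    allB⁺ p (y ∷ ys) h = true-∧ (h y (here refl)) (allB⁺ p ys (λ x m → h x (there m)))

    anyB⁻ : ∀ {A : Set} (p : A → Bool) xs → anyB p xs ≡ true → ∃ λ x → x ∈ xs × p x ≡ true
    anyB⁻ p (y ∷ ys) e with ∨-true {p y} e
    ... | inj₁ q = y , here refl , q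
    ... | inj₂ q = let (x , m , r) = anyB⁻ p ys q in x , there m , r

    anyB⁺ : ∀ {A : Set} (p : A → Bool) {x} xs → x ∈ xs → p x ≡ true → anyB p xs ≡ true
    anyB⁺ p (y ∷ ys) (here refl) e rewrite e = refl
    anyB⁺ p (y ∷ ys) (there m) e rewrite anyB⁺ p ys m e = ∨-zeroʳ (p y)

    Hosts : HostGraph n → Emb → Set
    Hosts G φ = ∀ i j → adj H i j ≡ true → G (lookup φ i) (lookup φ j) ≡ true

    copy⁻ : ∀ G → containsCopy H G ≡ true → ∃ λ φ → Inj φ × Hosts G φ
    copy⁻ G e with anyB⁻ (isEmbedding H G) (allVecs (allFin n) v) e
    ... | φ , _ , q = φ , mkInj inj , hosts
      where
      cell : ∀ i j → (((i == j) ∨ not (lookup φ i == lookup φ j)) ∧ (not (adj H i j) ∨ G (lookup φ i) (lookup φ j))) ≡ true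
      cell i j = allB⁻ _ (allFin v) (allB⁻ _ (allFin v) q (∈-allFin i)) (∈-allFin j)
      inj : ∀ i j → lookup φ i ≡ lookup φ j → i ≡ j
      inj i j p with ∨-true {i == j} (proj₁ (∧-true (cell i j)))
      ... | inj₁ r = ==⁻ r
      ... | inj₂ r rewrite ==⁺ p with () ← r
      hosts : Hosts G φ
      hosts i j a with ∨-true {not (adj H i j)} (proj₂ (∧-true {(i == j) ∨ not (lookup φ i == lookup φ j)} (cell i j)))
      ... | inj₁ r rewrite a with () ← r
      ... | inj₂ r = r

    copy⁺ : ∀ G φ → Inj φ → Hosts G φ → containsCopy H G ≡ true
    copy⁺ G φ inj h = anyB⁺ (isEmbedding H G) (allVecs (allFin n) v) (∈-allVecs v φ)
      (allB⁺ _ (allFin v) λ i _ → allB⁺ _ (allFin v) λ j _ → true-∧ (dis i j) (emb i j))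
      where
      dis : ∀ i j → ((i == j) ∨ not (lookup φ i == lookup φ j)) ≡ true
      dis i j with lookup φ i == lookup φ j in e
      ... | false = ∨-zeroʳ (i == j)
      ... | true rewrite ==⁺ {a = i} {j} (inj-at inj i j (==⁻ e)) = refl
      emb : ∀ i j → (not (adj H i j) ∨ G (lookup φ i) (lookup φ j)) ≡ true
      emb i j with adj H i j in a
      ... | false = refl
      ... | true = h i j a

    cp : Edge n → Fin N
    cp (i , j) = code i j

    add⁻ : ∀ G a b x y → addEdge G (a , b) x y ≡ true → G x y ≡ true ⊎ code x y ≡ code a b
    add⁻ G a b x y e with ∨-true {G x y} e
    ... | inj₁ p = inj₁ p
    ... | inj₂ p with ∨-true {(x == a) ∧ (y == b)} p
    ...   | inj₁ q = inj₂ (cong₂ code (==⁻ (proj₁ (∧-true q))) (==⁻ (proj₂ (∧-true {x == a} q))))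
    ...   | inj₂ q = inj₂ (trans (cong₂ code (==⁻ (proj₁ (∧-true q))) (==⁻ (proj₂ (∧-true {x == b} q)))) (code-sym b a))

    add-old : ∀ (G : HostGraph n) (f : Edge n) x y → G x y ≡ true → addEdge G f x y ≡ true
    add-old G f x y p rewrite p = refl

    add-new : ∀ G a b x y → x ≢ y → code x y ≡ code a b → addEdge G (a , b) x y ≡ true
    add-new G a b x y ne e with code-inj ne e
    ... | inj₁ (p , q) rewrite true-∧ (==⁺ p) (==⁺ q) = ∨-zeroʳ (G x y)
    ... | inj₂ (p , q) rewrite true-∧ (==⁺ p) (==⁺ q) | ∨-zeroʳ ((x == a) ∧ (y == b)) = ∨-zeroʳ (G x y)

    edgeB : Edge n → Bool
    edgeB p = toℕ (proj₁ p) <ᵇ toℕ (proj₂ p)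

    valid-edge : ∀ {g} → Valid g → ∃ λ f → f ∈ edgesK n × cp f ≡ g
    valid-edge (i , j , ne , refl) with toℕ i <ᵇ toℕ j in e
    ... | true = (i , j) , ∈-filterB⁺ edgeB (∈-pairs i j) e , lem
      where
      lem : code i j ≡ combine i j
      lem rewrite e = refl
    ... | false = (j , i) , ∈-filterB⁺ edgeB (∈-pairs j i) (true-<ᵇ j<i) , lem
      where
      j<i : toℕ j ℕ.< toℕ i
      j<i = ℕ.≤∧≢⇒< (ℕ.≮⇒≥ (λ lt → absurd (true-<ᵇ lt) e)) (λ q → ne (sym (toℕ-injective q)))
      lem : code j i ≡ combine j i
      lem rewrite true-<ᵇ j<i = refl

    -- The invariant along an ordering: the current graph consists of the accepted ones among the
    -- processed edges. It ties the process to `Acc`, which refers to labels alone.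
    record State (G : HostGraph n) (done : List (Edge n)) : Set where
      field
        inG : ∀ x y → G x y ≡ true → ∃ λ f → f ∈ done × Acc (cp f) ≡ true × cp f ≡ code x y
        toG : ∀ f → f ∈ done → Acc (cp f) ≡ true → ∀ x y → x ≢ y → code x y ≡ cp f → G x y ≡ true
        free : containsCopy H G ≡ false

    module _ {G done f} (st : State G done) (f∈ : f ∈ edgesK n)
      (earlier : ∀ {g} → g ∈ done → lab cp β g ℕ.< lab cp β f)
      (all-earlier : ∀ {g} → g ∈ edgesK n → lab cp β g ℕ.< lab cp β f → g ∈ done) where
      open State st

      -- A copy avoiding f would already lie in the current graph. For a copy through f the other
      -- edges are accepted and earlier, so they form a link that forbids accepting f.
      accepted : Acc (cp f) ≡ true → containsCopy H (addEdge G f) ≡ false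
      accepted a with containsCopy H (addEdge G f) in e
      ... | false = refl
      ... | true with copy⁻ (addEdge G f) e
      ...   | φ , inj , h with cp f ∈? im φ
      ...     | no u∉ = absurd (copy⁺ G φ inj old) free
        where
        old : Hosts G φ
        old i j p with add⁻ G (proj₁ f) (proj₂ f) (lookup φ i) (lookup φ j) (h i j p)
        ... | inj₁ q = q
        ... | inj₂ q = ⊥-elim (u∉ (subst (_∈ im φ) q (∈-im⁺ φ p)))
      ...     | yes u∈ = ⊥-elim (acc-true (lab cp β f) (links (cp f)) a (∈-links⁺ inj u∈) good)
        where
        good : Good (lab cp β f) (linkOf φ (cp f))
        good m with ∈-linkOf⁻ φ m
        ... | m′ , g≢ with ∈-im⁻ φ m′
        ...   | i , j , p , refl with add⁻ G (proj₁ f) (proj₂ f) (lookup φ i) (lookup φ j) (h i j (proj₂ (∈-EH⁻ p)))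
        ...     | inj₂ q = ⊥-elim (g≢ q)
        ...     | inj₁ q with inG (lookup φ i) (lookup φ j) q
        ...       | f′ , f′∈ , ac , e′ = subst (λ z → toℕ (lookup β z) ℕ.< lab cp β f × Acc z ≡ true) e′ (earlier f′∈ , ac)

      rejected : Acc (cp f) ≡ false → containsCopy H (addEdge G f) ≡ true
      rejected a with acc-false (lab cp β f) (links (cp f)) a
      ... | C , C∈ , good with ∈-links⁻ C∈
      ...   | φ , inj , u∈ , refl = copy⁺ (addEdge G f) φ inj hosts
        where
        hosts : Hosts (addEdge G f) φ
        hosts i j p with code (lookup φ i) (lookup φ j) ≟F cp f
        ... | yes q = add-new G (proj₁ f) (proj₂ f) (lookup φ i) (lookup φ j) (λ r → adj-≢ p (inj-at inj i j r)) q
        ... | no q with ∈-linkOf⁺ φ (∈-im⁺ φ p) q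
        ...   | m with valid-edge (valid-im inj (∈-im⁺ φ p)) | good m
        ...     | f′ , f′∈ , e′ | lt , ac = add-old G f (lookup φ i) (lookup φ j)
                  (toG f′ (all-earlier f′∈ (subst (λ z → toℕ (lookup β z) ℕ.< lab cp β f) (sym e′) lt))
                    (trans (cong Acc e′) ac) (lookup φ i) (lookup φ j) (λ r → adj-≢ p (inj-at inj i j r)) (sym e′))

    inc-lower : ∀ lo {g} xs → inc (lab cp β) lo xs ≡ true → g ∈ xs → lo ℕ.≤ lab cp β g
    inc-lower lo (x ∷ xs) e (here refl) = ℕ.≤ᵇ⇒≤ lo _ (subst T (sym (proj₁ (∧-true e))) _)
    inc-lower lo (x ∷ xs) e (there m) = ℕ.≤-trans (ℕ.≤ᵇ⇒≤ lo _ (subst T (sym (proj₁ (∧-true e))) _))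
      (ℕ.<⇒≤ (inc-lower (suc (lab cp β x)) xs (proj₂ (∧-true {lo ≤ᵇ lab cp β x} e)) m))

    run-bound : ∀ rest lo G done → State G done → inc (lab cp β) lo rest ≡ true →
      (∀ {g} → g ∈ done → lab cp β g ℕ.< lo) → rest ⊆ edgesK n → (∀ {g} → g ∈ edgesK n → g ∈ done ⊎ g ∈ rest) →
      sumL (λ f → b2F (Acc (cp f))) rest ≤ ι (runProcess H G rest)
    run-bound [] lo G done st _ _ _ _ = ≤-refl
    run-bound (f ∷ rest) lo G done st e dl sub cov = go (Acc (cp f)) refl
      where
      lo≤ : lo ℕ.≤ lab cp β f
      lo≤ = inc-lower lo (f ∷ rest) e (here refl)
      e′ : inc (lab cp β) (suc (lab cp β f)) rest ≡ true
      e′ = proj₂ (∧-true {lo ≤ᵇ lab cp β f} e)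
      earlier : ∀ {g} → g ∈ done → lab cp β g ℕ.< lab cp β f
      earlier m = ℕ.<-≤-trans (dl m) lo≤
      all-earlier : ∀ {g} → g ∈ edgesK n → lab cp β g ℕ.< lab cp β f → g ∈ done
      all-earlier g∈ lt with cov g∈
      ... | inj₁ m = m
      ... | inj₂ (here refl) = ⊥-elim (ℕ.<-irrefl refl lt)
      ... | inj₂ (there m) = ⊥-elim (ℕ.<-asym lt (inc-lower (suc (lab cp β f)) rest e′ m))
      dl′ : ∀ {g} → g ∈ f ∷ done → lab cp β g ℕ.< suc (lab cp β f)
      dl′ (here refl) = ℕ.≤-refl
      dl′ (there m) = ℕ.m≤n⇒m≤1+n (earlier m)
      cov′ : ∀ {g} → g ∈ edgesK n → g ∈ f ∷ done ⊎ g ∈ rest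
      cov′ g∈ with cov g∈
      ... | inj₁ m = inj₁ (there m)
      ... | inj₂ (here p) = inj₁ (here p)
      ... | inj₂ (there m) = inj₂ m
      f∈ = sub (here refl)
      skip : Acc (cp f) ≡ false → State G (f ∷ done)
      skip a = record { inG = λ x y p → let (f′ , m , q) = State.inG st x y p in f′ , there m , q
                      ; toG = λ { f′ (here refl) ac → absurd ac a ; f′ (there m) ac → State.toG st f′ m ac }
                      ; free = State.free st }
      take : Acc (cp f) ≡ true → State (addEdge G f) (f ∷ done)
      take a = record { inG = inG′ ; toG = toG′ ; free = accepted st f∈ earlier all-earlier a }
        where
        inG′ : ∀ x y → addEdge G f x y ≡ true → ∃ λ f′ → f′ ∈ f ∷ done × Acc (cp f′) ≡ true × cp f′ ≡ code x y
        inG′ x y p with add⁻ G (proj₁ f) (proj₂ f) x y p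
        ... | inj₁ q = let (f′ , m , r) = State.inG st x y q in f′ , there m , r
        ... | inj₂ q = f , here refl , a , sym q
        toG′ : ∀ f′ → f′ ∈ f ∷ done → Acc (cp f′) ≡ true → ∀ x y → x ≢ y → code x y ≡ cp f′ → addEdge G f x y ≡ true
        toG′ f′ (here refl) ac x y x≢y q = add-new G (proj₁ f) (proj₂ f) x y x≢y q
        toG′ f′ (there m) ac x y x≢y q = add-old G f x y (State.toG st f′ m ac x y x≢y q)
      go : ∀ b → Acc (cp f) ≡ b → b2F (Acc (cp f)) + sumL (λ f → b2F (Acc (cp f))) rest ≤ ι (runProcess H G (f ∷ rest))
      go false a rewrite a | rejected st f∈ earlier all-earlier a =
        ≤-trans (≤-reflexive (+-identityˡ _)) (run-bound rest (suc (lab cp β f)) G (f ∷ done) (skip a) e′ dl′ (λ m → sub (there m)) cov′)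
      go true a rewrite a | accepted st f∈ earlier all-earlier a =
        ≤-trans (+-monoʳ 1# (run-bound rest (suc (lab cp β f)) (addEdge G f) (f ∷ done) (take a) e′ dl′ (λ m → sub (there m)) cov′)) (≤-reflexive (sym (ι-suc _)))

    -- An edge of H is what makes the empty graph free of copies, so that the invariant holds at the
    -- start.
    greedy-≥ : ∀ {h} → h ∈ EH → ∀ π → π ∈ permutations (edgesK n) → inc (lab cp β) 0 π ≡ true →
      sumL (λ f → b2F (Acc (cp f))) π ≤ ι (eM H n π)
    greedy-≥ {i , j} h π π∈ e = run-bound π 0 emptyG [] st e (λ ()) (Arranged.all ar) (λ m → inj₂ (Arranged.old ar m))
      where
      ar = arranged (edgesK n) π∈
      st : State emptyG []
      st = record { inG = λ _ _ () ; toG = λ _ () ; free = free }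
        where
        ¬true : ∀ {b} → (b ≡ true → ⊥) → b ≡ false
        ¬true {false} _ = refl
        ¬true {true} f = ⊥-elim (f refl)
        free : containsCopy H emptyG ≡ false
        free = ¬true λ q → let (φ , _ , hosts) = copy⁻ emptyG q in absurd (hosts i j (proj₂ (∈-EH⁻ h))) refl

-- The bound for given parameters.

module Assembly {v : ℕ} (H : Graph v) (n L′ : ℕ) (1≤n : 1 ℕ.≤ n) (reg : Regular H) (s2b : Strictly2Balanced H)
  (r′ Tm M : ℕ) (e≡ : edges H ≡ suc (suc r′)) (Tm≤L : Tm ℕ.≤ suc L′)
  (u₀ : Fin (n ℕ.* n)) (Vu₀ : Codes.Valid n u₀) where
  open import Defs using (Graph; edges; Strictly2Balanced; Regular; edgesK; permutations; eM; totalE; numOrders)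
  open import Data.Fin.Base using (Fin; toℕ)

  open Field
  open Sums
  open Lists
  open Codes n
  open Copies H n
  open Structure H n reg s2b
  open Counting H n reg s2b
  open Hits H n reg s2b
  open Perm
  open Avg L′
  open DT L′ N links
  open WF L′ N links
  open Main L′ N links Valid Gen r′ Tm
  open Transfer L′ N
  open Greedy H n L′
  open import Data.Bool.Base using (true; false; not; T)
  open import Data.Empty using (⊥; ⊥-elim)
  open import Data.Fin.Properties using (toℕ<n) renaming (_≟_ to _≟F_)
  open import Data.Integer.Base using () renaming (+_ to pos)
  open import Data.List.Base using ([]; _∷_; _++_; length; map)
  open import Data.List.Membership.Propositional using (_∈_; _∉_)
  open import Data.List.Relation.Binary.Subset.Propositional using (_⊆_)
  open import Data.List.Relation.Unary.Any using (here; there)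
  open import Data.List.Relation.Unary.All as All using (All; []; _∷_)
  open import Data.List.Relation.Unary.AllPairs using ([]; _∷_)
  open import Data.List.Relation.Unary.Unique.Propositional using (Unique)
  open import Data.Product using (∃; ∃₂; _×_; _,_; proj₁; proj₂)
  open import Data.Sum using (inj₁; inj₂)
  import Data.Nat.ListAction
  open import Data.Unit using (tt)
  open import Data.Vec.Base using ([]; _∷_; lookup)
  open import Relation.Nullary using (yes; no)

  D : ℕ
  D = length (links u₀)

  len-links : ∀ {u} → Valid u → length (links u) ≡ D
  len-links Vu = links-length Vu Vu₀

  len-link : ∀ {u C} → Valid u → C ∈ links u → length C ≡ r
  len-link _ m = ℕ.suc-injective (trans (link-length m) e≡)

  ok-link : ∀ {u C} → Valid u → C ∈ links u → All Valid C × Unique C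
  ok-link _ m = link-ok m

  open Basic len-link ok-link

  -- An edge of C lying in Z has both ends among those of u by genericity, so it is u itself; but u
  -- is not in its own link.
  gen-disj : ∀ {Z u C} → All Valid Z → u ∈ Z → C ∈ links u → T (Gen Z u C) → All (_∉ Z) C
  gen-disj {Z} {u} {C} VZ u∈ C∈ g = All.tabulate λ {x} x∈C x∈Z →
    link-self C∈ (subst (_∈ C) (valid-ext (All.lookup VZ x∈Z) (All.lookup VZ u∈)
      (λ m → All.lookup (gen⁻ Z u C g) (∈-verts⁺ x∈C m) (∈-verts⁺ x∈Z m))) x∈C)

  gen-anti : ∀ X {Z u C} → T (Gen (X ++ Z) u C) → T (Gen Z u C)
  gen-anti X {Z} {u} {C} g = subst T (sym (does⁺ (gen? Z u C) (All.map (λ h m → h (verts-++ X m)) (gen⁻ (X ++ Z) u C g)))) _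

  -- Induction on the tree. A copy that uses an edge of the link attached last coincides with the
  -- copy attached then, by the overlap argument; any other copy was present before. A single edge
  -- is too small to contain a copy.
  copies-inside : ∀ {ζ 𝒴 φ} → Tree ζ 𝒴 → Inj φ → im φ ⊆ dom ζ →
    ∃₂ λ w C → (w , C) ∈ 𝒴 × im φ ⊆ w ∷ C × w ∷ C ⊆ im φ
  copies-inside {φ = φ} (root {f} _ _) inj s = ⊥-elim (1≱3 (ℕ.≤-trans 3≤e (ℕ.≤-trans (ℕ.≤-reflexive (sym (length-im φ))) (unique-⊆-length {ys = f ∷ []} (unique-im inj) s))))
    where
    1≱3 : 3 ℕ.≤ 1 → ⊥
    1≱3 (s≤s ())
  copies-inside {φ = φ} (grow {ζ} {𝒴} {w} {ℓ} {C} vs t w∈ C∈ g bl) inj s with All.all? (λ x → x ∈? dom ζ) (im φ)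
  ... | yes al = let (w′ , C′ , m , a , b) = copies-inside t inj (λ p → All.lookup al p) in w′ , C′ , there m , a , b
  ... | no nal with find (im φ) nal | ∈-links⁻ C∈
    where
    find : ∀ xs → (All (_∈ dom ζ) xs → ⊥) → ∃ λ x → x ∈ xs × x ∉ dom ζ
    find [] h = ⊥-elim (h [])
    find (x ∷ xs) h with x ∈? dom ζ
    ... | yes p = let (y , m , q) = find xs (λ a → h (p ∷ a)) in y , there m , q
    ... | no np = x , here refl , np
  ...   | x₀ , x₀∈ , x₀∉ | ψ , injψ , w∈ψ , refl = w , linkOf ψ w , here refl , to , from
    where
    open Overlap {φ} {ψ} {w} {dom ζ} inj injψ (tree-V t) (∈-dom w∈) w∈ψ (gen⁻ (dom ζ) w (linkOf ψ w) g)
      (λ {x} m → subst (x ∈_) (dom-++ (linkOf ψ w) vs ζ) (s m)) x₀∈ x₀∉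
    to : im φ ⊆ w ∷ linkOf ψ w
    to {x} m with x ≟F w
    ... | yes e = here e
    ... | no ne = there (∈-linkOf⁺ ψ (φ⊆ψ m) ne)
    from : w ∷ linkOf ψ w ⊆ im φ
    from (here refl) = ψ⊆φ w∈ψ
    from (there m) = ψ⊆φ (proj₁ (∈-linkOf⁻ ψ m))

  closed : ∀ {ζ 𝒴 u C} → Tree ζ 𝒴 → u ∈ dom ζ → C ∈ links u → C ⊆ dom ζ →
    ∃₂ λ w C′ → (w , C′) ∈ 𝒴 × (u ∷ C) ⊆ (w ∷ C′) × (w ∷ C′) ⊆ (u ∷ C)
  closed {ζ} {u = u} t u∈ C∈ s with ∈-links⁻ C∈
  ... | φ , inj , u∈φ , refl with copies-inside t inj im⊆
    where
    im⊆ : im φ ⊆ dom ζ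
    im⊆ {x} m with x ≟F u
    ... | yes refl = u∈
    ... | no ne = s (∈-linkOf⁺ φ m ne)
  ...   | w , C′ , m , a , b = w , C′ , m , (λ { (here refl) → a u∈φ ; (there q) → a (proj₁ (∈-linkOf⁻ φ q)) }) , back
    where
    back : w ∷ C′ ⊆ u ∷ linkOf φ u
    back {x} q with x ≟F u
    ... | yes e = here e
    ... | no ne = there (∈-linkOf⁺ φ (b q) ne)

  p : F
  p = ratio Tm

  ratio-mono : ∀ s → s ℕ.≤ Tm → ratio s ≤ p
  ratio-mono s le = avg-mono (λ ℓ → b2F-mono {toℕ ℓ ℕ.<ᵇ s} {toℕ ℓ ℕ.<ᵇ Tm}
    (λ t → ℕ.<⇒<ᵇ (ℕ.<-≤-trans (ℕ.<ᵇ⇒< (toℕ ℓ) s t) le)))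

  p≤1 : p ≤ 1#
  p≤1 = subst (p ≤_) (avg-const 1#) (avg-mono (λ ℓ → b2F≤1 (toℕ ℓ ℕ.<ᵇ Tm)))

  0≤p : 0# ≤ p
  0≤p = 0≤ratio Tm

  -- z bounds the number of known edges, so 2 z bounds the number of their vertices. b is the
  -- resulting bound for the non-generic links at one edge.
  z b : ℕ
  z = suc (M ℕ.* r)
  b = suc (z ℕ.* 2) ℕ.^ v ℕ.* n ℕ.^ (v ∸ 3)

  -- In `partial`, o is the number of edges still to be drawn and j the number of vertices already
  -- prescribed: p ^ o n ^ (v - j) is the order of the expected number of such overlaps. The
  -- inequality in its premise is the one supplied by strict balance.
  module Run (K η : F) (0≤K : 0# ≤ K)
    (partial : ∀ o j → 1 ℕ.≤ o → o ℕ.≤ r → j ℕ.≤ v →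
      (e ∸ o ∸ 1) ℕ.* (v ∸ 2) ℕ.< (e ∸ 1) ℕ.* (j ∸ 2) → p ^ o * ι n ^ (v ∸ j) ≤ K)
    (η-bound : ι z * (ι (suc (z ℕ.* 2)) ^ v * K) ≤ η) (η≤1 : η ≤ 1#) where

    verts-≤ : ∀ {ζ 𝒴} → Tree ζ 𝒴 → length 𝒴 ℕ.≤ M → suc (length (verts (dom ζ))) ℕ.≤ suc (z ℕ.* 2)
    verts-≤ {ζ} t le = s≤s (ℕ.≤-trans (ℕ.≤-reflexive (length-verts (dom ζ)))
      (ℕ.*-monoˡ-≤ 2 (ℕ.≤-trans (ℕ.≤-reflexive (tree-length t)) (s≤s (ℕ.*-monoˡ-≤ r le)))))

    count : ∀ {ζ 𝒴 u} → Tree ζ 𝒴 → length 𝒴 ℕ.≤ M → u ∈ dom ζ →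
      sumL (λ C → b2F (not (Gen (dom ζ) u C))) (links u) ≤ ι b
    count {ζ} t le u∈ = ≤-trans (few-nongeneric 1≤n u∈)
      (≤-trans (*-monoʳ _ (0≤^ (v ∸ 3) (0≤ι n)) (^-mono v (0≤ι _) (ι-mono (verts-≤ t le))))
        (≤-reflexive (trans (cong₂ _*_ (sym (ι-^ _ v)) (sym (ι-^ n (v ∸ 3)))) (sym (ι-* _ _)))))

    inv-^ : ∀ k x → x * ι n ^ k * inv n ^ k ≡ x
    inv-^ k x = trans (*-assoc x _ _) (trans (cong (x *_) (trans (sym (*-^ (ι n) (inv n) k)) (trans (cong (_^ k) (ι-inv′ 1≤n)) (1^ k)))) (*-identityʳ x))

    small : ∀ {ζ 𝒴 u} → Tree ζ 𝒴 → length 𝒴 ℕ.≤ M → u ∈ dom ζ →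
      sumL (ρ p (dom ζ)) (links u) ≤ ι (suc (z ℕ.* 2)) ^ v * K
    small {ζ} {𝒴} {u} t le u∈ = ≤-trans
      (sum-links u (verts (dom ζ)) (ρ p (dom ζ)) W K ρ≥0 0≤K 0≤W (λ j _ → ≤-reflexive (trans (S.solve 3 (λ k a b → k S.:* a S.:* b S.:= k S.:* b S.:* a) refl K _ _) (inv-^ (v ∸ j) K))) bound)
      (*-monoʳ K 0≤K (^-mono v (0≤ι _) (ι-mono (verts-≤ t le))))
      where
      W : ℕ → F
      W j = K * inv n ^ (v ∸ j)
      0≤W : ∀ j → 0# ≤ W j
      0≤W j = 0≤* 0≤K (0≤^ (v ∸ j) (inv-nonneg n))
      ρ≥0 : ∀ C → 0# ≤ ρ p (dom ζ) C
      ρ≥0 C with mixed (length (fresh (dom ζ) C)) (length C)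
      ... | true = 0≤^ (length (fresh (dom ζ) C)) 0≤p
      ... | false = ≤-refl
      mixed⁻ : ∀ o m → mixed o m ≡ true → 1 ℕ.≤ o × o ℕ.< m
      mixed⁻ (suc o) m q = s≤s z≤n , <ᵇ-true {suc o} {m} q
      bound : ∀ φ → Inj φ → u ∈ im φ → ρ p (dom ζ) (linkOf φ u) ≤ W (hits (verts (dom ζ)) φ)
      bound φ inj u∈φ with mixed (length (fresh (dom ζ) (linkOf φ u))) (length (linkOf φ u)) in q
      ... | false = 0≤W (hits (verts (dom ζ)) φ)
      ... | true = ≤-trans (≤-reflexive (sym (inv-^ (v ∸ h) (p ^ o))))
          (*-monoʳ _ (0≤^ (v ∸ h) (inv-nonneg n)) (partial o h (proj₁ lohi) (ℕ.≤-trans (ℕ.<⇒≤ (proj₂ lohi)) (ℕ.≤-reflexive (ℕ.suc-injective (trans (length-linkOf inj u∈φ) e≡)))) (hits-≤ (verts (dom ζ)) φ)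
            (overlap-balance 1≤n (tree-V t) u∈ inj u∈φ (proj₁ lohi) (proj₂ lohi))))
        where
        o = length (fresh (dom ζ) (linkOf φ u))
        h = hits (verts (dom ζ)) φ
        lohi = mixed⁻ o (length (linkOf φ u)) q

    open Hyps len-link ok-link unique-links (λ _ → link-canon) (λ _ → link-self) gen-disj gen-anti closed
      M b p (ι (suc (z ℕ.* 2)) ^ v * K) η 0≤p p≤1 ratio-mono count small
      (0≤* (0≤^ v (0≤ι (suc (z ℕ.* 2)))) 0≤K) η-bound η≤1

    open Density D r
    open Analysis Valid D r′ len-links (λ Vu → All.tabulate (λ m → len-link Vu m , proj₁ (link-ok m))) using (ideal-node; module Cost)

    -- A supersolution for `cost`. Exact would be the factor ratio s ^ r′ in front of `Sy s`;
    -- replacing it by its maximum p ^ r′ makes the recursion linear with constant coefficients,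
    -- hence geometric (`y-closed`).
    mutual
      Sy y : ℕ → F
      Sy zero = 0#
      Sy (suc s) = Sy s + inv L * (1# + ι r * (ι D * y s))
      y s = p ^ r′ * Sy s

    0≤Sy : ∀ s → 0# ≤ Sy s
    0≤Sy zero = ≤-refl
    0≤Sy (suc s) = 0≤+ (0≤Sy s) (0≤* (inv-nonneg L) (0≤+ 0≤1 (0≤* (0≤ι r) (0≤* (0≤ι D) (0≤* (0≤^ r′ 0≤p) (0≤Sy s))))))

    0≤y : ∀ s → 0# ≤ y s
    0≤y s = 0≤* (0≤^ r′ 0≤p) (0≤Sy s)

    Sy-avg : ∀ s → s ℕ.≤ L → Sy s ≡ ratio s + ι r * avg (λ ℓ → below s ℓ * (ι D * y (toℕ ℓ)))
    Sy-avg s le = trans (lem s) (cong₂ (λ x w → x + ι r * w)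
        (trans (sym (avg-below s (λ _ → 1#) le)) (avg-cong (λ ℓ → *-identityʳ _))) (sym (avg-below s (λ i → ι D * y i) le)))
      where
      lem : ∀ s → Sy s ≡ inv L * sumℕ s (λ _ → 1#) + ι r * (inv L * sumℕ s (λ i → ι D * y i))
      lem zero = S.solve 2 (λ i k → S.con (pos 0) S.:= i S.:* S.con (pos 0) S.:+ k S.:* (i S.:* S.con (pos 0))) refl (inv L) (ι r)
      lem (suc s) = trans (cong (_+ inv L * (1# + ι r * (ι D * y s))) (lem s))
        (S.solve 5 (λ i k a b c → i S.:* a S.:+ k S.:* (i S.:* b) S.:+ i S.:* (S.con (pos 1) S.:+ k S.:* c) S.:=
          i S.:* (a S.:+ S.con (pos 1)) S.:+ k S.:* (i S.:* (b S.:+ c))) refl (inv L) (ι r) _ _ (ι D * y s))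

    y-step : ∀ s → s ℕ.≤ Tm →
      ratio s ^ r + E r (λ w → b2F (alive s w) * sumV (λ ℓ → ι D * y (toℕ ℓ)) w) ≤ y s
    y-step s le =
      ratio s ^ r + E r (λ w → b2F (alive s w) * sumV h w)
        ≈⟨ cong (ratio s ^ r +_) (trans (E-cong r (λ w → cong (_* sumV h w) (b2F-alive s w))) (E-prodV-sumV r′ (below s) h)) ⟩
      ratio s * ratio s ^ r′ + ι r * (ratio s ^ r′ * X)
        ≈⟨ S.solve 4 (λ a b k x → a S.:* b S.:+ k S.:* (b S.:* x) S.:= b S.:* (a S.:+ k S.:* x)) refl (ratio s) (ratio s ^ r′) (ι r) X ⟩
      ratio s ^ r′ * (ratio s + ι r * X)
        ≈⟨ cong (ratio s ^ r′ *_) (sym (Sy-avg s (ℕ.≤-trans le Tm≤L))) ⟩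
      ratio s ^ r′ * Sy s
        ≤⟨ *-monoʳ (Sy s) (0≤Sy s) (^-mono r′ (0≤ratio s) (ratio-mono s le)) ⟩
      y s ∎
      where
      h : Fin L → F
      h ℓ = ι D * y (toℕ ℓ)
      X = avg (λ ℓ → below s ℓ * h ℓ)

    open Cost Tm y 0≤y y-step using (cost-node)

    -- The expected size of the explored tree satisfies a linear recursion in the label.
    growth : F
    growth = ι r * ι D * p ^ r′ * inv L

    0≤growth : 0# ≤ growth
    0≤growth = 0≤* (0≤* (0≤* (0≤ι r) (0≤ι D)) (0≤^ r′ 0≤p)) (inv-nonneg L)

    y-closed : ∀ s → 1# + ι r * (ι D * y s) ≡ (1# + growth) ^ s
    y-closed zero = S.solve 3 (λ r d p → S.con (pos 1) S.:+ r S.:* (d S.:* (p S.:* S.con (pos 0))) S.:= S.con (pos 1)) refl (ι r) (ι D) (p ^ r′)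
    y-closed (suc s) = trans
      (S.solve 5 (λ k d p i x → let g = S.con (pos 1) S.:+ k S.:* (d S.:* (p S.:* x)) in
        S.con (pos 1) S.:+ k S.:* (d S.:* (p S.:* (x S.:+ i S.:* g))) S.:=
        (S.con (pos 1) S.:+ k S.:* d S.:* p S.:* i) S.:* g) refl (ι r) (ι D) (p ^ r′) (inv L) (Sy s))
      (cong ((1# + growth) *_) (y-closed s))

    maxCost : F
    maxCost = (1# + growth) ^ Tm

    cost-≤ : ∀ {f} (ℓ : Fin L) → Valid f → toℕ ℓ ℕ.≤ Tm → cost (node L f (toℕ ℓ) (links f) leaf) ≤ maxCost
    cost-≤ {f} ℓ Vf le =
      cost (node L f s (links f) leaf)
        ≤⟨ cost-node L f s (links f) leaf 0# le (All.tabulate (λ m → len-link Vf m , proj₁ (link-ok m))) (λ _ → ≤-refl) ⟩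
      ι (length (links f)) * y s + 0#
        ≈⟨ trans (+-identityʳ _) (cong (λ k → ι k * y s) (len-links Vf)) ⟩
      ι D * y s
        ≤⟨ ≤-trans (≤-trans (≤-reflexive (sym (*-identityˡ _))) (*-monoʳ _ (0≤* (0≤ι D) (0≤y s)) (1≤ι {r} (s≤s z≤n)))) (x≤y+x _ 0≤1) ⟩
      1# + ι r * (ι D * y s)
        ≈⟨ y-closed s ⟩
      (1# + growth) ^ s
        ≤⟨ ^-increasing le ⟩
      maxCost ∎
      where
      s = toℕ ℓ
      1≤1+g : 1# ≤ 1# + growth
      1≤1+g = x≤x+y 1# 0≤growth
      ^-increasing : ∀ {m k} → m ℕ.≤ k → (1# + growth) ^ m ≤ (1# + growth) ^ k
      ^-increasing {k = k} z≤n = 1≤^ k 1≤1+g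
      ^-increasing (s≤s q) = *-monoˡ _ (≤-trans 0≤1 1≤1+g) (^-increasing q)

    err : F
    err = p ^ r * (ι z * ι b) + maxCost * inv (suc M)

    -- The main inequality at the root, where only the label of f is known: no negative answers,
    -- weight 1 and no flagged links. What remains of the subtracted terms is at most `err`.
    accepted-≥ : ∀ {f} ℓ → Valid f → toℕ ℓ ℕ.≤ Tm →
      (1# - η) * (q (toℕ ℓ) - err) ≤ E N (λ β → δ (lookup β f) ℓ * b2F (accL L (toℕ ℓ) (links f) β))
    accepted-≥ {f} ℓ Vf le =
      (1# - η) * (q s - err)
        ≤⟨ *-monoˡ _ 0≤1-η step ⟩
      (1# - η) * bracket t (f ∷ []) [] []
        ≈⟨ cong (_* bracket t (f ∷ []) [] []) (sym (*-identityʳ (1# - η))) ⟩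
      (1# - η) * 1# * bracket t (f ∷ []) [] []
        ≤⟨ main t ((f , ℓ) ∷ []) [] [] (root Vf le) z≤n [] []
             (wf-node Valid (λ _ m → link-ok m) unique-links L f ℓ (links f) leaf ((f , ℓ) ∷ []) [] [] Vf (here refl) (unique-links f) (λ m → m)
               (λ { _ _ (inj₁ ()) ; _ _ (inj₂ ()) }) (λ { _ _ (inj₁ ()) ; _ _ (inj₂ ()) }) (λ _ _ _ _ _ → tt)) ⟩
      real t ((f , ℓ) ∷ []) []
        ≈⟨ E-cong N (λ β → cong₂ _*_ (trans (*-identityʳ _) (*-identityʳ _)) (cong b2F (run-node L f s (links f) leaf β))) ⟩
      E N (λ β → δ (lookup β f) ℓ * b2F (accL L s (links f) β)) ∎
      where
      s = toℕ ℓ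
      t = node L f s (links f) leaf
      ideal≡ : ideal t ≡ q s
      ideal≡ = trans (ideal-node L f s (links f) leaf (ℕ.<⇒≤ (toℕ<n ℓ)) (ℕ.<⇒≤ (toℕ<n ℓ)) (All.tabulate (λ m → len-link Vf m , proj₁ (link-ok m))))
        (trans (S.solve 1 (λ x → x S.:* S.con (pos 1) S.:+ (S.con (pos 1) S.:- x) S.:* S.con (pos 0) S.:= x) refl _)
          (cong ((1# - Q s ^ r) ^_) (len-links Vf)))
      step : q s - err ≤ bracket t (f ∷ []) [] []
      step =
        q s - err
          ≈⟨ S.solve 4 (λ q a m i → q S.:- (a S.:+ m S.:* i) S.:= q S.:- a S.:- m S.:* i) refl (q s) (p ^ r * (ι z * ι b)) maxCost (inv (suc M)) ⟩
        q s - p ^ r * (ι z * ι b) - maxCost * inv (suc M)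
          ≤⟨ sub-monoʳ _ (*-monoʳ _ (inv-nonneg (suc M)) (cost-≤ ℓ Vf le)) ⟩
        q s - p ^ r * (ι z * ι b) - cost t * inv (suc M)
          ≈⟨ cong₂ (λ x c → x - p ^ r * (ι z * ι b) - c * inv (suc M)) (sym ideal≡) (sym (+-identityˡ (cost t))) ⟩
        ideal t - p ^ r * (ι z * ι b) - (0# + cost t) * inv (suc M)
          ≈⟨ cong (λ x → ideal t - p ^ r * x - (0# + cost t) * inv (suc M)) (S.solve 1 (λ x → x S.:= x S.:- S.con (pos 0)) refl (ι z * ι b)) ⟩
        bracket t (f ∷ []) [] [] ∎

    ne-link : ∀ {u C} → C ∈ links u → NonEmpty C
    ne-link m = ℕ.≤-trans (s≤s z≤n) (ℕ.≤-reflexive (sym (ℕ.suc-injective (trans (link-length m) e≡))))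

    cpn : Fin n × Fin n → Fin N
    cpn (i , j) = code i j

    score : Labels → F
    score β = sumL (λ f → below Tm (lookup β (cpn f)) * b2F (Acc ne-link β (cpn f))) (edgesK n)

    valid-edgesK : ∀ {f} → f ∈ edgesK n → Valid (cpn f)
    valid-edgesK {i , j} m = i , j , (λ { refl → ℕ.<-irrefl refl (<ᵇ-true {toℕ i} {toℕ i} (proj₂ (∈-filterB⁻ (λ q → toℕ (proj₁ q) ℕ.<ᵇ toℕ (proj₂ q)) (pairs n) m))) }) , refl

    -- The bound of `accepted-≥` is averaged over the labels below `Tm`: the `q` sum up to `Q Tm`,
    -- and the constant error is met with probability p.
    E-score : ι (length (edgesK n)) * ((1# - η) * (Q Tm - p * err)) ≤ E N score
    E-score =
      ι (length (edgesK n)) * c ≈⟨ sym (sumL-const c (edgesK n)) ⟩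
      sumL (λ _ → c) (edgesK n) ≤⟨ sumL-mono-∈ (edgesK n) each ⟩
      sumL (λ f → E N (λ β → below Tm (lookup β (cpn f)) * b2F (Acc ne-link β (cpn f)))) (edgesK n) ≈⟨ sym (E-sumL N _ (edgesK n)) ⟩
      E N score ∎
      where
      c = (1# - η) * (Q Tm - p * err)
      each : ∀ f → f ∈ edgesK n → c ≤ E N (λ β → below Tm (lookup β (cpn f)) * b2F (Acc ne-link β (cpn f)))
      each f m =
        c ≈⟨ trans (cong (λ x → (1# - η) * (x - p * err)) (sym (Q-avg Tm Tm≤L)))
               (trans (S.solve 4 (λ k x w y → k S.:* (x S.:- w S.:* y) S.:= k S.:* x S.:+ (S.:- (k S.:* y)) S.:* w) refl (1# - η) _ p err)
               (trans (cong₂ _+_ (sym (avg-*ˡ (1# - η) _)) (sym (avg-*ˡ (- ((1# - η) * err)) (below Tm)))) (sym (avg-+ _ _)))) ⟩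
        avg (λ ℓ → (1# - η) * (below Tm ℓ * q (toℕ ℓ)) + (- ((1# - η) * err)) * below Tm ℓ)
          ≤⟨ avg-mono pt ⟩
        avg (λ ℓ → below Tm ℓ * E N (λ β → δ (lookup β g) ℓ * b2F (accL L (toℕ ℓ) (links g) β)))
          ≈⟨ trans (avg-cong (λ ℓ → sym (E-*ˡ N (below Tm ℓ) _))) (sym (E-avg N _)) ⟩
        E N (λ β → avg (λ ℓ → below Tm ℓ * (δ (lookup β g) ℓ * b2F (accL L (toℕ ℓ) (links g) β))))
          ≈⟨ E-cong N (λ β → trans (avg-cong (λ ℓ → S.solve 3 (λ a d x → a S.:* (d S.:* x) S.:= d S.:* (a S.:* x)) refl (below Tm ℓ) (δ (lookup β g) ℓ) _))
               (avg-δ (lookup β g) (λ ℓ → below Tm ℓ * b2F (accL L (toℕ ℓ) (links g) β)))) ⟩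
        E N (λ β → below Tm (lookup β g) * b2F (Acc ne-link β g)) ∎
        where
        g = cpn f
        pt : ∀ ℓ → (1# - η) * (below Tm ℓ * q (toℕ ℓ)) + (- ((1# - η) * err)) * below Tm ℓ ≤
          below Tm ℓ * E N (λ β → δ (lookup β g) ℓ * b2F (accL L (toℕ ℓ) (links g) β))
        pt ℓ = go (toℕ ℓ ℕ.<ᵇ Tm) (λ lt → accepted-≥ ℓ (valid-edgesK m) (ℕ.<⇒≤ (<ᵇ-true {toℕ ℓ} {Tm} lt)))
          where
          go : ∀ bl {k qs er X} → (bl ≡ true → k * (qs - er) ≤ X) →
            k * (b2F bl * qs) + (- (k * er)) * b2F bl ≤ b2F bl * X
          go false {k} {qs} {er} {X} _ = ≤-reflexive (S.solve 4 (λ k q e x → k S.:* (S.con (pos 0) S.:* q) S.:+ (S.:- (k S.:* e)) S.:* S.con (pos 0) S.:= S.con (pos 0) S.:* x) refl k qs er X)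
          go true {k} {qs} {er} {X} h = ≤-trans (≤-reflexive (S.solve 3 (λ k q e → k S.:* (S.con (pos 1) S.:* q) S.:+ (S.:- (k S.:* e)) S.:* S.con (pos 1) S.:= k S.:* (q S.:- e)) refl k qs er))
            (≤-trans (h refl) (≤-reflexive (sym (*-identityˡ X))))

    unique-edgesK : Unique (edgesK n)
    unique-edgesK = unique-filterB _ (unique-pairs n)

    unique-codes : Unique (map cpn (edgesK n))
    unique-codes = unique-map-∈ cpn inj unique-edgesK
      where
      lt : ∀ {i j} → (i , j) ∈ edgesK n → toℕ i ℕ.< toℕ j
      lt {i} {j} m = <ᵇ-true {toℕ i} {toℕ j} (proj₂ (∈-filterB⁻ (λ q → toℕ (proj₁ q) ℕ.<ᵇ toℕ (proj₂ q)) (pairs n) m))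
      inj : ∀ {f g} → f ∈ edgesK n → g ∈ edgesK n → cpn f ≡ cpn g → f ≡ g
      inj {i , j} {k , l} m m′ e with code-inj {i} {j} {k} {l} (λ { refl → ℕ.<-irrefl refl (lt m) }) e
      ... | inj₁ (refl , refl) = refl
      ... | inj₂ (refl , refl) = ⊥-elim (ℕ.<-asym (lt m) (lt m′))

    score-≤ : ∀ β → score β ≤ ι (length (edgesK n))
    score-≤ β = ≤-trans (sumL-mono (λ f → ≤-trans (*-mono (0≤b2F _) 0≤1 (b2F≤1 _) (b2F≤1 _)) (≤-reflexive (*-identityˡ 1#))) (edgesK n))
      (≤-reflexive (trans (sumL-const 1# (edgesK n)) (*-identityʳ _)))

    0≤score : ∀ β → 0# ≤ score β
    0≤score β = sumL-nonneg (λ f → 0≤* (0≤b2F _) (0≤b2F _)) (edgesK n)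

    an-edge : ∃ λ h → h ∈ EH
    an-edge with EH | edges≡
    ... | [] | q with () ← trans (sym e≡) q
    ... | h ∷ _ | _ = h , here refl

    sum-ι : ∀ {A : Set} (f : A → ℕ) xs → ι (Data.Nat.ListAction.sum (map f xs)) ≡ sumL (λ x → ι (f x)) xs
    sum-ι f [] = refl
    sum-ι f (x ∷ xs) = trans (ι-+ (f x) _) (cong (ι (f x) +_) (sum-ι f xs))

    -- The score is at most m, so restricting it to labellings without ties costs at most m times
    -- the probability of a tie.
    result : (let m = length (edgesK n) in
      (ι m * ((1# - η) * (Q Tm - p * err)) - ι m * (ι (m ℕ.* m) * inv L)) * ι (numOrders n) ≤ ι (totalE H n))
    result =
      (ι m * ((1# - η) * (Q Tm - p * err)) - ι m * (ι (m ℕ.* m) * inv L)) * ι (numOrders n)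
        ≤⟨ *-monoʳ _ (0≤ι (numOrders n)) lower ⟩
      E N (λ β → injB cpn (edgesK n) β * score β) * ι (numOrders n)
        ≤⟨ transfer cpn (edgesK n) score (eM H n) unique-codes unique-edgesK 0≤score compare ⟩
      sumL (λ π → ι (eM H n π)) (permutations (edgesK n))
        ≈⟨ sym (sum-ι (eM H n) (permutations (edgesK n))) ⟩
      ι (totalE H n) ∎
      where
      m = length (edgesK n)
      Jn = injB cpn (edgesK n)
      lower : ι m * ((1# - η) * (Q Tm - p * err)) - ι m * (ι (m ℕ.* m) * inv L) ≤ E N (λ β → Jn β * score β)
      lower =
        ι m * ((1# - η) * (Q Tm - p * err)) - ι m * (ι (m ℕ.* m) * inv L)
          ≤⟨ +-mono-≤ E-score (neg-mono (*-monoˡ _ (0≤ι m) 1-Jn)) ⟩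
        E N score - ι m * (1# - E N Jn)
          ≈⟨ trans (cong (λ x → E N score - ι m * x) (sym (E-1- N Jn))) (trans
               (S.solve 3 (λ s m x → s S.:- m S.:* x S.:= s S.:+ (S.:- m) S.:* x) refl (E N score) (ι m) (E N (λ β → 1# - Jn β)))
               (trans (cong (E N score +_) (sym (E-*ˡ N (- ι m) _))) (sym (E-+ N _ _)))) ⟩
        E N (λ β → score β + (- ι m) * (1# - Jn β))
          ≤⟨ E-mono N (λ β → 0≤-⇒≤ (subst (0# ≤_) (S.solve 3 (λ s j m → (m S.:- s) S.:* (S.con (pos 1) S.:- j) S.:= j S.:* s S.:- (s S.:+ (S.:- m) S.:* (S.con (pos 1) S.:- j))) refl (score β) (Jn β) (ι m))
               (0≤* (≤⇒0≤- (score-≤ β)) (≤⇒0≤- (b2F≤1 _))))) ⟩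
        E N (λ β → Jn β * score β) ∎
        where
        1-Jn : 1# - E N Jn ≤ ι (m ℕ.* m) * inv L
        1-Jn = ≤-trans (sub-monoʳ 1# (injB-≥ cpn (edgesK n) unique-codes)) (≤-reflexive (S.solve 1 (λ x → S.con (pos 1) S.:- (S.con (pos 1) S.:- x) S.:= x) refl (ι (m ℕ.* m) * inv L)))
      compare : ∀ β π → π ∈ permutations (edgesK n) → Unique (map (lab cpn β) (edgesK n)) → inc (lab cpn β) 0 π ≡ true → score β ≤ ι (eM H n π)
      compare β π π∈ _ e =
        score β ≤⟨ sumL-mono (λ f → ≤-trans (*-monoʳ _ (0≤b2F _) (b2F≤1 _)) (≤-reflexive (*-identityˡ _))) (edgesK n) ⟩
        sumL (λ f → b2F (Acc ne-link β (cpn f))) (edgesK n) ≤⟨ sumL-⊆ (λ f → b2F (Acc ne-link β (cpn f))) (λ f → 0≤b2F _) unique-edgesK (Arranged.old (arranged (edgesK n) π∈)) ⟩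
        sumL (λ f → b2F (Acc ne-link β (cpn f))) π ≤⟨ greedy-≥ ne-link β (proj₂ an-edge) π π∈ e ⟩
        ι (eM H n π) ∎

-- Numerical estimates for the chosen parameters.

module Final where
  open import Defs using (Graph; edges; Strictly2Balanced; Regular; edgesK; totalE; numOrders)

  open Field
  open Sums
  open import Data.Nat.DivMod using (_/_; m≡m%n+[m/n]*n; m%n<n; m/n*n≤m)
  open import Data.Fin.Base using (Fin; zero; suc)
  open import Data.Integer.Base using () renaming (+_ to pos)
  open import Data.List.Base using (length)
  open import Data.Product using (∃₂; _×_; _,_; proj₁; proj₂)
  open import Data.Nat.Solver using (module +-*-Solver)
  open import Data.Sum using (inj₁; inj₂)

  cancel-ι : ∀ {k x y} → 1 ℕ.≤ k → ι k * x ≤ ι k * y → x ≤ y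
  cancel-ι {k} {x} {y} 1≤k h = subst₂ _≤_ (undo x) (undo y) (*-monoˡ (inv k) (inv-nonneg k) h)
    where
    undo : ∀ x → inv k * (ι k * x) ≡ x
    undo x = trans (sym (*-assoc _ _ x)) (trans (cong (_* x) (trans (*-comm _ _) (ι-inv′ 1≤k))) (*-identityˡ x))

  -- Bernoulli's inequality on blocks of about D/(2κ) factors, each of which contributes at least 1/4.
  power-≥ : ∀ {y} D κ → 0# ≤ y → ι 4 * y ≤ 1# → 1 ℕ.≤ κ → ι D * y ≤ ι κ →
    1# ≤ ι (16 ℕ.^ κ) * (1# - y) ^ D
  power-≥ {y} D κ 0≤y 4y≤1 (s≤s {n = κ′} z≤n) Dy≤κ =
    1#
      ≤⟨ ≤-trans (≤-reflexive (sym (1^ κ))) (^-mono κ 0≤1 sixteen) ⟩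
    (ι 16 * ((1# - y) ^ m * (1# - y) ^ m)) ^ κ
      ≈⟨ trans (*-^ (ι 16) _ κ) (cong₂ _*_ (sym (ι-^ 16 κ)) (trans (cong (_^ κ) (sym (^-+ (1# - y) m m))) (sym (^-* (1# - y) κ (m ℕ.+ m))))) ⟩
    ι (16 ℕ.^ κ) * (1# - y) ^ (κ ℕ.* (m ℕ.+ m))
      ≤⟨ *-monoˡ _ (0≤ι _) (^-anti 0≤1-y (x-y≤x 1# 0≤y) D≤) ⟩
    ι (16 ℕ.^ κ) * (1# - y) ^ D ∎
    where
    k = 2 ℕ.* κ
    m = suc (D / k)
    y≤1 : y ≤ 1#
    y≤1 = ≤-trans (≤-trans (≤-reflexive (sym (*-identityˡ y))) (*-monoʳ y 0≤y (1≤ι {4} (s≤s z≤n)))) 4y≤1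
    0≤1-y : 0# ≤ 1# - y
    0≤1-y = ≤⇒0≤- y≤1
    D≤ : D ℕ.≤ κ ℕ.* (m ℕ.+ m)
    D≤ = ℕ.≤-trans (ℕ.≤-reflexive (m≡m%n+[m/n]*n D k)) (ℕ.≤-trans (ℕ.+-monoˡ-≤ (D / k ℕ.* k) (ℕ.<⇒≤ (m%n<n D k)))
      (ℕ.≤-reflexive (trans (ℕ.*-comm m k) (trans (cong (ℕ._* m) (ℕ.*-comm 2 κ)) (trans (ℕ.*-assoc κ 2 m) (cong (λ z → κ ℕ.* (m ℕ.+ z)) (ℕ.+-identityʳ m)))))))
    bernoulli : ∀ j → 1# - ι j * y ≤ (1# - y) ^ j
    bernoulli zero = ≤-reflexive (S.solve 1 (λ y → S.con (pos 1) S.:- S.con (pos 0) S.:* y S.:= S.con (pos 1)) refl y)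
    bernoulli (suc j) =
      1# - ι (suc j) * y
        ≈⟨ cong (λ z → 1# - z * y) (ι-suc j) ⟩
      1# - (1# + ι j) * y
        ≤⟨ 0≤-⇒≤ (subst (0# ≤_) (S.solve 2 (λ y j → j S.:* (y S.:* y) S.:= (S.con (pos 1) S.:- y) S.:* (S.con (pos 1) S.:- j S.:* y) S.:- (S.con (pos 1) S.:- (S.con (pos 1) S.:+ j) S.:* y)) refl y (ι j)) (0≤* (0≤ι j) (0≤* 0≤y 0≤y))) ⟩
      (1# - y) * (1# - ι j * y)
        ≤⟨ *-monoˡ _ 0≤1-y (bernoulli j) ⟩
      (1# - y) * (1# - y) ^ j ∎
    -- m y = y + (D / k) y is at most 1/4 + 1/2: the first part is the smallness of y, the second
    -- follows from D y ≤ κ and k = 2 κ. Bernoulli then leaves 1/4 per block, and two blocks for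
    -- each unit of κ give the base 16.
    my : ι 4 * (ι m * y) ≤ ι 3
    my = cancel-ι {k} (ℕ.*-mono-≤ {1} {2} {1} {κ} (s≤s z≤n) (s≤s z≤n)) (
      ι k * (ι 4 * (ι m * y))
        ≈⟨ cong (λ z → ι k * (ι 4 * (z * y))) (ι-suc (D / k)) ⟩
      ι k * (ι 4 * ((1# + ι (D / k)) * y))
        ≈⟨ S.solve 3 (λ k d y → k S.:* (S.con (pos 4) S.:* ((S.con (pos 1) S.:+ d) S.:* y)) S.:= k S.:* (S.con (pos 4) S.:* y) S.:+ S.con (pos 4) S.:* ((d S.:* k) S.:* y)) refl (ι k) (ι (D / k)) y ⟩
      ι k * (ι 4 * y) + ι 4 * ((ι (D / k) * ι k) * y)
        ≤⟨ +-mono-≤ (*-monoˡ _ (0≤ι k) 4y≤1) (*-monoˡ _ (0≤ι 4) (≤-trans (*-monoʳ y 0≤y (≤-trans (≤-reflexive (sym (ι-* (D / k) k))) (ι-mono (m/n*n≤m D k)))) Dy≤κ)) ⟩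
      ι k * 1# + ι 4 * ι κ
        ≈⟨ trans (cong (_+ ι 4 * ι κ) (cong (_* 1#) (ι-* 2 κ))) (S.solve 1 (λ κ → S.con (pos 2) S.:* κ S.:* S.con (pos 1) S.:+ S.con (pos 4) S.:* κ S.:= S.con (pos 2) S.:* κ S.:* S.con (pos 3)) refl (ι κ)) ⟩
      ι 2 * ι κ * ι 3
        ≈⟨ cong (_* ι 3) (sym (ι-* 2 κ)) ⟩
      ι k * ι 3 ∎)
    quarter : 1# ≤ ι 4 * (1# - y) ^ m
    quarter = ≤-trans (0≤-⇒≤ (subst (0# ≤_) (S.solve 1 (λ x → S.con (pos 3) S.:- x S.:= (S.con (pos 4) S.:- x) S.:- S.con (pos 1)) refl (ι 4 * (ι m * y))) (≤⇒0≤- my)))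
      (≤-trans (≤-reflexive (S.solve 1 (λ x → S.con (pos 4) S.:- S.con (pos 4) S.:* x S.:= S.con (pos 4) S.:* (S.con (pos 1) S.:- x)) refl (ι m * y)))
        (*-monoˡ _ (0≤ι 4) (bernoulli m)))
    sixteen : 1# ≤ ι 16 * ((1# - y) ^ m * (1# - y) ^ m)
    sixteen = ≤-trans (≤-reflexive (sym (*-identityˡ 1#))) (≤-trans (*-mono 0≤1 (≤-trans 0≤1 quarter) quarter quarter)
      (≤-reflexive (S.solve 1 (λ x → S.con (pos 4) S.:* x S.:* (S.con (pos 4) S.:* x) S.:= S.con (pos 16) S.:* (x S.:* x)) refl ((1# - y) ^ m))))

  -- Since (1 + y) (1 - y) ≤ 1, the power is at most the reciprocal of the one bounded in `power-≥`.
  power-≤ : ∀ {y} D κ → 0# ≤ y → ι 4 * y ≤ 1# → 1 ℕ.≤ κ → ι D * y ≤ ι κ →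
    (1# + y) ^ D ≤ ι (16 ℕ.^ κ)
  power-≤ {y} D κ 0≤y 4y≤1 1≤κ h =
    (1# + y) ^ D
      ≈⟨ sym (*-identityʳ _) ⟩
    (1# + y) ^ D * 1#
      ≤⟨ *-monoˡ _ 0≤^D (power-≥ D κ 0≤y 4y≤1 1≤κ h) ⟩
    (1# + y) ^ D * (ι (16 ℕ.^ κ) * (1# - y) ^ D)
      ≈⟨ trans (S.solve 3 (λ a b c → a S.:* (b S.:* c) S.:= b S.:* (a S.:* c)) refl _ _ _) (cong (ι (16 ℕ.^ κ) *_) (sym (*-^ (1# + y) (1# - y) D))) ⟩
    ι (16 ℕ.^ κ) * ((1# + y) * (1# - y)) ^ D
      ≤⟨ *-monoˡ _ (0≤ι _) (^≤1 D (0≤* (0≤+ 0≤1 0≤y) (≤⇒0≤- y≤1))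
           (0≤-⇒≤ (subst (0# ≤_) (S.solve 1 (λ y → y S.:* y S.:= S.con (pos 1) S.:- (S.con (pos 1) S.:+ y) S.:* (S.con (pos 1) S.:- y)) refl y) (0≤* 0≤y 0≤y)))) ⟩
    ι (16 ℕ.^ κ) * 1#
      ≈⟨ *-identityʳ _ ⟩
    ι (16 ℕ.^ κ) ∎
    where
    y≤1 : y ≤ 1#
    y≤1 = ≤-trans (≤-trans (≤-reflexive (sym (*-identityˡ y))) (*-monoʳ y 0≤y (1≤ι {4} (s≤s z≤n)))) 4y≤1
    0≤^D : 0# ≤ (1# + y) ^ D
    0≤^D = 0≤^ D (0≤+ 0≤1 0≤y)

  ^-reflect : ∀ {a b} w → 1 ℕ.≤ w → a ℕ.^ w ℕ.≤ b ℕ.^ w → a ℕ.≤ b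
  ^-reflect {a} {b} w 1≤w h = ℕ.≮⇒≥ (λ lt → ℕ.<⇒≱ (ℕ.^-monoˡ-< w {{ℕ.>-nonZero 1≤w}} lt) h)

  pow-* : ∀ a b k → (a ℕ.* b) ℕ.^ k ≡ a ℕ.^ k ℕ.* b ℕ.^ k
  pow-* a b zero = refl
  pow-* a b (suc k) = trans (cong (a ℕ.* b ℕ.*_) (pow-* a b k))
    (solve 4 (λ a b c d → a :* b :* (c :* d) := a :* c :* (b :* d)) refl a b (a ℕ.^ k) (b ℕ.^ k))
    where open +-*-Solver

  two-vertices : ∀ {n} → 2 ℕ.≤ n → ∃₂ λ (i j : Fin n) → i ≢ j
  two-vertices (s≤s (s≤s _)) = zero , suc zero , λ ()

  -- Labels below Tm correspond to the edge probability x / a, where 1 / a is about the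
  -- critical value n ^ (- (v - 2) / (e - 1)).
  module Estimate {v : ℕ} (H : Graph v) (reg : Regular H) (s2b : Strictly2Balanced H)
    (r′ : ℕ) (e≡ : edges H ≡ suc (suc r′))
    (n a x κ K₀ : ℕ) (2≤n : 2 ℕ.≤ n) where

    -- `c₁` is the constant in D ≤ c₁ a ^ r: the factor 3 ^ v counts links, and 2 ^ r comes from n ^
    -- w ≤ (2 a) ^ r. `θ` bounds r D p ^ r, the exponent of the expected cost.
    r w c₁ X θ : ℕ
    r = suc r′
    w = v ∸ 2
    c₁ = 3 ℕ.^ v ℕ.* 2 ℕ.^ r
    X = x ℕ.^ r
    θ = r ℕ.* (c₁ ℕ.* X)

    -- `M` makes x maxCost / (M + 1) at most 1/4, as maxCost ≤ 16 ^ θ. `Cz` makes the loss factor η,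
    -- which is z (2 z + 1) ^ v / Cz, equal to 1/2.
    M z Cz : ℕ
    M = 4 ℕ.* x ℕ.* 16 ℕ.^ θ ∸ 1
    z = suc (M ℕ.* r)
    Cz = 2 ℕ.* z ℕ.* suc (z ℕ.* 2) ℕ.^ v

    -- `cond₁` makes the non-generic links negligible (`bad-ℕ`), and `cond₂` the partial overlaps
    -- (`partial-ℕ`).
    module Conditions
      (n^w≤ : n ℕ.^ w ℕ.≤ (2 ℕ.* a) ℕ.^ r)
      (1≤K₀ : 1 ℕ.≤ K₀) (1≤κ : 1 ℕ.≤ κ) (K₀≤κ : c₁ ℕ.* K₀ ℕ.^ r ℕ.≤ κ)
      (16K₀≤x : 16 ℕ.^ κ ℕ.* K₀ ℕ.≤ x) (4K₀≤a : 4 ℕ.* K₀ ℕ.≤ a) (x≤a : x ℕ.≤ a)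
      (cond₁ : 4 ℕ.* x ℕ.* X ℕ.* 2 ℕ.^ r ℕ.* z ℕ.* suc (z ℕ.* 2) ℕ.^ v ℕ.≤ n)
      (cond₂ : (Cz ℕ.* X) ℕ.^ w ℕ.* 2 ℕ.^ (r ℕ.* v) ℕ.≤ a) where

      3≤v : 3 ℕ.≤ v
      3≤v = proj₁ s2b

      1≤n : 1 ℕ.≤ n
      1≤n = ℕ.≤-trans (s≤s z≤n) 2≤n
      1≤x : 1 ℕ.≤ x
      1≤x = ℕ.≤-trans (ℕ.*-mono-≤ (ℕ.m^n>0 16 κ) 1≤K₀) 16K₀≤x
      1≤a : 1 ℕ.≤ a
      1≤a = ℕ.≤-trans 1≤x x≤a

      ia : F
      ia = inv a

      a*ia : ι a * ia ≡ 1#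
      a*ia = ι-inv′ 1≤a

      mE L″ L′ Tm : ℕ
      mE = length (edgesK n)
      -- The number of cells per unit 1 / a. The first summand makes the growth per cell at most
      -- 1/4, as `power-≤` demands; the second makes the probability of a tie at most k / 8.
      L″ = suc (4 ℕ.* θ ℕ.+ 8 ℕ.* (mE ℕ.* mE))
      L′ = a ℕ.* L″ ∸ 1
      Tm = x ℕ.* L″

      L≡ : suc L′ ≡ a ℕ.* L″
      L≡ = ℕ.m+[n∸m]≡n {1} (ℕ.*-mono-≤ {1} {a} {1} {L″} 1≤a (s≤s z≤n))

      Tm≤L : Tm ℕ.≤ suc L′
      Tm≤L = ℕ.≤-trans (ℕ.*-monoˡ-≤ L″ x≤a) (ℕ.≤-reflexive (sym L≡))

      u₀ : Fin (n ℕ.* n)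
      u₀ = Codes.code n (proj₁ (two-vertices 2≤n)) (proj₁ (proj₂ (two-vertices 2≤n)))

      open Avg L′ using (avg; below; avg-below; sumℕ; ratio; avg-cong; 0≤ratio; module Density)

      D b : ℕ
      D = length (Copies.links H n u₀)
      b = suc (z ℕ.* 2) ℕ.^ v ℕ.* n ℕ.^ (v ∸ 3)

      p : F
      p = ratio Tm

      K η : F
      K = inv Cz
      η = inv 2

      ratio≡ : ∀ s → s ℕ.≤ suc L′ → ratio s ≡ inv (suc L′) * ι s
      ratio≡ s le = trans (avg-cong (λ ℓ → sym (*-identityʳ _))) (trans (avg-below s (λ _ → 1#) le) (cong (inv (suc L′) *_) (lem s)))
        where
        lem : ∀ s → sumℕ s (λ _ → 1#) ≡ ι s
        lem zero = refl
        lem (suc s) = trans (cong (_+ 1#) (lem s)) (trans (+-comm _ _) (sym (ι-suc s)))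

      p≡ : p ≡ ι x * ia
      p≡ = trans (ratio≡ Tm Tm≤L) (trans (sym (trans (cong (inv (suc L′) *_) (cong (_* ι Tm) a*ia)) (cong (inv (suc L′) *_) (*-identityˡ (ι Tm)))))
        (trans (cong (λ t → inv (suc L′) * ((ι a * ia) * t)) (ι-* x L″))
        (trans (S.solve 5 (λ i a b x l → i S.:* ((a S.:* b) S.:* (x S.:* l)) S.:= (i S.:* (a S.:* l)) S.:* (x S.:* b)) refl (inv (suc L′)) (ι a) ia (ι x) (ι L″))
        (trans (cong (_* (ι x * ia)) (trans (cong (inv (suc L′) *_) (trans (sym (ι-* a L″)) (cong ι (sym L≡)))) (trans (*-comm _ _) (ι-inv L′)))) (*-identityˡ _)))))

      p^ : ∀ o → p ^ o ≡ ι (x ℕ.^ o) * ia ^ o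
      p^ o = trans (cong (_^ o) p≡) (trans (*-^ (ι x) ia o) (cong (_* ia ^ o) (sym (ι-^ x o))))

      a^*ia^ : ∀ o → ι (a ℕ.^ o) * ia ^ o ≡ 1#
      a^*ia^ o = trans (cong (_* ia ^ o) (ι-^ a o)) (trans (sym (*-^ (ι a) ia o)) (trans (cong (_^ o) a*ia) (1^ o)))

      0≤ia^ : ∀ o → 0# ≤ ia ^ o
      0≤ia^ o = 0≤^ o (inv-nonneg a)

      1≤z : 1 ℕ.≤ z
      1≤z = s≤s z≤n
      1≤Cz : 1 ℕ.≤ Cz
      1≤Cz = ℕ.*-mono-≤ {1} {2 ℕ.* z} {1} (ℕ.*-mono-≤ {1} {2} {1} {z} (s≤s z≤n) 1≤z) (ℕ.m^n>0 (suc (z ℕ.* 2)) v)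
      1≤w : 1 ℕ.≤ w
      1≤w = ℕ.∸-monoˡ-≤ 2 3≤v

      -- Compared after raising to the power w, where n ^ w becomes a power of a. Balance gives r (v
      -- - j) < o w; since these are integers, a full factor a is left over, and by `cond₂` it
      -- absorbs the constants.
      partial-ℕ : ∀ o j → 1 ℕ.≤ o → o ℕ.≤ r → j ℕ.≤ v → (edges H ∸ o ∸ 1) ℕ.* w ℕ.< (edges H ∸ 1) ℕ.* (j ∸ 2) →
        Cz ℕ.* (x ℕ.^ o ℕ.* n ℕ.^ (v ∸ j)) ℕ.≤ a ℕ.^ o
      partial-ℕ o j 1≤o o≤r j≤v bal = ^-reflect w 1≤w (ℕ.≤-trans (ℕ.≤-reflexive eq₁) (ℕ.≤-trans
          (ℕ.*-mono-≤ (ℕ.^-monoˡ-≤ w (ℕ.*-monoʳ-≤ Cz (ℕ.^-monoʳ-≤ x {{ℕ.>-nonZero 1≤x}} o≤r)))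
            (ℕ.≤-trans (ℕ.^-monoˡ-≤ k n^w≤) (ℕ.≤-reflexive (trans (ℕ.^-*-assoc (2 ℕ.* a) r k) (pow-* 2 a (r ℕ.* k))))))
          (ℕ.≤-trans (ℕ.≤-reflexive (sym (ℕ.*-assoc ((Cz ℕ.* X) ℕ.^ w) (2 ℕ.^ (r ℕ.* k)) (a ℕ.^ (r ℕ.* k)))))
            (ℕ.≤-trans (ℕ.*-monoˡ-≤ (a ℕ.^ (r ℕ.* k)) (ℕ.≤-trans (ℕ.*-monoʳ-≤ ((Cz ℕ.* X) ℕ.^ w) (ℕ.^-monoʳ-≤ 2 (ℕ.*-monoʳ-≤ r (ℕ.m∸n≤m v j)))) cond₂))
              (ℕ.≤-trans (ℕ.^-monoʳ-≤ a {{ℕ.>-nonZero 1≤a}} rk<) (ℕ.≤-reflexive (sym (ℕ.^-*-assoc a o w))))))))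
        where
        k = v ∸ j
        eq₁ : (Cz ℕ.* (x ℕ.^ o ℕ.* n ℕ.^ k)) ℕ.^ w ≡ (Cz ℕ.* x ℕ.^ o) ℕ.^ w ℕ.* (n ℕ.^ w) ℕ.^ k
        eq₁ = trans (cong (ℕ._^ w) (sym (ℕ.*-assoc Cz _ _))) (trans (pow-* (Cz ℕ.* x ℕ.^ o) (n ℕ.^ k) w)
          (cong ((Cz ℕ.* x ℕ.^ o) ℕ.^ w ℕ.*_) (trans (ℕ.^-*-assoc n k w) (trans (cong (n ℕ.^_) (ℕ.*-comm k w)) (sym (ℕ.^-*-assoc n w k))))))
        2≤j : 2 ℕ.≤ j
        2≤j = ℕ.≮⇒≥ (λ lt → ℕ.n≮0 (subst ((edges H ∸ o ∸ 1) ℕ.* w ℕ.<_) (trans (cong ((edges H ∸ 1) ℕ.*_) (ℕ.m≤n⇒m∸n≡0 (ℕ.<⇒≤ lt))) (ℕ.*-zeroʳ (edges H ∸ 1))) bal))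
        bal′ : (r ∸ o) ℕ.* w ℕ.< r ℕ.* (j ∸ 2)
        bal′ = subst₂ (λ s t → s ℕ.* w ℕ.< t ℕ.* (j ∸ 2)) (trans (ℕ.∸-+-assoc (edges H) o 1) (trans (cong₂ _∸_ e≡ (ℕ.+-comm o 1)) refl)) (cong (_∸ 1) e≡) bal
        w≡ : k ℕ.+ (j ∸ 2) ≡ w
        w≡ = trans (sym (ℕ.+-∸-assoc k 2≤j)) (cong (_∸ 2) (ℕ.m∸n+n≡m j≤v))
        rk< : suc (r ℕ.* k) ℕ.≤ o ℕ.* w
        rk< = ℕ.+-cancelʳ-< ((r ∸ o) ℕ.* w) (r ℕ.* k) (o ℕ.* w) (ℕ.<-≤-trans (ℕ.+-monoʳ-< (r ℕ.* k) bal′)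
          (ℕ.≤-reflexive (trans (sym (ℕ.*-distribˡ-+ r k (j ∸ 2))) (trans (cong (r ℕ.*_) w≡) (trans (cong (ℕ._* w) (sym (ℕ.m+[n∸m]≡n o≤r))) (ℕ.*-distribʳ-+ w o (r ∸ o)))))))

      partial : ∀ o j → 1 ℕ.≤ o → o ℕ.≤ r → j ℕ.≤ v → (edges H ∸ o ∸ 1) ℕ.* (v ∸ 2) ℕ.< (edges H ∸ 1) ℕ.* (j ∸ 2) →
        p ^ o * ι n ^ (v ∸ j) ≤ K
      partial o j h₁ h₂ h₃ h₄ = cancel-ι {Cz} 1≤Cz (
        ι Cz * (p ^ o * ι n ^ (v ∸ j))
          ≈⟨ cong₂ (λ s t → ι Cz * (s * t)) (p^ o) (sym (ι-^ n (v ∸ j))) ⟩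
        ι Cz * (ι (x ℕ.^ o) * ia ^ o * ι (n ℕ.^ (v ∸ j)))
          ≈⟨ S.solve 4 (λ c x i n → c S.:* (x S.:* i S.:* n) S.:= (c S.:* (x S.:* n)) S.:* i) refl _ _ _ _ ⟩
        ι Cz * (ι (x ℕ.^ o) * ι (n ℕ.^ (v ∸ j))) * ia ^ o
          ≈⟨ cong (_* ia ^ o) (sym (trans (ι-* Cz _) (cong (ι Cz *_) (ι-* _ _)))) ⟩
        ι (Cz ℕ.* (x ℕ.^ o ℕ.* n ℕ.^ (v ∸ j))) * ia ^ o
          ≤⟨ *-monoʳ _ (0≤ia^ o) (ι-mono (partial-ℕ o j h₁ h₂ h₃ h₄)) ⟩
        ι (a ℕ.^ o) * ia ^ o
          ≈⟨ trans (a^*ia^ o) (sym (ι-inv′ 1≤Cz)) ⟩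
        ι Cz * K ∎)

      two-half : ι 2 * η ≡ 1#
      two-half = ι-inv 1

      η-bound : ι z * (ι (suc (z ℕ.* 2)) ^ v * K) ≤ η
      η-bound = cancel-ι {2} (s≤s z≤n) (≤-reflexive (
        trans (S.solve 4 (λ two z b k → two S.:* (z S.:* (b S.:* k)) S.:= (two S.:* z S.:* b) S.:* k) refl (ι 2) (ι z) (ι (suc (z ℕ.* 2)) ^ v) K)
        (trans (cong (_* K) (sym (trans (ι-* (2 ℕ.* z) _) (cong₂ _*_ (ι-* 2 z) (ι-^ (suc (z ℕ.* 2)) v)))))
        (trans (ι-inv′ 1≤Cz) (sym two-half)))))

      η≤1 : η ≤ 1#
      η≤1 = cancel-ι {2} (s≤s z≤n) (≤-trans (≤-reflexive two-half) (≤-trans (1≤ι {2} (s≤s z≤n)) (≤-reflexive (sym (*-identityʳ _)))))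

      open Density D r using (Q)

      growth maxCost err : F
      growth = ι r * ι D * p ^ r′ * inv (suc L′)
      maxCost = (1# + growth) ^ Tm
      err = p ^ r * (ι z * ι b) + maxCost * inv (suc M)

      D≤ : D ℕ.≤ c₁ ℕ.* a ℕ.^ r
      D≤ = ι-reflect (≤-trans (Hits.few-links H n reg s2b 1≤n u₀)
        (≤-trans (≤-reflexive (trans (cong₂ _*_ (sym (ι-^ 3 v)) (sym (ι-^ n (v ∸ 2)))) (sym (ι-* _ _))))
          (ι-mono (ℕ.≤-trans (ℕ.*-monoʳ-≤ (3 ℕ.^ v) n^w≤) (ℕ.≤-reflexive (trans (cong (3 ℕ.^ v ℕ.*_) (pow-* 2 a r)) (sym (ℕ.*-assoc (3 ℕ.^ v) _ _))))))))

      D*ia^r : ∀ t → ι D * (ι t * ia ^ r) ≤ ι (c₁ ℕ.* t)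
      D*ia^r t =
        ι D * (ι t * ia ^ r)
          ≤⟨ *-monoʳ _ (0≤* (0≤ι t) (0≤ia^ r)) (ι-mono D≤) ⟩
        ι (c₁ ℕ.* a ℕ.^ r) * (ι t * ia ^ r)
          ≈⟨ trans (cong (_* (ι t * ia ^ r)) (ι-* c₁ (a ℕ.^ r))) (S.solve 4 (λ c a t i → c S.:* a S.:* (t S.:* i) S.:= c S.:* t S.:* (a S.:* i)) refl _ _ _ _) ⟩
        ι c₁ * ι t * (ι (a ℕ.^ r) * ia ^ r)
          ≈⟨ trans (cong (ι c₁ * ι t *_) (a^*ia^ r)) (trans (*-identityʳ _) (sym (ι-* c₁ t))) ⟩
        ι (c₁ ℕ.* t) ∎

      L : ℕ
      L = suc L′

      unit-share : ∀ s → s ℕ.≤ L → inv L * ι s ≤ 1#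
      unit-share s le = ≤-trans (*-monoˡ _ (inv-nonneg L) (ι-mono le)) (≤-reflexive (trans (*-comm _ _) (ι-inv L′)))

      q-range : ∀ {Qs} → 0# ≤ Qs → Qs ≤ 1# → 0# ≤ (1# - Qs ^ r) ^ D × (1# - Qs ^ r) ^ D ≤ 1#
      q-range {Qs} lo hi = 0≤^ D 0≤1-Q , ^≤1 D 0≤1-Q (x-y≤x 1# (0≤^ r lo))
        where
        0≤1-Q : 0# ≤ 1# - Qs ^ r
        0≤1-Q = ≤⇒0≤- (^≤1 r lo hi)

      Q-range : ∀ s → s ℕ.≤ L → 0# ≤ Q s × Q s ≤ inv L * ι s
      Q-range zero _ = ≤-refl , ≤-reflexive (sym (zeroʳ _))
      Q-range (suc s) le =
        let (lo , hi) = Q-range s (ℕ.<⇒≤ le)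
            (lo′ , hi′) = q-range lo (≤-trans hi (unit-share s (ℕ.<⇒≤ le)))
        in 0≤+ lo (0≤* (inv-nonneg L) lo′) ,
           ≤-trans (+-mono-≤ hi (*-monoˡ _ (inv-nonneg L) hi′)) (≤-reflexive (trans (S.solve 2 (λ i s → i S.:* s S.:+ i S.:* S.con (pos 1) S.:= i S.:* (S.con (pos 1) S.:+ s)) refl (inv L) (ι s)) (cong (inv L *_) (sym (ι-suc s)))))

      Q≤1 : ∀ s → s ℕ.≤ L → Q s ≤ 1#
      Q≤1 s le = ≤-trans (proj₂ (Q-range s le)) (unit-share s le)

      Q-mono : ∀ s k → s ℕ.+ k ℕ.≤ L → Q s ≤ Q (s ℕ.+ k)
      Q-mono s zero _ = ≤-reflexive (cong Q (sym (ℕ.+-identityʳ s)))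
      Q-mono s (suc k) le = ≤-trans (Q-mono s k le′) (≤-trans (x≤x+y _ (0≤* (inv-nonneg L) (proj₁ (q-range (proj₁ (Q-range (s ℕ.+ k) le′)) (Q≤1 (s ℕ.+ k) le′)))))
        (≤-reflexive (cong Q (sym (ℕ.+-suc s k)))))
        where
        le′ : s ℕ.+ k ℕ.≤ L
        le′ = ℕ.≤-trans (ℕ.+-monoʳ-≤ s (ℕ.n≤1+n k)) le

      k : F
      k = ι K₀ * ia

      0≤k : 0# ≤ k
      0≤k = 0≤* (0≤ι K₀) (inv-nonneg a)

      4k≤1 : ι 4 * k ≤ 1#
      4k≤1 = ≤-trans (≤-reflexive (trans (sym (*-assoc _ _ _)) (cong (_* ia) (sym (ι-* 4 K₀))))) (≤-trans (*-monoʳ ia (inv-nonneg a) (ι-mono 4K₀≤a)) (≤-reflexive a*ia))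

      k≤1 : k ≤ 1#
      k≤1 = ≤-trans (≤-trans (≤-reflexive (sym (*-identityˡ k))) (*-monoʳ k 0≤k (1≤ι {4} (s≤s z≤n)))) 4k≤1

      k^r≤k : k ^ r ≤ k
      k^r≤k = ≤-trans (*-monoˡ k 0≤k (^≤1 r′ 0≤k k≤1)) (≤-reflexive (*-identityʳ k))

      G : F
      G = (1# - k ^ r) ^ D

      0≤G : 0# ≤ G
      0≤G = proj₁ (q-range 0≤k k≤1)

      G-large : 1# ≤ ι (16 ℕ.^ κ) * G
      G-large = power-≥ D κ (0≤^ r 0≤k) (≤-trans (*-monoˡ _ (0≤ι 4) k^r≤k) 4k≤1) 1≤κ
        (≤-trans (≤-reflexive (cong (ι D *_) (trans (*-^ (ι K₀) ia r) (cong (_* ia ^ r) (sym (ι-^ K₀ r))))))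
          (≤-trans (D*ia^r (K₀ ℕ.^ r)) (ι-mono K₀≤κ)))

      pG≥k : k ≤ p * G
      pG≥k =
        k ≈⟨ sym (*-identityʳ k) ⟩
        k * 1# ≤⟨ *-monoˡ k 0≤k G-large ⟩
        ι K₀ * ia * (ι (16 ℕ.^ κ) * G) ≈⟨ trans (S.solve 4 (λ k i s g → k S.:* i S.:* (s S.:* g) S.:= (s S.:* k) S.:* i S.:* g) refl (ι K₀) ia (ι (16 ℕ.^ κ)) G) (cong (λ t → t * ia * G) (sym (ι-* (16 ℕ.^ κ) K₀))) ⟩
        ι (16 ℕ.^ κ ℕ.* K₀) * ia * G ≤⟨ *-monoʳ G 0≤G (*-monoʳ ia (inv-nonneg a) (ι-mono 16K₀≤x)) ⟩
        ι x * ia * G ≈⟨ cong (_* G) (sym p≡) ⟩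
        p * G ∎

      -- As long as Q stays below k, it grows at rate at least G.
      Q-large : k ≤ Q Tm
      Q-large with ≤-total k (Q Tm)
      ... | inj₁ le = le
      ... | inj₂ ge = ≤-trans pG≥k (≤-trans (≤-reflexive (cong (_* G) (ratio≡ Tm Tm≤L))) (grow Tm ℕ.≤-refl))
        where
        grow : ∀ s → s ℕ.≤ Tm → inv L * ι s * G ≤ Q s
        grow zero _ = ≤-reflexive (trans (cong (_* G) (zeroʳ _)) (zeroˡ G))
        grow (suc s) le =
          inv L * ι (suc s) * G
            ≈⟨ trans (cong (λ t → inv L * t * G) (ι-suc s)) (S.solve 3 (λ i s g → i S.:* (S.con (pos 1) S.:+ s) S.:* g S.:= i S.:* s S.:* g S.:+ i S.:* g) refl (inv L) (ι s) G) ⟩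
          inv L * ι s * G + inv L * G
            ≤⟨ +-mono-≤ (grow s (ℕ.<⇒≤ le)) (*-monoˡ _ (inv-nonneg L) (^-mono D (≤⇒0≤- (^≤1 r 0≤k k≤1)) (sub-monoʳ 1# (^-mono r (proj₁ (Q-range s s≤L)) Qs≤k)))) ⟩
          Q (suc s) ∎
          where
          s≤L : s ℕ.≤ L
          s≤L = ℕ.≤-trans (ℕ.<⇒≤ le) Tm≤L
          Qs≤k : Q s ≤ k
          Qs≤k = ≤-trans (≤-trans (Q-mono s (Tm ∸ s) (ℕ.≤-trans (ℕ.≤-reflexive (ℕ.m+[n∸m]≡n (ℕ.<⇒≤ le))) Tm≤L)) (≤-reflexive (cong Q (ℕ.m+[n∸m]≡n (ℕ.<⇒≤ le))))) ge

      1≤X : 1 ℕ.≤ X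
      1≤X = ℕ.m^n>0 x {{ℕ.>-nonZero 1≤x}} r

      1≤θ : 1 ℕ.≤ θ
      1≤θ = ℕ.*-mono-≤ {1} {r} (s≤s z≤n) (ℕ.*-mono-≤ {1} {c₁} (ℕ.*-mono-≤ (ℕ.m^n>0 3 v) (ℕ.m^n>0 2 r)) 1≤X)

      growth-Tm : ι Tm * growth ≤ ι θ
      growth-Tm =
        ι Tm * (ι r * ι D * p ^ r′ * inv L)
          ≈⟨ S.solve 5 (λ t r d q i → t S.:* (r S.:* d S.:* q S.:* i) S.:= r S.:* (d S.:* ((i S.:* t) S.:* q))) refl (ι Tm) (ι r) (ι D) (p ^ r′) (inv L) ⟩
        ι r * (ι D * ((inv L * ι Tm) * p ^ r′))
          ≈⟨ cong (λ t → ι r * (ι D * t)) (trans (cong (_* p ^ r′) (sym (ratio≡ Tm Tm≤L))) (p^ r)) ⟩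
        ι r * (ι D * (ι X * ia ^ r))
          ≤⟨ *-monoˡ _ (0≤ι r) (D*ia^r X) ⟩
        ι r * ι (c₁ ℕ.* X)
          ≈⟨ sym (ι-* r (c₁ ℕ.* X)) ⟩
        ι θ ∎

      4θ≤Tm : 4 ℕ.* θ ℕ.≤ Tm
      4θ≤Tm = ℕ.≤-trans (ℕ.≤-trans (ℕ.m≤m+n (4 ℕ.* θ) _) (ℕ.n≤1+n _)) (ℕ.≤-trans (ℕ.≤-reflexive (sym (ℕ.*-identityˡ L″))) (ℕ.*-monoˡ-≤ L″ 1≤x))

      4growth≤1 : ι 4 * growth ≤ 1#
      4growth≤1 = cancel-ι {Tm} (ℕ.≤-trans (ℕ.*-mono-≤ {1} {4} (s≤s z≤n) 1≤θ) 4θ≤Tm)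
        (≤-trans (≤-reflexive (S.solve 2 (λ t g → t S.:* (S.con (pos 4) S.:* g) S.:= S.con (pos 4) S.:* (t S.:* g)) refl (ι Tm) growth))
        (≤-trans (*-monoˡ _ (0≤ι 4) growth-Tm) (≤-trans (≤-reflexive (sym (ι-* 4 θ))) (≤-trans (ι-mono 4θ≤Tm) (≤-reflexive (sym (*-identityʳ _)))))))

      maxCost≤ : maxCost ≤ ι (16 ℕ.^ θ)
      maxCost≤ = power-≤ Tm θ (0≤* (0≤* (0≤* (0≤ι r) (0≤ι D)) (0≤^ r′ (0≤ratio Tm))) (inv-nonneg L)) 4growth≤1 1≤θ growth-Tm

      -- A non-generic link has one free vertex fewer than the w = v - 2 of a link in general; the
      -- factor n thus saved absorbs the constants by `cond₁`.
      bad-ℕ : 4 ℕ.* x ℕ.* X ℕ.* z ℕ.* suc (z ℕ.* 2) ℕ.^ v ℕ.* n ℕ.^ (v ∸ 3) ℕ.≤ a ℕ.^ r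
      bad-ℕ = ℕ.*-cancelʳ-≤ _ _ (2 ℕ.^ r) {{ℕ.m^n≢0 2 r}} (ℕ.≤-trans (ℕ.≤-reflexive (regroup (4 ℕ.* x ℕ.* X) z (suc (z ℕ.* 2) ℕ.^ v) (n ℕ.^ (v ∸ 3)) (2 ℕ.^ r)))
        (ℕ.≤-trans (ℕ.*-monoˡ-≤ (n ℕ.^ (v ∸ 3)) cond₁) (ℕ.≤-trans (ℕ.≤-reflexive (cong (n ℕ.^_) (sym (ℕ.+-∸-assoc 1 3≤v))))
          (ℕ.≤-trans n^w≤ (ℕ.≤-reflexive (trans (pow-* 2 a r) (ℕ.*-comm (2 ℕ.^ r) _)))))))
        where
        regroup : ∀ q z s m t → q ℕ.* z ℕ.* s ℕ.* m ℕ.* t ≡ q ℕ.* t ℕ.* z ℕ.* s ℕ.* m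
        regroup = +-*-Solver.solve 5 (λ q z s m t → q +-*-Solver.:* z +-*-Solver.:* s +-*-Solver.:* m +-*-Solver.:* t +-*-Solver.:= q +-*-Solver.:* t +-*-Solver.:* z +-*-Solver.:* s +-*-Solver.:* m) refl

      err₁ : ι 4 * (ι x * (p ^ r * (ι z * ι b))) ≤ 1#
      err₁ =
        ι 4 * (ι x * (p ^ r * (ι z * ι b)))
          ≈⟨ cong₂ (λ s t → ι 4 * (ι x * (s * (ι z * t)))) (p^ r) (ι-* (suc (z ℕ.* 2) ℕ.^ v) (n ℕ.^ (v ∸ 3))) ⟩
        ι 4 * (ι x * (ι X * ia ^ r * (ι z * (ι (suc (z ℕ.* 2) ℕ.^ v) * ι (n ℕ.^ (v ∸ 3))))))
          ≈⟨ S.solve 7 (λ f x c i z s m → f S.:* (x S.:* (c S.:* i S.:* (z S.:* (s S.:* m)))) S.:= f S.:* x S.:* c S.:* z S.:* s S.:* m S.:* i) refl (ι 4) (ι x) (ι X) (ia ^ r) (ι z) _ _ ⟩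
        ι 4 * ι x * ι X * ι z * ι (suc (z ℕ.* 2) ℕ.^ v) * ι (n ℕ.^ (v ∸ 3)) * ia ^ r
          ≈⟨ cong (_* ia ^ r) (sym (trans (ι-* _ (n ℕ.^ (v ∸ 3))) (cong (_* ι (n ℕ.^ (v ∸ 3))) (trans (ι-* _ (suc (z ℕ.* 2) ℕ.^ v)) (cong (_* ι (suc (z ℕ.* 2) ℕ.^ v)) (trans (ι-* (4 ℕ.* x ℕ.* X) z) (cong (_* ι z) (trans (ι-* (4 ℕ.* x) X) (cong (_* ι X) (ι-* 4 x)))))))))) ⟩
        ι (4 ℕ.* x ℕ.* X ℕ.* z ℕ.* suc (z ℕ.* 2) ℕ.^ v ℕ.* n ℕ.^ (v ∸ 3)) * ia ^ r
          ≤⟨ *-monoʳ _ (0≤ia^ r) (ι-mono bad-ℕ) ⟩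
        ι (a ℕ.^ r) * ia ^ r
          ≈⟨ a^*ia^ r ⟩
        1# ∎

      sucM≡ : suc M ≡ 4 ℕ.* x ℕ.* 16 ℕ.^ θ
      sucM≡ = ℕ.m+[n∸m]≡n {1} (ℕ.*-mono-≤ {1} {4 ℕ.* x} (ℕ.*-mono-≤ {1} {4} (s≤s z≤n) 1≤x) (ℕ.m^n>0 16 θ))

      err₂ : ι 4 * (ι x * (maxCost * inv (suc M))) ≤ 1#
      err₂ =
        ι 4 * (ι x * (maxCost * inv (suc M)))
          ≈⟨ S.solve 4 (λ f x m i → f S.:* (x S.:* (m S.:* i)) S.:= f S.:* x S.:* m S.:* i) refl (ι 4) (ι x) maxCost (inv (suc M)) ⟩
        ι 4 * ι x * maxCost * inv (suc M)
          ≤⟨ *-monoʳ _ (inv-nonneg (suc M)) (*-monoˡ _ (0≤* (0≤ι 4) (0≤ι x)) maxCost≤) ⟩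
        ι 4 * ι x * ι (16 ℕ.^ θ) * inv (suc M)
          ≈⟨ cong (_* inv (suc M)) (trans (trans (cong (_* ι (16 ℕ.^ θ)) (sym (ι-* 4 x))) (sym (ι-* (4 ℕ.* x) (16 ℕ.^ θ)))) (cong ι (sym sucM≡))) ⟩
        ι (suc M) * inv (suc M)
          ≈⟨ ι-inv M ⟩
        1# ∎

      p-err : p * err ≤ k * η
      p-err =
        p * err ≈⟨ trans (cong (_* err) p≡) (S.solve 3 (λ x i e → x S.:* i S.:* e S.:= i S.:* (x S.:* e)) refl (ι x) ia err) ⟩
        ia * (ι x * err) ≤⟨ *-monoˡ _ (inv-nonneg a) (cancel-ι {4} (s≤s z≤n) x-err) ⟩
        ia * η ≤⟨ *-monoʳ η (inv-nonneg 2) ia≤k ⟩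
        k * η ∎
        where
        x-err : ι 4 * (ι x * err) ≤ ι 4 * η
        x-err = ≤-trans (≤-reflexive (S.solve 4 (λ f x a b → f S.:* (x S.:* (a S.:+ b)) S.:= f S.:* (x S.:* a) S.:+ f S.:* (x S.:* b)) refl (ι 4) (ι x) (p ^ r * (ι z * ι b)) (maxCost * inv (suc M))))
          (≤-trans (+-mono-≤ err₁ err₂) (≤-reflexive (trans (cong₂ _+_ (sym two-half) (sym two-half)) (S.solve 1 (λ h → S.con (pos 2) S.:* h S.:+ S.con (pos 2) S.:* h S.:= S.con (pos 4) S.:* h) refl η))))
        ia≤k : ia ≤ k
        ia≤k = ≤-trans (≤-reflexive (sym (*-identityˡ ia))) (*-monoʳ ia (inv-nonneg a) (1≤ι 1≤K₀))

      half-left : k * η ≤ Q Tm - p * err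
      half-left = ≤-trans (≤-reflexive (trans (S.solve 2 (λ k h → k S.:* h S.:= k S.:* (S.con (pos 2) S.:* h) S.:- k S.:* h) refl k η) (cong (λ t → k * t - k * η) two-half)))
        (+-mono-≤ (≤-trans (≤-reflexive (*-identityʳ k)) Q-large) (neg-mono p-err))

      ties : ι 8 * (ι (mE ℕ.* mE) * inv L) ≤ k
      ties = cancel-ι {L} (s≤s z≤n) (
        ι L * (ι 8 * (ι (mE ℕ.* mE) * inv L))
          ≈⟨ S.solve 4 (λ l e m i → l S.:* (e S.:* (m S.:* i)) S.:= (e S.:* m) S.:* (l S.:* i)) refl (ι L) (ι 8) (ι (mE ℕ.* mE)) (inv L) ⟩
        ι 8 * ι (mE ℕ.* mE) * (ι L * inv L)
          ≈⟨ trans (cong₂ _*_ (sym (ι-* 8 (mE ℕ.* mE))) (ι-inv L′)) (*-identityʳ _) ⟩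
        ι (8 ℕ.* (mE ℕ.* mE))
          ≤⟨ ι-mono (ℕ.≤-trans (ℕ.m≤n+m _ (4 ℕ.* θ)) (ℕ.n≤1+n _)) ⟩
        ι L″
          ≈⟨ trans (sym (*-identityʳ _)) (trans (cong (ι L″ *_) (sym a*ia)) (trans (S.solve 3 (λ l a i → l S.:* (a S.:* i) S.:= (a S.:* l) S.:* i) refl (ι L″) (ι a) ia) (cong (_* ia) (trans (sym (ι-* a L″)) (cong ι (sym L≡)))))) ⟩
        ι L * ia
          ≤⟨ *-monoˡ _ (0≤ι L) (≤-trans (≤-reflexive (sym (*-identityˡ ia))) (*-monoʳ ia (inv-nonneg a) (1≤ι 1≤K₀))) ⟩
        ι L * k ∎)

      -- `Q Tm` is at least k. Half of that survives `err`, half again the factor 1 - η, and ties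
      -- cost a further eighth of k, so k / 8 remains for each edge.
      estimate : mE ℕ.* K₀ ℕ.* numOrders n ℕ.≤ 8 ℕ.* a ℕ.* totalE H n
      estimate = ι-reflect (
        ι (mE ℕ.* K₀ ℕ.* numOrders n)
          ≈⟨ trans (ι-* (mE ℕ.* K₀) _) (cong (_* O) (ι-* mE K₀)) ⟩
        ι mE * ι K₀ * O
          ≈⟨ trans (sym (*-identityʳ _)) (trans (cong (ι mE * ι K₀ * O *_) (sym a*ia)) (S.solve 5 (λ m k o a i → m S.:* k S.:* o S.:* (a S.:* i) S.:= a S.:* (m S.:* (k S.:* i) S.:* o)) refl (ι mE) (ι K₀) O (ι a) ia)) ⟩
        ι a * (ι mE * k * O)
          ≤⟨ *-monoˡ _ (0≤ι a) (*-monoʳ O (0≤ι (numOrders n)) core) ⟩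
        ι a * (ι 8 * Sc * O)
          ≈⟨ S.solve 4 (λ a e s o → a S.:* (e S.:* s S.:* o) S.:= (e S.:* a) S.:* (s S.:* o)) refl (ι a) (ι 8) Sc O ⟩
        ι 8 * ι a * (Sc * O)
          ≤⟨ *-monoˡ _ (0≤* (0≤ι 8) (0≤ι a)) (Assembly.Run.result H n L′ 1≤n reg s2b r′ Tm M e≡ Tm≤L u₀ (_ , _ , proj₂ (proj₂ (two-vertices 2≤n)) , refl)
             K η (inv-nonneg Cz) partial η-bound η≤1) ⟩
        ι 8 * ι a * ι (totalE H n)
          ≈⟨ sym (trans (ι-* (8 ℕ.* a) _) (cong (_* ι (totalE H n)) (ι-* 8 a))) ⟩
        ι (8 ℕ.* a ℕ.* totalE H n) ∎)
        where
        O = ι (numOrders n)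
        Sc = ι mE * ((1# - η) * (Q Tm - p * err)) - ι mE * (ι (mE ℕ.* mE) * inv L)
        1-η : 1# - η ≡ η
        1-η = trans (cong (_- η) (sym two-half)) (S.solve 1 (λ h → S.con (pos 2) S.:* h S.:- h S.:= h) refl η)
        core : ι mE * k ≤ ι 8 * Sc
        core =
          ι mE * k
            ≈⟨ trans (S.solve 2 (λ m k → m S.:* k S.:= m S.:* (S.con (pos 2) S.:* (S.con (pos 1) S.:* S.con (pos 1)) S.:* k) S.:- m S.:* k) refl (ι mE) k)
                 (trans (cong (λ t → ι mE * (ι 2 * (t * t) * k) - ι mE * k) (sym two-half))
                 (S.solve 3 (λ m k h → m S.:* (S.con (pos 2) S.:* (S.con (pos 2) S.:* h S.:* (S.con (pos 2) S.:* h)) S.:* k) S.:- m S.:* k S.:= m S.:* (S.con (pos 8) S.:* (h S.:* (k S.:* h))) S.:- m S.:* k) refl (ι mE) k η)) ⟩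
          ι mE * (ι 8 * (η * (k * η))) - ι mE * k
            ≤⟨ +-mono-≤ (*-monoˡ _ (0≤ι mE) (*-monoˡ _ (0≤ι 8) (*-monoˡ _ (inv-nonneg 2) half-left))) (neg-mono (*-monoˡ _ (0≤ι mE) ties)) ⟩
          ι mE * (ι 8 * (η * (Q Tm - p * err))) - ι mE * (ι 8 * (ι (mE ℕ.* mE) * inv L))
            ≈⟨ trans (S.solve 4 (λ m e b c → m S.:* (e S.:* b) S.:- m S.:* (e S.:* c) S.:= e S.:* (m S.:* b S.:- m S.:* c)) refl (ι mE) (ι 8) (η * (Q Tm - p * err)) (ι (mE ℕ.* mE) * inv L))
                 (cong (λ t → ι 8 * (ι mE * (t * (Q Tm - p * err)) - ι mE * (ι (mE ℕ.* mE) * inv L))) (sym 1-η)) ⟩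
          ι 8 * Sc ∎

-- Choice of the parameters as functions of n.

module Theorem where
  open import Defs hiding (sym; irrefl)
  open import Data.Nat using (ℕ; _+_; _*_; _∸_; _^_; _≤_; _<_; zero; suc; z≤n; s≤s; NonZero; >-nonZero; ⌊_/2⌋; _<ᵇ_)
  open import Data.Product using (Σ; _×_; _,_; proj₁; proj₂; ∃)
  open import Data.Nat.Properties
  open import Data.Nat.DivMod using (_/_; _%_; m≡m%n+[m/n]*n; m%n<n; m/n*n≤m; m*n/n≡m; /-monoˡ-≤)
  open import Data.Nat.Induction using (<-rec)
  open import Data.Nat.Logarithm using (⌊log₂_⌋; ⌊log₂⌋-mono-≤; ⌊log₂⌊n/2⌋⌋≡⌊log₂n⌋∸1; ⌊log₂[2^n]⌋≡n)
  open import Data.Nat.Solver using (module +-*-Solver)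
  open import Data.Bool.Base using (Bool; true; not; T)
  open import Data.Empty using (⊥; ⊥-elim)
  open import Data.Fin.Base using (toℕ)
  open import Data.Fin.Properties using (toℕ-injective)
  open import Data.List.Base using ([]; _∷_; length; map; _++_; allFin; concatMap)
  open import Data.List.Properties using (length-map; length-++; length-tabulate)
  open import Data.List.Membership.Propositional using (_∈_)
  open import Data.List.Membership.Propositional.Properties using (∈-map⁺; ∈-++⁺ˡ; ∈-++⁺ʳ; ∈-allFin)
  open import Function.Base using (id)
  open import Relation.Nullary using (yes; no)
  open import Relation.Binary.Definitions using (tri<; tri≈; tri>)
  open Lists

  -- Integer roots stand in for the real quantities: applied to n ^ w for the inverse critical
  -- density a, and applied to m for K.
  root : ∀ r m → 1 ≤ r → ∃ λ k → k ^ r ≤ m × m < suc k ^ r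
  root (suc r) zero _ = 0 , z≤n , ≤-reflexive (sym (^-zeroˡ (suc r)))
  root r (suc m) 1≤r with root r m 1≤r
  ... | k , lo , hi with suc k ^ r ≤? suc m
  ...   | yes le = suc k , le , ≤-<-trans hi (^-monoˡ-< r {{>-nonZero 1≤r}} (n<1+n (suc k)))
  ...   | no gt = k , ≤-trans lo (n≤1+n m) , ≰⇒> gt

  n<2^n : ∀ n → n < 2 ^ n
  n<2^n zero = s≤s z≤n
  n<2^n (suc n) = ≤-trans (+-mono-≤ {1} (m^n>0 2 n) (n<2^n n)) (≤-reflexive (cong (2 ^ n +_) (sym (+-identityʳ (2 ^ n)))))

  2^log≤ : ∀ n → 1 ≤ n → 2 ^ ⌊log₂ n ⌋ ≤ n
  2^log≤ = <-rec _ step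
    where
    step : ∀ n → (∀ {m} → m < n → 1 ≤ m → 2 ^ ⌊log₂ m ⌋ ≤ m) → 1 ≤ n → 2 ^ ⌊log₂ n ⌋ ≤ n
    step (suc zero) _ _ = ≤-refl
    step n@(suc (suc k)) rec _ = ≤-trans (≤-reflexive (cong (2 ^_) (sym (m+[n∸m]≡n 1≤log))))
      (≤-trans (*-monoʳ-≤ 2 (≤-trans (≤-reflexive (cong (2 ^_) (sym (⌊log₂⌊n/2⌋⌋≡⌊log₂n⌋∸1 n)))) (rec (⌊n/2⌋<n (suc k)) (s≤s z≤n))))
        (≤-trans (≤-reflexive (cong (⌊ n /2⌋ +_) (+-identityʳ ⌊ n /2⌋))) (≤-trans (+-monoʳ-≤ ⌊ n /2⌋ (⌊n/2⌋≤⌈n/2⌉ n)) (≤-reflexive (⌊n/2⌋+⌈n/2⌉≡n n)))))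
      where
      1≤log : 1 ≤ ⌊log₂ n ⌋
      1≤log = ≤-trans (≤-reflexive (sym (⌊log₂[2^n]⌋≡n 1))) (⌊log₂⌋-mono-≤ {2} {n} (s≤s (s≤s z≤n)))

  -- A pair that is not increasing is a reversed edge or lies on the diagonal, so n ^ 2 ≤ 2 m + n.
  -- Doubling this and using 2 n ≤ n ^ 2 gives the claim.
  many-edges : ∀ n → 2 ≤ n → n * n ≤ 4 * length (edgesK n)
  many-edges n 2≤n = +-cancelʳ-≤ (n * n) _ _ (begin
      n * n + n * n
        ≤⟨ +-mono-≤ total total ⟩
      (m + (m + n)) + (m + (m + n))
        ≡⟨ solve 2 (λ m n → (m :+ (m :+ n)) :+ (m :+ (m :+ n)) := con 4 :* m :+ con 2 :* n) refl m n ⟩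
      4 * m + 2 * n
        ≤⟨ +-monoʳ-≤ (4 * m) (*-monoˡ-≤ n 2≤n) ⟩
      4 * m + n * n ∎)
    where
    open ≤-Reasoning
    open +-*-Solver
    m = length (edgesK n)
    up : Edge n → Bool
    up p = toℕ (proj₁ p) <ᵇ toℕ (proj₂ p)
    incl : ∀ {p} → p ∈ filterB (λ p → not (up p)) (pairs n) →
      p ∈ map (λ q → proj₂ q , proj₁ q) (edgesK n) ++ map (λ i → i , i) (allFin n)
    incl {i , j} q with <-cmp (toℕ i) (toℕ j)
    ... | tri< lt _ _ = ⊥-elim (not-lt (proj₂ (∈-filterB⁻ (λ p → not (up p)) (pairs n) q)))
      where
      not-lt : not (up (i , j)) ≡ true → ⊥
      not-lt e with up (i , j) | <⇒<ᵇ lt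
      not-lt () | true | _
    ... | tri≈ _ e _ with toℕ-injective e
    ...   | refl = ∈-++⁺ʳ (map (λ q → proj₂ q , proj₁ q) (edgesK n)) (∈-map⁺ (λ i → i , i) (∈-allFin i))
    incl {i , j} q | tri> _ _ gt = ∈-++⁺ˡ (∈-map⁺ (λ q → proj₂ q , proj₁ q) (∈-filterB⁺ up (∈-pairs j i) (lt-true (<⇒<ᵇ gt))))
      where
      lt-true : ∀ {b} → T b → b ≡ true
      lt-true {true} _ = refl
    go : ∀ is → length (concatMap (λ i → map (λ j → i , j) (allFin n)) is) ≡ length is * length (allFin n)
    go [] = refl
    go (i ∷ is) = trans (length-++ (map (λ j → i , j) (allFin n))) (cong₂ _+_ (length-map _ (allFin n)) (go is))
    total : n * n ≤ m + (m + n)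
    total = begin
      n * n
        ≡⟨ sym (trans (go (allFin n)) (cong₂ _*_ (length-tabulate {n = n} id) (length-tabulate {n = n} id))) ⟩
      length (pairs n)
        ≡⟨ sym (filterB-split up (pairs n)) ⟩
      m + length (filterB (λ p → not (up p)) (pairs n))
        ≤⟨ +-monoʳ-≤ m (unique-⊆-length (unique-filterB _ (unique-pairs n)) incl) ⟩
      m + length (map (λ q → proj₂ q , proj₁ q) (edgesK n) ++ map (λ i → i , i) (allFin n))
        ≡⟨ cong (m +_) (trans (length-++ (map (λ q → proj₂ q , proj₁ q) (edgesK n))) (cong₂ _+_ (length-map _ (edgesK n)) (trans (length-map _ (allFin n)) (length-tabulate {n = n} id)))) ⟩
      m + (m + n) ∎

  module Growth (X : ℕ) (1≤X : 1 ≤ X) where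

    -- Membership in 2 ^ O(X) with an explicit constant, so that sizes can be estimated factor by
    -- factor.
    infix 4 _⊴_
    _⊴_ : ℕ → ℕ → Set
    t ⊴ c = t ≤ 2 ^ (c * X)

    ⊴-* : ∀ {s t c d} → s ⊴ c → t ⊴ d → s * t ⊴ c + d
    ⊴-* {c = c} {d} p q = ≤-trans (*-mono-≤ p q) (≤-reflexive (trans (sym (^-distribˡ-+-* 2 (c * X) (d * X))) (cong (2 ^_) (sym (*-distribʳ-+ X c d)))))

    ⊴-^ : ∀ {s c} k → s ⊴ c → s ^ k ⊴ k * c
    ⊴-^ {s} {c} k p = ≤-trans (^-monoˡ-≤ k p) (≤-reflexive (trans (^-*-assoc 2 (c * X) k) (cong (2 ^_) (trans (*-comm (c * X) k) (sym (*-assoc k c X))))))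

    ⊴-2^ : ∀ k → 2 ^ k ⊴ k
    ⊴-2^ k = ^-monoʳ-≤ 2 (≤-trans (≤-reflexive (sym (*-identityʳ k))) (*-monoʳ-≤ k 1≤X))

    ⊴-≤X : ∀ {t} → t ≤ X → t ⊴ 1
    ⊴-≤X p = ≤-trans p (≤-trans (<⇒≤ (n<2^n X)) (≤-reflexive (cong (2 ^_) (sym (*-identityˡ X)))))

    ⊴-const : ∀ k → k ⊴ k
    ⊴-const k = ≤-trans (<⇒≤ (n<2^n k)) (⊴-2^ k)

  module Choice {v : ℕ} (H : Graph v) (reg : Regular H) (s2b : Strictly2Balanced H)
    (r′ : ℕ) (e≡ : edges H ≡ suc (suc r′)) where

    r w c₁ c₂ C : ℕ
    r = suc r′
    w = v ∸ 2
    c₁ = 3 ^ v * 2 ^ r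
    c₂ = 4 * c₁ + 1
    C = 2 * r * c₂

    -- Constants in the sense of `_⊴_` for M + 1, z, 2 z + 1, Cz, the left side of the first size
    -- condition, and the r-th power of the left side of the second. Each is added up along the
    -- factors of the quantity it bounds.
    cM cz cs cC c₄ c₅ c₆ : ℕ
    cM = 2 + 1 + 4 * (r * c₁)
    cz = cM + r
    cs = 2 + cz
    cC = 1 + cz + v * cs
    c₄ = 2 + 1 + 1 + r + cz + v * cs
    c₅ = r * (w * (cC + 1) + r * v)
    c₆ = c₄ + c₅

    -- Its iterated logarithm is c₆ C, which makes m at least c₆.
    n₀ : ℕ
    n₀ = 2 ^ (2 ^ (c₆ * C))

    instance
      C≢0 : NonZero C
      C≢0 = >-nonZero (*-mono-≤ {1} {2 * r} (s≤s z≤n) (m≤n+m 1 (4 * c₁)))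

    1≤w : 1 ≤ w
    1≤w = ∸-monoˡ-≤ 2 (proj₁ s2b)

    -- C is chosen so that X * X ≤ 2 ^ loglog n, which makes every error term 2 ^ (O (X)) at most n.
    module _ (n : ℕ) (n₀≤n : n₀ ≤ n) where

      ll m : ℕ
      ll = loglog n
      m = ll / C

      c₆≤m : c₆ ≤ m
      c₆≤m = ≤-trans (≤-reflexive (sym (m*n/n≡m c₆ C))) (/-monoˡ-≤ C (≤-trans (≤-reflexive (sym (⌊log₂[2^n]⌋≡n (c₆ * C))))
        (⌊log₂⌋-mono-≤ (≤-trans (≤-reflexive (sym (⌊log₂[2^n]⌋≡n (2 ^ (c₆ * C))))) (⌊log₂⌋-mono-≤ n₀≤n)))))

      1≤m : 1 ≤ m
      1≤m = ≤-trans (s≤s z≤n) c₆≤m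

      kroot = root r m (s≤s z≤n)
      K₀ = proj₁ kroot

      aroot = root r (n ^ w) (s≤s z≤n)
      a = proj₁ aroot

      κ x : ℕ
      κ = c₁ * m
      -- 16 ^ κ is the loss in the growth of Q, and 2 ^ m exceeds K₀; so at density x times critical
      -- Q has reached K₀ times critical.
      x = 2 ^ (4 * κ + m)

      2≤n : 2 ≤ n
      2≤n = ≤-trans (^-monoʳ-≤ 2 {1} (m^n>0 2 (c₆ * C))) n₀≤n

      open Final.Estimate H reg s2b r′ e≡ n a x κ K₀ 2≤n using (X; θ; M; z; Cz)

      1≤x : 1 ≤ x
      1≤x = m^n>0 2 (4 * κ + m)

      x≤X : x ≤ X
      x≤X = ≤-trans (≤-reflexive (sym (^-identityʳ x))) (^-monoʳ-≤ x {{>-nonZero 1≤x}} {1} {r} (s≤s z≤n))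

      m≤x : m ≤ x
      m≤x = ≤-trans (<⇒≤ (n<2^n m)) (^-monoʳ-≤ 2 (m≤n+m m (4 * κ)))

      1≤X : 1 ≤ X
      1≤X = ≤-trans 1≤x x≤X

      open Growth X 1≤X

      θ≤ : 16 ^ θ ⊴ 4 * (r * c₁)
      θ≤ = ≤-reflexive (trans (^-*-assoc 2 4 θ) (cong (2 ^_) (trans (cong (4 *_) (sym (*-assoc r c₁ X))) (sym (*-assoc 4 (r * c₁) X)))))

      M≤ : 4 * x * 16 ^ θ ⊴ cM
      M≤ = ⊴-* {c = 2 + 1} {d = 4 * (r * c₁)} (⊴-* {c = 2} {d = 1} (⊴-2^ 2) (⊴-≤X x≤X)) θ≤

      z≤ : z ⊴ cz
      z≤ = ≤-trans zle (⊴-* {c = cM} {d = r} M≤ (⊴-const r))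
        where
        zle : z ≤ 4 * x * 16 ^ θ * r
        zle = ≤-trans (+-monoˡ-≤ (M * r) (s≤s {0} {r′} z≤n)) (≤-reflexive (cong (_* r) (m+[n∸m]≡n {1} (*-mono-≤ {1} {4 * x} (*-mono-≤ {1} {4} (s≤s z≤n) 1≤x) (m^n>0 16 θ)))))

      s≤ : suc (z * 2) ⊴ cs
      s≤ = ≤-trans sle (⊴-* {c = 2} {d = cz} (⊴-2^ 2) z≤)
        where
        open +-*-Solver
        sle : suc (z * 2) ≤ 4 * z
        sle = ≤-trans (+-monoˡ-≤ (z * 2) (≤-trans (s≤s z≤n) (m≤m+n z z))) (≤-reflexive (solve 1 (λ z → z :+ z :+ z :* con 2 := con 4 :* z) refl z))

      s^v≤ : suc (z * 2) ^ v ⊴ v * cs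
      s^v≤ = ⊴-^ v s≤

      cond₁⊴ : 4 * x * X * 2 ^ r * z * suc (z * 2) ^ v ⊴ c₄
      cond₁⊴ = ⊴-* {c = 2 + 1 + 1 + r + cz} {d = v * cs} (⊴-* {c = 2 + 1 + 1 + r} {d = cz} (⊴-* {c = 2 + 1 + 1} {d = r}
        (⊴-* {c = 2 + 1} {d = 1} (⊴-* {c = 2} {d = 1} (⊴-2^ 2) (⊴-≤X x≤X)) (⊴-≤X ≤-refl)) (⊴-2^ r)) z≤) s^v≤

      B₀ : ℕ
      B₀ = (Cz * X) ^ w * 2 ^ (r * v)

      B₀⊴ : B₀ ^ r ⊴ c₅
      B₀⊴ = ⊴-^ {c = w * (cC + 1) + r * v} r (⊴-* {c = w * (cC + 1)} {d = r * v} (⊴-^ {c = cC + 1} w (⊴-* {c = cC} {d = 1}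
        (⊴-* {c = 1 + cz} {d = v * cs} (⊴-* {c = 1} {d = cz} (⊴-2^ 1) z≤) s^v≤) (⊴-≤X ≤-refl))) (⊴-2^ (r * v)))

      1≤log : 1 ≤ ⌊log₂ n ⌋
      1≤log = ≤-trans (m^n>0 2 (c₆ * C)) (≤-trans (≤-reflexive (sym (⌊log₂[2^n]⌋≡n (2 ^ (c₆ * C))))) (⌊log₂⌋-mono-≤ n₀≤n))

      1≤n : 1 ≤ n
      1≤n = ≤-trans (m^n>0 2 (2 ^ (c₆ * C))) n₀≤n

      XX≤ : X * X ≤ 2 ^ ll
      XX≤ = begin
        X * X
          ≡⟨ cong₂ _*_ X≡ X≡ ⟩
        2 ^ ((4 * κ + m) * r) * 2 ^ ((4 * κ + m) * r)
          ≡⟨ sym (^-distribˡ-+-* 2 ((4 * κ + m) * r) ((4 * κ + m) * r)) ⟩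
        2 ^ ((4 * κ + m) * r + (4 * κ + m) * r)
          ≡⟨ cong (2 ^_) (solve 3 (λ c m r → (con 4 :* (c :* m) :+ m) :* r :+ (con 4 :* (c :* m) :+ m) :* r := m :* (con 2 :* r :* (con 4 :* c :+ con 1))) refl c₁ m r) ⟩
        2 ^ (m * C)
          ≤⟨ ^-monoʳ-≤ 2 (m/n*n≤m ll C) ⟩
        2 ^ ll ∎
        where
        open ≤-Reasoning
        open +-*-Solver
        X≡ : X ≡ 2 ^ ((4 * κ + m) * r)
        X≡ = ^-*-assoc 2 (4 * κ + m) r

      -- c₆ ≤ m ≤ x ≤ X, so c₆ X is at most X * X, which the choice of C keeps below the binary
      -- logarithm of n.
      2^c₆X≤n : 2 ^ (c₆ * X) ≤ n
      2^c₆X≤n = ≤-trans (^-monoʳ-≤ 2 (≤-trans (*-monoˡ-≤ X (≤-trans c₆≤m (≤-trans m≤x x≤X))) (≤-trans XX≤ (2^log≤ ⌊log₂ n ⌋ 1≤log)))) (2^log≤ n 1≤n)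

      ⊴⇒≤n : ∀ {t c} → c ≤ c₆ → t ⊴ c → t ≤ n
      ⊴⇒≤n c≤ p = ≤-trans p (≤-trans (^-monoʳ-≤ 2 (*-monoˡ-≤ X c≤)) 2^c₆X≤n)

      -- Otherwise a + 1 ≤ B₀, and (a + 1) ^ r would be at most B₀ ^ r ≤ n ≤ n ^ w, against the
      -- choice of a as integer root.
      B₀≤a : B₀ ≤ a
      B₀≤a = ≮⇒≥ λ lt → <⇒≱ (proj₂ (proj₂ aroot)) (≤-trans (^-monoˡ-≤ r lt) (≤-trans (⊴⇒≤n {c = c₅} (m≤n+m c₅ c₄) B₀⊴)
        (≤-trans (≤-reflexive (sym (^-identityʳ n))) (^-monoʳ-≤ n {{>-nonZero 1≤n}} 1≤w))))

      4≤Cz : 4 ≤ Cz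
      4≤Cz = *-mono-≤ {2} {2 * z} {2} (*-mono-≤ {2} {2} {1} {z} ≤-refl (s≤s z≤n))
        (≤-trans (≤-trans (s≤s (s≤s z≤n)) (≤-reflexive (sym (^-identityʳ (suc (z * 2)))))) (^-monoʳ-≤ (suc (z * 2)) {1} {v} (≤-trans (s≤s z≤n) (proj₁ s2b))))

      CzX≤a : Cz * X ≤ a
      CzX≤a = ≤-trans (≤-trans (≤-trans (≤-reflexive (sym (^-identityʳ (Cz * X)))) (^-monoʳ-≤ (Cz * X) {{>-nonZero 1≤CzX}} 1≤w))
        (≤-trans (≤-reflexive (sym (*-identityʳ _))) (*-monoʳ-≤ ((Cz * X) ^ w) (m^n>0 2 (r * v))))) B₀≤a
        where
        1≤CzX : 1 ≤ Cz * X
        1≤CzX = *-mono-≤ {1} {Cz} (≤-trans (s≤s z≤n) 4≤Cz) 1≤X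

      1≤K₀ : 1 ≤ K₀
      1≤K₀ = ≮⇒≥ λ { (s≤s z) → <⇒≱ (proj₂ (proj₂ kroot)) (≤-trans (≤-reflexive (trans (cong (λ k → suc k ^ r) (n≤0⇒n≡0 z)) (^-zeroˡ r))) 1≤m) }

      K₀≤m : K₀ ≤ m
      K₀≤m = ≤-trans (≤-trans (≤-reflexive (sym (^-identityʳ K₀))) (^-monoʳ-≤ K₀ {{>-nonZero 1≤K₀}} {1} {r} (s≤s z≤n))) (proj₁ (proj₂ kroot))

      x≤a : x ≤ a
      x≤a = ≤-trans x≤X (≤-trans (≤-trans (≤-reflexive (sym (*-identityˡ X))) (*-monoˡ-≤ X (≤-trans (s≤s z≤n) 4≤Cz))) CzX≤a)

      4K₀≤a : 4 * K₀ ≤ a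
      4K₀≤a = ≤-trans (*-mono-≤ 4≤Cz (≤-trans K₀≤m (≤-trans m≤x x≤X))) CzX≤a

      1≤a : 1 ≤ a
      1≤a = ≤-trans 1≤x x≤a

      suc≤2* : ∀ {k} → 1 ≤ k → suc k ≤ 2 * k
      suc≤2* {k} p = ≤-trans (+-monoˡ-≤ k p) (≤-reflexive (cong (k +_) (sym (+-identityʳ k))))

      16K₀≤x : 16 ^ κ * K₀ ≤ x
      16K₀≤x = ≤-trans (*-mono-≤ (≤-reflexive (^-*-assoc 2 4 κ)) (≤-trans K₀≤m (<⇒≤ (n<2^n m)))) (≤-reflexive (sym (^-distribˡ-+-* 2 (4 * κ) m)))

      estimate : length (edgesK n) * K₀ * numOrders n ≤ 8 * a * totalE H n
      estimate = Final.Estimate.Conditions.estimate H reg s2b r′ e≡ n a x κ K₀ 2≤n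
        (≤-trans (<⇒≤ (proj₂ (proj₂ aroot))) (^-monoˡ-≤ r (suc≤2* 1≤a)))
        1≤K₀ (*-mono-≤ {1} {c₁} (*-mono-≤ (m^n>0 3 v) (m^n>0 2 r)) 1≤m)
        (*-monoʳ-≤ c₁ (proj₁ (proj₂ kroot))) 16K₀≤x 4K₀≤a x≤a
        (⊴⇒≤n {c = c₄} (m≤m+n c₄ c₅) cond₁⊴) B₀≤a

      ll≤ : ll ≤ C * 2 ^ r * K₀ ^ r
      ll≤ = begin
        ll                   ≡⟨ m≡m%n+[m/n]*n ll C ⟩
        ll % C + m * C       ≤⟨ +-monoˡ-≤ (m * C) (<⇒≤ (m%n<n ll C)) ⟩
        suc m * C            ≤⟨ *-monoˡ-≤ C (proj₂ (proj₂ kroot)) ⟩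
        suc K₀ ^ r * C       ≤⟨ *-monoˡ-≤ C (^-monoˡ-≤ r (suc≤2* 1≤K₀)) ⟩
        (2 * K₀) ^ r * C     ≡⟨ trans (cong (_* C) (Final.pow-* 2 K₀ r)) (solve 3 (λ a b c → a :* b :* c := c :* a :* b) refl (2 ^ r) (K₀ ^ r) C) ⟩
        C * 2 ^ r * K₀ ^ r   ∎
        where
        open ≤-Reasoning
        open +-*-Solver

      -- The r-th power of the statement that the expectation is at least n ^ 2 K₀ / (32 a), with K₀
      -- ^ r of order log log n and a ^ r ≤ n ^ w. The constant 32 is 4 from the number of edges
      -- times 8 from the estimate.
      bound : 1 * numOrders n ^ r * n ^ (2 * r) * ll ≤ C * 2 ^ r * 32 ^ r * totalE H n ^ r * n ^ w
      bound = begin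
        1 * O ^ r * n ^ (2 * r) * ll
          ≤⟨ *-monoʳ-≤ (1 * O ^ r * n ^ (2 * r)) ll≤ ⟩
        1 * O ^ r * n ^ (2 * r) * (C * 2 ^ r * K₀ ^ r)
          ≡⟨ cong (λ t → 1 * O ^ r * t * (C * 2 ^ r * K₀ ^ r)) (trans (sym (^-*-assoc n 2 r)) (cong (_^ r) (cong (n *_) (*-identityʳ n)))) ⟩
        1 * O ^ r * (n * n) ^ r * (C * 2 ^ r * K₀ ^ r)
          ≡⟨ solve 5 (λ o n c d k → con 1 :* o :* n :* (c :* d :* k) := c :* d :* (n :* k :* o)) refl (O ^ r) ((n * n) ^ r) C (2 ^ r) (K₀ ^ r) ⟩
        C * 2 ^ r * ((n * n) ^ r * K₀ ^ r * O ^ r)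
          ≡⟨ cong (C * 2 ^ r *_) (sym (trans (Final.pow-* (n * n * K₀) O r) (cong (_* O ^ r) (Final.pow-* (n * n) K₀ r)))) ⟩
        C * 2 ^ r * (n * n * K₀ * O) ^ r
          ≤⟨ *-monoʳ-≤ (C * 2 ^ r) (^-monoˡ-≤ r scaled) ⟩
        C * 2 ^ r * (32 * a * S) ^ r
          ≡⟨ cong (C * 2 ^ r *_) (trans (Final.pow-* (32 * a) S r) (cong (_* S ^ r) (Final.pow-* 32 a r))) ⟩
        C * 2 ^ r * (32 ^ r * a ^ r * S ^ r)
          ≡⟨ solve 4 (λ c b a s → c :* (b :* a :* s) := c :* b :* s :* a) refl (C * 2 ^ r) (32 ^ r) (a ^ r) (S ^ r) ⟩
        C * 2 ^ r * 32 ^ r * S ^ r * a ^ r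
          ≤⟨ *-monoʳ-≤ (C * 2 ^ r * 32 ^ r * S ^ r) (proj₁ (proj₂ aroot)) ⟩
        C * 2 ^ r * 32 ^ r * S ^ r * n ^ w ∎
        where
        open ≤-Reasoning
        open +-*-Solver
        O = numOrders n
        S = totalE H n
        scaled : n * n * K₀ * O ≤ 32 * a * S
        scaled = begin
          n * n * K₀ * O                        ≤⟨ *-monoˡ-≤ O (*-monoˡ-≤ K₀ (many-edges n 2≤n)) ⟩
          4 * length (edgesK n) * K₀ * O        ≡⟨ solve 3 (λ m k o → con 4 :* m :* k :* o := con 4 :* (m :* k :* o)) refl (length (edgesK n)) K₀ O ⟩
          4 * (length (edgesK n) * K₀ * O)      ≤⟨ *-monoʳ-≤ 4 estimate ⟩
          4 * (8 * a * S)                       ≡⟨ solve 2 (λ a s → con 4 :* (con 8 :* a :* s) := con 32 :* a :* s) refl a S ⟩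
          32 * a * S                            ∎

open Theorem using (module Choice)
open import Defs hiding (sym)
open import Data.Nat using (ℕ; _+_; _*_; _∸_; _^_; _≤_; _<_)
open import Data.Product using (Σ; _×_; _,_; proj₁; proj₂)

theorem1 : ∀ {v} (H : Graph v) → Regular H → Strictly2Balanced H →
    Σ ℕ λ p → Σ ℕ λ q → Σ ℕ λ n₀ → (1 ≤ p) ×
    (∀ n → n₀ ≤ n →
    p * numOrders n ^ (edges H ∸ 1) * n ^ (2 * (edges H ∸ 1)) * loglog n
    ≤ q * totalE H n ^ (edges H ∸ 1) * n ^ (v ∸ 2))
theorem1 {v} H reg s2b = 1 , A.C * 2 ^ A.r * 32 ^ A.r , A.n₀ , ℕ.≤-refl , λ n le →
  subst (λ k → 1 * numOrders n ^ k * n ^ (2 * k) * loglog n ≤ A.C * 2 ^ A.r * 32 ^ A.r * totalE H n ^ k * n ^ (v ∸ 2))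
    (sym (cong (_∸ 1) e≡)) (A.bound n le)
  where
  e≡ : edges H ≡ suc (suc (edges H ∸ 2))
  e≡ = sym (ℕ.m+[n∸m]≡n {2} (ℕ.≤-trans (s≤s (s≤s z≤n)) (proj₁ (proj₂ s2b))))
  module A = Choice H reg s2b (edges H ∸ 2) e≡
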